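{- There is an algorithm and an absolute constant $C$ (independent of $N$, $r$ and $d$) such that the following holds. Given integers $d\ge 1$ and $0<r<N$ and an ordered list $\mathcal R=(R_1,\dots,R_N)$ of $N$ $d$-rectangles in $\mathbb R^d$ (repetitions allowed), presented as an $N\times 2d$ real matrix, the algorithm determines, for each $s$ with $0<s\le r$, exactly $s$ entries to delete from the list $\mathcal R$, so that the intersection of the remaining $N-s$ $d$-rectangles of the list has $d$-volume that is maximal among all $\binom{N}{s}$ possible choices of $s$ entries of $\mathcal R$ to delete. The algorithm takes at most $$C\left(d\binom{r+2d}{2d}+dN\right)$$ steps.
   Context: **$d$-rectangles.** A $d$-rectangle is a product $R=[\lambda_1,\rho_1]\times\dots\times[\lambda_d,\rho_d]$, recorded by its row vector of $2d$ real endpoints $[\lambda_1\ \rho_1\ \cdots\ \lambda_d\ \rho_d]$. Here $[\lambda,\rho]=\{x:\lambda\le x\le\rho\}$. The cases $\lambda=\rho$ (a point) and $\lambda>\rho$ (the empty set) are allowed, and the endpoints are remembered even when the underlying set is empty. **Intersection.** For a non-empty $L\subseteq\{1,\dots,N\}$ and $R_j=[\lambda_{j,1}\ \rho_{j,1}\ \cdots\ \lambda_{j,d}\ \rho_{j,d}]$, the intersection of the family $(R_j)_{j\in L}$ is the $d$-rectangle $[M_1\ m_1\ \cdots\ M_d\ m_d]$ with $M_i=\max_{j\in L}\lambda_{j,i}$ and $m_i=\min_{j\in L}\rho_{j,i}$. **$d$-volume.** The $d$-volume of a $d$-rectangle $R$ is the pair $(\dim(R),\mathrm{vol}(R))$ defined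 as follows. If $\lambda_i>\rho_i$ for some $i$, the pair is $(-1,0)$. Otherwise $\dim(R)$ is the number $k$ of indices $i$ with $\lambda_i<\rho_i$. If $k\ge1$, then $\mathrm{vol}(R)$ is the product of $\rho_i-\lambda_i$ over those $i$ with $\lambda_i<\rho_i$. If $k=0$, then $\mathrm{vol}(R)=0$. $d$-volumes are compared lexicographically. **Model of computation.** The model is the usual RAM machine. There are as many memory cells as needed, each accessed in unit time and each able to hold any number occurring in the computation. Arithmetical operations and comparisons take unit time. (Formally the numbers are integers, after a change of scale if necessary, but one may treat them as real numbers.) -}

module Defs where

open import Algebra.Bundles using (CommutativeRing)
import Algebra.Definitions.RawMonoid as RawMonoidDefinitions
open import Data.Bool.Base using (if_then_else_)
open import Data.Fin.Base using (Fin; toℕ)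
open import Data.Fin.Subset using (Subset; Nonempty; ∁; ∣_∣; _∈_)
open import Data.Fin.Subset.Properties
  using (_∈?_; nonempty?; Empty-unique; ∣∁p∣≡n∸∣p∣; ∣⊥∣≡0)
open import Data.Integer.Base as ℤ using (ℤ; +_; -[1+_])
import Data.Integer.Properties as ℤ
open import Data.List.Base as List
  using (List; []; _∷_; head; drop; filter; map; foldr; length; tabulate;
         concatMap; allFin)
import Data.List.Extrema as Extrema
open import Data.List.Relation.Unary.Any using (any?)
open import Data.Maybe.Base using (Maybe; just; fromMaybe)
open import Data.Nat.Base as ℕ using (ℕ; suc)
import Data.Nat.Properties as ℕ
open import Data.Product.Base using (Σ; ∃; ∃-syntax; _×_; _,_; proj₁)
import Data.Product.Relation.Binary.Lex.Strict as Lex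
open import Data.Vec.Functional using (Vector)
open import Function.Bundles using (_⇔_)
open import Level using (Level) renaming (_⊔_ to _⊔ˡ_; suc to sucˡ)
open import Relation.Binary.Bundles using (DecTotalOrder; StrictTotalOrder)
open import Relation.Binary.Core using (Rel)
import Relation.Binary.Properties.DecTotalOrder as DecTotalOrderProperties
open import Relation.Binary.PropositionalEquality.Core
  using (_≡_; sym; trans; cong; subst)
open import Relation.Binary.Structures using (IsDecTotalOrder)
open import Relation.Nullary using (¬_; does; yes; no; contradiction)

------------------------------------------------------------------------
-- Numbers

-- The numbers a memory cell can hold: a nontrivial commutative ring with a
-- decidable compatible total order.  Taking ℤ gives the integer RAM; the real
-- field (whose order is decidable classically) gives the real RAM.

record OrderedRing a ℓ₁ ℓ₂ : Set (sucˡ (a ⊔ˡ ℓ₁ ⊔ˡ ℓ₂)) where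
  field
    commutativeRing : CommutativeRing a ℓ₁

  open CommutativeRing commutativeRing public
    using (Carrier; _≈_; _+_; _*_; _-_; 0#; 1#)

  infix 4 _≤_

  field
    _≤_             : Rel Carrier ℓ₂
    isDecTotalOrder : IsDecTotalOrder _≈_ _≤_
    +-monoˡ-≤       : ∀ z {x y} → x ≤ y → x + z ≤ y + z
    *-nonNegative   : ∀ {x y} → 0# ≤ x → 0# ≤ y → 0# ≤ x * y
    0≉1             : ¬ 0# ≈ 1#

  decTotalOrder : DecTotalOrder a ℓ₁ ℓ₂
  decTotalOrder = record { isDecTotalOrder = isDecTotalOrder }

  open DecTotalOrder decTotalOrder public using (_≤?_; totalOrder)
  open DecTotalOrderProperties decTotalOrder public
    using (_<_; <-strictTotalOrder)
  open StrictTotalOrder <-strictTotalOrder public using (_<?_)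

  fromℕ : ℕ → Carrier
  fromℕ n = n ·ℕ 1#
    where open RawMonoidDefinitions
                 (CommutativeRing.+-rawMonoid commutativeRing)
                 renaming (_×_ to _·ℕ_) using ()

ℤ-orderedRing : OrderedRing _ _ _
ℤ-orderedRing = record
  { commutativeRing = ℤ.+-*-commutativeRing
  ; _≤_             = ℤ._≤_
  ; isDecTotalOrder = ℤ.≤-isDecTotalOrder
  ; +-monoˡ-≤       = ℤ.+-monoˡ-≤
  ; *-nonNegative   = λ {x} {y} 0≤x 0≤y →
      subst (ℤ._≤ x ℤ.* y) (ℤ.*-zeroʳ x)
        (ℤ.*-monoˡ-≤-nonNeg x {{ℤ.nonNegative 0≤x}} 0≤y)
  ; 0≉1             = λ ()
  }

------------------------------------------------------------------------
-- RAM programs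

-- Operands are cell addresses and labels are positions in the program.
-- Division is left out: having fewer instructions only makes it harder for an
-- algorithm to exist.

Address Label : Set
Address = ℕ
Label   = ℕ

data Instruction : Set where
  const        : (dst : Address) (n : ℕ)         → Instruction
  move         : (dst src : Address)             → Instruction
  add sub mul  : (dst src₁ src₂ : Address)       → Instruction
  load         : (dst ptr : Address)             → Instruction
  store        : (ptr src : Address)             → Instruction
  jump         : (l : Label)                     → Instruction
  jump-if-≤    : (src₁ src₂ : Address) (l : Label) → Instruction
  halt         : Instruction

-- Whether the numbers are integers or reals is not visible to a program.
Program : Set
Program = List Instruction

infixl 5 _‼_

_‼_ : ∀ {a} {A : Set a} → List A → ℕ → Maybe A
xs ‼ n = head (drop n xs)

module _ {a ℓ₁ ℓ₂} (K : OrderedRing a ℓ₁ ℓ₂) where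

  open OrderedRing K

  infix 8 _[_≔_]
  infix 4 _PointsTo_ _≤ᵛ_

  Memory : Set a
  Memory = Address → Carrier

  _[_≔_] : Memory → Address → Carrier → Memory
  (m [ x ≔ v ]) y = if does (y ℕ.≟ x) then v else m y

  -- The cell a pointer refers to is unique, since the numbers fromℕ n are
  -- pairwise distinct.
  _PointsTo_ : Carrier → Address → Set ℓ₁
  v PointsTo x = v ≈ fromℕ x

  -- Execution of one instruction other than halt, found at position pc.
  data Step (pc : Label) (m : Memory) :
       Instruction → Label → Memory → Set (a ⊔ˡ ℓ₁ ⊔ˡ ℓ₂) where
    const : ∀ {x n} →
      Step pc m (const x n) (suc pc) (m [ x ≔ fromℕ n ])
    move  : ∀ {x y} →
      Step pc m (move x y) (suc pc) (m [ x ≔ m y ])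
    add   : ∀ {x y z} →
      Step pc m (add x y z) (suc pc) (m [ x ≔ m y + m z ])
    sub   : ∀ {x y z} →
      Step pc m (sub x y z) (suc pc) (m [ x ≔ m y - m z ])
    mul   : ∀ {x y z} →
      Step pc m (mul x y z) (suc pc) (m [ x ≔ m y * m z ])
    load  : ∀ {x p y} → m p PointsTo y →
      Step pc m (load x p) (suc pc) (m [ x ≔ m y ])
    store : ∀ {p x y} → m p PointsTo y →
      Step pc m (store p x) (suc pc) (m [ y ≔ m x ])
    jump  : ∀ {l} →
      Step pc m (jump l) l m
    jump-if-≤-yes : ∀ {x y l} → m x ≤ m y →
      Step pc m (jump-if-≤ x y l) l m
    jump-if-≤-no  : ∀ {x y l} → ¬ m x ≤ m y →
      Step pc m (jump-if-≤ x y l) (suc pc) m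

  -- Run P pc m t m′: started at pc with memory m, the program P halts after
  -- exactly t steps (the halt instruction included) with memory m′.  A machine
  -- that leaves the program or follows an invalid pointer never halts.
  data Run (P : Program) (pc : Label) (m : Memory) :
       ℕ → Memory → Set (a ⊔ˡ ℓ₁ ⊔ˡ ℓ₂) where
    halt : P ‼ pc ≡ just halt → Run P pc m 1 m
    step : ∀ {i pc′ m′ t m″} →
      P ‼ pc ≡ just i → Step pc m i pc′ m′ → Run P pc′ m′ t m″ →
      Run P pc m (suc t) m″

  ----------------------------------------------------------------------
  -- Rectangles

  -- No relation between the endpoints is imposed.
  record Interval : Set a where
    constructor ⟦_,_⟧
    field
      lo hi : Carrier

  open Interval

  Rectangle : ℕ → Set a
  Rectangle d = Vector Interval d

  module _ {d N : ℕ} where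

    open Extrema totalOrder using (max; min)

    -- max and min take an initial value, for which the endpoint of the given
    -- member of L is used, so that they range over exactly the members of L.
    intersection : Vector (Rectangle d) N →
                   (L : Subset N) → Nonempty L → Rectangle d
    intersection ℛ L (j₀ , _) i =
      ⟦ max (lo (ℛ j₀ i)) (map (λ j → lo (ℛ j i)) members)
      , min (hi (ℛ j₀ i)) (map (λ j → hi (ℛ j i)) members) ⟧
      where members = filter (_∈? L) (allFin N)

  DVolume : Set a
  DVolume = ℤ × Carrier

  volume : ∀ {d} → Rectangle d → DVolume
  volume {d} R =
    if does (any? (λ I → hi I <? lo I) sides)
    then (-[1+ 0 ] , 0#)
    else measure (filter (λ I → lo I <? hi I) sides)
    where
    sides : List Interval
    sides = tabulate R

    measure : List Interval → DVolume
    measure []         = + 0 , 0#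
    measure Is@(_ ∷ _) =
      + length Is , foldr _*_ 1# (map (λ I → hi I - lo I) Is)

  _≤ᵛ_ : Rel DVolume _
  _≤ᵛ_ = Lex.×-Lex _≡_ ℤ._<_ _≤_

------------------------------------------------------------------------
-- Deletions

Deletion : ℕ → ℕ → Set
Deletion N s = Σ (Subset N) λ S → ∣ S ∣ ≡ s

remaining : ∀ {N s} → Deletion N s → Subset N
remaining (S , _) = ∁ S

remaining-nonempty : ∀ {N s} → s ℕ.< N →
                     (D : Deletion N s) → Nonempty (remaining D)
remaining-nonempty {N} {s} s<N (S , ∣S∣≡s) with nonempty? (∁ S)
... | yes ne = ne
... | no  e  = contradiction (ℕ.m∸n≡0⇒m≤n N∸s≡0) (ℕ.<⇒≱ s<N)
  where
  N∸s≡0 : N ℕ.∸ s ≡ 0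
  N∸s≡0 = trans (cong (N ℕ.∸_) (sym ∣S∣≡s))
         (trans (sym (∣∁p∣≡n∸∣p∣ S))
         (trans (cong ∣_∣ (Empty-unique e)) (∣⊥∣≡0 N)))

module _ {a ℓ₁ ℓ₂} (K : OrderedRing a ℓ₁ ℓ₂) where

  open OrderedRing K

  volumeAfter : ∀ {d N s} → Vector (Rectangle K d) N → s ℕ.< N →
                Deletion N s → DVolume K
  volumeAfter ℛ s<N D =
    volume K (intersection K ℛ (remaining D) (remaining-nonempty s<N D))

  Optimal : ∀ {d N s} → Vector (Rectangle K d) N → s ℕ.< N →
            Deletion N s → Set _
  Optimal {N = N} {s} ℛ s<N D =
    (D′ : Deletion N s) →
    _≤ᵛ_ K (volumeAfter ℛ s<N D′) (volumeAfter ℛ s<N D)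

  ----------------------------------------------------------------------
  -- Input and output of the algorithm

  -- Cells 0, 1, 2 hold d, r, N; the N × 2d matrix follows, row by row; all
  -- further cells hold 0.
  input : ∀ {d N} → ℕ → Vector (Rectangle K d) N → Memory K
  input {d} {N} r ℛ x = fromMaybe 0# (cells ‼ x)
    where
    row : Rectangle K d → List Carrier
    row R = concatMap (λ i → Interval.lo (R i) ∷ Interval.hi (R i) ∷ [])
                      (allFin d)

    cells : List Carrier
    cells = fromℕ d ∷ fromℕ r ∷ fromℕ N ∷ concatMap (λ j → row (ℛ j)) (allFin N)

  -- The s cells from x onwards hold the positions, counted from 0, of the
  -- deleted entries.  As there are s of them, each cell holds one, without
  -- repetition.
  ListedAt : ∀ {N s} → Memory K → Address → Deletion N s → Set _
  ListedAt {N} {s} m x (S , _) =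
    (j : Fin N) → j ∈ S ⇔ (∃[ k ] m (x ℕ.+ toℕ {s} k) ≈ fromℕ (toℕ j))

  -- On halting, cell 0 points to an r × r matrix whose row s (counted from 1)
  -- starts with an optimal choice of s entries.
  Output : ∀ {d N} (r : ℕ) → r ℕ.< N → Vector (Rectangle K d) N →
           Memory K → Set _
  Output {N = N} r r<N ℛ m =
    ∃[ o ] _PointsTo_ K (m 0) o ×
      (∀ s → 0 ℕ.< s → (s≤r : s ℕ.≤ r) →
        ∃[ D ] ListedAt {N} {s} m (o ℕ.+ (s ℕ.∸ 1) ℕ.* r) D ×
               Optimal ℛ (ℕ.≤-<-trans s≤r r<N) D)

module Submission where

open import Defs
open import Data.Nat using (ℕ; _+_; _*_; _≤_; _<_)
open import Data.Nat.Combinatorics using (_C_)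
open import Data.Product using (_×_; ∃-syntax)
open import Data.Vec.Functional using (Vector)

open import Algebra.Bundles using (CommutativeRing)
import Algebra.Properties.Ring as RingProperties
import Algebra.Properties.Monoid.Mult as MonoidMult
import Algebra.Properties.Semiring.Mult as SemiringMult
open import Data.Bool.Base using (Bool; true; false; if_then_else_; _∧_; T)
open import Data.Empty using (⊥-elim)
open import Data.Fin.Base as Fin using (Fin; toℕ)
open import Data.Fin using (#_)
import Data.Fin.Properties as Fin
open import Data.List.Base as List using (List; []; _∷_; _++_; length)
import Data.List.Properties as List
open import Data.Maybe.Base using (Maybe; just; nothing; fromMaybe)
open import Data.Nat.Base using (zero; suc; z≤n; s≤s; _∸_; _≡ᵇ_; _≤ᵇ_; _≤′_; ≤′-refl; ≤′-step)
open import Data.Nat.Properties as ℕ using (≤-refl; ≤-trans)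
open import Data.Product.Base using (∃; _,_; proj₁; proj₂)
open import Data.Sum.Base as Sum using (_⊎_; inj₁; inj₂)
open import Data.Unit.Base using (⊤; tt)
open import Function.Base using (_∘_; id)
open import Level using (Level) renaming (_⊔_ to _⊔ˡ_)
open import Relation.Binary.PropositionalEquality
  using (_≡_; _≢_; refl; sym; trans; cong; cong₂; subst; subst₂)
open import Relation.Nullary using (¬_; Dec; does; yes; no; contradiction)
open import Data.Nat.Solver using (module +-*-Solver)
open import Relation.Binary.Definitions using (tri<; tri≈; tri>)
open import Data.Fin.Subset as Subset using (Subset; inside; ∣_∣; _∈_; ∁)
import Data.Fin.Subset.Properties as Subset
open import Data.Fin.Subset.Properties using (p⊆q⇒∣p∣≤∣q∣; ∣⊥∣≡0)
import Data.Integer.Base as ℤ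
import Data.Integer.Properties as ℤ
open import Data.List.Relation.Unary.Any using (any?)
open import Data.Nat.Combinatorics using (nCn≡1; nCk≡nC[n∸k]; nCk+nC[k+1]≡[n+1]C[k+1])
open import Data.Vec.Base as Vec using (_[_]≔_; []; _∷_)
open import Data.Nat.Base using (>-nonZero)
import Data.List.Extrema as Extrema
import Data.List.Relation.Unary.All as AllBase
open import Data.List.Relation.Unary.All using (All)
import Data.List.Relation.Unary.All.Properties as All
open import Data.List.Membership.Propositional using () renaming (_∈_ to _∈ᴸ_)
open import Data.List.Membership.Propositional.Properties using (∈-map⁺; ∈-filter⁺; ∈-allFin)
open import Function.Bundles using (_⇔_; mk⇔; module Equivalence)

open +-*-Solver using (con; _:+_; _:*_; _:=_) renaming (solve to identity)

-- Keep every lower endpoint and negate every upper one. Each of the `2d` columns of the matrix then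
-- has a maximum over the rows that remain, and the sides of the intersection are the negated sums
-- of two adjacent maxima. Since the `d`-volume is monotone in the side lengths (`codeOf-mono`),
-- numbers above the column maxima yield a lower bound for the volume, and numbers below them an
-- upper bound.
--
-- At most `r` rows are deleted, so only the `r + 1` greatest entries of a column matter. To list
-- them in decreasing order, the column is cut into blocks of length `r + 1` with a known best entry
-- each; the best of the block winners is extracted `r + 1` times, and each time only its own block
-- is scanned again. This costs a multiple of `N + (r + 1)²` per column.
--
-- A search tree then treats the columns one after the other. A node of level `l` carries a list of
-- `t ≤ r` deletions and upper bounds for the first `l` column maxima over the rows not deleted. Its
-- list is prolonged by the sorted entries of column `l` that are not deleted yet. For every `s`
-- from `t` to `r` there is a child that deletes the first `s` entries of the prolonged list, and
-- the entry in position `s` is then the maximum of column `l`. The nodes of level `l` thus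
-- correspond to the `l`-tuples of natural numbers with sum at most `r`, and their number is
-- `(r + l) C l`. The leaves, at level `2d`, are not stored: each is evaluated at once, in time
-- linear in `d`, by climbing to the root. For every `s` the best leaf with exactly `s` deletions is
-- remembered.
--
-- The value of a leaf never exceeds the true volume of its deletions, as its bounds lie above the
-- column maxima (`Witness`). Conversely, let `S` be a set of `s ≤ r` rows. Descend from every node
-- to the child given by the first entry of its list outside `S`: only members of `S` get deleted,
-- and every bound is attained outside `S`. In the last column delete `s` entries instead, which can
-- only lower the last bound. The leaf reached has `s` deletions and a value at least the volume
-- after deleting `S` (`Dominated`). So the remembered leaf is optimal.
--
-- The time rests on two facts about binomials. An inner node costs a multiple of `r + 1`, and
-- `r + 1` times the number of inner nodes is `2d` times the number of leaves (`binomSum≡`).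
-- Further, `(r + 1)²` is at most twice the number of leaves (`square≤binom`), which absorbs the
-- selection phase.
--
-- The algorithm is written in a small structured language whose semantics counts steps, and is
-- compiled to RAM code that is simulated step for step (`simulate`). Its arrays lie beyond the
-- input and are addressed by a pairing function; as memory is zero there, they need no
-- initialisation.

-- Arithmetic identities for adding up step counts

rearrange₁ : ∀ t j w → t + (j * 7 + (w + 1)) + 1 + 1 + 1 + 3 + 1 ≡ t + (suc j * 7 + (w + 1))
rearrange₁ = identity 3 (λ t j w → t :+ (j :* con 7 :+ (w :+ con 1)) :+ con 1 :+ con 1 :+ con 1 :+ con 3 :+ con 1 := t :+ ((con 1 :+ j) :* con 7 :+ (w :+ con 1))) refl

rearrange₂ : ∀ t j w c → t + (j * 7 + (w + 1)) + 1 + 1 + 1 + c + 3 + 1 ≡ t + (suc j * 7 + (c + w + 1))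
rearrange₂ = identity 4 (λ t j w c → t :+ (j :* con 7 :+ (w :+ con 1)) :+ con 1 :+ con 1 :+ con 1 :+ c :+ con 3 :+ con 1 := t :+ ((con 1 :+ j) :* con 7 :+ (c :+ w :+ con 1))) refl

rearrange₃ : ∀ t i w b c e r → t + (i * (6 + (e + r)) + (w * c + 1)) + 1 + e + (r + (b * c + 1)) + 1 + 3 ≡ t + (suc i * (6 + (e + r)) + ((w + b) * c + 1))
rearrange₃ = identity 7 (λ t i w b c e r → t :+ (i :* (con 6 :+ (e :+ r)) :+ (w :* c :+ con 1)) :+ con 1 :+ e :+ (r :+ (b :* c :+ con 1)) :+ con 1 :+ con 3 := t :+ ((con 1 :+ i) :* (con 6 :+ (e :+ r)) :+ ((w :+ b) :* c :+ con 1))) refl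

rearrange₄ : ∀ t a b → t + 1 + 1 + 1 + (a + (b + 2)) + 1 + 1 ≡ t + (7 + (a + b))
rearrange₄ = identity 3 (λ t a b → t :+ con 1 :+ con 1 :+ con 1 :+ (a :+ (b :+ con 2)) :+ con 1 :+ con 1 := t :+ (con 7 :+ (a :+ b))) refl

rearrange₅ : ∀ t a b → t + 1 + 1 + 1 + (a + (b + 1)) + 1 + 1 + 1 ≡ t + (7 + (a + b))
rearrange₅ = identity 3 (λ t a b → t :+ con 1 :+ con 1 :+ con 1 :+ (a :+ (b :+ con 1)) :+ con 1 :+ con 1 :+ con 1 := t :+ (con 7 :+ (a :+ b))) refl

rearrange₆ : ∀ t u → t + 1 + 9 + 1 + u ≡ t + (11 + u)
rearrange₆ = identity 2 (λ t u → t :+ con 1 :+ con 9 :+ con 1 :+ u := t :+ (con 11 :+ u)) refl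

rearrange₇ : ∀ q x → q + x + 1 ≡ q + suc x
rearrange₇ = identity 2 (λ q x → q :+ x :+ con 1 := q :+ (con 1 :+ x)) refl

rearrange₈ : ∀ l → 7 + (l + 9) ≡ 9 + (l + 7)
rearrange₈ = identity 1 (λ l → con 7 :+ (l :+ con 9) := con 9 :+ (l :+ con 7)) refl

rearrange₉ : ∀ t u → t + 9 + 9 + 1 + u ≡ t + (19 + u)
rearrange₉ = identity 2 (λ t u → t :+ con 9 :+ con 9 :+ con 1 :+ u := t :+ (con 19 :+ u)) refl

rearrange₁₀ : ∀ t j w c → t + (j * 7 + (w + 1)) + 1 + 1 + 1 + c + 1 + 3 ≡ t + (suc j * 7 + (c + w + 1))
rearrange₁₀ = identity 4 (λ t j w c → t :+ (j :* con 7 :+ (w :+ con 1)) :+ con 1 :+ con 1 :+ con 1 :+ c :+ con 1 :+ con 3 := t :+ ((con 1 :+ j) :* con 7 :+ (c :+ w :+ con 1))) refl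

rearrange₁₁ : ∀ t i w b c e r → t + (i * (6 + (e + r)) + (w * c + 1)) + 1 + (e + (r + (b * c + 2))) + 3 ≡ t + (suc i * (6 + (e + r)) + ((w + b) * c + 1))
rearrange₁₁ = identity 7 (λ t i w b c e r → t :+ (i :* (con 6 :+ (e :+ r)) :+ (w :* c :+ con 1)) :+ con 1 :+ (e :+ (r :+ (b :* c :+ con 2))) :+ con 3 := t :+ ((con 1 :+ i) :* (con 6 :+ (e :+ r)) :+ ((w :+ b) :* c :+ con 1))) refl

rearrange₁₂ : ∀ t l a a′ b b′ n c → t + 1 + (l * 12 + (a * n + b * c)) + 1 + (7 + (a′ * n + b′ * c)) + 3 + 1 ≡ t + 1 + (suc l * 12 + ((a + a′) * n + (b + b′) * c))
rearrange₁₂ = identity 8 (λ t l a a′ b b′ n c → t :+ con 1 :+ (l :* con 12 :+ (a :* n :+ b :* c)) :+ con 1 :+ (con 7 :+ (a′ :* n :+ b′ :* c)) :+ con 3 :+ con 1 := t :+ con 1 :+ ((con 1 :+ l) :* con 12 :+ ((a :+ a′) :* n :+ (b :+ b′) :* c))) refl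

rearrange₁₃ : ∀ t l a a′ b b′ n c f → t + 1 + (l * 12 + (a * n + b * c)) + 1 + (7 + (a′ * n + b′ * f)) + 3 + 1 ≡ t + 1 + (suc l * 12 + ((a + a′) * n + (b * c + b′ * f)))
rearrange₁₃ = identity 9 (λ t l a a′ b b′ n c f → t :+ con 1 :+ (l :* con 12 :+ (a :* n :+ b :* c)) :+ con 1 :+ (con 7 :+ (a′ :* n :+ b′ :* f)) :+ con 3 :+ con 1 := t :+ con 1 :+ ((con 1 :+ l) :* con 12 :+ ((a :+ a′) :* n :+ (b :* c :+ b′ :* f)))) refl

rearrange₁₄ : ∀ t b c → t + 1 + 1 + 1 + b + 1 + (1 + c) ≡ t + (5 + c + b)
rearrange₁₄ = identity 3 (λ t b c → t :+ con 1 :+ con 1 :+ con 1 :+ b :+ con 1 :+ (con 1 :+ c) := t :+ (con 5 :+ c :+ b)) refl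

rearrange₁₅ : ∀ d → d + d ≡ d * 2
rearrange₁₅ = identity 1 (λ d → d :+ d := d :* con 2) refl

rearrange₁₆ : ∀ r n → r * (n + r) ≡ n * r + r * r
rearrange₁₆ = identity 2 (λ r n → r :* (n :+ r) := n :* r :+ r :* r) refl

rearrange₁₇ : ∀ t u w → t + (u + (w + 1)) + 1 ≡ t + (u + (w + 2))
rearrange₁₇ = identity 3 (λ t u w → t :+ (u :+ (w :+ con 1)) :+ con 1 := t :+ (u :+ (w :+ con 2))) refl

rearrange₁₈ : ∀ t a b c → t + a + b + c ≡ t + (a + b + c)
rearrange₁₈ = identity 4 (λ t a b c → t :+ a :+ b :+ c := t :+ (a :+ b :+ c)) refl

rearrange₁₉ : ∀ t c → t + 1 + 1 + c + 1 + 1 + 1 ≡ t + (5 + c)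
rearrange₁₉ = identity 2 (λ t c → t :+ con 1 :+ con 1 :+ c :+ con 1 :+ con 1 :+ con 1 := t :+ (con 5 :+ c)) refl

rearrange₂₀ : ∀ t u b → ((t + (u + 1)) + 1 + b) + 3 ≡ t + (4 + b + u + 1)
rearrange₂₀ = identity 3 (λ t u b → t :+ (u :+ con 1) :+ con 1 :+ b :+ con 3 := t :+ (con 4 :+ b :+ u :+ con 1)) refl

rearrange₂₁ : ∀ t u → (t + (u + 1)) + 1 ≡ t + (u + 2)
rearrange₂₁ = identity 2 (λ t u → t :+ (u :+ con 1) :+ con 1 := t :+ (u :+ con 2)) refl

rearrange₂₂ : ∀ t u → (t + 1 + u) + 1 ≡ t + (2 + u)
rearrange₂₂ = identity 2 (λ t u → t :+ con 1 :+ u :+ con 1 := t :+ (con 2 :+ u)) refl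

rearrange₂₃ : ∀ n → n + n ≡ 2 * n
rearrange₂₃ = identity 1 (λ n → n :+ n := con 2 :* n) refl

rearrange₂₄ : ∀ d N → 62 * (d * N) + N * (d * 2) ≡ 64 * (d * N)
rearrange₂₄ = identity 2 (λ d N → con 62 :* (d :* N) :+ N :* (d :* con 2) := con 64 :* (d :* N)) refl

rearrange₂₅ : ∀ l k → 4 + l + k ≡ l + (4 + k)
rearrange₂₅ = identity 2 (λ l k → con 4 :+ l :+ k := l :+ (con 4 :+ k)) refl

rearrange₂₆ : ∀ t u → t + 1 + (u + 2) + 9 ≡ t + (12 + u)
rearrange₂₆ = identity 2 (λ t u → t :+ con 1 :+ (u :+ con 2) :+ con 9 := t :+ (con 12 :+ u)) refl

rearrange₂₇ : ∀ t u → t + 1 + (u + 2) ≡ t + (u + 3)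
rearrange₂₇ = identity 2 (λ t u → t :+ con 1 :+ (u :+ con 2) := t :+ (u :+ con 3)) refl

rearrange₂₈ : ∀ t u → t + 9 + 1 + (u + 2) ≡ t + (12 + u)
rearrange₂₈ = identity 2 (λ t u → t :+ con 9 :+ con 1 :+ (u :+ con 2) := t :+ (con 12 :+ u)) refl

rearrange₂₉ : ∀ n → n + n ≡ n * 2
rearrange₂₉ = identity 1 (λ n → n :+ n := n :* con 2) refl

rearrange₃₀ : ∀ t u → t + 1 + (u + 2) ≡ t + (3 + u)
rearrange₃₀ = identity 2 (λ t u → t :+ con 1 :+ (u :+ con 2) := t :+ (con 3 :+ u)) refl

rearrange₃₁ : ∀ a b c → a * (b * c) ≡ b * (a * c)
rearrange₃₁ = identity 3 (λ a b c → a :* (b :* c) := b :* (a :* c)) refl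

rearrange₃₂ : ∀ a b c → a * b * c ≡ c * a * b
rearrange₃₂ = identity 3 (λ a b c → a :* b :* c := c :* a :* b) refl

rearrange₃₃ : ∀ a b → a * 2 * b ≡ 2 * (a * b)
rearrange₃₃ = identity 2 (λ a b → a :* con 2 :* b := con 2 :* (a :* b)) refl

rearrange₃₄ : ∀ N d → N * (d * 2) ≡ d * N * 2
rearrange₃₄ = identity 2 (λ N d → N :* (d :* con 2) := d :* N :* con 2) refl

rearrange₃₅ : ∀ x → 64 * (x * x) + x * x + 4031 * (x * x) ≡ 64 * x * (64 * x)
rearrange₃₅ = identity 1 (λ x → con 64 :* (x :* x) :+ x :* x :+ con 4031 :* (x :* x) := con 64 :* x :* (con 64 :* x)) refl

rearrange₃₆ : ∀ m n k → m + n + k ≡ n + (m + k)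
rearrange₃₆ = identity 3 (λ m n k → m :+ n :+ k := n :+ (m :+ k)) refl

rearrange₃₇ : ∀ m n k → suc (m + suc n + k) ≡ n + suc (m + suc k)
rearrange₃₇ = identity 3 (λ m n k → con 1 :+ (m :+ (con 1 :+ n) :+ k) := n :+ (con 1 :+ (m :+ (con 1 :+ k)))) refl

rearrange₃₈ : ∀ m k → 2 + (m + 3 + k) ≡ 3 + (m + (2 + k))
rearrange₃₈ = identity 2 (λ m k → con 2 :+ (m :+ con 3 :+ k) := con 3 :+ (m :+ (con 2 :+ k))) refl

rearrange₃₉ : ∀ s → s * s + s + suc s ≡ suc s * suc s
rearrange₃₉ = identity 1 (λ s → s :* s :+ s :+ (con 1 :+ s) := (con 1 :+ s) :* (con 1 :+ s)) refl

rearrange₄₀ : ∀ l r b → suc r * b + suc l * b ≡ (suc l + suc r) * b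
rearrange₄₀ = identity 3 (λ l r b → (con 1 :+ r) :* b :+ (con 1 :+ l) :* b := (con 1 :+ l :+ (con 1 :+ r)) :* b) refl

rearrange₄₁ : ∀ l r b → suc r * b + suc l * b ≡ (suc (suc l) + r) * b
rearrange₄₁ = identity 3 (λ l r b → (con 1 :+ r) :* b :+ (con 1 :+ l) :* b := (con 1 :+ (con 1 :+ l) :+ r) :* b) refl

rearrange₄₂ : ∀ l r b → l * b + suc r * b ≡ (suc l + r) * b
rearrange₄₂ = identity 3 (λ l r b → l :* b :+ (con 1 :+ r) :* b := (con 1 :+ l :+ r) :* b) refl

-- Consequences of the ordered ring axioms

module OrderedRingFacts {a ℓ₁ ℓ₂} (K : OrderedRing a ℓ₁ ℓ₂) where

  open OrderedRing K public
    using (Carrier; _≈_; 0#; 1#; fromℕ)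
    renaming (_+_ to _⊕_; _*_ to _⊗_; _-_ to _⊖_; _≤_ to _≼_; _≤?_ to _≼?_;
              _<_ to _≺_; _<?_ to _≺?_)
  open OrderedRing K using (+-monoˡ-≤; *-nonNegative; 0≉1; commutativeRing; isDecTotalOrder)
  open CommutativeRing commutativeRing public
    using (+-cong; +-congˡ; +-congʳ; *-cong; *-congˡ; *-congʳ; +-comm; +-assoc; *-comm; *-assoc;
           +-identityˡ; +-identityʳ; *-identityˡ; *-identityʳ; -‿cong; -‿inverseʳ;
           -‿inverseˡ; zeroˡ; zeroʳ; distribʳ; distribˡ)
    renaming (refl to ≈-refl; sym to ≈-sym; trans to ≈-trans; reflexive to ≈-reflexive;
              -_ to ⊝_)
  open CommutativeRing commutativeRing using (ring; semiring; +-monoid; setoid)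
  open RingProperties ring using (-‿distribˡ-*; -‿distribʳ-*; -‿involutive; -‿+-comm; -0#≈0#)
  open import Relation.Binary.Reasoning.Setoid setoid
  open import Relation.Binary.Structures using (IsDecTotalOrder)
  open IsDecTotalOrder isDecTotalOrder public
    using (≤-resp-≈)
    renaming (refl to ≼-refl; trans to ≼-trans; antisym to ≼-antisym; total to ≼-total;
              reflexive to ≼-reflexive)

  ≼-respʳ : ∀ {x y z} → y ≈ z → x ≼ y → x ≼ z
  ≼-respʳ = proj₁ ≤-resp-≈

  ≼-respˡ : ∀ {x y z} → y ≈ z → y ≼ x → z ≼ x
  ≼-respˡ = proj₂ ≤-resp-≈

  ≼-resp : ∀ {x y u v} → x ≈ u → y ≈ v → x ≼ y → u ≼ v
  ≼-resp p q = ≼-respˡ p ∘ ≼-respʳ q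

  fromℕ-+ : ∀ m n → fromℕ (m + n) ≈ fromℕ m ⊕ fromℕ n
  fromℕ-+ = MonoidMult.×-homo-+ +-monoid 1#

  fromℕ-* : ∀ m n → fromℕ (m * n) ≈ fromℕ m ⊗ fromℕ n
  fromℕ-* = SemiringMult.×1-homo-* semiring

  ≼-+-monoʳ : ∀ z {x y} → x ≼ y → z ⊕ x ≼ z ⊕ y
  ≼-+-monoʳ z p = ≼-resp (+-comm _ z) (+-comm _ z) (+-monoˡ-≤ z p)

  ≼-+-mono : ∀ {x y u v} → x ≼ y → u ≼ v → x ⊕ u ≼ y ⊕ v
  ≼-+-mono p q = ≼-trans (+-monoˡ-≤ _ p) (≼-+-monoʳ _ q)

  x-y+y≈x : ∀ x y → (x ⊖ y) ⊕ y ≈ x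
  x-y+y≈x x y = ≈-trans (+-assoc x (⊝ y) y) (≈-trans (+-congˡ (-‿inverseˡ y)) (+-identityʳ x))

  x+y-y≈x : ∀ x y → (x ⊕ y) ⊖ y ≈ x
  x+y-y≈x x y = ≈-trans (+-assoc x y (⊝ y)) (≈-trans (+-congˡ (-‿inverseʳ y)) (+-identityʳ x))

  ≼⇒0≼- : ∀ {x y} → x ≼ y → 0# ≼ y ⊖ x
  ≼⇒0≼- {x} p = ≼-respˡ (-‿inverseʳ x) (+-monoˡ-≤ (⊝ x) p)

  0≼-⇒≼ : ∀ {x y} → 0# ≼ y ⊖ x → x ≼ y
  0≼-⇒≼ {x} {y} p = ≼-resp (+-identityˡ x) (x-y+y≈x y x) (+-monoˡ-≤ x p)

  -‿anti : ∀ {x y} → x ≼ y → ⊝ y ≼ ⊝ x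
  -‿anti {x} {y} p = 0≼-⇒≼ (≼-respʳ eq (≼⇒0≼- p))
    where
    eq : y ⊖ x ≈ ⊝ x ⊖ ⊝ y
    eq = ≈-trans (+-comm y (⊝ x)) (+-congˡ (≈-sym (-‿involutive y)))

  -‿mono-anti : ∀ {x y u v} → x ≼ y → u ≼ v → x ⊖ v ≼ y ⊖ u
  -‿mono-anti p q = ≼-+-mono p (-‿anti q)

  *-monoʳ-≼ : ∀ {z x y} → 0# ≼ z → x ≼ y → z ⊗ x ≼ z ⊗ y
  *-monoʳ-≼ {z} {x} {y} p q = 0≼-⇒≼ (≼-respʳ eq (*-nonNegative p (≼⇒0≼- q)))
    where
    eq : z ⊗ (y ⊖ x) ≈ z ⊗ y ⊖ z ⊗ x
    eq = ≈-trans (distribˡ z y (⊝ x)) (+-congˡ (≈-sym (-‿distribʳ-* z x)))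

  *-mono-≼ : ∀ {x y u v} → 0# ≼ u → 0# ≼ y → x ≼ y → u ≼ v → x ⊗ u ≼ y ⊗ v
  *-mono-≼ p q r s = ≼-trans (≼-resp (*-comm _ _) (*-comm _ _) (*-monoʳ-≼ p r)) (*-monoʳ-≼ q s)

  0≼* : ∀ {x y} → 0# ≼ x → 0# ≼ y → 0# ≼ x ⊗ y
  0≼* = *-nonNegative

  -- Otherwise `1 ≤ 0` gives `0 ≤ -1`, and then `1`, as the square of `-1`, is nonnegative after
  -- all.
  0≼1 : 0# ≼ 1#
  0≼1 with ≼-total 0# 1#
  ... | inj₁ p = p
  ... | inj₂ p = ≼-respʳ eq (*-nonNegative q q)
    where
    q : 0# ≼ ⊝ 1#
    q = ≼-respˡ -0#≈0# (-‿anti p)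
    eq : ⊝ 1# ⊗ ⊝ 1# ≈ 1#
    eq = ≈-trans (≈-sym (-‿distribˡ-* 1# (⊝ 1#)))
           (≈-trans (-‿cong (*-identityˡ (⊝ 1#))) (-‿involutive 1#))

  fromℕ-nonNegative : ∀ n → 0# ≼ fromℕ n
  fromℕ-nonNegative zero    = ≼-refl
  fromℕ-nonNegative (suc n) = ≼-respˡ (+-identityˡ 0#) (≼-+-mono 0≼1 (fromℕ-nonNegative n))

  fromℕ-mono : ∀ {m n} → m ≤ n → fromℕ m ≼ fromℕ n
  fromℕ-mono {n = n} z≤n = fromℕ-nonNegative n
  fromℕ-mono (s≤s p)     = ≼-+-monoʳ 1# (fromℕ-mono p)

  +-cancelˡ-≼ : ∀ z {x y} → z ⊕ x ≼ z ⊕ y → x ≼ y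
  +-cancelˡ-≼ z {x} {y} p = ≼-resp (eq x) (eq y) (+-monoˡ-≤ (⊝ z) p)
    where
    eq : ∀ w → (z ⊕ w) ⊖ z ≈ w
    eq w = ≈-trans (+-congʳ (+-comm z w)) (x+y-y≈x w z)

  -- A nontrivial ordered ring has characteristic zero: cancelling ones on both sides ends in
  -- `1 ≤ 0` if the claim fails. Numerals can therefore serve as addresses and loop counters.
  fromℕ-reflects : ∀ m n → fromℕ m ≼ fromℕ n → m ≤ n
  fromℕ-reflects zero    n       p = z≤n
  fromℕ-reflects (suc m) zero    p = contradiction (≼-antisym 0≼1 1≼0) 0≉1
    where
    1≼0 : 1# ≼ 0#
    1≼0 = ≼-trans (≼-respˡ (+-identityʳ 1#) (≼-+-monoʳ 1# (fromℕ-nonNegative m))) p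
  fromℕ-reflects (suc m) (suc n) p = s≤s (fromℕ-reflects m n (+-cancelˡ-≼ 1# p))

  fromℕ-injective : ∀ {m n} → fromℕ m ≈ fromℕ n → m ≡ n
  fromℕ-injective {m} {n} p = ℕ.≤-antisym
    (fromℕ-reflects m n (≼-reflexive p)) (fromℕ-reflects n m (≼-reflexive (≈-sym p)))

  ⊖-cong : ∀ {x y u v} → x ≈ y → u ≈ v → x ⊖ u ≈ y ⊖ v
  ⊖-cong p q = +-cong p (-‿cong q)

-- A structured language with a step-counting semantics

-- A structured language over typed cells, with for-loops and unbounded
-- two-dimensional arrays, to be compiled to RAM programs.

data Ty : Set where
  nat ring : Ty

Var Arr : Set
Var = Fin 28
Arr = Fin 8

data Loc : Set where
  var : Var → Loc
  arr : Arr → ℕ → ℕ → Loc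

-- Indices are known at run time only, so the static analysis of writes identifies all cells of an
-- array.
data Name : Set where
  var : Var → Name
  arr : Arr → Name

name : Loc → Name
name (var x)     = var x
name (arr a _ _) = arr a

infixr 4 _⨾_

data Cmd : Set where
  skip      : Cmd
  _⨾_       : Cmd → Cmd → Cmd
  setᶜ      : Ty → (x : Var) → ℕ → Cmd
  copyᶜ     : Ty → (x y : Var) → Cmd
  addᶜ mulᶜ : Ty → (x y z : Var) → Cmd
  subᶜ      : (x y z : Var) → Cmd
  getᶜ      : Ty → (x : Var) (a : Arr) (i j : Var) → Cmd
  putᶜ      : Ty → (a : Arr) (i j : Var) (x : Var) → Cmd
  readᶜ     : (x : Var) (z : Var) → Cmd
  writeᶜ    : (z : Var) (x : Var) → Cmd
  if≤       : Ty → (x y : Var) → Cmd → Cmd → Cmd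
  for       : (x y : Var) → Cmd → Cmd

_==ᶠ_ : ∀ {n} → Fin n → Fin n → Bool
i ==ᶠ j = toℕ i ≡ᵇ toℕ j

_==ᴸ_ : Loc → Loc → Bool
var x     ==ᴸ var y        = x ==ᶠ y
arr a i j ==ᴸ arr b i′ j′  = (a ==ᶠ b) ∧ ((i ≡ᵇ i′) ∧ (j ≡ᵇ j′))
_         ==ᴸ _            = false

_==ᴺ_ : Name → Name → Bool
var x ==ᴺ var y = x ==ᶠ y
arr a ==ᴺ arr b = a ==ᶠ b
_     ==ᴺ _     = false

_==ᵀ_ : Ty → Ty → Bool
nat  ==ᵀ nat  = true
ring ==ᵀ ring = true
_    ==ᵀ _    = false

not : Bool → Bool
not true  = false
not false = true

not-true : ∀ {b} → not b ≡ true → b ≡ false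
not-true {false} _ = refl

-- Boolean-valued, so that for a concrete command every frame condition is proved by `refl`. A
-- `writeᶜ` changes the contiguous region only, which no name denotes.
unwritten : Cmd → Ty → Name → Bool
unwritten skip             τ n = true
unwritten (c₁ ⨾ c₂)        τ n = unwritten c₁ τ n ∧ unwritten c₂ τ n
unwritten (setᶜ σ x _)     τ n = not ((σ ==ᵀ τ) ∧ (var x ==ᴺ n))
unwritten (copyᶜ σ x _)    τ n = not ((σ ==ᵀ τ) ∧ (var x ==ᴺ n))
unwritten (addᶜ σ x _ _)   τ n = not ((σ ==ᵀ τ) ∧ (var x ==ᴺ n))
unwritten (mulᶜ σ x _ _)   τ n = not ((σ ==ᵀ τ) ∧ (var x ==ᴺ n))
unwritten (subᶜ x _ _)     τ n = not ((ring ==ᵀ τ) ∧ (var x ==ᴺ n))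
unwritten (getᶜ σ x _ _ _) τ n = not ((σ ==ᵀ τ) ∧ (var x ==ᴺ n))
unwritten (putᶜ σ a _ _ _) τ n = not ((σ ==ᵀ τ) ∧ (arr a ==ᴺ n))
unwritten (readᶜ x _)      τ n = not ((ring ==ᵀ τ) ∧ (var x ==ᴺ n))
unwritten (writeᶜ _ _)     τ n = true
unwritten (if≤ _ _ _ c c′) τ n = unwritten c τ n ∧ unwritten c′ τ n
unwritten (for x _ c)      τ n = not ((nat ==ᵀ τ) ∧ (var x ==ᴺ n)) ∧ unwritten c τ n

-- A loop body may change neither the counter nor the bound. The compiled loop compares them anew in
-- each round, whereas the semantics fixes the number of rounds on entry; under this condition both
-- agree.
wellFormed : Cmd → Bool
wellFormed (c₁ ⨾ c₂)        = wellFormed c₁ ∧ wellFormed c₂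
wellFormed (if≤ _ _ _ c c′) = wellFormed c ∧ wellFormed c′
wellFormed (for x y c)      =
  not (y ==ᶠ x) ∧ (unwritten c nat (var x) ∧ (unwritten c nat (var y) ∧ wellFormed c))
wellFormed _                = true

loopFree : Cmd → Bool
loopFree (c₁ ⨾ c₂)        = loopFree c₁ ∧ loopFree c₂
loopFree (if≤ _ _ _ c c′) = loopFree c ∧ loopFree c′
loopFree (for _ _ _)      = false
loopFree _                = true

-- An upper bound for loop-free commands, as both branches of a conditional are charged; the value
-- at loops is a dummy.
steps : Cmd → ℕ
steps skip             = 0
steps (c₁ ⨾ c₂)        = steps c₁ + steps c₂
steps (getᶜ _ _ _ _ _) = 9
steps (putᶜ _ _ _ _ _) = 9
steps (readᶜ _ _)      = 4
steps (writeᶜ _ _)     = 4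
steps (if≤ _ _ _ c c′) = 2 + (steps c + steps c′)
steps (for _ _ c)      = 0
steps _                = 1

∧-trueˡ : ∀ {b c} → b ∧ c ≡ true → b ≡ true
∧-trueˡ {true} _ = refl

∧-trueʳ : ∀ {b c} → b ∧ c ≡ true → c ≡ true
∧-trueʳ {true} p = p

≡ᵇ-true : ∀ m n → (m ≡ᵇ n) ≡ true → m ≡ n
≡ᵇ-true m n p = ℕ.≡ᵇ⇒≡ m n (subst T (sym p) tt)

≡ᵇ-refl : ∀ n → (n ≡ᵇ n) ≡ true
≡ᵇ-refl zero    = refl
≡ᵇ-refl (suc n) = ≡ᵇ-refl n

≢⇒≡ᵇ-false : ∀ {m n} → m ≢ n → (m ≡ᵇ n) ≡ false
≢⇒≡ᵇ-false {m} {n} p with m ≡ᵇ n in eq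
... | true  = contradiction (≡ᵇ-true m n eq) p
... | false = refl

==ᶠ-true : ∀ {n} (i j : Fin n) → (i ==ᶠ j) ≡ true → i ≡ j
==ᶠ-true i j p = Fin.toℕ-injective (≡ᵇ-true (toℕ i) (toℕ j) p)

==ᴸ-true : ∀ l l′ → (l ==ᴸ l′) ≡ true → l ≡ l′
==ᴸ-true (var x)     (var y)       p = cong var (==ᶠ-true x y p)
==ᴸ-true (arr a i j) (arr b i′ j′) p
  with refl ← ==ᶠ-true a b (∧-trueˡ p)
     | refl ← ≡ᵇ-true i i′ (∧-trueˡ {i ≡ᵇ i′} (∧-trueʳ {a ==ᶠ b} p))
     | refl ← ≡ᵇ-true j j′ (∧-trueʳ {i ≡ᵇ i′} (∧-trueʳ {a ==ᶠ b} p)) = refl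

==ᴸ-refl : ∀ l → (l ==ᴸ l) ≡ true
==ᴸ-refl (var x) = ≡ᵇ-refl (toℕ x)
==ᴸ-refl (arr a i j) rewrite ≡ᵇ-refl (toℕ a) | ≡ᵇ-refl i = ≡ᵇ-refl j

==ᴸ⇒==ᴺ : ∀ l l′ → (l ==ᴸ l′) ≡ true → (name l′ ==ᴺ name l) ≡ true
==ᴸ⇒==ᴺ l l′ p with refl ← ==ᴸ-true l l′ p = go l
  where
  go : ∀ l → (name l ==ᴺ name l) ≡ true
  go (var x)     = ≡ᵇ-refl (toℕ x)
  go (arr a _ _) = ≡ᵇ-refl (toℕ a)

reading : Cmd → Bool
reading (c₁ ⨾ c₂)        = reading c₁ ∧ reading c₂
reading (writeᶜ _ _)     = false
reading (if≤ _ _ _ c c′) = reading c ∧ reading c′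
reading (for _ _ c)      = reading c
reading _                = true

-- The parameter lim bounds the contiguous region.
module Semantics {a ℓ₁ ℓ₂} (K : OrderedRing a ℓ₁ ℓ₂) (lim : ℕ) where

  open OrderedRingFacts K

  valLevel : Ty → Level
  valLevel nat  = Level.zero
  valLevel ring = a

  Val : (τ : Ty) → Set (valLevel τ)
  Val nat  = ℕ
  Val ring = Carrier

  -- Without η, distinct states are told apart without comparing their fields.
  record State : Set a where
    no-eta-equality
    pattern
    constructor ⟨_,_,_,_⟩
    field
      nats  : Loc → ℕ
      rings : Loc → Carrier
      flat  : ℕ → Carrier
      time  : ℕ

  open State public

  _[_↦_] : ∀ {b} {A : Set b} → (Loc → A) → Loc → A → Loc → A
  (f [ l ↦ v ]) l′ = if l′ ==ᴸ l then v else f l′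

  get : (τ : Ty) → State → Loc → Val τ
  get nat  s = nats s
  get ring s = rings s

  set : (τ : Ty) → Loc → Val τ → State → State
  set nat  l v s = record s { nats  = nats s [ l ↦ v ] }
  set ring l v s = record s { rings = rings s [ l ↦ v ] }

  write : ℕ → Carrier → State → State
  write z v s = record s { flat = λ z′ → if z′ ≡ᵇ z then v else flat s z′ }

  tick : ℕ → State → State
  tick n s = record s { time = time s + n }

  numeral : (τ : Ty) → ℕ → Val τ
  numeral nat  n = n
  numeral ring n = fromℕ n

  plus times : (τ : Ty) → Val τ → Val τ → Val τ
  plus nat   = _+_
  plus ring  = _⊕_
  times nat  = _*_
  times ring = _⊗_

  leq : (τ : Ty) → Val τ → Val τ → Bool
  leq nat  m n = m ≤ᵇ n
  leq ring x y = does (x ≼? y)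

  -- The ticks are those of the compiled code: eight instructions locate an array cell, and an else
  -- branch pays for one more jump. The guard in `readᶜ` and `writeᶜ` turns an access past the
  -- contiguous region into a no-op, so that the semantics is total and the region cannot interfere
  -- with the arrays.
  ⟦_⟧ : Cmd → State → State
  iterate : Cmd → Var → (n j : ℕ) → State → State

  ⟦ skip ⟧           s = s
  ⟦ c₁ ⨾ c₂ ⟧        s = ⟦ c₂ ⟧ (⟦ c₁ ⟧ s)
  ⟦ setᶜ τ x n ⟧     s = set τ (var x) (numeral τ n) (tick 1 s)
  ⟦ copyᶜ τ x y ⟧    s = set τ (var x) (get τ s (var y)) (tick 1 s)
  ⟦ addᶜ τ x y z ⟧   s = set τ (var x) (plus τ (get τ s (var y)) (get τ s (var z))) (tick 1 s)
  ⟦ mulᶜ τ x y z ⟧   s = set τ (var x) (times τ (get τ s (var y)) (get τ s (var z))) (tick 1 s)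
  ⟦ subᶜ x y z ⟧     s = set ring (var x) (rings s (var y) ⊖ rings s (var z)) (tick 1 s)
  ⟦ getᶜ τ x a i j ⟧ s =
    set τ (var x) (get τ s (arr a (nats s (var i)) (nats s (var j)))) (tick 9 s)
  ⟦ putᶜ τ a i j x ⟧ s =
    set τ (arr a (nats s (var i)) (nats s (var j))) (get τ s (var x)) (tick 9 s)
  ⟦ readᶜ x z ⟧      s = if lim ≤ᵇ 64 + nats s (var z) then tick 3 s
    else set ring (var x) (flat s (nats s (var z))) (tick 4 s)
  ⟦ writeᶜ z x ⟧     s = if lim ≤ᵇ 64 + nats s (var z) then tick 3 s
    else write (nats s (var z)) (fromℕ (nats s (var x))) (tick 4 s)
  ⟦ if≤ τ x y c c′ ⟧ s = if leq τ (get τ s (var x)) (get τ s (var y))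
    then ⟦ c ⟧ (tick 1 s) else tick 1 (⟦ c′ ⟧ (tick 1 s))
  ⟦ for x y c ⟧      s =
    iterate c x (nats s (var y)) 0 (set nat (var x) 0 (tick 1 s))

  iterate c x zero    j s = tick 1 s
  iterate c x (suc n) j s =
    iterate c x n (suc j) (set nat (var x) (suc j) (tick 3 (⟦ c ⟧ (tick 1 s))))

  if-elim : ∀ {b p} {A : Set b} (P : A → Set p) {u v : A} c →
            (c ≡ true → P u) → (c ≡ false → P v) → P (if c then u else v)
  if-elim P true  t f = t refl
  if-elim P false t f = f refl

  if-true : ∀ {b} {A : Set b} {c} {u v : A} → c ≡ true → (if c then u else v) ≡ u
  if-true refl = refl

  if-false : ∀ {b} {A : Set b} {c} {u v : A} → c ≡ false → (if c then u else v) ≡ v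
  if-false refl = refl

  ≤ᵇ-true : ∀ {m n} → (m ≤ᵇ n) ≡ true → m ≤ n
  ≤ᵇ-true {m} p = ℕ.≤ᵇ⇒≤ m _ (subst T (sym p) tt)

  ≤ᵇ-false : ∀ {m n} → (m ≤ᵇ n) ≡ false → n < m
  ≤ᵇ-false {m} p = ℕ.≰⇒> λ q → subst T p (ℕ.≤⇒≤ᵇ q)

  <⇒≤ᵇ-false : ∀ {m n} → n < m → (m ≤ᵇ n) ≡ false
  <⇒≤ᵇ-false {m} {n} p with m ≤ᵇ n in eq
  ... | true  = contradiction (≤ᵇ-true {m} eq) (ℕ.<⇒≱ p)
  ... | false = refl

  module _ {q} (Q : State → Set q) where

    if-nat : ∀ x y c c′ s →
             (nats s (var x) ≤ nats s (var y) → Q (⟦ c ⟧ (tick 1 s))) →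
             (nats s (var y) < nats s (var x) → Q (tick 1 (⟦ c′ ⟧ (tick 1 s)))) →
             Q (⟦ if≤ nat x y c c′ ⟧ s)
    if-nat x y c c′ s t f =
      if-elim Q (nats s (var x) ≤ᵇ nats s (var y))
        (t ∘ ≤ᵇ-true {nats s (var x)}) (f ∘ ≤ᵇ-false {nats s (var x)})

    if-ring : ∀ x y c c′ s →
              (rings s (var x) ≼ rings s (var y) → Q (⟦ c ⟧ (tick 1 s))) →
              (¬ rings s (var x) ≼ rings s (var y) → Q (tick 1 (⟦ c′ ⟧ (tick 1 s)))) →
              Q (⟦ if≤ ring x y c c′ ⟧ s)
    if-ring x y c c′ s t f with rings s (var x) ≼? rings s (var y)
    ... | yes p = t p
    ... | no ¬p = f ¬p

    seq : ∀ {r} (R : State → Set r) c₁ c₂ s →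
          R (⟦ c₁ ⟧ s) → (∀ s′ → R s′ → Q (⟦ c₂ ⟧ s′)) → Q (⟦ c₁ ⨾ c₂ ⟧ s)
    seq R c₁ c₂ s p k = k (⟦ c₁ ⟧ s) p

  iterate-rule : ∀ {i} (I : ℕ → State → Set i) c x n j {s} →
    nats s (var x) ≡ j → I j s →
    (∀ k s′ → k < j + n → nats s′ (var x) ≡ k → I k s′ →
       I (suc k) (set nat (var x) (suc k) (tick 3 (⟦ c ⟧ (tick 1 s′))))) →
    ∃[ s′ ] I (j + n) s′ × iterate c x n j s ≡ tick 1 s′
  iterate-rule I c x zero    j {s} eq p round = s , subst (λ k → I k s) (sym (ℕ.+-identityʳ j)) p , refl
  iterate-rule I c x (suc n) j {s} eq p round
    with s′ , p′ , eq′ ← iterate-rule I c x n (suc j)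
           (if-true (≡ᵇ-refl (toℕ x)))
           (round j s (ℕ.m<m+n j (s≤s z≤n)) eq p)
           (λ k s′ k< → round k s′ (subst (k <_) (sym (ℕ.+-suc j n)) k<))
    = s′ , subst (λ k → I k s′) (sym (ℕ.+-suc j n)) p′ , eq′

  -- The invariant rule for loops, with an arbitrary property `Q` of the final state so that this
  -- state is never computed. The closing `tick 1` is the loop test that leaves the loop.
  for-rule : ∀ {i q} (I : ℕ → State → Set i) (Q : State → Set q) x y c n s →
    nats s (var y) ≡ n →
    I 0 (set nat (var x) 0 (tick 1 s)) →
    (∀ j s′ → j < n → nats s′ (var x) ≡ j → I j s′ →
       I (suc j) (set nat (var x) (suc j) (tick 3 (⟦ c ⟧ (tick 1 s′))))) →
    (∀ s′ → I n s′ → Q (tick 1 s′)) → Q (⟦ for x y c ⟧ s)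
  for-rule I Q x y c n s refl entry round end
    with s′ , p , eq ← iterate-rule I c x n 0 (if-true (≡ᵇ-refl (toℕ x))) entry round
    = subst Q (sym eq) (end s′ p)

  -- The body of the loop takes at most b steps, and the loop itself 4 steps
  -- per round and 2 more.
  for-rule-timed : ∀ {i q} (I : ℕ → State → Set i) (Q : State → Set q) x y c n b s →
    nats s (var y) ≡ n →
    I 0 (set nat (var x) 0 (tick 1 s)) →
    (∀ j s′ → j < n → nats s′ (var x) ≡ j → I j s′ →
       I (suc j) (set nat (var x) (suc j) (tick 3 (⟦ c ⟧ (tick 1 s′)))) ×
       time (⟦ c ⟧ (tick 1 s′)) ≤ time (tick 1 s′) + b) →
    (∀ s′ → I n s′ → time (tick 1 s′) ≤ time s + (n * (4 + b) + 2) → Q (tick 1 s′)) →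
    Q (⟦ for x y c ⟧ s)
  for-rule-timed I Q x y c n b s eq entry round end =
    for-rule (λ j s′ → I j s′ × time s′ ≤ time s + (j * (4 + b) + 1)) Q x y c n s eq
      (entry , ≤-refl)
      (λ j s′ j<n eq′ (p , t) → proj₁ (round j s′ j<n eq′ p) ,
        ℕ.≤-trans (ℕ.+-monoˡ-≤ 3 (≤-trans (proj₂ (round j s′ j<n eq′ p))
          (ℕ.+-monoˡ-≤ b (ℕ.+-monoˡ-≤ 1 t)))) (ℕ.≤-reflexive (rearrange₂₀ (time s) (j * (4 + b)) b)))
      (λ s′ (p , t) → end s′ p (≤-trans (ℕ.+-monoˡ-≤ 1 t)
        (ℕ.≤-reflexive (rearrange₂₁ (time s) (n * (4 + b))))))

  time-loopFree : ∀ c → loopFree c ≡ true → ∀ s → time (⟦ c ⟧ s) ≤ time s + steps c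
  time-loopFree skip             p s = ℕ.m≤m+n (time s) 0
  time-loopFree (c₁ ⨾ c₂)        p s = ≤-trans (time-loopFree c₂ (∧-trueʳ {loopFree c₁} p) _)
    (≤-trans (ℕ.+-monoˡ-≤ (steps c₂) (time-loopFree c₁ (∧-trueˡ p) s))
      (ℕ.≤-reflexive (ℕ.+-assoc (time s) (steps c₁) (steps c₂))))
  time-loopFree (setᶜ nat x n)     p s = ≤-refl
  time-loopFree (setᶜ ring x n)    p s = ≤-refl
  time-loopFree (copyᶜ nat x y)    p s = ≤-refl
  time-loopFree (copyᶜ ring x y)   p s = ≤-refl
  time-loopFree (addᶜ nat x y z)   p s = ≤-refl
  time-loopFree (addᶜ ring x y z)  p s = ≤-refl
  time-loopFree (mulᶜ nat x y z)   p s = ≤-refl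
  time-loopFree (mulᶜ ring x y z)  p s = ≤-refl
  time-loopFree (subᶜ x y z)       p s = ≤-refl
  time-loopFree (getᶜ nat x a i j)  p s = ≤-refl
  time-loopFree (getᶜ ring x a i j) p s = ≤-refl
  time-loopFree (putᶜ nat a i j x)  p s = ≤-refl
  time-loopFree (putᶜ ring a i j x) p s = ≤-refl
  time-loopFree (readᶜ x z)        p s =
    if-elim (λ s′ → time s′ ≤ time s + 4) (lim ≤ᵇ 64 + nats s (var z))
      (λ _ → ℕ.+-monoʳ-≤ (time s) (ℕ.n≤1+n 3)) (λ _ → ≤-refl)
  time-loopFree (writeᶜ z x)       p s =
    if-elim (λ s′ → time s′ ≤ time s + 4) (lim ≤ᵇ 64 + nats s (var z))
      (λ _ → ℕ.+-monoʳ-≤ (time s) (ℕ.n≤1+n 3)) (λ _ → ≤-refl)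
  time-loopFree (if≤ τ x y c c′)   p s =
    if-elim (λ s′ → time s′ ≤ time s + steps (if≤ τ x y c c′))
      (leq τ (get τ s (var x)) (get τ s (var y)))
      (λ _ → ≤-trans (time-loopFree c (∧-trueˡ p) (tick 1 s))
        (≤-trans (ℕ.≤-reflexive (ℕ.+-assoc (time s) 1 (steps c)))
          (ℕ.+-monoʳ-≤ (time s) (s≤s (ℕ.m≤n⇒m≤1+n (ℕ.m≤m+n (steps c) (steps c′)))))))
      (λ _ → ≤-trans (ℕ.+-monoˡ-≤ 1 (time-loopFree c′ (∧-trueʳ {loopFree c} p) (tick 1 s)))
        (≤-trans (ℕ.≤-reflexive (rearrange₂₂ (time s) (steps c′)))
          (ℕ.+-monoʳ-≤ (time s) (s≤s (s≤s (ℕ.m≤n+m (steps c′) (steps c)))))))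

  set-unwritten : ∀ σ τ l l′ {v s} → not ((σ ==ᵀ τ) ∧ (name l ==ᴺ name l′)) ≡ true →
                  get τ (set σ l v s) l′ ≡ get τ s l′
  set-unwritten nat  ring l l′ p = refl
  set-unwritten ring nat  l l′ p = refl
  set-unwritten nat  nat  l l′ p with l′ ==ᴸ l in eq
  ... | false = refl
  ... | true rewrite ==ᴸ⇒==ᴺ l′ l eq with () ← p
  set-unwritten ring ring l l′ p with l′ ==ᴸ l in eq
  ... | false = refl
  ... | true rewrite ==ᴸ⇒==ᴺ l′ l eq with () ← p

  get-tick : ∀ τ n s l → get τ (tick n s) l ≡ get τ s l
  get-tick nat  n s l = refl
  get-tick ring n s l = refl

  get-write : ∀ τ z v s l → get τ (write z v s) l ≡ get τ s l
  get-write nat  z v s l = refl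
  get-write ring z v s l = refl

  set-tick-unwritten : ∀ σ τ l l′ {v s} n → not ((σ ==ᵀ τ) ∧ (name l ==ᴺ name l′)) ≡ true →
                       get τ (set σ l v (tick n s)) l′ ≡ get τ s l′
  set-tick-unwritten σ τ l l′ {v} {s} n p =
    trans (set-unwritten σ τ l l′ {v} {tick n s} p) (get-tick τ n s l′)

  frame : ∀ c τ l → unwritten c τ (name l) ≡ true → ∀ s → get τ (⟦ c ⟧ s) l ≡ get τ s l
  iterate-frame : ∀ c x τ l → not ((nat ==ᵀ τ) ∧ (var x ==ᴺ name l)) ≡ true →
    unwritten c τ (name l) ≡ true → ∀ n j s → get τ (iterate c x n j s) l ≡ get τ s l

  frame skip             τ l p s = refl
  frame (c₁ ⨾ c₂)        τ l p s = trans (frame c₂ τ l (∧-trueʳ {unwritten c₁ τ (name l)} p) _)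
                                         (frame c₁ τ l (∧-trueˡ p) s)
  frame (setᶜ σ x _)     τ l p s = set-tick-unwritten σ τ (var x) l 1 p
  frame (copyᶜ σ x _)    τ l p s = set-tick-unwritten σ τ (var x) l 1 p
  frame (addᶜ σ x _ _)   τ l p s = set-tick-unwritten σ τ (var x) l 1 p
  frame (mulᶜ σ x _ _)   τ l p s = set-tick-unwritten σ τ (var x) l 1 p
  frame (subᶜ x _ _)     τ l p s = set-tick-unwritten ring τ (var x) l 1 p
  frame (getᶜ σ x _ _ _) τ l p s = set-tick-unwritten σ τ (var x) l 9 p
  frame (putᶜ σ a i j _) τ l p s = set-tick-unwritten σ τ (arr a _ _) l 9 p
  frame (readᶜ x z)      τ l p s =
    if-elim (λ s′ → get τ s′ l ≡ get τ s l) (lim ≤ᵇ 64 + nats s (var z))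
      (λ _ → get-tick τ 3 s l) (λ _ → set-tick-unwritten ring τ (var x) l 4 p)
  frame (writeᶜ z x)     τ l p s =
    if-elim (λ s′ → get τ s′ l ≡ get τ s l) (lim ≤ᵇ 64 + nats s (var z))
      (λ _ → get-tick τ 3 s l)
      (λ _ → trans (get-write τ _ _ (tick 4 s) l) (get-tick τ 4 s l))
  frame (if≤ σ x y c c′) τ l p s =
    if-elim (λ s′ → get τ s′ l ≡ get τ s l) (leq σ (get σ s (var x)) (get σ s (var y)))
      (λ _ → trans (frame c τ l (∧-trueˡ p) _) (get-tick τ 1 s l))
      (λ _ → trans (get-tick τ 1 _ l)
        (trans (frame c′ τ l (∧-trueʳ {unwritten c τ (name l)} p) _) (get-tick τ 1 s l)))
  frame (for x y c)      τ l p s =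
    trans (iterate-frame c x τ l (∧-trueˡ p)
            (∧-trueʳ {not ((nat ==ᵀ τ) ∧ (var x ==ᴺ name l))} p) (nats s (var y)) 0 _)
          (set-tick-unwritten nat τ (var x) l {0} {s} 1 (∧-trueˡ p))

  iterate-frame c x τ l p q zero    j s = get-tick τ 1 s l
  iterate-frame c x τ l p q (suc n) j s =
    trans (iterate-frame c x τ l p q n (suc j) _)
      (trans (set-tick-unwritten nat τ (var x) l {suc j} {⟦ c ⟧ (tick 1 s)} 3 p)
        (trans (frame c τ l q _) (get-tick τ 1 s l)))

  Fixed : List (Var × ℕ) → State → Set
  Fixed []             s = ⊤
  Fixed ((x , n) ∷ os) s = nats s (var x) ≡ n × Fixed os s

  unwrittenVars : Cmd → List (Var × ℕ) → Bool
  unwrittenVars c []             = true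
  unwrittenVars c ((x , _) ∷ os) = unwritten c nat (var x) ∧ unwrittenVars c os

  fixed-frame : ∀ os c → unwrittenVars c os ≡ true → ∀ s → Fixed os s → Fixed os (⟦ c ⟧ s)
  fixed-frame []             c p s _       = tt
  fixed-frame ((x , n) ∷ os) c p s (e , f) =
    trans (frame c nat (var x) (∧-trueˡ p) s) e ,
    fixed-frame os c (∧-trueʳ {unwritten c nat (var x)} p) s f

  module _ {b} {B : Set b} {u w : B} where

    entry-hit : ∀ {i′ i j′ j} → i′ ≡ i → j′ ≡ j → (if (i′ ≡ᵇ i) ∧ (j′ ≡ᵇ j) then u else w) ≡ u
    entry-hit {i} {j′ = j} refl refl rewrite ≡ᵇ-refl i | ≡ᵇ-refl j = refl

    entry-row : ∀ {i′ i} j′ j → i′ ≢ i → (if (i′ ≡ᵇ i) ∧ (j′ ≡ᵇ j) then u else w) ≡ w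
    entry-row j′ j p rewrite ≢⇒≡ᵇ-false p = refl

    entry-column : ∀ i′ i {j′ j} → j′ ≢ j → (if (i′ ≡ᵇ i) ∧ (j′ ≡ᵇ j) then u else w) ≡ w
    entry-column i′ i p with i′ ≡ᵇ i
    ... | true rewrite ≢⇒≡ᵇ-false p = refl
    ... | false = refl

  flat-set : ∀ τ l u s → flat (set τ l u s) ≡ flat s
  flat-set nat  l u s = refl
  flat-set ring l u s = refl

  flat-frame : ∀ c → reading c ≡ true → ∀ s → flat (⟦ c ⟧ s) ≡ flat s
  flat-iterate : ∀ c x → reading c ≡ true → ∀ n j s → flat (iterate c x n j s) ≡ flat s

  flat-frame skip             p s = refl
  flat-frame (c₁ ⨾ c₂)        p s = trans (flat-frame c₂ (∧-trueʳ {reading c₁} p) _) (flat-frame c₁ (∧-trueˡ p) s)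
  flat-frame (setᶜ τ x n)     p s = flat-set τ (var x) _ (tick 1 s)
  flat-frame (copyᶜ τ x y)    p s = flat-set τ (var x) _ (tick 1 s)
  flat-frame (addᶜ τ x y z)   p s = flat-set τ (var x) _ (tick 1 s)
  flat-frame (mulᶜ τ x y z)   p s = flat-set τ (var x) _ (tick 1 s)
  flat-frame (subᶜ x y z)     p s = refl
  flat-frame (getᶜ τ x b i j) p s = flat-set τ (var x) _ (tick 9 s)
  flat-frame (putᶜ τ b i j x) p s = flat-set τ (arr b _ _) _ (tick 9 s)
  flat-frame (readᶜ x z)      p s = if-elim (λ s′ → flat s′ ≡ flat s) (lim ≤ᵇ 64 + nats s (var z))
    (λ _ → refl) (λ _ → refl)
  flat-frame (if≤ τ x y c c′) p s = if-elim (λ s′ → flat s′ ≡ flat s) (leq τ (get τ s (var x)) (get τ s (var y)))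
    (λ _ → flat-frame c (∧-trueˡ p) (tick 1 s)) (λ _ → flat-frame c′ (∧-trueʳ {reading c} p) (tick 1 s))
  flat-frame (for x y c)      p s = flat-iterate c x p (nats s (var y)) 0 _

  flat-iterate c x p zero    j s = refl
  flat-iterate c x p (suc n) j s = trans (flat-iterate c x p n (suc j) _) (flat-frame c p (tick 1 s))

-- Compilation to RAM programs and exact simulation

tag : Ty → ℕ
tag nat  = 0
tag ring = 1

-- The cells below 6 are reserved for the base address, for `r` and `N` as given, and for scratch
-- values. The 28 variables of both types then end before cell 64.
varAddress : Ty → Var → Address
varAddress τ x = 6 + (toℕ x * 2 + tag τ)

-- Cell 0 holds the first address of the arrays, cells 3 and 4 are scratch
-- cells, and (i + j)² + i is injective in the pair (i , j).
locate : Ty → Arr → (i j : Var) → Program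
locate τ a i j =
  add 3 (varAddress nat i) (varAddress nat j) ∷
  mul 3 3 3 ∷
  add 3 3 (varAddress nat i) ∷
  const 4 16 ∷
  mul 3 3 4 ∷
  const 4 (toℕ a * 2 + tag τ) ∷
  add 3 3 4 ∷
  add 3 3 0 ∷ []

-- The end label is computed without the code, so that forward jumps have their targets while the
-- code is being generated.
exit : Cmd → Label → Label
exit skip             k = k
exit (c₁ ⨾ c₂)        k = exit c₂ (exit c₁ k)
exit (getᶜ _ _ _ _ _) k = 9 + k
exit (putᶜ _ _ _ _ _) k = 9 + k
exit (readᶜ _ _)      k = 4 + k
exit (writeᶜ _ _)     k = 4 + k
exit (if≤ _ _ _ c c′) k = exit c (suc (exit c′ (suc k)))
exit (for _ _ c)      k = 3 + exit c (2 + k)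
exit _                k = suc k

code : Cmd → Label → Program
code skip             k = []
code (c₁ ⨾ c₂)        k = code c₁ k ++ code c₂ (exit c₁ k)
code (setᶜ τ x n)     k = const (varAddress τ x) n ∷ []
code (copyᶜ τ x y)    k = move (varAddress τ x) (varAddress τ y) ∷ []
code (addᶜ τ x y z)   k = add (varAddress τ x) (varAddress τ y) (varAddress τ z) ∷ []
code (mulᶜ τ x y z)   k = mul (varAddress τ x) (varAddress τ y) (varAddress τ z) ∷ []
code (subᶜ x y z)     k =
  sub (varAddress ring x) (varAddress ring y) (varAddress ring z) ∷ []
code (getᶜ τ x a i j) k = locate τ a i j ++ load (varAddress τ x) 3 ∷ []
code (putᶜ τ a i j x) k = locate τ a i j ++ store 3 (varAddress τ x) ∷ []
code (readᶜ x z)      k =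
  const 3 64 ∷ add 3 3 (varAddress nat z) ∷ jump-if-≤ 0 3 (4 + k) ∷
  load (varAddress ring x) 3 ∷ []
code (writeᶜ z x)     k =
  const 3 64 ∷ add 3 3 (varAddress nat z) ∷ jump-if-≤ 0 3 (4 + k) ∷
  store 3 (varAddress nat x) ∷ []
code (if≤ τ x y c c′) k =
  jump-if-≤ (varAddress τ x) (varAddress τ y) (suc e) ∷
  code c′ (suc k) ++ jump (exit c (suc e)) ∷ code c (suc e)
  where e = exit c′ (suc k)
code (for x y c)      k =
  const (varAddress nat x) 0 ∷
  jump-if-≤ (varAddress nat y) (varAddress nat x) (3 + e) ∷
  code c (2 + k) ++
  const 3 1 ∷ add (varAddress nat x) (varAddress nat x) 3 ∷ jump (1 + k) ∷ []
  where e = exit c (2 + k)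

length-code : ∀ c k → length (code c k) + k ≡ exit c k
length-code skip             k = refl
length-code (c₁ ⨾ c₂)        k = trans (cong (_+ k) (List.length-++ (code c₁ k)))
  (trans (rearrange₃₆ (length (code c₁ k)) (length (code c₂ (exit c₁ k))) k)
  (trans (cong (length (code c₂ (exit c₁ k)) +_) (length-code c₁ k))
         (length-code c₂ (exit c₁ k))))
length-code (setᶜ _ _ _)     k = refl
length-code (copyᶜ _ _ _)    k = refl
length-code (addᶜ _ _ _ _)   k = refl
length-code (mulᶜ _ _ _ _)   k = refl
length-code (subᶜ _ _ _)     k = refl
length-code (getᶜ _ _ _ _ _) k = refl
length-code (putᶜ _ _ _ _ _) k = refl
length-code (readᶜ _ _)      k = refl
length-code (writeᶜ _ _)     k = refl
length-code (if≤ _ _ _ c c′) k =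
  trans (cong (λ n → suc (n + k)) (List.length-++ (code c′ (suc k))))
  (trans (rearrange₃₇ (length (code c′ (suc k))) _ k)
  (trans (cong (λ n → length (code c (suc (exit c′ (suc k)))) + suc n) (length-code c′ (suc k)))
         (length-code c _)))
length-code (for x y c)      k =
  trans (cong (λ n → 2 + (n + k)) (List.length-++ (code c (2 + k))))
  (trans (rearrange₃₈ (length (code c (2 + k))) k)
         (cong (3 +_) (length-code c (2 + k))))

CodeAt : Program → Label → Program → Set
CodeAt P k []       = ⊤
CodeAt P k (i ∷ is) = (P ‼ k ≡ just i) × CodeAt P (suc k) is

CodeAt-++ : ∀ {P} k is {js} → CodeAt P k (is ++ js) →
            CodeAt P k is × CodeAt P (length is + k) js
CodeAt-++ k []       q       = tt , q
CodeAt-++ {P} k (i ∷ is) {js} (p , q) with q₁ , q₂ ← CodeAt-++ (suc k) is q =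
  (p , q₁) , subst (λ n → CodeAt P n js) (ℕ.+-suc (length is) k) q₂

CodeAt-code : ∀ {P} c k {js} → CodeAt P k (code c k ++ js) →
              CodeAt P k (code c k) × CodeAt P (exit c k) js
CodeAt-code {P} c k {js} p with q₁ , q₂ ← CodeAt-++ k (code c k) p =
  q₁ , subst (λ n → CodeAt P n js) (length-code c k) q₂

CodeAt-suffix : ∀ is js {P} → P ≡ is ++ js → CodeAt P (length is) js
CodeAt-suffix is []       eq = tt
CodeAt-suffix is (j ∷ js) refl =
  here is , subst (λ n → CodeAt (is ++ j ∷ js) n js)
    (trans (List.length-++ is) (ℕ.+-comm (length is) 1))
    (CodeAt-suffix (is ++ j ∷ []) js (sym (List.++-assoc is (j ∷ []) js)))
  where
  here : ∀ is → (is ++ j ∷ js) ‼ length is ≡ just j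
  here []       = refl
  here (_ ∷ is) = here is

*+-injective : ∀ n {m m′ k k′} → k < n → k′ < n → m * n + k ≡ m′ * n + k′ →
               m ≡ m′ × k ≡ k′
*+-injective n {zero}  {zero}   p q eq = refl , eq
*+-injective n {zero}  {suc m′} {k} {k′} p q eq =
  contradiction p (ℕ.≤⇒≯ (≤-trans (≤-trans (ℕ.m≤m+n n (m′ * n)) (ℕ.m≤m+n _ k′)) (ℕ.≤-reflexive (sym eq))))
*+-injective n {suc m} {zero}   {k} {k′} p q eq =
  contradiction q (ℕ.≤⇒≯ (≤-trans (≤-trans (ℕ.m≤m+n n (m * n)) (ℕ.m≤m+n _ k)) (ℕ.≤-reflexive eq)))
*+-injective n {suc m} {suc m′} {k} {k′} p q eq
  with *+-injective n p q (ℕ.+-cancelˡ-≡ n _ _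
         (trans (sym (ℕ.+-assoc n (m * n) k)) (trans eq (ℕ.+-assoc n (m′ * n) k′))))
... | e , e′ = cong suc e , e′

pair : ℕ → ℕ → ℕ
pair i j = (i + j) * (i + j) + i

-- With `s = i + j` and `i ≤ s`, the value `s² + i` stays below `(s + 1)²`. So pairs with different
-- sums have values in disjoint intervals, which is the main step towards injectivity.
pair-mono : ∀ {i j i′ j′} → i + j < i′ + j′ → pair i j < pair i′ j′
pair-mono {i} {j} {i′} {j′} p = begin-strict
  (i + j) * (i + j) + i                      ≤⟨ ℕ.+-monoʳ-≤ _ (ℕ.m≤m+n i j) ⟩
  (i + j) * (i + j) + (i + j)                <⟨ ℕ.m<m+n _ (s≤s z≤n) ⟩
  (i + j) * (i + j) + (i + j) + suc (i + j)  ≡⟨ rearrange₃₉ (i + j) ⟩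
  suc (i + j) * suc (i + j)                  ≤⟨ ℕ.*-mono-≤ p p ⟩
  (i′ + j′) * (i′ + j′)                      ≤⟨ ℕ.m≤m+n _ i′ ⟩
  (i′ + j′) * (i′ + j′) + i′                 ∎
  where
  open ℕ.≤-Reasoning

pair-injective : ∀ {i j i′ j′} → pair i j ≡ pair i′ j′ → i ≡ i′ × j ≡ j′
pair-injective {i} {j} {i′} {j′} eq with ℕ.<-cmp (i + j) (i′ + j′)
... | tri< p _ _ = contradiction eq (ℕ.<⇒≢ (pair-mono {i} {j} {i′} {j′} p))
... | tri> _ _ p = contradiction (sym eq) (ℕ.<⇒≢ (pair-mono {i′} {j′} {i} {j} p))
... | tri≈ _ p _ = e , ℕ.+-cancelˡ-≡ i′ _ _ (trans (cong (_+ j) (sym e)) p)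
  where
  e : i ≡ i′
  e = ℕ.+-cancelˡ-≡ ((i + j) * (i + j)) _ _ (trans eq (cong (λ s → s * s + i′) (sym p)))

tag<2 : ∀ τ → tag τ < 2
tag<2 nat  = s≤s z≤n
tag<2 ring = s≤s (s≤s z≤n)

tag-injective : ∀ {τ σ} → tag τ ≡ tag σ → τ ≡ σ
tag-injective {nat}  {nat}  _ = refl
tag-injective {ring} {ring} _ = refl

module Simulation {a ℓ₁ ℓ₂} (K : OrderedRing a ℓ₁ ℓ₂) (lim : ℕ) (64≤lim : 64 ≤ lim)
                  (P : Program) where

  open OrderedRingFacts K
  open Semantics K lim

  -- Eight arrays of two types are interleaved by residues modulo 16, beginning at cell `lim`.
  address : Ty → Loc → Address
  address τ (var x)     = varAddress τ x
  address τ (arr a i j) = (pair i j * 16 + (toℕ a * 2 + tag τ)) + lim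

  slot : ∀ {n} → Ty → Fin n → ℕ
  slot τ x = toℕ x * 2 + tag τ

  slot< : ∀ {n} τ (x : Fin n) → slot τ x < n * 2
  slot< {n} τ x = ≤-trans (ℕ.+-monoʳ-< (toℕ x * 2) (tag<2 τ))
    (≤-trans (ℕ.≤-reflexive (ℕ.+-comm (toℕ x * 2) 2)) (ℕ.*-monoˡ-≤ 2 (Fin.toℕ<n x)))

  slot-injective : ∀ {n τ σ} {x y : Fin n} → slot τ x ≡ slot σ y → τ ≡ σ × x ≡ y
  slot-injective {τ = τ} {σ} {x} {y} eq
    with e , e′ ← *+-injective 2 {toℕ x} {toℕ y} (tag<2 τ) (tag<2 σ) eq =
    tag-injective e′ , Fin.toℕ-injective e

  varAddress<64 : ∀ τ x → varAddress τ x < 64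
  varAddress<64 τ x = ≤-trans (ℕ.+-monoʳ-< 6 (slot< τ x)) (ℕ.m≤m+n 62 2)

  var≢arr : ∀ {τ σ x a i j} → address τ (var x) ≢ address σ (arr a i j)
  var≢arr {τ} {x = x} = ℕ.<⇒≢ (ℕ.<-≤-trans (varAddress<64 τ x)
    (≤-trans 64≤lim (ℕ.m≤n+m lim _)))

  address-injective : ∀ {τ σ} l l′ → address τ l ≡ address σ l′ → τ ≡ σ × l ≡ l′
  address-injective (var x) (var y) eq
    with e , e′ ← slot-injective {x = x} {y} (ℕ.+-cancelˡ-≡ 6 _ _ eq) = e , cong var e′
  address-injective (var x) (arr a i j) eq = contradiction eq (var≢arr {x = x} {a} {i} {j})
  address-injective (arr a i j) (var x) eq = contradiction (sym eq) (var≢arr {x = x} {a} {i} {j})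
  address-injective {τ} {σ} (arr a i j) (arr b i′ j′) eq
    with e , e′ ← *+-injective 16 {pair i j} {pair i′ j′} (slot< τ a) (slot< σ b)
                    (ℕ.+-cancelʳ-≡ lim _ _ eq)
    with refl , refl ← pair-injective {i} {j} {i′} {j′} e
       | refl , refl ← slot-injective {τ = τ} {σ} {a} {b} e′ = refl , refl

  put-same : ∀ (m : Memory K) x {v} → _[_≔_] K m x v x ≡ v
  put-same m x = if-true (≡ᵇ-refl x)

  put-other : ∀ (m : Memory K) {x y v} → y ≢ x → _[_≔_] K m x v y ≡ m y
  put-other m p = if-false (≢⇒≡ᵇ-false p)

  -- Nothing is said of cells 1 to 5, so scratch computations preserve the relation.
  record Sim (m : Memory K) (s : State) : Set ℓ₁ where
    field
      base       : m 0 ≈ fromℕ lim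
      nat-cells  : ∀ l → m (address nat l) ≈ fromℕ (nats s l)
      ring-cells : ∀ l → m (address ring l) ≈ rings s l
      flat-cells : ∀ z → 64 + z < lim → m (64 + z) ≈ flat s z

  open Sim public

  embed : ∀ τ → Val τ → Carrier
  embed nat  n = fromℕ n
  embed ring x = x

  cells : ∀ {m s} → Sim m s → ∀ τ l → m (address τ l) ≈ embed τ (get τ s l)
  cells S nat  = nat-cells S
  cells S ring = ring-cells S

  sim-untouched : ∀ {m s x v} → 1 ≤ x → x < 6 → Sim m s → Sim (_[_≔_] K m x v) s
  sim-untouched {m} {s} {x} {v} p q S = record
    { base       = ≈-trans (≈-reflexive (put-other m (ℕ.<⇒≢ p))) (base S)
    ; nat-cells  = λ l → ≈-trans (≈-reflexive (put-other m (other nat l))) (nat-cells S l)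
    ; ring-cells = λ l → ≈-trans (≈-reflexive (put-other m (other ring l))) (ring-cells S l)
    ; flat-cells = λ z z< → ≈-trans (≈-reflexive (put-other m
        (ℕ.>⇒≢ (ℕ.<-≤-trans q (≤-trans (ℕ.m≤m+n 6 58) (ℕ.m≤m+n 64 z)))))) (flat-cells S z z<) }
    where
    other : ∀ τ l → address τ l ≢ x
    other τ (var y)     = ℕ.>⇒≢ (ℕ.<-≤-trans q (ℕ.m≤m+n 6 _))
    other τ (arr _ _ _) = ℕ.>⇒≢ (ℕ.<-≤-trans q
      (≤-trans (≤-trans (ℕ.m≤m+n 6 58) 64≤lim) (ℕ.m≤n+m lim _)))

  sim-tick : ∀ {m s} n → Sim m s → Sim m (tick n s)
  sim-tick n S = record { base = base S ; nat-cells = nat-cells S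
                        ; ring-cells = ring-cells S ; flat-cells = flat-cells S }

  address-positive : ∀ τ l → address τ l ≢ 0
  address-positive τ (var x) ()
  address-positive τ (arr a i j) eq =
    contradiction (≤-trans 64≤lim (≤-trans (ℕ.m≤n+m lim _) (ℕ.≤-reflexive eq))) λ ()

  flat≢address : ∀ τ l {z} → 64 + z < lim → 64 + z ≢ address τ l
  flat≢address τ (var x) {z} p = ℕ.>⇒≢ (ℕ.<-≤-trans (varAddress<64 τ x) (ℕ.m≤m+n 64 z))
  flat≢address τ (arr a i j) p = ℕ.<⇒≢ (ℕ.<-≤-trans p (ℕ.m≤n+m lim _))

  sim-set : ∀ {m s} τ l {v u} → Sim m s → v ≈ embed τ u →
            Sim (_[_≔_] K m (address τ l) v) (set τ l u s)
  sim-set {m} {s} nat l {v} {u} S eq = record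
    { base       = ≈-trans (≈-reflexive (put-other m (address-positive nat l ∘ sym))) (base S)
    ; nat-cells  = same
    ; ring-cells = λ l′ → ≈-trans (≈-reflexive (put-other m (λ e → case′ (proj₁ (address-injective {ring} {nat} l′ l e))))) (ring-cells S l′)
    ; flat-cells = λ z p → ≈-trans (≈-reflexive (put-other m (flat≢address nat l p))) (flat-cells S z p) }
    where
    case′ : ring ≢ nat
    case′ ()
    same : ∀ l′ → _[_≔_] K m (address nat l) v (address nat l′) ≈ fromℕ (nats (set nat l u s) l′)
    same l′ with l′ ==ᴸ l in e
    ... | true with refl ← ==ᴸ-true l′ l e = ≈-trans (≈-reflexive (put-same m (address nat l))) eq
    ... | false = ≈-trans (≈-reflexive (put-other m λ e′ → f (proj₂ (address-injective {nat} {nat} l′ l e′)))) (nat-cells S l′)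
      where
      f : l′ ≢ l
      f refl with () ← trans (sym (==ᴸ-refl l)) e
  sim-set {m} {s} ring l {v} {u} S eq = record
    { base       = ≈-trans (≈-reflexive (put-other m (address-positive ring l ∘ sym))) (base S)
    ; nat-cells  = λ l′ → ≈-trans (≈-reflexive (put-other m (λ e → case′ (proj₁ (address-injective {nat} {ring} l′ l e))))) (nat-cells S l′)
    ; ring-cells = same
    ; flat-cells = λ z p → ≈-trans (≈-reflexive (put-other m (flat≢address ring l p))) (flat-cells S z p) }
    where
    case′ : nat ≢ ring
    case′ ()
    same : ∀ l′ → _[_≔_] K m (address ring l) v (address ring l′) ≈ rings (set ring l u s) l′
    same l′ with l′ ==ᴸ l in e
    ... | true with refl ← ==ᴸ-true l′ l e = ≈-trans (≈-reflexive (put-same m (address ring l))) eq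
    ... | false = ≈-trans (≈-reflexive (put-other m λ e′ → f (proj₂ (address-injective {ring} {ring} l′ l e′)))) (ring-cells S l′)
      where
      f : l′ ≢ l
      f refl with () ← trans (sym (==ᴸ-refl l)) e

  sim-write : ∀ {m s} z {v u} → 64 + z < lim → Sim m s → v ≈ u →
              Sim (_[_≔_] K m (64 + z) v) (write z u s)
  sim-write {m} {s} z {v} {u} p S eq = record
    { base       = base S
    ; nat-cells  = λ l → ≈-trans (≈-reflexive (put-other m (flat≢address nat l p ∘ sym))) (nat-cells S l)
    ; ring-cells = λ l → ≈-trans (≈-reflexive (put-other m (flat≢address ring l p ∘ sym))) (ring-cells S l)
    ; flat-cells = same }
    where
    same : ∀ z′ → 64 + z′ < lim → _[_≔_] K m (64 + z) v (64 + z′) ≈ flat (write z u s) z′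
    same z′ q with z′ ≡ᵇ z in e
    ... | true  = eq
    ... | false = flat-cells S z′ q

  -- Since `Run` describes halting computations only, a partial computation is expressed by what it
  -- does to them: any run from its end becomes a run from its start. Such statements compose as
  -- functions.
  Reach : Label → Memory K → ℕ → Label → Memory K → Set _
  Reach k m n k′ m′ = ∀ {t m″} → Run K P k′ m′ t m″ → Run K P k m (n + t) m″

  one : ∀ {k m i k′ m′} → P ‼ k ≡ just i → Step K k m i k′ m′ → Reach k m 1 k′ m′
  one p st = step p st

  infixr 5 _▷_
  _▷_ : ∀ {k m n k′ m′ n′ k″ m″} → Reach k m n k′ m′ → Reach k′ m′ n′ k″ m″ →
        Reach k m (n + n′) k″ m″
  _▷_ {k} {m} {n} {n′ = n′} f g {t} {m″} run =
    subst (λ i → Run K P k m i m″) (sym (ℕ.+-assoc n n′ t)) (f (g run))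

  -- The clock of the state and the number of machine steps agree exactly, so bounds on `time` are
  -- bounds for the RAM.
  record Simulates (k : Label) (m : Memory K) (s : State) (k′ : Label) (s′ : State) :
                   Set (a ⊔ˡ ℓ₁ ⊔ˡ ℓ₂) where
    constructor wrap
    field
      unwrap : ∃[ m′ ] ∃[ n ] (Reach k m n k′ m′ × Sim m′ s′ × time s′ ≡ time s + n)

  compose : ∀ {k m s k′ s′ k″ s″} → Simulates k m s k′ s′ →
    (∀ m′ → Sim m′ s′ → Simulates k′ m′ s′ k″ s″) → Simulates k m s k″ s″
  compose {s = s} (wrap (m′ , n , R , S , T)) g with wrap (m″ , n′ , R′ , S′ , T′) ← g m′ S = wrap
    (m″ , n + n′ , R ▷ R′ , S′ ,
    trans T′ (trans (cong (_+ n′) T) (ℕ.+-assoc (time s) n n′)))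

  sum : ∀ {x y} m n → x ≈ fromℕ m → y ≈ fromℕ n → x ⊕ y ≈ fromℕ (m + n)
  sum m n p q = ≈-trans (+-cong p q) (≈-sym (fromℕ-+ m n))

  product : ∀ {x y} m n → x ≈ fromℕ m → y ≈ fromℕ n → x ⊗ y ≈ fromℕ (m * n)
  product m n p q = ≈-trans (*-cong p q) (≈-sym (fromℕ-* m n))

  sim-plus : ∀ τ {x y} u v → x ≈ embed τ u → y ≈ embed τ v → x ⊕ y ≈ embed τ (plus τ u v)
  sim-plus nat u v p q = sum u v p q
  sim-plus ring u v p q = +-cong p q

  sim-times : ∀ τ {x y} u v → x ≈ embed τ u → y ≈ embed τ v → x ⊗ y ≈ embed τ (times τ u v)
  sim-times nat u v p q = product u v p q
  sim-times ring u v p q = *-cong p q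

  sim-numeral : ∀ τ n → fromℕ n ≈ embed τ (numeral τ n)
  sim-numeral nat  n = ≈-refl
  sim-numeral ring n = ≈-refl

  sim-leq : ∀ τ {x y u v} → x ≈ embed τ u → y ≈ embed τ v →
            (leq τ u v ≡ true → x ≼ y) × (leq τ u v ≡ false → ¬ x ≼ y)
  sim-leq nat {u = u} {v} p q =
    (λ e → ≼-resp (≈-sym p) (≈-sym q) (fromℕ-mono (≤ᵇ-true {u} e))) ,
    (λ e le → ℕ.<⇒≱ (≤ᵇ-false {u} e) (fromℕ-reflects u v (≼-resp p q le)))
  sim-leq ring {u = u} {v} p q with u ≼? v
  ... | yes le = (λ _ → ≼-resp (≈-sym p) (≈-sym q) le) , λ ()
  ... | no ¬le = (λ ()) , λ _ le → ¬le (≼-resp p q le)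

  time-set : ∀ τ l v s → time (set τ l v s) ≡ time s
  time-set nat  l v s = refl
  time-set ring l v s = refl

  assign : ∀ {k m s i v} τ x u n → P ‼ k ≡ just i →
    Step K k m i (suc k) (_[_≔_] K m (varAddress τ x) v) → Sim m s → v ≈ embed τ u → n ≡ 1 →
    Simulates k m s (suc k) (set τ (var x) u (tick n s))
  assign {s = s} τ x u n p st S eq refl =
    wrap (_ , 1 , one p st , sim-set τ (var x) (sim-tick 1 S) eq , time-set τ (var x) u (tick 1 s))

  located : ∀ {k m s} τ a i j → CodeAt P k (locate τ a i j) → Sim m s →
    ∃[ m′ ] (Reach k m 8 (8 + k) m′ × Sim m′ s ×
             m′ 3 ≈ fromℕ (address τ (arr a (nats s (var i)) (nats s (var j)))))
  located {k} {m} {s} τ a i j (p₁ , p₂ , p₃ , p₄ , p₅ , p₆ , p₇ , p₈ , _) S =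
    _ , (λ run → step p₁ add (step p₂ mul (step p₃ add (step p₄ const
           (step p₅ mul (step p₆ const (step p₇ add (step p₈ add run)))))))) ,
    (t3 (t3 (t4 (t3 (t4 (t3 (t3 (t3 S)))))))) ,
    sum (pair i₀ j₀ * 16 + (toℕ a * 2 + tag τ)) lim (sum (pair i₀ j₀ * 16) (toℕ a * 2 + tag τ)
      (product (pair i₀ j₀) 16 (sum ((i₀ + j₀) * (i₀ + j₀)) i₀
        (product (i₀ + j₀) (i₀ + j₀) ij ij) (nat-cells S (var i)))
      ≈-refl) ≈-refl) (base S)
    where
    i₀ = nats s (var i)
    j₀ = nats s (var j)
    ij : m (varAddress nat i) ⊕ m (varAddress nat j) ≈ fromℕ (nats s (var i) + nats s (var j))
    ij = sum i₀ j₀ (nat-cells S (var i)) (nat-cells S (var j))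
    t3 : ∀ {m v} → Sim m s → Sim (_[_≔_] K m 3 v) s
    t3 = sim-untouched (s≤s z≤n) (s≤s (s≤s (s≤s (s≤s z≤n))))
    t4 : ∀ {m v} → Sim m s → Sim (_[_≔_] K m 4 v) s
    t4 = sim-untouched (s≤s z≤n) (s≤s (s≤s (s≤s (s≤s (s≤s z≤n)))))

  simulate : ∀ c k {m s} → wellFormed c ≡ true → CodeAt P k (code c k) → Sim m s →
             Simulates k m s (exit c k) (⟦ c ⟧ s)
  -- The claim starts at the loop test, label `1 + k`, because the backward jump returns there. With
  -- counter `j` and bound `n + j`, the test leaves the loop exactly when `n` is zero.
  simulate-for : ∀ x y c k → (y ==ᶠ x) ≡ false → unwritten c nat (var x) ≡ true →
    unwritten c nat (var y) ≡ true → wellFormed c ≡ true →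
    CodeAt P k (code (for x y c) k) → ∀ n j m s → nats s (var x) ≡ j →
    nats s (var y) ≡ n + j → Sim m s →
    Simulates (1 + k) m s (exit (for x y c) k) (iterate c x n j s)

  simulate skip k {m} {s} w p S = wrap (m , 0 , (λ run → run) , S , sym (ℕ.+-identityʳ (time s)))
  simulate (c₁ ⨾ c₂) k w p S with p₁ , p₂ ← CodeAt-code c₁ k p =
    compose (simulate c₁ k (∧-trueˡ w) p₁ S)
      (λ m′ → simulate c₂ _ (∧-trueʳ {wellFormed c₁} w) p₂)
  simulate (setᶜ τ x n) k w (p , _) S = assign τ x _ 1 p const S (sim-numeral τ n) refl
  simulate (copyᶜ τ x y) k w (p , _) S = assign τ x _ 1 p move S (cells S τ (var y)) refl
  simulate (addᶜ τ x y z) k w (p , _) S =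
    assign τ x _ 1 p add S (sim-plus τ _ _ (cells S τ (var y)) (cells S τ (var z))) refl
  simulate (mulᶜ τ x y z) k w (p , _) S =
    assign τ x _ 1 p mul S (sim-times τ _ _ (cells S τ (var y)) (cells S τ (var z))) refl
  simulate (subᶜ x y z) k w (p , _) S =
    assign ring x _ 1 p sub S (⊖-cong (cells S ring (var y)) (cells S ring (var z))) refl
  simulate (getᶜ τ x a i j) k {s = s} w p S
    with p₁ , (p₂ , _) ← CodeAt-++ k (locate τ a i j) p
    with m′ , R , S′ , eq ← located τ a i j p₁ S =
    wrap (_ , 9 , (λ {t} {m″} run → R (step p₂ (load eq) run)) ,
    sim-set τ (var x) (sim-tick 9 S′) (cells S′ τ _) , time-set τ (var x) _ (tick 9 s))
  simulate (putᶜ τ a i j x) k {s = s} w p S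
    with p₁ , (p₂ , _) ← CodeAt-++ k (locate τ a i j) p
    with m′ , R , S′ , eq ← located τ a i j p₁ S =
    wrap (_ , 9 , (λ {t} {m″} run → R (step p₂ (store eq) run)) ,
    sim-set τ (arr a _ _) (sim-tick 9 S′) (cells S′ τ (var x)) , time-set τ (arr a _ _) _ (tick 9 s))
  simulate (readᶜ x z) k {m} {s} w (p₁ , p₂ , p₃ , p₄ , _) S
    with lim ≤ᵇ 64 + nats s (var z) in e
  ... | true = wrap (_ , 3 , (λ run → step p₁ const (step p₂ add (step p₃
      (jump-if-≤-yes (≼-resp (≈-sym (base S)) (≈-sym (sum 64 (nats s (var z)) ≈-refl (nat-cells S (var z)))) (fromℕ-mono (≤ᵇ-true {lim} e)))) run))) ,
      sim-untouched (s≤s z≤n) (s≤s (s≤s (s≤s (s≤s z≤n)))) (sim-untouched (s≤s z≤n) (s≤s (s≤s (s≤s (s≤s z≤n)))) (sim-tick 3 S)) , refl)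
  ... | false = wrap (_ , 4 , (λ run → step p₁ const (step p₂ add (step p₃
      (jump-if-≤-no λ le → ℕ.<⇒≱ (≤ᵇ-false {lim} e) (fromℕ-reflects lim _
        (≼-resp (base S) (sum 64 (nats s (var z)) ≈-refl (nat-cells S (var z))) le)))
      (step p₄ (load {y = 64 + nats s (var z)} (sum 64 (nats s (var z)) ≈-refl (nat-cells S (var z)))) run)))) ,
      sim-set ring (var x) (sim-tick 4 S′) (flat-cells S′ (nats s (var z)) (≤ᵇ-false {lim} e)) , refl)
    where
    S′ = sim-untouched (s≤s z≤n) (s≤s (s≤s (s≤s (s≤s z≤n)))) (sim-untouched (s≤s z≤n) (s≤s (s≤s (s≤s (s≤s z≤n)))) S)
  simulate (writeᶜ z x) k {m} {s} w (p₁ , p₂ , p₃ , p₄ , _) S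
    with lim ≤ᵇ 64 + nats s (var z) in e
  ... | true = wrap (_ , 3 , (λ run → step p₁ const (step p₂ add (step p₃
      (jump-if-≤-yes (≼-resp (≈-sym (base S)) (≈-sym (sum 64 (nats s (var z)) ≈-refl (nat-cells S (var z)))) (fromℕ-mono (≤ᵇ-true {lim} e)))) run))) ,
      sim-untouched (s≤s z≤n) (s≤s (s≤s (s≤s (s≤s z≤n)))) (sim-untouched (s≤s z≤n) (s≤s (s≤s (s≤s (s≤s z≤n)))) (sim-tick 3 S)) , refl)
  ... | false = wrap (_ , 4 , (λ run → step p₁ const (step p₂ add (step p₃
      (jump-if-≤-no λ le → ℕ.<⇒≱ (≤ᵇ-false {lim} e) (fromℕ-reflects lim _
        (≼-resp (base S) (sum 64 (nats s (var z)) ≈-refl (nat-cells S (var z))) le)))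
      (step p₄ (store {y = 64 + nats s (var z)} (sum 64 (nats s (var z)) ≈-refl (nat-cells S (var z)))) run)))) ,
      sim-write (nats s (var z)) (≤ᵇ-false {lim} e) (sim-tick 4 S′) (nat-cells S′ (var x)) , refl)
    where
    S′ = sim-untouched (s≤s z≤n) (s≤s (s≤s (s≤s (s≤s z≤n)))) (sim-untouched (s≤s z≤n) (s≤s (s≤s (s≤s (s≤s z≤n)))) S)
  simulate (if≤ τ x y c c′) k {m} {s} w (p , q) S
    with q₁ , r , q₃ ← CodeAt-code c′ (suc k) q
    with leq τ (get τ s (var x)) (get τ s (var y)) in e
  ... | true = compose {s′ = tick 1 s}
      (wrap (m , 1 , one p (jump-if-≤-yes (proj₁ (sim-leq τ (cells S τ (var x)) (cells S τ (var y))) e)) ,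
       sim-tick 1 S , refl))
      (λ m′ → simulate c _ (∧-trueˡ w) q₃)
  ... | false = compose {s′ = tick 1 s}
      (wrap (m , 1 , one p (jump-if-≤-no (proj₂ (sim-leq τ (cells S τ (var x)) (cells S τ (var y))) e)) ,
       sim-tick 1 S , refl))
      (λ m′ S′ → compose (simulate c′ _ (∧-trueʳ {wellFormed c} w) q₁ S′)
        (λ m″ S″ → wrap (m″ , 1 , one r jump , sim-tick 1 S″ , refl)))
  simulate (for x y c) k {m} {s} w p@(p₁ , _) S =
    compose (assign nat x 0 1 p₁ const S ≈-refl refl)
      (λ m′ → simulate-for x y c k y≠x (∧-trueˡ w₁) (∧-trueˡ w₂) (∧-trueʳ {unwritten c nat (var y)} w₂)
        p (nats s (var y)) 0 m′ _ (if-true (≡ᵇ-refl (toℕ x)))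
        (trans (if-false y≠x) (sym (ℕ.+-identityʳ _))))
    where
    y≠x : (y ==ᶠ x) ≡ false
    y≠x = not-true (∧-trueˡ w)
    w₁ = ∧-trueʳ {not (y ==ᶠ x)} w
    w₂ = ∧-trueʳ {unwritten c nat (var x)} w₁

  simulate-for x y c k y≠x ux uy w p@(_ , p₂ , q) zero j m s ex ey S =
    wrap (m , 1 , one p₂ (jump-if-≤-yes (≼-resp (≈-sym (nat-cells S (var y))) (≈-sym (nat-cells S (var x)))
      (fromℕ-mono (ℕ.≤-reflexive (trans ey (sym ex)))))) , sim-tick 1 S , refl)
  simulate-for x y c k y≠x ux uy w p@(_ , p₂ , q) (suc n) j m s ex ey S
    with q₁ , r₁ , r₂ , r₃ , _ ← CodeAt-code c (2 + k) q =
    compose {s′ = tick 1 s}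
      (wrap (m , 1 , one p₂ (jump-if-≤-no λ le → ℕ.<⇒≱ (s≤s (ℕ.m≤n+m j n))
          (subst₂ _≤_ ey ex (fromℕ-reflects _ _ (≼-resp (nat-cells S (var y)) (nat-cells S (var x)) le)))) ,
       sim-tick 1 S , refl))
      (λ m₁ S₁ → compose (simulate c (2 + k) w q₁ S₁)
        (λ m₂ S₂ → compose
          (wrap (_ , 3 , (λ run → step r₁ const (step r₂ add (step r₃ jump run))) ,
           sim-set nat (var x) (sim-tick 3 (sim-untouched (s≤s z≤n) (s≤s (s≤s (s≤s (s≤s z≤n)))) S₂))
             (≈-trans (sum (nats (⟦ c ⟧ (tick 1 s)) (var x)) 1 (nat-cells S₂ (var x)) ≈-refl)
               (≈-reflexive (cong fromℕ (trans (ℕ.+-comm _ 1) (cong suc (trans (frame c nat (var x) ux (tick 1 s)) ex)))))) , refl))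
          (λ m₃ S₃ → simulate-for x y c k y≠x ux uy w p n (suc j) m₃ _
            (if-true (≡ᵇ-refl (toℕ x)))
            (trans (if-false y≠x) (trans (frame c nat (var y) uy (tick 1 s)) (trans ey (sym (ℕ.+-suc n j))))) S₃)))

-- Boot code: freeing the registers that the input occupies

qV oV rV NV : Var
qV = # 0
oV = # 1
rV = # 2
NV = # 3

-- Straight-line code, because no register is free yet: cell 0 is the write pointer, and cell 3
-- serves as scratch cell because it is the first one to be saved.
saves : (x n : ℕ) → Program
saves x zero    = []
saves x (suc n) = store 0 (3 + x) ∷ const 3 1 ∷ add 0 0 3 ∷ const (3 + x) 0 ∷ saves (suc x) n

-- The cells 3 to 63 are moved to the cells from q = 64dN onwards, then cleared
-- to serve as registers.
opaque
  registerSaves : Program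
  registerSaves = saves 0 61

  registerSaves≡ : registerSaves ≡ saves 0 61
  registerSaves≡ = refl

-- One product and six doublings give `q = 64dN`, which is at least 64 and lies beyond the input;
-- `q * q` lies beyond the saved cells as well and becomes the base of the arrays. The value `d` in
-- cell 0 is lost here and is recovered later from `q` and `N`.
prologue₁ prologue₂ prologue : Program
prologue₁ =
  mul 0 0 2 ∷ List.replicate 6 (add 0 0 0)
prologue₂ =
  const 3 61 ∷ sub 0 0 3 ∷ move 5 0 ∷ mul 0 0 0 ∷ move (varAddress nat qV) 5 ∷
  const 3 64 ∷ sub (varAddress nat oV) 5 3 ∷ move (varAddress nat rV) 1 ∷
  move (varAddress nat NV) 2 ∷ []
prologue = prologue₁ ++ (registerSaves ++ prologue₂)

double : ℕ → ℕ
double n = n + n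

doubles : ℕ → ℕ → ℕ
doubles zero    n = n
doubles (suc i) n = doubles i (double n)

module _ {b} {B : Set b} where

  ‼-++ˡ : ∀ (xs : List B) {ys c} → c < length xs → (xs ++ ys) ‼ c ≡ xs ‼ c
  ‼-++ˡ (x ∷ xs) {c = zero}  p       = refl
  ‼-++ˡ (x ∷ xs) {c = suc c} (s≤s p) = ‼-++ˡ xs p

  ‼-++ʳ : ∀ (xs : List B) {ys} c → (xs ++ ys) ‼ (length xs + c) ≡ ys ‼ c
  ‼-++ʳ []       c = refl
  ‼-++ʳ (x ∷ xs) c = ‼-++ʳ xs c

  ‼-beyond : ∀ (xs : List B) {c} → length xs ≤ c → xs ‼ c ≡ nothing
  ‼-beyond []       {zero}  p       = refl
  ‼-beyond []       {suc c} p       = refl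
  ‼-beyond (x ∷ xs) {suc c} (s≤s p) = ‼-beyond xs p

  module _ {a} {A : Set a} (f : A → List B) (L : ℕ) (length-f : ∀ a → length (f a) ≡ L) where

    length-concatMap : ∀ {n} (g : Fin n → A) →
      length (List.concatMap f (List.tabulate g)) ≡ n * L
    length-concatMap {zero}  g = refl
    length-concatMap {suc n} g = trans (List.length-++ (f (g Fin.zero)))
      (cong₂ _+_ (length-f _) (length-concatMap (g ∘ Fin.suc)))

    ‼-concatMap : ∀ {n} (g : Fin n → A) (j : Fin n) {c} → c < L →
      List.concatMap f (List.tabulate g) ‼ (toℕ j * L + c) ≡ f (g j) ‼ c
    ‼-concatMap g Fin.zero {c} p =
      ‼-++ˡ (f (g Fin.zero)) (subst (c <_) (sym (length-f _)) p)
    ‼-concatMap g (Fin.suc j) {c} p =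
      trans (cong (List.concatMap f (List.tabulate g) ‼_)
              (trans (ℕ.+-assoc L (toℕ j * L) c) (cong (_+ (toℕ j * L + c)) (sym (length-f (g Fin.zero))))))
      (trans (‼-++ʳ (f (g Fin.zero)) (toℕ j * L + c))
             (‼-concatMap (g ∘ Fin.suc) j p))

module InputFacts {a ℓ₁ ℓ₂} (K : OrderedRing a ℓ₁ ℓ₂) {d N : ℕ} (r : ℕ)
                  (ℛ : Vector (Rectangle K d) N) where

  open OrderedRing K using (Carrier; 0#)

  sides : Rectangle K d → Fin d → List Carrier
  sides R i = Interval.lo (R i) ∷ Interval.hi (R i) ∷ []

  row : Rectangle K d → List Carrier
  row R = List.concatMap (sides R) (List.allFin d)

  length-row : ∀ R → length (row R) ≡ d * 2
  length-row R = length-concatMap (sides R) 2 (λ _ → refl) id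

  matrix : List Carrier
  matrix = List.concatMap (λ j → row (ℛ j)) (List.allFin N)

  input-entry : ∀ (j : Fin N) (i : Fin d) {c} → c < 2 →
    input K r ℛ (3 + (toℕ j * (d * 2) + (toℕ i * 2 + c))) ≡ fromMaybe 0# (sides (ℛ j) i ‼ c)
  input-entry j i {c} p = cong (fromMaybe 0#)
    (trans (‼-concatMap (λ j → row (ℛ j)) (d * 2) (λ j → length-row (ℛ j)) id j
             (≤-trans (ℕ.+-monoʳ-< (toℕ i * 2) p)
               (≤-trans (ℕ.≤-reflexive (ℕ.+-comm (toℕ i * 2) 2)) (ℕ.*-monoˡ-≤ 2 (Fin.toℕ<n i)))))
           (‼-concatMap (sides (ℛ j)) 2 (λ _ → refl) id i p))

  input-beyond : ∀ {x} → N * (d * 2) ≤ x → input K r ℛ (3 + x) ≡ 0#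
  input-beyond p = cong (fromMaybe 0#) (‼-beyond matrix
    (≤-trans (ℕ.≤-reflexive (length-concatMap (λ j → row (ℛ j)) (d * 2) (λ j → length-row (ℛ j)) id)) p))

module Prologue {a ℓ₁ ℓ₂} (K : OrderedRing a ℓ₁ ℓ₂) {d N : ℕ} (r : ℕ)
                (1≤d : 1 ≤ d) (1≤N : 1 ≤ N) (ℛ : Vector (Rectangle K d) N)
                (q : ℕ) (q-def : doubles 6 (d * N) ≡ q)
                where

  open OrderedRingFacts K
  open InputFacts K r ℛ

  lim : ℕ
  lim = q * q

  q≡ : q ≡ 64 * (d * N)
  q≡ = trans (sym q-def) (lemma (d * N))
    where
    twice : ∀ n m → double (m * n) ≡ double m * n
    twice n m = sym (ℕ.*-distribʳ-+ n m m)
    lemma : ∀ n → doubles 6 n ≡ 64 * n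
    lemma n = trans (cong (double ∘ double ∘ double ∘ double ∘ double ∘ double) (sym (ℕ.*-identityˡ n)))
      (trans (cong (double ∘ double ∘ double ∘ double ∘ double) (twice n 1))
      (trans (cong (double ∘ double ∘ double ∘ double) (twice n 2))
      (trans (cong (double ∘ double ∘ double) (twice n 4))
      (trans (cong (double ∘ double) (twice n 8))
      (trans (cong double (twice n 16)) (twice n 32))))))

  1≤dN : 1 ≤ d * N
  1≤dN = ℕ.*-mono-≤ 1≤d 1≤N

  64≤q : 64 ≤ q
  64≤q = subst (64 ≤_) (sym q≡) (ℕ.*-monoʳ-≤ 64 1≤dN)

  q+61≤lim : q + 61 ≤ lim
  q+61≤lim = ≤-trans (ℕ.+-monoʳ-≤ q (≤-trans (ℕ.m≤m+n 61 3) 64≤q))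
    (≤-trans (ℕ.≤-reflexive (rearrange₂₃ q)) (ℕ.*-monoˡ-≤ q (≤-trans (ℕ.m≤m+n 2 62) 64≤q)))

  64≤lim : 64 ≤ lim
  64≤lim = ≤-trans 64≤q (≤-trans (ℕ.m≤m+n q 61) q+61≤lim)

  matrix<q : 3 + N * (d * 2) ≤ q
  matrix<q = subst (3 + N * (d * 2) ≤_) (sym q≡)
    (≤-trans (ℕ.+-monoˡ-≤ (N * (d * 2)) (≤-trans (ℕ.m≤m+n 3 59) (ℕ.*-monoʳ-≤ 62 1≤dN)))
      (ℕ.≤-reflexive (rearrange₂₄ d N)))

  m₀ : Memory K
  m₀ = input K r ℛ

  input-zero : ∀ {y} → q ≤ y → m₀ y ≡ 0#
  input-zero {y} p = subst (λ z → m₀ z ≡ 0#) (ℕ.m+[n∸m]≡n (≤-trans (ℕ.m≤m+n 3 (N * (d * 2))) 3+≤))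
    (input-beyond (ℕ.m+n≤o⇒m≤o∸n (N * (d * 2)) (subst (_≤ y) (ℕ.+-comm 3 _) 3+≤)))
    where
    3+≤ : 3 + N * (d * 2) ≤ y
    3+≤ = ≤-trans matrix<q p

  module _ (P : Program) where

    open Semantics K lim
    open Simulation K lim 64≤lim P

    -- The state after `x` of the cells have been moved. Clearing is claimed from cell 6 on only:
    -- cell 3 is in use for the increment, and no register lies below 6.
    record Saved (x : ℕ) (m : Memory K) : Set ℓ₁ where
      field
        pointer : m 0 ≈ fromℕ (q + x)
        cell-1  : m 1 ≈ fromℕ r
        cell-2  : m 2 ≈ fromℕ N
        cleared : ∀ y → 6 ≤ y → y < 3 + x → m y ≈ 0#
        saved   : ∀ y → y < x → m (q + y) ≈ m₀ (3 + y)
        rest    : ∀ y → 3 + x ≤ y → y < q ⊎ q + x ≤ y → m y ≈ m₀ y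

    save-one : ∀ x m → x < 61 → Saved x m →
      let m¹ = _[_≔_] K m (q + x) (m (3 + x))
          m² = _[_≔_] K m¹ 3 (fromℕ 1)
          m³ = _[_≔_] K m² 0 (m² 0 ⊕ m² 3)
      in Saved (suc x) (_[_≔_] K m³ (3 + x) (fromℕ 0))
    save-one x m x<61 S = S⁺
      where
      open Saved S
      m¹ m² m³ m⁺ : Memory K
      m¹ = _[_≔_] K m (q + x) (m (3 + x))
      m² = _[_≔_] K m¹ 3 (fromℕ 1)
      m³ = _[_≔_] K m² 0 (m² 0 ⊕ m² 3)
      m⁺ = _[_≔_] K m³ (3 + x) (fromℕ 0)
      3+x<q : 3 + x < q
      3+x<q = ≤-trans (ℕ.+-monoʳ-< 3 x<61) 64≤q
      low : ∀ {y} → y < 64 → y ≢ q + x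
      low p = ℕ.<⇒≢ (ℕ.<-≤-trans p (≤-trans 64≤q (ℕ.m≤m+n q x)))
      unchanged : ∀ y → y ≢ 3 + x → y ≢ 0 → y ≢ 3 → y ≢ q + x → m⁺ y ≈ m y
      unchanged y p₁ p₂ p₃ p₄ = ≈-reflexive (trans (put-other m³ p₁) (trans (put-other m² p₂)
        (trans (put-other m¹ p₃) (put-other m p₄))))
      S⁺ : Saved (suc x) m⁺
      S⁺ = record
        { pointer = ≈-trans (sum (q + x) 1 (≈-trans (≈-reflexive (put-other m (low (s≤s z≤n)))) pointer) (≈-refl {fromℕ 1}))
            (≈-reflexive (cong fromℕ (rearrange₇ q x)))
        ; cell-1  = ≈-trans (≈-reflexive (put-other m (low (s≤s (s≤s z≤n))))) cell-1
        ; cell-2  = ≈-trans (≈-reflexive (put-other m (low (s≤s (s≤s (s≤s z≤n)))))) cell-2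
        ; cleared = clear
        ; saved   = keep
        ; rest    = λ y p b → ≈-trans (unchanged y (ℕ.>⇒≢ p) (ℕ.>⇒≢ (≤-trans (s≤s z≤n) p))
            (ℕ.>⇒≢ (≤-trans (ℕ.+-monoʳ-≤ 4 z≤n) p)) (outside y b))
            (rest y (≤-trans (ℕ.n≤1+n _) p) (weaken y b)) }
        where
        outside : ∀ y → y < q ⊎ q + suc x ≤ y → y ≢ q + x
        outside y (inj₁ p) = ℕ.<⇒≢ (ℕ.<-≤-trans p (ℕ.m≤m+n q x))
        outside y (inj₂ p) = ℕ.>⇒≢ (≤-trans (ℕ.≤-reflexive (sym (ℕ.+-suc q x))) p)
        weaken : ∀ y → y < q ⊎ q + suc x ≤ y → y < q ⊎ q + x ≤ y
        weaken y (inj₁ p) = inj₁ p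
        weaken y (inj₂ p) = inj₂ (≤-trans (ℕ.+-monoʳ-≤ q (ℕ.n≤1+n x)) p)
        clear : ∀ y → 6 ≤ y → y < 3 + suc x → m⁺ y ≈ 0#
        clear y p b with y ℕ.<? 3 + x
        ... | yes b′ = ≈-trans (unchanged y (ℕ.<⇒≢ b′) (ℕ.>⇒≢ (≤-trans (s≤s z≤n) p))
          (ℕ.>⇒≢ (≤-trans (ℕ.+-monoʳ-≤ 4 z≤n) p)) (low (ℕ.<-≤-trans b′ (ℕ.<⇒≤ (ℕ.+-monoʳ-< 3 x<61))))) (cleared y p b′)
        ... | no ¬b with refl ← ℕ.≤-antisym (ℕ.≤-pred b) (ℕ.≮⇒≥ ¬b) = ≈-reflexive (put-same m³ (3 + x))
        q-low : ∀ y z → z < 64 → q + y ≢ z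
        q-low y z p = ℕ.>⇒≢ (ℕ.<-≤-trans p (≤-trans 64≤q (ℕ.m≤m+n q y)))
        keep : ∀ y → y < suc x → m⁺ (q + y) ≈ m₀ (3 + y)
        keep y b with y ℕ.<? x
        ... | yes b′ = ≈-trans (unchanged (q + y) (q-low y (3 + x) (ℕ.+-monoʳ-< 3 x<61)) (q-low y 0 (s≤s z≤n))
          (q-low y 3 (ℕ.+-monoʳ-≤ 4 z≤n)) (λ e′ → ℕ.<⇒≢ b′ (ℕ.+-cancelˡ-≡ q _ _ e′))) (saved y b′)
        ... | no ¬b with refl ← ℕ.≤-antisym (ℕ.≤-pred b) (ℕ.≮⇒≥ ¬b) =
          ≈-trans (≈-reflexive (trans (put-other m³ (q-low x (3 + x) (ℕ.+-monoʳ-< 3 x<61)))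
            (trans (put-other m² (q-low x 0 (s≤s z≤n))) (trans (put-other m¹ (q-low x 3 (ℕ.+-monoʳ-≤ 4 z≤n)))
              (put-same m (q + x)))))) (rest (3 + x) ≤-refl (inj₁ 3+x<q))

    abstract
      save : ∀ n x k m → n + x ≡ 61 → CodeAt P k (saves x n) → Saved x m →
             ∃[ m′ ] (Reach k m (n * 4) (length (saves x n) + k) m′ × Saved (n + x) m′)
      save zero    x k m e p S = m , (λ run → run) , S
      save (suc n) x k m e (p₁ , p₂ , p₃ , p₄ , p) S
        with m′ , R , S′ ← save n (suc x) (4 + k) _ (trans (ℕ.+-suc n x) e) p
                             (save-one x m (subst (x <_) e (s≤s (ℕ.m≤n+m x n))) S)
        = m′ , (λ {t} {m″} run → step p₁ (store (Saved.pointer S)) (step p₂ const (step p₃ add (step p₄ const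
            (R (subst (λ l → Run K P l m′ t m″) (rearrange₂₅ (length (saves (suc x) n)) k) run))))))
             , subst (λ y → Saved y m′) (ℕ.+-suc n x) S′

    record Initial (s : State) : Set (a ⊔ˡ ℓ₁) where
      field
        q-var : nats s (var qV) ≡ q
        o-var : 64 + nats s (var oV) ≡ q
        r-var : nats s (var rV) ≡ r
        N-var : nats s (var NV) ≡ N
        low   : ∀ x → x < 61 → flat s (nats s (var oV) + x) ≈ m₀ (3 + x)
        high  : ∀ z → 64 + z < q → flat s z ≈ m₀ (64 + z)
        nat-arrays  : ∀ b i j → nats s (arr b i j) ≡ 0
        ring-arrays : ∀ b i j → rings s (arr b i j) ≡ 0#
        others : ∀ x → 4 ≤ toℕ x → nats s (var x) ≡ 0
        ring-vars : ∀ x → rings s (var x) ≡ 0#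
        time-zero : time s ≡ 0

    Grown : ℕ → Memory K → Set ℓ₁
    Grown n m = m 0 ≈ fromℕ n × (∀ y → 1 ≤ y → m y ≈ m₀ y)

    abstract
      grow : ∀ i k n m → CodeAt P k (List.replicate i (add 0 0 0)) → Grown n m →
             ∃[ m′ ] (Reach k m i (i + k) m′ × Grown (doubles i n) m′)
      grow zero    k n m p G = m , (λ run → run) , G
      grow (suc i) k n m (p₁ , p) (e , f)
        with m′ , R , G ← grow i (suc k) (double n) (_[_≔_] K m 0 (m 0 ⊕ m 0)) p
                            (sum n n e e , λ { (suc y) 1≤ → f (suc y) 1≤ })
        = m′ , (λ {t} {m″} run → step p₁ add (R (subst (λ l → Run K P l m′ t m″) (sym (ℕ.+-suc i k)) run))) , G

    unsaved : ∀ m → Grown q m → Saved 0 m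
    unsaved m (e , f) = record
      { pointer = ≈-trans e (≈-reflexive (cong fromℕ (sym (ℕ.+-identityʳ q))))
      ; cell-1  = f 1 ≤-refl
      ; cell-2  = f 2 (s≤s z≤n)
      ; cleared = λ y p b → contradiction (ℕ.<-≤-trans b (≤-trans (ℕ.+-monoʳ-≤ 3 z≤n) p)) (ℕ.<-irrefl refl)
      ; saved   = λ y ()
      ; rest    = λ { (suc y) p b → f (suc y) (s≤s z≤n) } }

    abstract
      finish : ∀ m k → CodeAt P k prologue₂ → Saved 61 m →
               ∃[ m′ ] ∃[ s ] (Reach k m 9 (9 + k) m′ × Sim m′ s × Initial s)
      finish m k (b₁ , b₂ , b₃ , b₄ , b₅ , b₆ , b₇ , b₈ , b₉ , _) S =
        m⁹ , s , (λ run → step b₁ const (step b₂ sub (step b₃ move (step b₄ mul (step b₅ move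
            (step b₆ const (step b₇ sub (step b₈ move (step b₉ move run)))))))))
            , S⁹ , I
        where
        open Saved S
        m¹ m² m³ m⁴ m⁵ m⁶ m⁷ m⁸ m⁹ : Memory K
        m¹ = _[_≔_] K m 3 (fromℕ 61)
        m² = _[_≔_] K m¹ 0 (m¹ 0 ⊖ m¹ 3)
        m³ = _[_≔_] K m² 5 (m² 0)
        m⁴ = _[_≔_] K m³ 0 (m³ 0 ⊗ m³ 0)
        m⁵ = _[_≔_] K m⁴ (varAddress nat qV) (m⁴ 5)
        m⁶ = _[_≔_] K m⁵ 3 (fromℕ 64)
        m⁷ = _[_≔_] K m⁶ (varAddress nat oV) (m⁶ 5 ⊖ m⁶ 3)
        m⁸ = _[_≔_] K m⁷ (varAddress nat rV) (m⁷ 1)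
        m⁹ = _[_≔_] K m⁸ (varAddress nat NV) (m⁸ 2)
        -- The saved cells begin at cell `q`; the contiguous region is indexed from cell 64, hence
        -- the offset.
        o : ℕ
        o = q ∸ 64
        64+o : 64 + o ≡ q
        64+o = ℕ.m+[n∸m]≡n 64≤q
        m²-0 : m² 0 ≈ fromℕ q
        m²-0 = ≈-trans (+-congʳ (≈-trans pointer (fromℕ-+ q 61))) (x+y-y≈x (fromℕ q) (fromℕ 61))
        blank : State
        blank = ⟨ (λ _ → 0) , (λ _ → 0#) , (λ z → m (64 + z)) , 0 ⟩
        -- Array cells lie beyond both the input and the saved block, so they still hold the initial
        -- zero.
        array : ∀ {y} → lim ≤ y → m⁴ y ≈ 0#
        array {y} l = ≈-trans (≈-reflexive (trans (put-other m³ (big 0)) (trans (put-other m² (big 5))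
          (trans (put-other m¹ (big 0)) (put-other m (big 3))))))
          (≈-trans (rest y (≤-trans 64≤lim l) (inj₂ (≤-trans q+61≤lim l)))
            (≈-reflexive (input-zero (≤-trans (ℕ.m≤m+n q 61) (≤-trans q+61≤lim l)))))
          where
          big : ∀ z → {T (z ≤ᵇ 63)} → y ≢ z
          big z {t} = ℕ.>⇒≢ (ℕ.<-≤-trans (s≤s (ℕ.≤ᵇ⇒≤ z 63 t)) (≤-trans 64≤lim l))
        zero-cell : ∀ τ l → m⁴ (address τ l) ≈ 0#
        zero-cell τ (var x)     = cleared (varAddress τ x) (ℕ.m≤m+n 6 _) (varAddress<64 τ x)
        zero-cell τ (arr b i j) = array (ℕ.m≤n+m lim (pair i j * 16 + (toℕ b * 2 + tag τ)))
        S⁴ : Sim m⁴ blank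
        S⁴ = record
          { base       = product q q m²-0 m²-0
          ; nat-cells  = zero-cell nat
          ; ring-cells = zero-cell ring
          ; flat-cells = λ z _ → ≈-refl }
        s : State
        s = set nat (var NV) N (set nat (var rV) r (set nat (var oV) o (set nat (var qV) q blank)))
        S⁹ : Sim m⁹ s
        S⁹ = sim-set nat (var NV) (sim-set nat (var rV) (sim-set nat (var oV)
               (sim-untouched (s≤s z≤n) (s≤s (s≤s (s≤s (s≤s z≤n)))) (sim-set nat (var qV) S⁴ m²-0))
               (≈-trans (+-congʳ (≈-trans m²-0 (≈-trans (≈-reflexive (cong fromℕ (trans (sym 64+o) (ℕ.+-comm 64 o)))) (fromℕ-+ o 64))))
                 (x+y-y≈x (fromℕ o) (fromℕ 64)))) cell-1) cell-2
        I : Initial s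
        I = record
          { q-var = refl
          ; o-var = 64+o
          ; r-var = refl
          ; N-var = refl
          ; low   = λ x b → ≈-trans (≈-reflexive (cong m (trans (sym (ℕ.+-assoc 64 o x)) (cong (_+ x) 64+o)))) (saved x b)
          ; high  = λ z b → rest (64 + z) (ℕ.m≤m+n 64 z) (inj₁ b)
          ; nat-arrays  = λ _ _ _ → refl
          ; ring-arrays = λ _ _ _ → refl
          ; others = λ x b → trans (if-false (high-var 3 b _)) (trans (if-false (high-var 2 b _)) (trans (if-false (high-var 1 b _)) (if-false (high-var 0 b _))))
          ; ring-vars = λ _ → refl
          ; time-zero = refl }
          where
          high-var : ∀ n {k} → 4 ≤ k → T (n ≤ᵇ 3) → (k ≡ᵇ n) ≡ false
          high-var n b t = ≢⇒≡ᵇ-false (ℕ.>⇒≢ (ℕ.<-≤-trans (s≤s (ℕ.≤ᵇ⇒≤ n 3 t)) b))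

    abstract
      grown : ∀ i b {m} → doubles i b ≡ q → CodeAt P 1 (List.replicate i (add 0 0 0)) → Grown b m →
              ∃[ m′ ] (Reach 1 m i (i + 1) m′ × Saved 0 m′)
      grown i b refl p G with m′ , R , G′ ← grow i 1 b _ p G = m′ , R , unsaved m′ G′

      all-saved : ∀ n {m} → n ≡ 61 → CodeAt P 7 (saves 0 n) → Saved 0 m →
                  ∃[ m′ ] (Reach 7 m (n * 4) (length (saves 0 n) + 7) m′ × Saved 61 m′)
      all-saved n e p S with m′ , R , S′ ← save n 0 7 _ (trans (ℕ.+-identityʳ n) e) p S =
        m′ , R , subst (λ n → Saved n m′) (trans (ℕ.+-identityʳ n) e) S′

    boot-from : ∀ n is → n ≡ 61 → is ≡ saves 0 n → CodeAt P 0 prologue₁ → CodeAt P 7 is →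
      CodeAt P (length is + 7) prologue₂ →
      ∃[ m ] ∃[ s ] (Reach 0 m₀ (7 + (n * 4 + 9)) (9 + (length is + 7)) m × Sim m s × Initial s)
    boot-from n is n≡61 refl (a , a′) p₁ p₂ = first
      (grown 6 (d * N) q-def a′ (product d N ≈-refl ≈-refl , λ { (suc y) 1≤ → ≈-refl }))
      where
      Goal : Set _
      Goal = ∃[ m ] ∃[ s ] (Reach 0 m₀ (7 + (n * 4 + 9)) (9 + (length (saves 0 n) + 7)) m ×
                            Sim m s × Initial s)
      third : ∀ {m} → Reach 0 m₀ (7 + n * 4) (length (saves 0 n) + 7) m →
        ∃[ m′ ] ∃[ s ] (Reach (length (saves 0 n) + 7) m 9 (9 + (length (saves 0 n) + 7)) m′ ×
                        Sim m′ s × Initial s) → Goal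
      third R (m′ , s , R′ , S , I) = m′ , s , R ▷ R′ , S , I
      second : ∀ {m} → Reach 0 m₀ 7 7 m →
        ∃[ m′ ] (Reach 7 m (n * 4) (length (saves 0 n) + 7) m′ × Saved 61 m′) → Goal
      second R (m′ , R′ , S) = third (R ▷ R′) (finish m′ (length (saves 0 n) + 7) p₂ S)
      first : ∃[ m ] (Reach 1 (_[_≔_] K m₀ 0 (m₀ 0 ⊗ m₀ 2)) 6 7 m × Saved 0 m) → Goal
      first (m , R , S) = second (one a mul ▷ R) (all-saved n n≡61 p₁ S)

    boot : CodeAt P 0 prologue →
           ∃[ m ] ∃[ s ] (Reach 0 m₀ (7 + (61 * 4 + 9)) (length prologue) m × Sim m s × Initial s)
    boot p = subst (λ k → ∃[ m ] ∃[ s ] (Reach 0 m₀ (7 + (61 * 4 + 9)) k m × Sim m s × Initial s)) end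
      (boot-from 61 registerSaves refl registerSaves≡ (proj₁ p₁) (proj₁ p₂) (proj₂ p₂))
      where
      p₁ : CodeAt P 0 prologue₁ × CodeAt P 7 (registerSaves ++ prologue₂)
      p₁ = CodeAt-++ 0 prologue₁ p
      p₂ : CodeAt P 7 registerSaves × CodeAt P (length registerSaves + 7) prologue₂
      p₂ = CodeAt-++ 7 registerSaves (proj₂ p₁)
      end : 9 + (length registerSaves + 7) ≡ length prologue
      end = sym (trans (cong (7 +_) (List.length-++ registerSaves)) (rearrange₈ (length registerSaves)))

-- Binomial coefficients as numbers of tuples

-- binom r l is the number of l-tuples of natural numbers with sum at most r.
binom : ℕ → ℕ → ℕ
binom r       zero    = 1
binom zero    (suc l) = 1
binom (suc r) (suc l) = binom r (suc l) + binom (suc r) l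

binom-0 : ∀ l → binom 0 l ≡ 1
binom-0 zero    = refl
binom-0 (suc l) = refl

binom≡C : ∀ r l → binom r l ≡ (r + l) C l
binom≡C r       zero    = sym (trans (cong (_C 0) (ℕ.+-identityʳ r)) (nC0 r))
  where
  nC0 : ∀ n → n C 0 ≡ 1
  nC0 n = trans (nCk≡nC[n∸k] {0} {n} z≤n) (nCn≡1 n)
binom≡C zero    (suc l) = sym (nCn≡1 (suc l))
binom≡C (suc r) (suc l) = trans (cong₂ _+_ (binom≡C r (suc l)) (binom≡C (suc r) l))
  (trans (cong₂ _+_ (cong (_C suc l) (ℕ.+-suc r l)) refl)
  (trans (ℕ.+-comm ((suc (r + l)) C suc l) ((suc (r + l)) C l))
  (trans (nCk+nC[k+1]≡[n+1]C[k+1] (suc (r + l)) l)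
         (cong (λ n → suc n C suc l) (sym (ℕ.+-suc r l))))))

-- The two absorption identities. Pascal's recursion splits each left side in two; one summand is
-- handled by the identity itself and then turned by the other one into a multiple of the same
-- binomial as its neighbour.
binom-sucʳ : ∀ r l → suc l * binom r (suc l) ≡ (suc l + r) * binom r l
binom-sucˡ : ∀ r l → suc r * binom (suc r) l ≡ (suc l + r) * binom r l

binom-sucʳ zero    l = cong₂ _*_ (sym (ℕ.+-identityʳ (suc l))) (sym (binom-0 l))
binom-sucʳ (suc r) l = trans (ℕ.*-distribˡ-+ (suc l) (binom r (suc l)) (binom (suc r) l))
  (trans (cong (_+ suc l * binom (suc r) l) (trans (binom-sucʳ r l) (sym (binom-sucˡ r l))))
         (rearrange₄₀ l r (binom (suc r) l)))

binom-sucˡ r zero    = refl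
binom-sucˡ r (suc l) = trans (ℕ.*-distribˡ-+ (suc r) (binom r (suc l)) (binom (suc r) l))
  (trans (cong (suc r * binom r (suc l) +_) (trans (binom-sucˡ r l) (sym (binom-sucʳ r l))))
         (rearrange₄₁ l r (binom r (suc l))))

binomSum : ℕ → ℕ → ℕ
binomSum r zero    = 0
binomSum r (suc l) = binomSum r l + binom r l

-- With `binomSum r l` nodes above level `l`, work proportional to `r + 1` at each of them amounts
-- to `l` units of work per node of level `l`. By induction, the new term being absorbed by
-- `binom-sucʳ`.
binomSum≡ : ∀ r l → suc r * binomSum r l ≡ l * binom r l
binomSum≡ r zero    = ℕ.*-zeroʳ (suc r)
binomSum≡ r (suc l) = trans (ℕ.*-distribˡ-+ (suc r) (binomSum r l) (binom r l))
  (trans (cong (_+ suc r * binom r l) (binomSum≡ r l))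
  (trans (rearrange₄₂ l r (binom r l)) (sym (binom-sucʳ r l))))

binom-positive : ∀ r l → 1 ≤ binom r l
binom-positive r       zero    = ≤-refl
binom-positive zero    (suc l) = ≤-refl
binom-positive (suc r) (suc l) = ≤-trans (binom-positive (suc r) l) (ℕ.m≤n+m _ (binom r (suc l)))

binom-monoʳ : ∀ r {l l′} → l ≤ l′ → binom r l ≤ binom r l′
binom-monoʳ r p = go (ℕ.≤⇒≤′ p)
  where
  suc-mono : ∀ r l → binom r l ≤ binom r (suc l)
  suc-mono zero    l = ℕ.≤-reflexive (binom-0 l)
  suc-mono (suc r) l = ℕ.m≤n+m _ (binom r (suc l))
  go : ∀ {l l′} → l ≤′ l′ → binom r l ≤ binom r l′
  go ≤′-refl     = ≤-refl
  go {l} {suc l′} (≤′-step q) = ≤-trans (go q) (suc-mono r l′)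

-- Twice `binom r 2` is `(r + 2)(r + 1)`, and `binom r` is monotone in its second argument.
square≤binom : ∀ r {l} → 2 ≤ l → suc r * suc r ≤ 2 * binom r l
square≤binom r {l} p = ≤-trans (ℕ.*-monoˡ-≤ (suc r) (ℕ.n≤1+n (suc r)))
  (≤-trans (ℕ.≤-reflexive (trans (cong (suc (suc r) *_) (sym b1)) (sym (binom-sucʳ r 1))))
           (ℕ.*-monoʳ-≤ 2 (binom-monoʳ r p)))
  where
  b1 : binom r 1 ≡ suc r
  b1 = trans (sym (ℕ.*-identityˡ _)) (trans (binom-sucʳ r 0) (ℕ.*-identityʳ (suc r)))

-- Injections, images and cardinalities

Injective< : ℕ → (ℕ → ℕ) → Set
Injective< k f = ∀ {p q} → p < k → q < k → f p ≡ f q → p ≡ q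

Injective<-⊆ : ∀ {k l f} → l ≤ k → Injective< k f → Injective< l f
Injective<-⊆ l≤k inj p q = inj (ℕ.<-≤-trans p l≤k) (ℕ.<-≤-trans q l≤k)

-- Choosing for each argument of `f` an index where `g` has the same value is injective, since `f`
-- is.
pigeonhole : ∀ {k l f} → Injective< k f → (g : ℕ → ℕ) →
             (∀ p → p < k → ∃[ q ] (q < l × g q ≡ f p)) → k ≤ l
pigeonhole {k} {l} {f} inj g h = Fin.injective⇒≤ {f = i} i-injective
  where
  i : Fin k → Fin l
  i p with q , q<l , _ ← h (toℕ p) (Fin.toℕ<n p) = Fin.fromℕ< q<l
  i-injective : ∀ {p p′} → i p ≡ i p′ → p ≡ p′
  i-injective {p} {p′} eq
    with q , q<l , e ← h (toℕ p) (Fin.toℕ<n p) | q′ , q′<l , e′ ← h (toℕ p′) (Fin.toℕ<n p′)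
    = Fin.toℕ-injective (inj (Fin.toℕ<n p) (Fin.toℕ<n p′)
        (trans (sym e) (trans (cong g (Fin.fromℕ<-injective q q′ q<l q′<l eq)) e′)))

module _ {N : ℕ} where

  ∣insert∣ : ∀ {n} (S : Subset n) x → ¬ x ∈ S → ∣ S [ x ]≔ inside ∣ ≡ suc ∣ S ∣
  ∣insert∣ (true ∷ S)  Fin.zero    p = contradiction Vec.here p
  ∣insert∣ (false ∷ S) Fin.zero    p = refl
  ∣insert∣ (true ∷ S)  (Fin.suc x) p = cong suc (∣insert∣ S x (p ∘ Vec.there))
  ∣insert∣ (false ∷ S) (Fin.suc x) p = ∣insert∣ S x (p ∘ Vec.there)

  ∈-insert⁻ : ∀ {n} (S : Subset n) x {y} → y ∈ S [ x ]≔ inside → y ≡ x ⊎ y ∈ S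
  ∈-insert⁻ (_ ∷ S) Fin.zero    Vec.here      = inj₁ refl
  ∈-insert⁻ (_ ∷ S) Fin.zero    (Vec.there p) = inj₂ (Vec.there p)
  ∈-insert⁻ (_ ∷ S) (Fin.suc x) Vec.here      = inj₂ Vec.here
  ∈-insert⁻ (_ ∷ S) (Fin.suc x) (Vec.there p) with ∈-insert⁻ S x p
  ... | inj₁ e = inj₁ (cong Fin.suc e)
  ... | inj₂ q = inj₂ (Vec.there q)

  ∈-insert⁺ : ∀ {n} (S : Subset n) x {y} → y ≡ x ⊎ y ∈ S → y ∈ S [ x ]≔ inside
  ∈-insert⁺ (_ ∷ S) Fin.zero    (inj₁ refl)          = Vec.here
  ∈-insert⁺ (_ ∷ S) Fin.zero    (inj₂ Vec.here)      = Vec.here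
  ∈-insert⁺ (_ ∷ S) Fin.zero    (inj₂ (Vec.there p)) = Vec.there p
  ∈-insert⁺ (_ ∷ S) (Fin.suc x) (inj₁ refl)          = Vec.there (∈-insert⁺ S x (inj₁ refl))
  ∈-insert⁺ (_ ∷ S) (Fin.suc x) (inj₂ Vec.here)      = Vec.here
  ∈-insert⁺ (_ ∷ S) (Fin.suc x) (inj₂ (Vec.there p)) = Vec.there (∈-insert⁺ S x (inj₂ p))

  image : (f : ℕ → ℕ) (k : ℕ) → (∀ q → q < k → f q < N) → Subset N
  image f zero    bound = Subset.⊥
  image f (suc k) bound =
    image f k (λ q → bound q ∘ ℕ.m<n⇒m<1+n) [ Fin.fromℕ< (bound k ≤-refl) ]≔ inside

  ∈-image⁻ : ∀ f k bound {y} → y ∈ image f k bound → ∃[ q ] (q < k × f q ≡ toℕ y)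
  ∈-image⁻ f zero    bound p = contradiction p Subset.∉⊥
  ∈-image⁻ f (suc k) bound p with ∈-insert⁻ (image f k _) _ p
  ... | inj₁ refl = k , ≤-refl , sym (Fin.toℕ-fromℕ< (bound k ≤-refl))
  ... | inj₂ p′ with q , q<k , e ← ∈-image⁻ f k _ p′ = q , ℕ.m<n⇒m<1+n q<k , e

  ∈-image⁺ : ∀ f k bound {y} q → q < k → f q ≡ toℕ y → y ∈ image f k bound
  ∈-image⁺ f (suc k) bound q (s≤s q≤k) e with ℕ.m≤n⇒m<n∨m≡n q≤k
  ... | inj₁ q<k  = ∈-insert⁺ (image f k _) _ (inj₂ (∈-image⁺ f k _ q q<k e))
  ... | inj₂ refl = ∈-insert⁺ (image f k _) _
    (inj₁ (Fin.toℕ-injective (trans (sym e) (sym (Fin.toℕ-fromℕ< (bound k ≤-refl))))))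

  ∣image∣ : ∀ f k bound → Injective< k f → ∣ image f k bound ∣ ≡ k
  ∣image∣ f zero    bound inj = ∣⊥∣≡0 N
  ∣image∣ f (suc k) bound inj = trans (∣insert∣ (image f k _) _ new)
    (cong suc (∣image∣ f k _ (Injective<-⊆ (ℕ.n≤1+n k) inj)))
    where
    new : ¬ Fin.fromℕ< (bound k ≤-refl) ∈ image f k _
    new p with q , q<k , e ← ∈-image⁻ f k _ p = ℕ.<⇒≢ q<k
      (inj (ℕ.m<n⇒m<1+n q<k) ≤-refl (trans e (Fin.toℕ-fromℕ< (bound k ≤-refl))))

  -- The image has `k` elements and is contained in `S`. This bounds how long a list of distinct
  -- rows can stay inside a given set of deletions.
  injective⇒≤∣_∣ : ∀ (S : Subset N) {f k} → Injective< k f →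
                   (∀ q → q < k → ∃[ y ] (y ∈ S × f q ≡ toℕ y)) → k ≤ ∣ S ∣
  injective⇒≤∣ S ∣ {f} {k} inj h = subst (_≤ ∣ S ∣) (∣image∣ f k bound inj)
    (p⊆q⇒∣p∣≤∣q∣ λ {y} p → included y (∈-image⁻ f k bound p))
    where
    bound : ∀ q → q < k → f q < N
    bound q q<k with y , _ , e ← h q q<k = subst (_< N) (sym e) (Fin.toℕ<n y)
    included : ∀ y → ∃[ q ] (q < k × f q ≡ toℕ y) → y ∈ S
    included y (q , q<k , e) with y′ , p , e′ ← h q q<k =
      subst (_∈ S) (Fin.toℕ-injective (trans (sym e′) e)) p

-- `d`-volumes encoded over the natural numbers, monotone in the side lengths

module Volumes {a ℓ₁ ℓ₂} (K : OrderedRing a ℓ₁ ℓ₂) where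

  open OrderedRingFacts K
  open Interval

  Code : Set a
  Code = ℕ × Carrier

  infix 4 _⊑_
  _⊑_ : Code → Code → Set ℓ₂
  (m , x) ⊑ (n , y) = Level.Lift ℓ₂ (m < n) ⊎ (m ≡ n × x ≼ y)

  ⊑-refl : ∀ {u} → u ⊑ u
  ⊑-refl = inj₂ (refl , ≼-refl)

  ⊑-trans : ∀ {u v w} → u ⊑ v → v ⊑ w → u ⊑ w
  ⊑-trans (inj₁ (Level.lift p)) (inj₁ (Level.lift q)) = inj₁ (Level.lift (ℕ.<-trans p q))
  ⊑-trans (inj₁ p)          (inj₂ (refl , _)) = inj₁ p
  ⊑-trans (inj₂ (refl , _)) (inj₁ q)          = inj₁ q
  ⊑-trans (inj₂ (refl , p)) (inj₂ (refl , q)) = inj₂ (refl , ≼-trans p q)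

  negative : List Carrier → Bool
  negative []       = false
  negative (x ∷ xs) = if does (0# ≼? x) then negative xs else true

  dimension : List Carrier → ℕ
  dimension []       = 0
  dimension (x ∷ xs) = if does (x ≼? 0#) then dimension xs else suc (dimension xs)

  content : List Carrier → Carrier
  content []       = 1#
  content (x ∷ xs) = if does (x ≼? 0#) then content xs else content xs ⊗ x

  -- The first component is 1 for the empty set, 2 for a point and `2 + k` for dimension `k`. The
  -- value 0 stays free and will mean that nothing has been recorded.
  encode : Bool → ℕ → Carrier → Code
  encode true  _       _ = 1 , 0#
  encode false zero    _ = 2 , 0#
  encode false (suc n) x = 3 + n , x

  -- The d-volume of a rectangle with the given side lengths, its dimension
  -- increased by 2.
  codeOf : List Carrier → Code
  codeOf xs = encode (negative xs) (dimension xs) (content xs)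

  lengthOf : Interval K → Carrier
  lengthOf I = hi I ⊖ lo I

  data _≼*_ : List Carrier → List Carrier → Set (a ⊔ˡ ℓ₂) where
    []  : [] ≼* []
    _∷_ : ∀ {x y xs ys} → x ≼ y → xs ≼* ys → (x ∷ xs) ≼* (y ∷ ys)

  encode-mono : ∀ {m n x y} → m ≤ n → (m ≡ n → x ≼ y) → encode false m x ⊑ encode false n y
  encode-mono {zero}  {zero}  p q = ⊑-refl
  encode-mono {zero}  {suc n} p q = inj₁ (Level.lift (s≤s (s≤s (s≤s z≤n))))
  encode-mono {suc m} {suc n} (s≤s p) q with ℕ.m≤n⇒m<n∨m≡n p
  ... | inj₁ m<n = inj₁ (Level.lift (ℕ.+-monoʳ-< 3 m<n))
  ... | inj₂ m≡n = inj₂ (cong (3 +_) m≡n , q (cong suc m≡n))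

  1⊑encode : ∀ b n x → (1 , 0#) ⊑ encode b n x
  1⊑encode true  n       x = ⊑-refl
  1⊑encode false zero    x = inj₁ (Level.lift ≤-refl)
  1⊑encode false (suc n) x = inj₁ (Level.lift (s≤s (s≤s z≤n)))

  Compared : List Carrier → List Carrier → Set ℓ₂
  Compared xs ys = negative ys ≡ false × dimension xs ≤ dimension ys ×
    (dimension xs ≡ dimension ys → content xs ≼ content ys) ×
    0# ≼ content xs × 0# ≼ content ys

  -- When nonnegative sides grow, positive ones stay positive, so the dimension cannot drop. If it
  -- stays the same, then the same sides are positive in both lists, and the products compare factor
  -- by factor.
  compare : ∀ {xs ys} → xs ≼* ys → negative xs ≡ false → Compared xs ys
  compare []                       _ = refl , z≤n , (λ _ → ≼-refl) , 0≼1 , 0≼1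
  compare {x ∷ xs} {y ∷ ys} (p ∷ ps) e with 0# ≼? x | 0# ≼? y
  ... | no _ | _ with () ← e
  ... | yes q | no ¬q = contradiction (≼-trans q p) ¬q
  ... | yes 0≼x | yes 0≼y with e′ , d , c , nx , ny ← compare ps e with x ≼? 0# | y ≼? 0#
  ... | yes _  | yes _  = e′ , d , c , nx , ny
  ... | yes _  | no _   = e′ , ℕ.m≤n⇒m≤1+n d , (λ eq → contradiction (ℕ.≤-reflexive (sym eq)) (ℕ.<⇒≱ (s≤s d))) , nx , 0≼* ny 0≼y
  ... | no ¬q  | yes q  = contradiction (≼-trans p q) ¬q
  ... | no _   | no _   = e′ , s≤s d , (λ eq → *-mono-≼ 0≼x ny (c (ℕ.suc-injective eq)) p) , 0≼* nx 0≼x , 0≼* ny 0≼y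

  codeOf-mono : ∀ {xs ys} → xs ≼* ys → codeOf xs ⊑ codeOf ys
  codeOf-mono {xs} {ys} p with negative xs in e
  ... | true = 1⊑encode (negative ys) _ _
  ... | false with e′ , d , c , _ ← compare p e rewrite e′ = encode-mono d c

  ¬≼⇒≺ : ∀ {x y} → ¬ y ≼ x → x ≺ y
  ¬≼⇒≺ {x} {y} p with ≼-total x y
  ... | inj₁ q = q , λ e → p (≼-reflexive (≈-sym e))
  ... | inj₂ q = contradiction q p

  ≺⇒¬≼ : ∀ {x y} → x ≺ y → ¬ y ≼ x
  ≺⇒¬≼ (p , q) r = q (≼-antisym p r)

  does-cong : ∀ {p q} {A : Set p} {B : Set q} (A? : Dec A) (B? : Dec B) →
              (A → ¬ B) → (¬ A → B) → does A? ≡ not (does B?)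
  does-cong (yes a) (yes b) f g = contradiction b (f a)
  does-cong (yes a) (no ¬b) f g = refl
  does-cong (no ¬a) (yes b) f g = refl
  does-cong (no ¬a) (no ¬b) f g = contradiction (g ¬a) ¬b

  degenerate? : ∀ I → does (lo I ≺? hi I) ≡ not (does (lengthOf I ≼? 0#))
  degenerate? I = does-cong (lo I ≺? hi I) (lengthOf I ≼? 0#)
    (λ p q → ≺⇒¬≼ p (≼-resp (x-y+y≈x (hi I) (lo I)) (+-identityˡ (lo I)) (+-mono q)))
    (λ ¬p → 0≼-flip (≼-flip ¬p))
    where
    +-mono : lengthOf I ≼ 0# → lengthOf I ⊕ lo I ≼ 0# ⊕ lo I
    +-mono q = ≼-+-mono q ≼-refl
    ≼-flip : ¬ lo I ≺ hi I → hi I ≼ lo I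
    ≼-flip ¬p with ≼-total (hi I) (lo I)
    ... | inj₁ q = q
    ... | inj₂ q with hi I ≼? lo I
    ...   | yes q′ = q′
    ...   | no ¬q′ = contradiction (¬≼⇒≺ ¬q′) ¬p
    0≼-flip : hi I ≼ lo I → lengthOf I ≼ 0#
    0≼-flip q = ≼-respʳ (-‿inverseʳ (lo I)) (≼-+-mono q ≼-refl)

  empty? : ∀ I → does (hi I ≺? lo I) ≡ not (does (0# ≼? lengthOf I))
  empty? I = does-cong (hi I ≺? lo I) (0# ≼? lengthOf I)
    (λ p q → ≺⇒¬≼ p (0≼-⇒≼ q))
    (λ ¬p → ≼⇒0≼- (≼-flip ¬p))
    where
    ≼-flip : ¬ hi I ≺ lo I → lo I ≼ hi I
    ≼-flip ¬p with lo I ≼? hi I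
    ... | yes q = q
    ... | no ¬q = contradiction (¬≼⇒≺ ¬q) ¬p

  any?-negative : ∀ Is → does (any? (λ I → hi I ≺? lo I) Is) ≡ negative (List.map lengthOf Is)
  any?-negative []       = refl
  any?-negative (I ∷ Is) with does (hi I ≺? lo I) | does (0# ≼? lengthOf I) | empty? I
  ... | true  | false | _ = refl
  ... | false | true  | _ = any?-negative Is

  measures : List (Interval K) → Carrier
  measures Is = List.foldr _⊗_ 1# (List.map lengthOf Is)

  proper : List (Interval K) → List (Interval K)
  proper = List.filter (λ I → lo I ≺? hi I)

  length-proper : ∀ Is → length (proper Is) ≡ dimension (List.map lengthOf Is)
  length-proper []       = refl
  length-proper (I ∷ Is) with does (lo I ≺? hi I) | does (lengthOf I ≼? 0#) | degenerate? I
  ... | true  | false | _ = cong suc (length-proper Is)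
  ... | false | true  | _ = length-proper Is

  measures-proper : ∀ Is → measures (proper Is) ≈ content (List.map lengthOf Is)
  measures-proper []       = ≈-refl
  measures-proper (I ∷ Is) with does (lo I ≺? hi I) | does (lengthOf I ≼? 0#) | degenerate? I
  ... | true  | false | _ = ≈-trans (*-congˡ (measures-proper Is)) (*-comm _ _)
  ... | false | true  | _ = measures-proper Is

  lengths : ∀ {d} → Rectangle K d → List Carrier
  lengths R = List.map lengthOf (List.tabulate R)

  Represents : DVolume K → Code → Set ℓ₁
  Represents (z , x) (n , y) = (z ≡ n ℤ.⊖ 2) × x ≈ y

  -- The definition of the volume compares endpoints strictly, while the machine compares lengths
  -- with 0; `empty?` and `degenerate?` translate between the two.
  represents : ∀ {d} (R : Rectangle K d) → Represents (volume K R) (codeOf (lengths R))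
  represents R rewrite any?-negative (List.tabulate R) with negative (lengths R)
  ... | true = refl , ≈-refl
  ... | false with proper (List.tabulate R) | length-proper (List.tabulate R) | measures-proper (List.tabulate R)
  ...   | []     | e | p with dimension (lengths R)
  ...     | zero = refl , ≈-refl
  represents R | false | I ∷ Is | e | p with dimension (lengths R)
  ...     | suc n = cong ℤ.+_ e , p

  represents-mono : ∀ {v w} {b c : Code} → Represents v b → Represents w c → b ⊑ c → _≤ᵛ_ K v w
  represents-mono {b = m , x} {n , y} (e , p) (e′ , p′) (inj₁ (Level.lift l)) =
    inj₁ (subst₂ ℤ._<_ (sym e) (sym e′) (ℤ.⊖-monoˡ-< 2 l))
  represents-mono {b = m , x} {n , y} (e , p) (e′ , p′) (inj₂ (refl , l)) =
    inj₂ (trans e (sym e′) , ≼-resp (≈-sym p) (≈-sym p′) l)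

  module Sides (d : ℕ) where

    -- In terms of the maxima x of the columns, the length of side i is
    -- - x (2i + 1) - x (2i).
    side : (ℕ → Carrier) → ℕ → Carrier
    side x i = 0# ⊖ (x (suc (i * 2)) ⊕ x (i * 2))

    sidesFrom : (ℕ → Carrier) → ℕ → ℕ → List Carrier
    sidesFrom x i zero    = []
    sidesFrom x i (suc g) = side x i ∷ sidesFrom x (suc i) g

    volumeCode : (ℕ → Carrier) → Code
    volumeCode x = codeOf (sidesFrom x 0 d)

-- The algorithm as a command

dV DV RV MV oneV zV kV nbV : Var
dV   = # 4
DV   = # 5
RV   = # 6
MV   = # 7
oneV = # 8
zV   = # 9
kV   = # 10
nbV  = # 11

zR aR bR wR prodR : Var
zR    = # 0
aR    = # 1
bR    = # 2
wR    = # 3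
prodR = # 4

FLAG BLOCK ORD TOT PAR EXT MARK BEST : Arr
FLAG  = # 0
BLOCK = # 1
ORD   = # 2
TOT   = # 3
PAR   = # 4
EXT   = # 5
MARK  = # 6
BEST  = # 7

IN V VAL VOL : Arr
IN  = # 0
V   = # 1
VAL = # 2
VOL = # 3

module Setup where

  xV yV eV : Var
  xV = # 12
  yV = # 13
  eV = # 14

  wV : Var
  wV = # 15

  -- The number q = 64dN is known, and so is N.
  countStep countLoop recover : Cmd
  countStep = mulᶜ nat yV dV NV ⨾ setᶜ nat eV 64 ⨾ mulᶜ nat yV eV yV ⨾
    if≤ nat qV yV skip (addᶜ nat dV dV oneV)
  countLoop = for xV qV countStep
  recover = (setᶜ nat oneV 1 ⨾ setᶜ nat kV 61) ⨾ countLoop ⨾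
    addᶜ nat DV dV dV ⨾ addᶜ nat RV rV oneV ⨾ mulᶜ nat MV NV DV

  copyLow copyHigh copy : Cmd
  copyLow  = for xV kV (addᶜ nat yV oV xV ⨾ readᶜ aR yV ⨾ putᶜ ring IN xV zV aR)
  copyHigh = for xV MV (readᶜ aR xV ⨾ addᶜ nat yV xV kV ⨾ putᶜ ring IN yV zV aR)
  copy     = copyLow ⨾ copyHigh

  -- Upper endpoints are negated, so that every column is to be maximised.
  columnLow columnHigh columnStep columnLoop columns : Cmd
  columnLow = mulᶜ nat eV yV DV ⨾ addᶜ nat wV xV xV ⨾ addᶜ nat eV eV wV ⨾
    getᶜ ring aR IN eV zV ⨾ putᶜ ring V wV yV aR
  columnHigh = addᶜ nat eV eV oneV ⨾ addᶜ nat wV wV oneV ⨾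
    getᶜ ring aR IN eV zV ⨾ subᶜ aR zR aR ⨾ putᶜ ring V wV yV aR
  columnStep = columnLow ⨾ columnHigh
  columnLoop = for yV NV columnStep
  columns    = for xV dV columnLoop

  -- The number of blocks, `N` divided by `r + 1` and rounded up, is found by adding up multiples.
  blockStep blocks : Cmd
  blockStep = if≤ nat NV yV skip (addᶜ nat yV yV RV ⨾ addᶜ nat nbV nbV oneV)
  blocks    = setᶜ nat yV 0 ⨾ for xV NV blockStep

module Select where

  cV bV pV uV jV bestV bbV fV : Var
  cV    = # 12
  bV    = # 13
  pV    = # 14
  uV    = # 15
  jV    = # 16
  bestV = # 17
  bbV   = # 18
  fV    = # 19

  -- `BLOCK` holds the best unflagged entry of every block. An extraction takes the best of these,
  -- flags it, and rescans only its block, whose number has been kept in `bbV`.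
  accept compareBest considerLive consider scan consult search mark extract scanAll extractAll select selectAll : Cmd
  accept = copyᶜ nat bestV jV ⨾ copyᶜ nat bbV bV
  compareBest = getᶜ ring aR V cV bestV ⨾ getᶜ ring bR V cV jV ⨾ if≤ ring bR aR skip accept
  considerLive = if≤ nat NV bestV accept compareBest
  consider = if≤ nat NV jV skip (getᶜ nat fV FLAG cV jV ⨾ if≤ nat fV zV considerLive skip)
  scan = copyᶜ nat bestV NV ⨾
    for uV RV (mulᶜ nat jV bV RV ⨾ addᶜ nat jV jV uV ⨾ consider) ⨾
    putᶜ nat BLOCK cV bV bestV
  consult = getᶜ nat jV BLOCK cV bV ⨾ consider
  search  = copyᶜ nat bestV NV ⨾ for bV nbV consult
  mark    = putᶜ nat ORD cV pV bestV ⨾ putᶜ nat FLAG cV bestV oneV ⨾ copyᶜ nat bV bbV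
  extract = search ⨾ mark ⨾ scan
  scanAll    = for bV nbV scan
  extractAll = for pV RV extract
  select     = scanAll ⨾ extractAll
  selectAll = for cV DV select

module Tree where

  lV iV nV loV cntV newV nnV sV pV eV fV tV kkV gV ancV dimV topV : Var
  lV   = # 12
  iV   = # 13
  nV   = # 14
  loV  = # 15
  cntV = # 16
  newV = # 17
  nnV  = # 18
  sV   = # 19
  pV   = # 20
  eV   = # 21
  fV   = # 22
  tV   = # 23
  kkV  = # 24
  gV   = # 25
  ancV = # 26
  dimV = # 27
  topV = # 10

  -- Row `n` of `EXT` begins with the deletions of node `n`, as many as `TOT` says; their indicator
  -- function, in row `n` of `MARK`, keeps them from being listed again. Every node owns its rows,
  -- so nothing is ever cleared.
  pick prepare extend enter : Cmd
  pick = getᶜ nat eV ORD lV pV ⨾ getᶜ nat fV MARK nV eV ⨾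
    if≤ nat fV zV (putᶜ nat EXT nV kkV eV ⨾ addᶜ nat kkV kkV oneV) skip
  prepare = addᶜ nat nV loV iV
  extend  = getᶜ nat tV TOT nV zV ⨾ copyᶜ nat kkV tV ⨾ for pV RV pick
  enter   = prepare ⨾ extend

  copyOne copyAll tail child : Cmd
  copyOne = getᶜ nat eV EXT nV pV ⨾ putᶜ nat EXT nnV pV eV ⨾ putᶜ nat MARK nnV eV oneV
  copyAll = for pV sV copyOne
  tail = getᶜ nat eV EXT nV sV ⨾ getᶜ ring aR V lV eV ⨾ putᶜ ring VAL nnV zV aR ⨾
    putᶜ nat PAR nnV zV nV ⨾ putᶜ nat TOT nnV zV sV ⨾
    addᶜ nat nnV nnV oneV ⨾ addᶜ nat newV newV oneV
  child = copyAll ⨾ tail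

  evalSide startEval evalSides endEval evaluate record-best compareVolume compareBest leaf : Cmd

  -- Variable pV counts the empty sides.
  evalSide = getᶜ ring bR VAL ancV zV ⨾ addᶜ ring wR aR bR ⨾ subᶜ wR zR wR ⨾
    if≤ ring zR wR skip (setᶜ nat pV 1) ⨾
    if≤ ring wR zR skip (addᶜ nat dimV dimV oneV ⨾ mulᶜ ring prodR prodR wR) ⨾
    getᶜ nat ancV PAR ancV zV ⨾ getᶜ ring aR VAL ancV zV ⨾ getᶜ nat ancV PAR ancV zV

  startEval = getᶜ nat eV EXT nV sV ⨾ getᶜ ring aR V lV eV ⨾ copyᶜ nat ancV nV ⨾
    setᶜ nat pV 0 ⨾ setᶜ nat dimV 2 ⨾ setᶜ ring prodR 1
  evalSides = for gV dV evalSide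
  endEval = if≤ nat oneV pV (setᶜ nat dimV 1 ⨾ copyᶜ ring prodR zR)
    (setᶜ nat eV 2 ⨾ if≤ nat dimV eV (copyᶜ ring prodR zR) skip)
  evaluate = startEval ⨾ evalSides ⨾ endEval

  record-best = putᶜ nat BEST sV zV dimV ⨾ putᶜ nat BEST sV oneV nV ⨾ putᶜ ring VOL sV zV prodR
  compareVolume = getᶜ ring bR VOL sV zV ⨾ if≤ ring prodR bR skip record-best
  compareBest = getᶜ nat eV BEST sV zV ⨾
    if≤ nat dimV eV (if≤ nat eV dimV compareVolume skip) record-best
  leaf = evaluate ⨾ compareBest

  -- Nodes are numbered consecutively, level after level, so a level is the interval of `cntV`
  -- numbers from `loV` on. Leaves get no number: in the last column a child is evaluated instead of
  -- being created.
  branch kid offspring process startLevel nodesLoop endLevel level levels : Cmd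
  branch    = if≤ nat DV topV leaf child
  kid       = if≤ nat tV sV branch skip
  offspring = for sV RV kid
  process   = enter ⨾ offspring

  -- Variable topV holds the number of the next level.
  startLevel = setᶜ nat newV 0 ⨾ addᶜ nat topV lV oneV ⨾ addᶜ nat nnV loV cntV
  nodesLoop  = for iV cntV process
  endLevel   = addᶜ nat loV loV cntV ⨾ copyᶜ nat cntV newV
  level      = startLevel ⨾ nodesLoop ⨾ endLevel

  levels = setᶜ nat loV 0 ⨾ setᶜ nat cntV 1 ⨾ for lV DV level

  emitOne emitAll emitRow output : Cmd
  emitOne = getᶜ nat eV EXT nV pV ⨾ addᶜ nat gV fV pV ⨾ writeᶜ gV eV
  emitAll = for pV sV emitOne
  emitRow = addᶜ nat sV iV oneV ⨾ getᶜ nat nV BEST sV oneV ⨾ mulᶜ nat fV iV rV ⨾ emitAll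
  output  = for iV rV emitRow

setup solve main : Cmd
setup  = Setup.recover ⨾ Setup.copy ⨾ Setup.columns ⨾ Setup.blocks
solve  = setup ⨾ Select.selectAll ⨾ Tree.levels
main   = solve ⨾ Tree.output

-- Cell 64 is the first one of the contiguous region.
epilogue program : Program
epilogue = const 0 64 ∷ halt ∷ []
program  = prologue ++ (code main (length prologue) ++ epilogue)

main-wellFormed : wellFormed main ≡ true
main-wellFormed = refl

-- Selecting the `r + 1` greatest entries of every column

module SelectionTimes (r₁ nb : ℕ) where

  open Select

  scanTime consultTime searchTime extractTime selectTime : ℕ
  scanTime    = 12 + r₁ * (4 + (2 + steps consider))
  consultTime = 9 + steps consider
  searchTime  = nb * (4 + consultTime) + 3
  extractTime = searchTime + (19 + scanTime)
  selectTime  = (nb * (4 + scanTime) + 2) + (r₁ * (4 + extractTime) + 2)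

module ColumnSelection {a ℓ₁ ℓ₂} (K : OrderedRing a ℓ₁ ℓ₂) (lim : ℕ) (N r₁ nb : ℕ)
                       (N≤nb*r₁ : N ≤ nb * r₁) (r₁≤N : r₁ ≤ N) (c : ℕ)
                       (v : ℕ → OrderedRing.Carrier K) where

  open OrderedRingFacts K
  open Semantics K lim
  open Select
  open SelectionTimes r₁ nb public

  context : List (Var × ℕ)
  context = (NV , N) ∷ (RV , r₁) ∷ (nbV , nb) ∷ (oneV , 1) ∷ (zV , 0) ∷ (cV , c) ∷ []

  Flags : (ℕ → ℕ) → State → Set
  Flags flag s = ∀ j → nats s (arr FLAG c j) ≡ flag j

  Values : State → Set a
  Values s = ∀ j → rings s (arr V c j) ≡ v j

  Context : (ℕ → ℕ) → State → Set a
  Context flag s = Fixed context s × Flags flag s × Values s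

  context-frame : ∀ {flag} c′ → unwrittenVars c′ context ≡ true →
    unwritten c′ nat (arr FLAG) ≡ true → unwritten c′ ring (arr V) ≡ true →
    ∀ {s} → Context flag s → Context flag (⟦ c′ ⟧ s)
  context-frame c′ p q r {s} (f , g , h) = fixed-frame context c′ p s f ,
    (λ j → trans (frame c′ nat (arr FLAG c j) q _) (g j)) ,
    (λ j → trans (frame c′ ring (arr V c j) r _) (h j))

  Live : (ℕ → ℕ) → ℕ → Set
  Live flag j = j < N × flag j ≡ 0

  -- The index N stands for the absence of a live candidate.
  Best : (ℕ → ℕ) → (ℕ → Set) → ℕ → Set ℓ₂
  Best flag Q i = Level.Lift ℓ₂ (i ≡ N × (∀ j → Q j → ¬ Live flag j)) ⊎
                  (Q i × Live flag i × (∀ j → Q j → Live flag j → v j ≼ v i))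

  best-cong : ∀ {flag Q Q′ i} → (∀ j → Q j → Q′ j) → (∀ j → Q′ j → Q j) →
              Best flag Q i → Best flag Q′ i
  best-cong f g (inj₁ (Level.lift (e , h))) = inj₁ (Level.lift (e , λ j q → h j (g j q)))
  best-cong f g (inj₂ (q , l , h))          = inj₂ (f _ q , l , λ j q′ → h j (g j q′))

  module _ {flag : ℕ → ℕ} {Q : ℕ → Set} (s : State) where

    private
      j₀ i₀ : ℕ
      j₀ = nats s (var jV)
      i₀ = nats s (var bestV)

    -- Besides optimality the provenance of the best entry is tracked; this later identifies the
    -- block to be rescanned.
    Considered : State → Set ℓ₂
    Considered s′ = Best flag (λ j → Q j ⊎ j ≡ j₀) (nats s′ (var bestV)) ×
      ((nats s′ (var bestV) ≡ i₀ × nats s′ (var bbV) ≡ nats s (var bbV)) ⊎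
       (nats s′ (var bestV) ≡ j₀ × nats s′ (var bbV) ≡ nats s (var bV)))

    not-live : Best flag Q i₀ → ¬ Live flag j₀ → Best flag (λ j → Q j ⊎ j ≡ j₀) i₀
    not-live (inj₁ (Level.lift (e , h))) ¬l =
      inj₁ (Level.lift (e , λ { j (inj₁ q) → h j q ; j (inj₂ refl) → ¬l }))
    not-live (inj₂ (q , l , h)) ¬l =
      inj₂ (inj₁ q , l , λ { j (inj₁ q′) → h j q′ ; j (inj₂ refl) l′ → contradiction l′ ¬l })

    consider-correct : Context flag s → Best flag Q i₀ → Considered (⟦ consider ⟧ s)
    consider-correct ((NV≡ , RV≡ , nb≡ , one≡ , z≡ , cV≡ , _) , F , H) B =
      if-nat Considered NV jV skip (getᶜ nat fV FLAG cV jV ⨾ if≤ nat fV zV considerLive skip) s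
        (λ N≤j → not-live B (λ (j<N , _) → ℕ.<⇒≱ j<N (subst (_≤ j₀) NV≡ N≤j)) , inj₁ (refl , refl))
        λ j<NV →
      if-nat Considered fV zV considerLive skip (⟦ getᶜ nat fV FLAG cV jV ⟧ (tick 1 s))
        (λ f≤0 → live-case (subst (j₀ <_) NV≡ j<NV , ℕ.n≤0⇒n≡0 (subst₂ _≤_ flag≡ z≡ f≤0)))
        λ f>0 → not-live B (λ (_ , e) → ℕ.<⇒≱ (subst₂ _<_ z≡ flag≡ f>0) (ℕ.≤-reflexive e)) , inj₁ (refl , refl)
      where
      flag≡ : nats s (arr FLAG (nats s (var cV)) j₀) ≡ flag j₀
      flag≡ = trans (cong (λ c → nats s (arr FLAG c j₀)) cV≡) (F j₀)
      value : ∀ j → rings s (arr V (nats s (var cV)) j) ≡ v j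
      value j = trans (cong (λ c → rings s (arr V c j)) cV≡) (H j)
      first : Live flag j₀ → Best flag Q i₀ → N ≤ i₀ → Best flag (λ j → Q j ⊎ j ≡ j₀) j₀
      first l (inj₁ (Level.lift (e , h))) p =
        inj₂ (inj₂ refl , l , λ { j (inj₁ q) l′ → contradiction l′ (h j q) ; j (inj₂ refl) _ → ≼-refl })
      first l (inj₂ (_ , (i<N , _) , _)) p = contradiction i<N (ℕ.≤⇒≯ p)
      worse : Live flag j₀ → Best flag Q i₀ → i₀ < N → v j₀ ≼ v i₀ →
              Best flag (λ j → Q j ⊎ j ≡ j₀) i₀
      worse l (inj₁ (Level.lift (e , _))) p le = contradiction e (ℕ.<⇒≢ p)
      worse l (inj₂ (q , l′ , h)) p le =
        inj₂ (inj₁ q , l′ , λ { j (inj₁ q′) → h j q′ ; j (inj₂ refl) _ → le })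
      better : Live flag j₀ → Best flag Q i₀ → i₀ < N → ¬ v j₀ ≼ v i₀ →
               Best flag (λ j → Q j ⊎ j ≡ j₀) j₀
      better l (inj₁ (Level.lift (e , _))) p ¬le = contradiction e (ℕ.<⇒≢ p)
      better l (inj₂ (q , l′ , h)) p ¬le = inj₂ (inj₂ refl , l ,
        λ { j (inj₁ q′) l″ → ≼-trans (h j q′ l″) (other (≼-total (v i₀) (v j₀))) ; j (inj₂ refl) _ → ≼-refl })
        where
        other : v i₀ ≼ v j₀ ⊎ v j₀ ≼ v i₀ → v i₀ ≼ v j₀
        other (inj₁ le) = le
        other (inj₂ le) = contradiction le ¬le
      s₁ : State
      s₁ = tick 1 (⟦ getᶜ nat fV FLAG cV jV ⟧ (tick 1 s))
      live-case : Live flag j₀ → Considered (⟦ considerLive ⟧ s₁)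
      live-case l = if-nat Considered NV bestV accept compareBest s₁
        (λ N≤i → first l B (subst (_≤ i₀) NV≡ N≤i) , inj₂ (refl , refl))
        λ i<N → if-ring Considered bR aR skip accept
            (⟦ getᶜ ring aR V cV bestV ⨾ getᶜ ring bR V cV jV ⟧ (tick 1 s₁))
          (λ le → worse l B (subst (i₀ <_) NV≡ i<N) (subst₂ _≼_ (value j₀) (value i₀) le) , inj₁ (refl , refl))
          λ ¬le → better l B (subst (i₀ <_) NV≡ i<N)
            (λ le → ¬le (subst₂ _≼_ (sym (value j₀)) (sym (value i₀)) le)) , inj₂ (refl , refl)

  Block : ℕ → ℕ → Set
  Block b j = ∃[ u ] (u < r₁ × j ≡ b * r₁ + u)

  scan-correct : ∀ {flag b} s → Context flag s → nats s (var bV) ≡ b →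
    Best flag (Block b) (nats (⟦ scan ⟧ s) (arr BLOCK c b)) ×
    (∀ b′ → b′ ≢ b → nats (⟦ scan ⟧ s) (arr BLOCK c b′) ≡ nats s (arr BLOCK c b′)) ×
    time (⟦ scan ⟧ s) ≤ time s + scanTime
  scan-correct {flag} {b} s C@((NV≡ , RV≡ , _ , _ , _ , cV≡ , _) , _) bV≡ =
    for-rule-timed
      (λ u s′ → Context flag s′ × nats s′ (var bV) ≡ b ×
        (∀ b′ → nats s′ (arr BLOCK c b′) ≡ nats s (arr BLOCK c b′)) ×
        Best flag (λ j → ∃[ u′ ] (u′ < u × j ≡ b * r₁ + u′)) (nats s′ (var bestV)))
      (λ s₁ → let s′ = ⟦ putᶜ nat BLOCK cV bV bestV ⟧ s₁ in
        Best flag (Block b) (nats s′ (arr BLOCK c b)) ×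
        (∀ b′ → b′ ≢ b → nats s′ (arr BLOCK c b′) ≡ nats s (arr BLOCK c b′)) ×
        time s′ ≤ time s + scanTime)
      uV RV iteration r₁ (2 + steps consider)
      (⟦ copyᶜ nat bestV NV ⟧ s) RV≡
      (C , bV≡ , (λ _ → refl) , inj₁ (Level.lift (NV≡ , λ { j (_ , () , _) })))
      body
      λ s₁ (((_ , _ , _ , _ , _ , cV₁ , _) , _) , b₁ , keep , B) t →
        subst (Best flag (Block b)) (sym (entry-hit (sym cV₁) (sym b₁))) B ,
        (λ b′ b′≢b → trans (entry-column c (nats s₁ (var cV)) (λ e → b′≢b (trans e b₁))) (keep b′)) ,
        (begin
          time s₁ + 1 + 9                                    ≤⟨ ℕ.+-monoˡ-≤ 9 t ⟩
          time s + 1 + (r₁ * (4 + (2 + steps consider)) + 2) + 9 ≡⟨ rearrange₂₆ (time s) (r₁ * (4 + (2 + steps consider))) ⟩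
          time s + scanTime                                  ∎)
    where
    open ℕ.≤-Reasoning
    iteration : Cmd
    iteration = mulᶜ nat jV bV RV ⨾ addᶜ nat jV jV uV ⨾ consider
    body : ∀ u s′ → u < r₁ → nats s′ (var uV) ≡ u → _ →
      (Context flag (⟦ iteration ⟧ (tick 1 s′)) × nats (⟦ iteration ⟧ (tick 1 s′)) (var bV) ≡ b ×
        (∀ b′ → nats (⟦ iteration ⟧ (tick 1 s′)) (arr BLOCK c b′) ≡ nats s (arr BLOCK c b′)) ×
        Best flag (λ j → ∃[ u′ ] (u′ < suc u × j ≡ b * r₁ + u′)) (nats (⟦ iteration ⟧ (tick 1 s′)) (var bestV))) ×
      time (⟦ iteration ⟧ (tick 1 s′)) ≤ time (tick 1 s′) + (2 + steps consider)
    body u s′ u<r₁ uV≡ (C′@((_ , RV′ , _) , _) , b′≡ , keep , B) =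
      (context-frame iteration refl refl refl {tick 1 s′} C′ ,
       trans (frame iteration nat (var bV) refl (tick 1 s′)) b′≡ ,
       (λ b′ → trans (frame iteration nat (arr BLOCK c b′) refl (tick 1 s′)) (keep b′)) ,
       best-cong widen narrow (proj₁ (consider-correct s″ C″ B))) ,
      time-loopFree iteration refl (tick 1 s′)
      where
      s″ : State
      s″ = ⟦ mulᶜ nat jV bV RV ⨾ addᶜ nat jV jV uV ⟧ (tick 1 s′)
      C″ : Context flag s″
      C″ = C′
      j≡ : nats s′ (var bV) * nats s′ (var RV) + nats s′ (var uV) ≡ b * r₁ + u
      j≡ = cong₂ _+_ (cong₂ _*_ b′≡ RV′) uV≡
      widen : ∀ j → (∃[ u′ ] (u′ < u × j ≡ b * r₁ + u′)) ⊎ j ≡ nats s″ (var jV) →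
              ∃[ u′ ] (u′ < suc u × j ≡ b * r₁ + u′)
      widen j (inj₁ (u′ , p , e)) = u′ , ℕ.m<n⇒m<1+n p , e
      widen j (inj₂ e)            = u , ≤-refl , trans e j≡
      narrow : ∀ j → ∃[ u′ ] (u′ < suc u × j ≡ b * r₁ + u′) →
               (∃[ u′ ] (u′ < u × j ≡ b * r₁ + u′)) ⊎ j ≡ nats s″ (var jV)
      narrow j (u′ , s≤s p , e) with ℕ.m≤n⇒m<n∨m≡n p
      ... | inj₁ q    = inj₁ (u′ , q , e)
      ... | inj₂ refl = inj₂ (trans e (sym j≡))

  block-of : ∀ n j → j < n * r₁ → ∃[ b ] (b < n × Block b j)
  block-of (suc n) j p with j ℕ.<? n * r₁
  ... | yes q with b , b<n , B ← block-of n j q = b , ℕ.m<n⇒m<1+n b<n , B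
  ... | no ¬q = n , ≤-refl , j ∸ n * r₁ ,
    ℕ.+-cancelˡ-< (n * r₁) (j ∸ n * r₁) r₁
      (subst₂ _<_ (sym (ℕ.m+[n∸m]≡n (ℕ.≮⇒≥ ¬q))) (ℕ.+-comm r₁ (n * r₁)) p) ,
    sym (ℕ.m+[n∸m]≡n (ℕ.≮⇒≥ ¬q))

  block-unique : ∀ {b b′ j} → Block b j → Block b′ j → b ≡ b′
  block-unique {b} {b′} (u , u< , e) (u′ , u′< , e′) =
    proj₁ (*+-injective r₁ {b} {b′} u< u′< (trans (sym e) e′))

  best-flag : ∀ {flag flag′ Q i} → (∀ j → Q j → flag′ j ≡ flag j) →
              Best flag Q i → Best flag′ Q i
  best-flag f (inj₁ (Level.lift (e , h))) =
    inj₁ (Level.lift (e , λ j q (j<N , z) → h j q (j<N , trans (sym (f j q)) z)))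
  best-flag f (inj₂ (q , (i<N , z) , h)) =
    inj₂ (q , (i<N , trans (f _ q) z) , λ j q′ (j<N , z′) → h j q′ (j<N , trans (sym (f j q′)) z′))

  -- Maximality is weak, so ties may be broken in any way.
  record Top (ord : ℕ → ℕ) (p : ℕ) : Set ℓ₂ where
    field
      bounded   : ∀ k → k < p → ord k < N
      injective : Injective< p ord
      greatest  : ∀ k → k < p → ∀ j → j < N → (∀ k′ → k′ < k → ord k′ ≢ j) → v j ≼ v (ord k)

  flagOf ordOf blockOf : State → ℕ → ℕ
  flagOf  s j = nats s (arr FLAG c j)
  ordOf   s k = nats s (arr ORD c k)
  blockOf s b = nats s (arr BLOCK c b)

  -- `flagged` and `ordered` together say that the flags are the indicator function of the entries
  -- extracted so far.
  record Extracted (s₀ : State) (p : ℕ) (s : State) : Set (a ⊔ˡ ℓ₂) where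
    field
      fixed   : Fixed context s
      values  : Values s
      blocks  : ∀ b → b < nb → Best (flagOf s) (Block b) (blockOf s b)
      flagged : ∀ j → flagOf s j ≡ 0 ⊎ ∃[ k ] (k < p × ordOf s k ≡ j)
      ordered : ∀ k → k < p → flagOf s (ordOf s k) ≡ 1
      top     : Top (ordOf s) p
      others  : ∀ c′ → c′ ≢ c → ∀ j → nats s (arr FLAG c′ j) ≡ nats s₀ (arr FLAG c′ j) ×
                                      nats s (arr ORD c′ j) ≡ nats s₀ (arr ORD c′ j)

  extracted-admin : ∀ {s₀ p s k n} → Extracted s₀ p s →
                    Extracted s₀ p (set nat (var pV) k (tick n s))
  extracted-admin E = record
    { fixed = fixed ; values = values ; blocks = blocks ; flagged = flagged
    ; ordered = ordered ; top = top ; others = others }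
    where open Extracted E

  extracted-tick : ∀ {s₀ p s n} → Extracted s₀ p s → Extracted s₀ p (tick n s)
  extracted-tick E = record
    { fixed = fixed ; values = values ; blocks = blocks ; flagged = flagged
    ; ordered = ordered ; top = top ; others = others }
    where open Extracted E

  Found : (flag B : ℕ → ℕ) → ℕ → State → Set ℓ₂
  Found flag B n s = Best flag (λ j → ∃[ b ] (b < n × j ≡ B b)) (nats s (var bestV)) ×
    (nats s (var bestV) ≡ N ⊎ (nats s (var bbV) < nb × nats s (var bestV) ≡ B (nats s (var bbV))))

  search-correct : ∀ {flag} s → Context flag s →
    Found flag (blockOf s) nb (⟦ search ⟧ s) × time (⟦ search ⟧ s) ≤ time s + searchTime
  search-correct {flag} s C@((NV≡ , _ , nb≡ , _) , _) =
    for-rule-timed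
      (λ n s′ → Context flag s′ × (∀ b → blockOf s′ b ≡ B b) × Found flag B n s′)
      (λ s′ → Found flag B nb s′ × time s′ ≤ time s + searchTime)
      bV nbV consult nb consultTime (⟦ copyᶜ nat bestV NV ⟧ s) nb≡
      (C , (λ _ → refl) , inj₁ (Level.lift (NV≡ , λ { j (_ , () , _) })) , inj₁ NV≡)
      body
      λ s₁ (_ , _ , F) t → F , ≤-trans t (ℕ.≤-reflexive (rearrange₂₇ (time s) (nb * (4 + consultTime))))
    where
    B : ℕ → ℕ
    B = blockOf s
    body : ∀ n s′ → n < nb → nats s′ (var bV) ≡ n →
      Context flag s′ × (∀ b → blockOf s′ b ≡ B b) × Found flag B n s′ →
      (Context flag (⟦ consult ⟧ (tick 1 s′)) × (∀ b → blockOf (⟦ consult ⟧ (tick 1 s′)) b ≡ B b) ×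
       Found flag B (suc n) (⟦ consult ⟧ (tick 1 s′))) ×
      time (⟦ consult ⟧ (tick 1 s′)) ≤ time (tick 1 s′) + consultTime
    body n s′ n<nb bV≡ (C′@((_ , _ , _ , _ , _ , cV≡ , _) , _) , keep , F , src) =
      (context-frame consult refl refl refl {tick 1 s′} C′ ,
       (λ b → trans (frame consult nat (arr BLOCK c b) refl (tick 1 s′)) (keep b)) ,
       best-cong widen narrow (proj₁ R) , source (proj₂ R)) ,
      time-loopFree consult refl (tick 1 s′)
      where
      s″ : State
      s″ = ⟦ getᶜ nat jV BLOCK cV bV ⟧ (tick 1 s′)
      C″ : Context flag s″
      C″ = C′
      R : Considered {flag} {λ j → ∃[ b ] (b < n × j ≡ B b)} s″ (⟦ consider ⟧ s″)
      R = consider-correct s″ C″ F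
      j≡ : nats s″ (var jV) ≡ B n
      j≡ = trans (cong₂ (λ c b → nats s′ (arr BLOCK c b)) cV≡ bV≡) (keep n)
      widen : ∀ j → (∃[ b ] (b < n × j ≡ B b)) ⊎ j ≡ nats s″ (var jV) → ∃[ b ] (b < suc n × j ≡ B b)
      widen j (inj₁ (b , p , e)) = b , ℕ.m<n⇒m<1+n p , e
      widen j (inj₂ e)           = n , ≤-refl , trans e j≡
      narrow : ∀ j → ∃[ b ] (b < suc n × j ≡ B b) → (∃[ b ] (b < n × j ≡ B b)) ⊎ j ≡ nats s″ (var jV)
      narrow j (b , s≤s p , e) with ℕ.m≤n⇒m<n∨m≡n p
      ... | inj₁ q    = inj₁ (b , q , e)
      ... | inj₂ refl = inj₂ (trans e (sym j≡))
      source : (nats (⟦ consider ⟧ s″) (var bestV) ≡ nats s″ (var bestV) ×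
                nats (⟦ consider ⟧ s″) (var bbV) ≡ nats s″ (var bbV)) ⊎
               (nats (⟦ consider ⟧ s″) (var bestV) ≡ nats s″ (var jV) ×
                nats (⟦ consider ⟧ s″) (var bbV) ≡ nats s″ (var bV)) →
        nats (⟦ consider ⟧ s″) (var bestV) ≡ N ⊎
        (nats (⟦ consider ⟧ s″) (var bbV) < nb ×
         nats (⟦ consider ⟧ s″) (var bestV) ≡ B (nats (⟦ consider ⟧ s″) (var bbV)))
      source (inj₁ (e , e′)) = Sum.map (trans e)
        (λ (l , e″) → subst (_< nb) (sym e′) l , trans e (trans e″ (cong B (sym e′)))) src
      source (inj₂ (e , e′)) = inj₂ (subst (_< nb) (sym (trans e′ bV≡)) n<nb ,
        trans e (trans j≡ (cong B (sym (trans e′ bV≡)))))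

  module Round (s₀ : State) (p : ℕ) (p<r₁ : p < r₁) (s : State) (E : Extracted s₀ p s) where

    open Extracted E
    open Top top

    flag B ord : ℕ → ℕ
    flag = flagOf s
    B    = blockOf s
    ord  = ordOf s

    -- A live entry is dominated by the winner of its block, which is then live as well; so the best
    -- of the block winners is the best live entry of the column.
    live-block : ∀ j → Live flag j → ∃[ b ] (b < nb × Live flag (B b) × v j ≼ v (B b))
    live-block j l = go (block-of nb j (ℕ.<-≤-trans (proj₁ l) N≤nb*r₁))
      where
      go : ∃[ b ] (b < nb × Block b j) → ∃[ b ] (b < nb × Live flag (B b) × v j ≼ v (B b))
      go (b , b<nb , j∈b) = found (blocks b b<nb)
        where
        found : Best flag (Block b) (B b) → ∃[ b ] (b < nb × Live flag (B b) × v j ≼ v (B b))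
        found (inj₁ (Level.lift (_ , none))) = contradiction l (none j j∈b)
        found (inj₂ (_ , l′ , h))            = b , b<nb , l′ , h j j∈b l

    -- Otherwise the `p` extracted entries would exhaust all `N` rows, although `p < r₁ ≤ N`.
    some-live : ¬ (∀ j → ¬ Live flag j)
    some-live h = ℕ.<⇒≱ (ℕ.<-≤-trans p<r₁ r₁≤N) (pigeonhole {f = id} (λ _ _ e → e) ord covered)
      where
      covered : ∀ j → j < N → ∃[ k ] (k < p × ord k ≡ j)
      covered j j<N with flagged j
      ... | inj₁ z = contradiction (j<N , z) (h j)
      ... | inj₂ q = q

    module Winner (e bb : ℕ) (bb<nb : bb < nb) (e≡ : e ≡ B bb) (e-live : Live flag e)
                  (e-max : ∀ b → b < nb → Live flag (B b) → v (B b) ≼ v e)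
                  (s₂ : State) (F : Fixed context s₂) (H : Values s₂)
                  (best≡ : nats s₂ (var bestV) ≡ e) (bb≡ : nats s₂ (var bbV) ≡ bb)
                  (p≡ : nats s₂ (var pV) ≡ p)
                  (FLAG≡ : ∀ c j → nats s₂ (arr FLAG c j) ≡ nats s (arr FLAG c j))
                  (ORD≡ : ∀ c j → nats s₂ (arr ORD c j) ≡ nats s (arr ORD c j))
                  (BLOCK≡ : ∀ b → blockOf s₂ b ≡ B b) where

      s₃ s₄ : State
      s₃ = ⟦ mark ⟧ s₂
      s₄ = ⟦ scan ⟧ s₃

      cV≡ : nats s₂ (var cV) ≡ c
      cV≡ = proj₁ (proj₂ (proj₂ (proj₂ (proj₂ (proj₂ F)))))

      flag-hit : flagOf s₃ e ≡ 1
      flag-hit = trans (entry-hit (sym cV≡) (sym best≡)) (proj₁ (proj₂ (proj₂ (proj₂ F))))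

      flag-miss : ∀ {j} → j ≢ e → flagOf s₃ j ≡ flag j
      flag-miss {j} j≢e = trans (entry-column c (nats s₂ (var cV)) (λ e′ → j≢e (trans e′ best≡))) (FLAG≡ c j)

      ord-hit : ordOf s₃ p ≡ e
      ord-hit = trans (entry-hit (sym cV≡) (sym p≡)) best≡

      ord-miss : ∀ {k} → k ≢ p → ordOf s₃ k ≡ ord k
      ord-miss {k} k≢p = trans (entry-column c (nats s₂ (var cV)) (λ e′ → k≢p (trans e′ p≡))) (ORD≡ c k)

      C₃ : Context (flagOf s₃) s₃
      C₃ = fixed-frame context mark refl s₂ F , (λ _ → refl) , H

      scanned : Best (flagOf s₃) (Block bb) (blockOf s₄ bb) ×
        (∀ b → b ≢ bb → blockOf s₄ b ≡ blockOf s₃ b) × time s₄ ≤ time s₃ + scanTime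
      scanned = scan-correct s₃ C₃ bb≡

      flag₄ : ∀ c j → nats s₄ (arr FLAG c j) ≡ nats s₃ (arr FLAG c j)
      flag₄ c j = frame scan nat (arr FLAG c j) refl s₃

      ord₄ : ∀ c k → nats s₄ (arr ORD c k) ≡ nats s₃ (arr ORD c k)
      ord₄ c k = frame scan nat (arr ORD c k) refl s₃

      e∈bb : Block bb e
      e∈bb = inside-block (blocks bb bb<nb)
        where
        inside-block : Best flag (Block bb) (B bb) → Block bb e
        inside-block (inj₁ (Level.lift (z , _))) =
          contradiction (trans e≡ z) (ℕ.<⇒≢ (proj₁ e-live))
        inside-block (inj₂ (q , _)) = subst (Block bb) (sym e≡) q

      -- Flagging `e` disturbs only the block that contains it, and this block has been rescanned.
      -- Blocks are disjoint, so the other winners stand.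
      blocks₄ : ∀ b → b < nb → Best (flagOf s₄) (Block b) (blockOf s₄ b)
      blocks₄ b b<nb with b ℕ.≟ bb
      ... | yes refl = best-flag (λ j _ → flag₄ c j) (proj₁ scanned)
      ... | no b≢bb  = subst (Best (flagOf s₄) (Block b))
          (sym (trans (proj₁ (proj₂ scanned) b b≢bb) (BLOCK≡ b)))
          (best-flag (λ j q → trans (flag₄ c j)
            (flag-miss (λ j≡e → b≢bb (block-unique q (subst (Block bb) (sym j≡e) e∈bb))))) (blocks b b<nb))

      ord-old : ∀ {k} → k < p → ordOf s₄ k ≡ ord k
      ord-old k<p = trans (ord₄ c _) (ord-miss (ℕ.<⇒≢ k<p))

      ord-new : ordOf s₄ p ≡ e
      ord-new = trans (ord₄ c p) ord-hit

      flagged₄ : ∀ j → flagOf s₄ j ≡ 0 ⊎ ∃[ k ] (k < suc p × ordOf s₄ k ≡ j)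
      flagged₄ j with j ℕ.≟ e
      ... | yes refl = inj₂ (p , ≤-refl , ord-new)
      ... | no j≢e with flagged j
      ...   | inj₁ z = inj₁ (trans (flag₄ c j) (trans (flag-miss j≢e) z))
      ...   | inj₂ (k , k<p , e′) = inj₂ (k , ℕ.m<n⇒m<1+n k<p , trans (ord-old k<p) e′)

      old≢e : ∀ {k} → k < p → ord k ≢ e
      old≢e k<p e′ with () ← trans (sym (ordered _ k<p)) (trans (cong flag e′) (proj₂ e-live))

      cases : ∀ {ℓ} (Q : ℕ → Set ℓ) → (∀ k → k < p → Q k) → Q p → ∀ k → k < suc p → Q k
      cases Q f g k (s≤s k≤p) with ℕ.m≤n⇒m<n∨m≡n k≤p
      ... | inj₁ k<p  = f k k<p
      ... | inj₂ refl = g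

      ordered₄ : ∀ k → k < suc p → flagOf s₄ (ordOf s₄ k) ≡ 1
      ordered₄ = cases _
        (λ k k<p → trans (cong (flagOf s₄) (ord-old k<p)) (trans (flag₄ c (ord k))
          (trans (flag-miss (old≢e k<p)) (ordered k k<p))))
        (trans (cong (flagOf s₄) ord-new) (trans (flag₄ c e) flag-hit))

      top₄ : Top (ordOf s₄) (suc p)
      top₄ = record
        { bounded   = cases (λ k → ordOf s₄ k < N)
            (λ k k<p → subst (_< N) (sym (ord-old k<p)) (bounded k k<p))
            (subst (_< N) (sym ord-new) (proj₁ e-live))
        ; injective = λ {k} {k′} k< k′< e′ → inj k k< k′ k′< e′
        ; greatest  = cases _
            (λ k k<p j j<N h → subst (λ i → v j ≼ v i) (sym (ord-old k<p))
              (greatest k k<p j j<N λ k′ k′<k → h k′ k′<k ∘ trans (ord-old (ℕ.<-trans k′<k k<p))))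
            (λ j j<N h → subst (λ i → v j ≼ v i) (sym ord-new) (last j j<N h)) }
        where
        inj : ∀ k → k < suc p → ∀ k′ → k′ < suc p → ordOf s₄ k ≡ ordOf s₄ k′ → k ≡ k′
        inj = cases _
          (λ k k<p → cases _
            (λ k′ k′<p e′ → injective k<p k′<p (trans (sym (ord-old k<p)) (trans e′ (ord-old k′<p))))
            (λ e′ → contradiction (trans (sym (ord-old k<p)) (trans e′ ord-new)) (old≢e k<p)))
          (cases _
            (λ k′ k′<p e′ → contradiction (trans (sym (ord-old k′<p)) (trans (sym e′) ord-new)) (old≢e k′<p))
            (λ _ → refl))
        last : ∀ j → j < N → (∀ k → k < p → ordOf s₄ k ≢ j) → v j ≼ v e
        last j j<N h with flagged j
        ... | inj₂ (k , k<p , e′) = contradiction (trans (ord-old k<p) e′) (h k k<p)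
        ... | inj₁ z = through (live-block j (j<N , z))
          where
          through : ∃[ b ] (b < nb × Live flag (B b) × v j ≼ v (B b)) → v j ≼ v e
          through (b , b<nb , l , le) = ≼-trans le (e-max b b<nb l)

      others₄ : ∀ c′ → c′ ≢ c → ∀ j → nats s₄ (arr FLAG c′ j) ≡ nats s₀ (arr FLAG c′ j) ×
                                      nats s₄ (arr ORD c′ j) ≡ nats s₀ (arr ORD c′ j)
      others₄ c′ c′≢c j =
        trans (flag₄ c′ j) (trans (entry-row j (nats s₂ (var bestV)) (λ e′ → c′≢c (trans e′ cV≡)))
          (trans (FLAG≡ c′ j) (proj₁ (others c′ c′≢c j)))) ,
        trans (ord₄ c′ j) (trans (entry-row j (nats s₂ (var pV)) (λ e′ → c′≢c (trans e′ cV≡)))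
          (trans (ORD≡ c′ j) (proj₂ (others c′ c′≢c j))))

      result : Extracted s₀ (suc p) s₄ × time s₄ ≤ time s₂ + (19 + scanTime)
      result = record
        { fixed   = fixed-frame context scan refl s₃ (proj₁ C₃)
        ; values  = λ j → trans (frame scan ring (arr V c j) refl s₃) (H j)
        ; blocks  = blocks₄
        ; flagged = flagged₄
        ; ordered = ordered₄
        ; top     = top₄
        ; others  = others₄ } ,
        ≤-trans (proj₂ (proj₂ scanned)) (ℕ.≤-reflexive (rearrange₉ (time s₂) scanTime))

    after-search : ∀ s₂ → Fixed context s₂ → Values s₂ → nats s₂ (var pV) ≡ p →
      (∀ c j → nats s₂ (arr FLAG c j) ≡ nats s (arr FLAG c j)) →
      (∀ c j → nats s₂ (arr ORD c j) ≡ nats s (arr ORD c j)) →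
      (∀ b → blockOf s₂ b ≡ B b) → Found flag B nb s₂ →
      Extracted s₀ (suc p) (⟦ mark ⨾ scan ⟧ s₂) × time (⟦ mark ⨾ scan ⟧ s₂) ≤ time s₂ + (19 + scanTime)
    after-search s₂ F H p≡ FLAG≡ ORD≡ BLOCK≡ (inj₁ (Level.lift (_ , none)) , _) =
      contradiction (λ j l → let b , b<nb , l′ , _ = live-block j l in none (B b) (b , b<nb , refl) l′) some-live
    after-search s₂ F H p≡ FLAG≡ ORD≡ BLOCK≡ (inj₂ (_ , l , h) , inj₁ z) =
      contradiction z (ℕ.<⇒≢ (proj₁ l))
    after-search s₂ F H p≡ FLAG≡ ORD≡ BLOCK≡ (inj₂ (_ , l , h) , inj₂ (bb<nb , e≡)) =
      Winner.result _ _ bb<nb e≡ l (λ b b<nb l′ → h (B b) (b , b<nb , refl) l′)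
        s₂ F H refl refl p≡ FLAG≡ ORD≡ BLOCK≡

  extract-correct : ∀ s₀ p s → p < r₁ → nats s (var pV) ≡ p → Extracted s₀ p s →
    Extracted s₀ (suc p) (⟦ extract ⟧ s) × time (⟦ extract ⟧ s) ≤ time s + extractTime
  extract-correct s₀ p s p<r₁ p≡ E = finish
    (Round.after-search s₀ p p<r₁ s E (⟦ search ⟧ s)
      (fixed-frame context search refl s (Extracted.fixed E))
      (λ j → trans (frame search ring (arr V c j) refl s) (Extracted.values E j))
      (trans (frame search nat (var pV) refl s) p≡)
      (λ c j → frame search nat (arr FLAG c j) refl s)
      (λ c j → frame search nat (arr ORD c j) refl s)
      (λ b → frame search nat (arr BLOCK c b) refl s)
      (proj₁ searched))
    where
    searched : Found (flagOf s) (blockOf s) nb (⟦ search ⟧ s) ×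
               time (⟦ search ⟧ s) ≤ time s + searchTime
    searched = search-correct s (Extracted.fixed E , (λ _ → refl) , Extracted.values E)
    finish : Extracted s₀ (suc p) (⟦ extract ⟧ s) ×
      time (⟦ extract ⟧ s) ≤ time (⟦ search ⟧ s) + (19 + scanTime) →
      Extracted s₀ (suc p) (⟦ extract ⟧ s) × time (⟦ extract ⟧ s) ≤ time s + extractTime
    finish (E′ , t) = E′ , ≤-trans t (≤-trans (ℕ.+-monoˡ-≤ (19 + scanTime) (proj₂ searched))
      (ℕ.≤-reflexive (ℕ.+-assoc (time s) searchTime (19 + scanTime))))

  scanAll-correct : ∀ {flag} s → Context flag s →
    (∀ b → b < nb → Best flag (Block b) (blockOf (⟦ scanAll ⟧ s) b)) ×
    time (⟦ scanAll ⟧ s) ≤ time s + (nb * (4 + scanTime) + 2)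
  scanAll-correct {flag} s C@((_ , _ , nb≡ , _) , _) = for-rule-timed
    (λ n s′ → Context flag s′ × (∀ b → b < n → Best flag (Block b) (blockOf s′ b)))
    (λ s′ → (∀ b → b < nb → Best flag (Block b) (blockOf s′ b)) ×
            time s′ ≤ time s + (nb * (4 + scanTime) + 2))
    bV nbV scan nb scanTime s nb≡ (C , λ b ())
    (λ n s′ n<nb bV≡ (C′ , h) → round n s′ (tick 1 s′) bV≡ C′ h (scan-correct (tick 1 s′) C′ bV≡))
    (λ s′ (_ , h) t → h , t)
    where
    round : ∀ n s′ s″ → nats s″ (var bV) ≡ n → Context flag s″ →
      (∀ b → b < n → Best flag (Block b) (blockOf s″ b)) →
      Best flag (Block n) (blockOf (⟦ scan ⟧ s″) n) ×
      (∀ b → b ≢ n → blockOf (⟦ scan ⟧ s″) b ≡ blockOf s″ b) ×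
      time (⟦ scan ⟧ s″) ≤ time s″ + scanTime →
      (Context flag (⟦ scan ⟧ s″) × (∀ b → b < suc n → Best flag (Block b) (blockOf (⟦ scan ⟧ s″) b))) ×
      time (⟦ scan ⟧ s″) ≤ time s″ + scanTime
    round n s′ s″ e C′ h (B , keep , t) = (context-frame scan refl refl refl {s″} C′ , all) , t
      where
      all : ∀ b → b < suc n → Best flag (Block b) (blockOf (⟦ scan ⟧ s″) b)
      all b (s≤s b≤n) with ℕ.m≤n⇒m<n∨m≡n b≤n
      ... | inj₁ b<n  = subst (Best flag (Block b)) (sym (keep b (ℕ.<⇒≢ b<n))) (h b b<n)
      ... | inj₂ refl = B

  Selected : State → State → Set ℓ₂
  Selected s₀ s = Top (ordOf s) r₁ × (∀ c′ → c′ ≢ c → ∀ j →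
    nats s (arr FLAG c′ j) ≡ nats s₀ (arr FLAG c′ j) × nats s (arr ORD c′ j) ≡ nats s₀ (arr ORD c′ j))

  extractAll-correct : ∀ s₀ s → Extracted s₀ 0 s →
    Selected s₀ (⟦ extractAll ⟧ s) × time (⟦ extractAll ⟧ s) ≤ time s + (r₁ * (4 + extractTime) + 2)
  extractAll-correct s₀ s E = for-rule-timed
    (λ p s′ → Extracted s₀ p s′)
    (λ s′ → Selected s₀ s′ × time s′ ≤ time s + (r₁ * (4 + extractTime) + 2))
    pV RV extract r₁ extractTime s (proj₁ (proj₂ (Extracted.fixed E))) (extracted-admin E)
    (λ p s′ p<r₁ p≡ E′ → admin (extract-correct s₀ p (tick 1 s′) p<r₁ p≡ (extracted-tick E′)))
    (λ s′ E′ t → (Extracted.top E′ , Extracted.others E′) , t)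
    where
    admin : ∀ {p s t} → Extracted s₀ (suc p) s × time s ≤ t →
      Extracted s₀ (suc p) (set nat (var pV) (suc p) (tick 3 s)) × time s ≤ t
    admin (E , t) = extracted-admin E , t

  select-correct : ∀ s → Fixed context s → Values s → (∀ j → nats s (arr FLAG c j) ≡ 0) →
    Selected s (⟦ select ⟧ s) × time (⟦ select ⟧ s) ≤ time s + selectTime
  select-correct s F H Z = combine (scanAll-correct s C)
    where
    C : Context (flagOf s) s
    C = F , (λ _ → refl) , H
    s₁ : State
    s₁ = ⟦ scanAll ⟧ s
    E : (∀ b → b < nb → Best (flagOf s) (Block b) (blockOf s₁ b)) → Extracted s 0 s₁
    E h = record
      { fixed   = fixed-frame context scanAll refl s F
      ; values  = λ j → trans (frame scanAll ring (arr V c j) refl s) (H j)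
      ; blocks  = λ b b<nb → best-flag (λ j _ → frame scanAll nat (arr FLAG c j) refl s) (h b b<nb)
      ; flagged = λ j → inj₁ (trans (frame scanAll nat (arr FLAG c j) refl s) (Z j))
      ; ordered = λ k ()
      ; top     = record { bounded = λ k () ; injective = λ () ; greatest = λ k () }
      ; others  = λ c′ _ j → frame scanAll nat (arr FLAG c′ j) refl s , frame scanAll nat (arr ORD c′ j) refl s }
    combine : (∀ b → b < nb → Best (flagOf s) (Block b) (blockOf s₁ b)) ×
              time s₁ ≤ time s + (nb * (4 + scanTime) + 2) →
              Selected s (⟦ select ⟧ s) × time (⟦ select ⟧ s) ≤ time s + selectTime
    combine (h , t) = finish (extractAll-correct s s₁ (E h))
      where
      finish : Selected s (⟦ extractAll ⟧ s₁) × time (⟦ extractAll ⟧ s₁) ≤ time s₁ + (r₁ * (4 + extractTime) + 2) →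
               Selected s (⟦ select ⟧ s) × time (⟦ select ⟧ s) ≤ time s + selectTime
      finish (S , t′) = S , ≤-trans t′ (≤-trans (ℕ.+-monoˡ-≤ (r₁ * (4 + extractTime) + 2) t)
        (ℕ.≤-reflexive (ℕ.+-assoc (time s) _ _)))

module AllColumns {a ℓ₁ ℓ₂} (K : OrderedRing a ℓ₁ ℓ₂) (lim : ℕ) (N r₁ nb D : ℕ)
                  (N≤nb*r₁ : N ≤ nb * r₁) (r₁≤N : r₁ ≤ N)
                  (v : ℕ → ℕ → OrderedRing.Carrier K) where

  open OrderedRingFacts K
  open Semantics K lim
  open Select using (cV; select; selectAll)

  private module Column c = ColumnSelection K lim N r₁ nb N≤nb*r₁ r₁≤N c (v c)

  open Column using (Top) public
  open SelectionTimes r₁ nb public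

  known : List (Var × ℕ)
  known = (NV , N) ∷ (RV , r₁) ∷ (nbV , nb) ∷ (oneV , 1) ∷ (zV , 0) ∷ (DV , D) ∷ []

  Stored : State → Set a
  Stored s = ∀ c j → rings s (arr V c j) ≡ v c j

  order : State → ℕ → ℕ → ℕ
  order s c k = nats s (arr ORD c k)

  -- Each column has its own row of flags, which is still zero when the column is reached.
  selectAll-correct : ∀ s → Fixed known s → Stored s → (∀ c j → nats s (arr FLAG c j) ≡ 0) →
    (∀ c → c < D → Top c (order (⟦ selectAll ⟧ s) c) r₁) ×
    time (⟦ selectAll ⟧ s) ≤ time s + (D * (4 + selectTime) + 2)
  selectAll-correct s F@(_ , _ , _ , _ , _ , D≡ , _) H Z = for-rule-timed
    (λ c s′ → Fixed known s′ × Stored s′ × (∀ c′ → c′ < c → Top c′ (order s′ c′) r₁) ×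
              (∀ c′ → c ≤ c′ → ∀ j → nats s′ (arr FLAG c′ j) ≡ 0))
    (λ s′ → (∀ c → c < D → Top c (order s′ c) r₁) × time s′ ≤ time s + (D * (4 + selectTime) + 2))
    cV DV select D selectTime s D≡
    (F , H , (λ c ()) , λ c _ j → Z c j)
    (λ c s′ c<D c≡ (F′ , H′ , T , Z′) → round c (tick 1 s′) c≡ F′ H′ T Z′
      (Column.select-correct c (tick 1 s′)
        (proj₁ F′ , proj₁ (proj₂ F′) , proj₁ (proj₂ (proj₂ F′)) , proj₁ (proj₂ (proj₂ (proj₂ F′))) ,
         proj₁ (proj₂ (proj₂ (proj₂ (proj₂ F′)))) , c≡ , tt)
        (λ j → H′ c j) (Z′ c ≤-refl)))
    (λ s′ (_ , _ , T , _) t → T , t)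
    where
    round : ∀ c s′ → nats s′ (var cV) ≡ c → Fixed known s′ → Stored s′ →
      (∀ c′ → c′ < c → Top c′ (order s′ c′) r₁) →
      (∀ c′ → c ≤ c′ → ∀ j → nats s′ (arr FLAG c′ j) ≡ 0) →
      Column.Selected c s′ (⟦ select ⟧ s′) × time (⟦ select ⟧ s′) ≤ time s′ + selectTime →
      (Fixed known (⟦ select ⟧ s′) × Stored (⟦ select ⟧ s′) ×
       (∀ c′ → c′ < suc c → Top c′ (order (⟦ select ⟧ s′) c′) r₁) ×
       (∀ c′ → suc c ≤ c′ → ∀ j → nats (⟦ select ⟧ s′) (arr FLAG c′ j) ≡ 0)) ×
      time (⟦ select ⟧ s′) ≤ time s′ + selectTime
    round c s′ e F′ H′ T Z′ ((T₁ , others) , t) =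
      (fixed-frame known select refl s′ F′ ,
       (λ c j → trans (frame select ring (arr V c j) refl s′) (H′ c j)) ,
       tops ,
       (λ c′ c<c′ j → trans (proj₁ (others c′ (ℕ.>⇒≢ c<c′) j)) (Z′ c′ (ℕ.<⇒≤ c<c′) j))) , t
      where
      top-cong : ∀ {c f g} → (∀ k → g k ≡ f k) → Top c f r₁ → Top c g r₁
      top-cong {c} e T = record
        { bounded   = λ k p → subst (_< N) (sym (e k)) (bounded k p)
        ; injective = λ p q e′ → injective p q (trans (sym (e _)) (trans e′ (e _)))
        ; greatest  = λ k p j j<N h → subst (λ i → v c j ≼ v c i) (sym (e k))
            (greatest k p j j<N λ k′ k′<k e′ → h k′ k′<k (trans (e k′) e′)) }
        where open Column.Top c T
      tops : ∀ c′ → c′ < suc c → Top c′ (order (⟦ select ⟧ s′) c′) r₁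
      tops c′ (s≤s c′≤c) with ℕ.m≤n⇒m<n∨m≡n c′≤c
      ... | inj₁ c′<c = top-cong (λ k → proj₂ (others c′ (ℕ.<⇒≢ c′<c) k)) (T c′ c′<c)
      ... | inj₂ refl = T₁

-- Sums over consecutive node numbers

total : (ℕ → ℕ) → ℕ → ℕ → ℕ
total f b zero    = 0
total f b (suc n) = f b + total f (suc b) n

total-++ : ∀ f b m n → total f b (m + n) ≡ total f b m + total f (b + m) n
total-++ f b zero    n = cong (λ b → total f b n) (sym (ℕ.+-identityʳ b))
total-++ f b (suc m) n = trans (cong (f b +_) (trans (total-++ f (suc b) m n)
    (cong (λ c → total f (suc b) m + total f c n) (sym (ℕ.+-suc b m)))))
  (sym (ℕ.+-assoc (f b) _ _))

total-cong : ∀ f g b n → (∀ i → b ≤ i → i < b + n → f i ≡ g i) → total f b n ≡ total g b n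
total-cong f g b zero    h = refl
total-cong f g b (suc n) h = cong₂ _+_ (h b ≤-refl (ℕ.m<m+n b (s≤s z≤n)))
  (total-cong f g (suc b) n λ i b<i i< → h i (ℕ.<⇒≤ b<i) (subst (i <_) (sym (ℕ.+-suc b n)) i<))

total-one : ∀ f b n → (∀ i → f i ≡ 1) → total f b n ≡ n
total-one f b zero    h = refl
total-one f b (suc n) h = cong₂ _+_ (h b) (total-one f (suc b) n h)

-- The hockey-stick identity, in the form in which the children of one node present it: with budgets
-- `u`, ..., `0` left, they have together as many descendants `j` levels down as their parent, with
-- budget `u`, has `suc j` levels down.
total-binom : ∀ f b u j → (∀ i → i ≤ u → f (b + i) ≡ binom (u ∸ i) j) → total f b (suc u) ≡ binom u (suc j)
total-binom f b zero    j h =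
  trans (ℕ.+-identityʳ (f b)) (trans (trans (cong f (sym (ℕ.+-identityʳ b))) (h 0 z≤n)) (binom-0 j))
total-binom f b (suc u) j h = trans (cong₂ _+_ (trans (cong f (sym (ℕ.+-identityʳ b))) (h 0 z≤n))
    (total-binom f (suc b) u j λ i i≤u → trans (cong f (sym (ℕ.+-suc b i))) (h (suc i) (s≤s i≤u))))
  (ℕ.+-comm (binom (suc u) j) (binom u (suc j)))

-- Step counts of the tree search

module TreeTimes (r d : ℕ) where

  open Tree

  D : ℕ
  D = d * 2

  extendTime : ℕ
  extendTime = 12 + suc r * (4 + steps pick)

  copyTime : ℕ → ℕ
  copyTime s = s * (4 + steps copyOne) + 2

  childTime : ℕ
  childTime = copyTime r + steps tail

  enterTime : ℕ
  enterTime = 1 + extendTime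

  nodeTime : ℕ
  nodeTime = 6 + (enterTime + suc r * 7)

  evalTime : ℕ
  evalTime = steps startEval + (d * (4 + steps evalSide) + 2) + steps endEval

  leafTime : ℕ
  leafTime = evalTime + steps compareBest

  -- Every node above level `l` is charged once for being processed and once for being created, the
  -- root included; on top come the leaves and a constant per level.
  searchBoundAt : ℕ → ℕ
  searchBoundAt l = l * 12 + (binomSum r l * nodeTime + (binomSum r l * childTime + binom r D * leafTime))

  searchBound : ℕ
  searchBound = searchBoundAt D

module TreeSearch {a ℓ₁ ℓ₂} (K : OrderedRing a ℓ₁ ℓ₂) (lim : ℕ) (N r d : ℕ)
                  (v : ℕ → ℕ → OrderedRing.Carrier K) (ord : ℕ → ℕ → ℕ) where

  open OrderedRingFacts K
  open Semantics K lim
  open Volumes K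
  open Sides d
  open TreeTimes r d
  open Tree

  tot par : State → ℕ → ℕ
  tot s n = nats s (arr TOT n 0)
  par s n = nats s (arr PAR n 0)

  ext mrk : State → ℕ → ℕ → ℕ
  ext s n q = nats s (arr EXT n q)
  mrk s n e = nats s (arr MARK n e)

  val : State → ℕ → Carrier
  val s n = rings s (arr VAL n 0)

  Ordered : State → Set
  Ordered s = ∀ c k → nats s (arr ORD c k) ≡ ord c k

  Stored : State → Set a
  Stored s = ∀ c j → rings s (arr V c j) ≡ v c j

  -- Prolonging the row of a node by the sorted column

  record TopRow (l : ℕ) : Set ℓ₂ where
    field
      bounded   : ∀ p → p < suc r → ord l p < N
      injective : Injective< (suc r) (ord l)
      greatest  : ∀ p → p < suc r → ∀ j → j < N → (∀ p′ → p′ < p → ord l p′ ≢ j) → v l j ≼ v l (ord l p)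

  -- Of the row f, the first t entries are given; the others, up to k, are the
  -- entries of the sorted column l among its first p ones that are not given.
  record Partial (l t p k : ℕ) (f : ℕ → ℕ) : Set ℓ₂ where
    field
      t≤k       : t ≤ k
      bounded   : ∀ q → q < k → f q < N
      injective : Injective< k f
      sorted    : ∀ q → t ≤ q → q < k → ∀ j → j < N → (∀ q′ → q′ < q → f q′ ≢ j) → v l j ≼ v l (f q)
      taken     : ∀ p′ → p′ < p → ∃[ q ] (q < k × f q ≡ ord l p′)
      source    : ∀ q → t ≤ q → q < k → ∃[ p′ ] (p′ < p × ord l p′ ≡ f q)

  below-suc : ∀ {b k} (Q : ℕ → Set b) → (∀ q → q < k → Q q) → Q k → ∀ q → q < suc k → Q q
  below-suc Q f g q (s≤s q≤k) with ℕ.m≤n⇒m<n∨m≡n q≤k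
  ... | inj₁ q<k  = f q q<k
  ... | inj₂ refl = g

  partial-skip : ∀ {l t p k f} → Partial l t p k f → ∃[ q ] (q < t × f q ≡ ord l p) →
                 Partial l t (suc p) k f
  partial-skip {l} {t} {p} {k} {f} P (q , q<t , e) = record
    { t≤k = t≤k ; bounded = bounded ; injective = injective ; sorted = sorted
    ; taken  = below-suc (λ p′ → ∃[ q ] (q < k × f q ≡ ord l p′)) taken (q , ℕ.<-≤-trans q<t t≤k , e)
    ; source = λ q t≤q q<k → let p′ , p′<p , e′ = source q t≤q q<k in p′ , ℕ.m<n⇒m<1+n p′<p , e′ }
    where open Partial P

  -- The new entry heads what is left of the sorted column: all entries listed before it in the
  -- column already occur in the row, by `taken`. It is new because it is no deletion and the sorted
  -- column has no repetitions.
  partial-append : ∀ {l t p k f} f′ → TopRow l → p < suc r → Partial l t p k f →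
    (∀ q → q < t → f q ≢ ord l p) → (∀ q → q ≢ k → f′ q ≡ f q) → f′ k ≡ ord l p →
    Partial l t (suc p) (suc k) f′
  partial-append {l} {t} {p} {k} {f} f′ T p<r P new old here = record
    { t≤k       = ℕ.m≤n⇒m≤1+n t≤k
    ; bounded   = below-suc _ (λ q q<k → subst (_< N) (sym (old′ q q<k)) (bounded q q<k))
                              (subst (_< N) (sym here) (TopRow.bounded T p p<r))
    ; injective = λ {q} {q′} → inj q q′
    ; sorted    = λ q t≤q q<k → sort q q<k t≤q
    ; taken     = below-suc _
        (λ p′ p′<p → let q , q<k , e = taken p′ p′<p in q , ℕ.m<n⇒m<1+n q<k , trans (old′ q q<k) e)
        (k , ≤-refl , here)
    ; source    = λ q t≤q q<k → src q q<k t≤q }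
    where
    open Partial P
    old′ : ∀ q → q < k → f′ q ≡ f q
    old′ q q<k = old q (ℕ.<⇒≢ q<k)
    fresh : ∀ q → q < k → f q ≢ ord l p
    fresh q q<k e with q ℕ.<? t
    ... | yes q<t = new q q<t e
    ... | no ¬q<t = go (source q (ℕ.≮⇒≥ ¬q<t) q<k)
      where
      go : ¬ (∃[ p′ ] (p′ < p × ord l p′ ≡ f q))
      go (p′ , p′<p , e′) = ℕ.<⇒≢ p′<p (TopRow.injective T (ℕ.<-trans p′<p p<r) p<r (trans e′ e))
    inj : ∀ q q′ → q < suc k → q′ < suc k → f′ q ≡ f′ q′ → q ≡ q′
    inj q q′ q< q′< = below-suc (λ q → f′ q ≡ f′ q′ → q ≡ q′)
      (λ q q<k → below-suc (λ q′ → f′ q ≡ f′ q′ → q ≡ q′)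
        (λ q′ q′<k e → injective q<k q′<k (trans (sym (old′ q q<k)) (trans e (old′ q′ q′<k))))
        (λ e → contradiction (trans (sym (old′ q q<k)) (trans e here)) (fresh q q<k)) q′ q′<)
      (below-suc (λ q′ → f′ k ≡ f′ q′ → k ≡ q′)
        (λ q′ q′<k e → contradiction (trans (sym (old′ q′ q′<k)) (trans (sym e) here)) (fresh q′ q′<k))
        (λ _ → refl) q′ q′<) q q<
    Sorted : ℕ → Set ℓ₂
    Sorted q = t ≤ q → ∀ j → j < N → (∀ q′ → q′ < q → f′ q′ ≢ j) → v l j ≼ v l (f′ q)
    sort : ∀ q → q < suc k → Sorted q
    sort = below-suc Sorted
      (λ q q<k t≤q j j<N h → subst (λ i → v l j ≼ v l i) (sym (old′ q q<k))
        (sorted q t≤q q<k j j<N λ q′ q′<q e → h q′ q′<q (trans (old′ q′ (ℕ.<-trans q′<q q<k)) e)))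
      (λ _ j j<N h → subst (λ i → v l j ≼ v l i) (sym here)
        (TopRow.greatest T p p<r j j<N λ p′ p′<p e → let q , q<k , e′ = taken p′ p′<p in
          h q q<k (trans (old′ q q<k) (trans e′ e))))
    src : ∀ q → q < suc k → t ≤ q → ∃[ p′ ] (p′ < suc p × ord l p′ ≡ f′ q)
    src = below-suc (λ q → t ≤ q → ∃[ p′ ] (p′ < suc p × ord l p′ ≡ f′ q))
      (λ q q<k t≤q → let p′ , p′<p , e = source q t≤q q<k in
        p′ , ℕ.m<n⇒m<1+n p′<p , trans e (sym (old′ q q<k)))
      (λ _ → p , ≤-refl , sym here)

  -- The deletions of node n are the first tot s n entries of its row.
  record Marked (n : ℕ) (s : State) : Set where
    field
      t≤r       : tot s n ≤ r
      bounded   : ∀ q → q < tot s n → ext s n q < N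
      injective : Injective< (tot s n) (ext s n)
      marked    : ∀ q → q < tot s n → mrk s n (ext s n q) ≡ 1
      unmarked  : ∀ e → mrk s n e ≡ 0 ⊎ ∃[ q ] (q < tot s n × ext s n q ≡ e)

  record Row (l t : ℕ) (f : ℕ → ℕ) : Set ℓ₂ where
    field
      bounded   : ∀ q → q ≤ r → f q < N
      injective : Injective< (suc r) f
      sorted    : ∀ q → t ≤ q → q ≤ r → ∀ j → j < N → (∀ q′ → q′ < q → f q′ ≢ j) → v l j ≼ v l (f q)

  -- The `r + 1` leading entries of the column are distinct and all occur in the row, so the row has
  -- reached position `r`, however many deletions it started with.
  partial⇒row : ∀ {l t k f} → TopRow l → Partial l t (suc r) k f → Row l t f
  partial⇒row {l} {t} {k} {f} T P = record
    { bounded   = λ q q≤r → bounded q (ℕ.≤-<-trans q≤r r<k)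
    ; injective = Injective<-⊆ r<k injective
    ; sorted    = λ q t≤q q≤r → sorted q t≤q (ℕ.≤-<-trans q≤r r<k) }
    where
    open Partial P
    r<k : r < k
    r<k = pigeonhole (TopRow.injective T) f taken

  at-node : ℕ → ℕ → List (Var × ℕ)
  at-node l n = (RV , suc r) ∷ (oneV , 1) ∷ (zV , 0) ∷ (lV , l) ∷ (nV , n) ∷ []

  OtherRows : ℕ → State → State → Set
  OtherRows n s s′ = ∀ m → m ≢ n → ∀ q → ext s′ m q ≡ ext s m q

  extend-correct : ∀ l n s → Fixed (at-node l n) s → Ordered s → TopRow l → Marked n s →
    (Row l (tot s n) (ext (⟦ extend ⟧ s) n) × (∀ q → q < tot s n → ext (⟦ extend ⟧ s) n q ≡ ext s n q) ×
     OtherRows n s (⟦ extend ⟧ s)) × time (⟦ extend ⟧ s) ≤ time s + extendTime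
  extend-correct l n s F@(R≡ , _ , z≡ , _ , n≡ , _) O T M = for-rule-timed X
    (λ s′ → (Row l t (ext s′ n) × (∀ q → q < t → ext s′ n q ≡ ext s n q) × OtherRows n s s′) ×
            time s′ ≤ time s + extendTime)
    pV RV pick (suc r) (steps pick) (⟦ getᶜ nat tV TOT nV zV ⨾ copyᶜ nat kkV tV ⟧ s) R≡
    (F , O , (λ _ → refl) , subst (λ k → Partial l t 0 k (ext s n)) (sym k₀≡) P₀ , (λ _ _ → refl) , λ _ _ _ → refl)
    (λ p s′ p<r p≡ x → round p (tick 1 s′) p<r p≡ x , time-loopFree pick refl (tick 1 s′))
    λ s′ (_ , _ , _ , P , keep , others) time≤ → (partial⇒row T P , keep , others) ,
      ≤-trans time≤ (ℕ.≤-reflexive (rearrange₂₈ (time s) (suc r * (4 + steps pick))))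
    where
    open Marked M
    t : ℕ
    t = tot s n
    k₀≡ : nats s (arr TOT (nats s (var nV)) (nats s (var zV))) ≡ t
    k₀≡ = cong₂ (λ i j → nats s (arr TOT i j)) n≡ z≡
    P₀ : Partial l t 0 t (ext s n)
    P₀ = record
      { t≤k = ≤-refl ; bounded = bounded ; injective = injective
      ; sorted = λ q t≤q q<t → contradiction t≤q (ℕ.<⇒≱ q<t) ; taken = λ p ()
      ; source = λ q t≤q q<t → contradiction t≤q (ℕ.<⇒≱ q<t) }
    X : ℕ → State → Set ℓ₂
    X p s′ = Fixed (at-node l n) s′ × Ordered s′ × (∀ e → mrk s′ n e ≡ mrk s n e) ×
      Partial l t p (nats s′ (var kkV)) (ext s′ n) × (∀ q → q < t → ext s′ n q ≡ ext s n q) ×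
      OtherRows n s s′
    round : ∀ p s′ → p < suc r → nats s′ (var pV) ≡ p → X p s′ → X (suc p) (⟦ pick ⟧ s′)
    round p s′ p<r p≡ (F′@(_ , one≡ , z≡ , l≡ , n≡ , _) , O′ , m≡ , P , keep , others) =
      if-nat (X (suc p)) fV zV (putᶜ nat EXT nV kkV eV ⨾ addᶜ nat kkV kkV oneV) skip
        (⟦ getᶜ nat eV ORD lV pV ⨾ getᶜ nat fV MARK nV eV ⟧ s′)
        (λ f≤0 → F′ , O′ , m≡ ,
          subst (λ k → Partial l t (suc p) k f′) (trans (sym (ℕ.+-comm k 1)) (cong (k +_) (sym one≡)))
            (partial-append f′ T p<r P (new (ℕ.n≤0⇒n≡0 (subst₂ _≤_ f≡ z≡ f≤0)))
              (λ q q≢k → entry-column n (nats s′ (var nV)) q≢k) (trans (entry-hit {j′ = k} (sym n≡) refl) e≡)) ,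
          (λ q q<t → trans (entry-column n (nats s′ (var nV)) (ℕ.<⇒≢ (ℕ.<-≤-trans q<t (Partial.t≤k P)))) (keep q q<t)) ,
          λ m m≢n q → trans (entry-row q k (λ e → m≢n (trans e n≡))) (others m m≢n q))
        λ f>0 → F′ , O′ , m≡ ,
          partial-skip P (old (Marked.unmarked M (ord l p)) (subst₂ _<_ z≡ f≡ f>0)) , keep , others
      where
      k : ℕ
      k = nats s′ (var kkV)
      e≡ : nats s′ (arr ORD (nats s′ (var lV)) (nats s′ (var pV))) ≡ ord l p
      e≡ = trans (cong₂ (λ c k → nats s′ (arr ORD c k)) l≡ p≡) (O′ l p)
      f≡ : nats s′ (arr MARK (nats s′ (var nV)) (nats s′ (arr ORD (nats s′ (var lV)) (nats s′ (var pV))))) ≡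
           mrk s n (ord l p)
      f≡ = trans (cong₂ (λ i e → nats s′ (arr MARK i e)) n≡ e≡) (m≡ (ord l p))
      f′ : ℕ → ℕ
      f′ q = if (n ≡ᵇ nats s′ (var nV)) ∧ (q ≡ᵇ k)
        then nats s′ (arr ORD (nats s′ (var lV)) (nats s′ (var pV))) else ext s′ n q
      new : mrk s n (ord l p) ≡ 0 → ∀ q → q < t → ext s′ n q ≢ ord l p
      new z q q<t e with () ← trans (sym (marked q q<t)) (trans (cong (mrk s n) (trans (sym (keep q q<t)) e)) z)
      old : mrk s n (ord l p) ≡ 0 ⊎ ∃[ q ] (q < t × ext s n q ≡ ord l p) → 0 < mrk s n (ord l p) →
            ∃[ q ] (q < t × ext s′ n q ≡ ord l p)
      old (inj₁ z) pos = contradiction (sym z) (ℕ.<⇒≢ pos)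
      old (inj₂ (q , q<t , e)) _ = q , q<t , trans (keep q q<t) e

  -- Creating the children of a node

  -- Only the deletions at the beginning of the `EXT` row are compared, because prolonging a row
  -- writes behind them.
  record SameRow (m : ℕ) (σ σ′ : State) : Set a where
    field
      same-tot : tot σ′ m ≡ tot σ m
      same-par : par σ′ m ≡ par σ m
      same-val : val σ′ m ≡ val σ m
      same-mrk : ∀ e → mrk σ′ m e ≡ mrk σ m e
      same-ext : ∀ q → q < tot σ m → ext σ′ m q ≡ ext σ m q

  open SameRow

  same-refl : ∀ {m σ} → SameRow m σ σ
  same-refl = record { same-tot = refl ; same-par = refl ; same-val = refl
                     ; same-mrk = λ _ → refl ; same-ext = λ _ _ → refl }

  same-trans : ∀ {m σ σ′ σ″} → SameRow m σ σ′ → SameRow m σ′ σ″ → SameRow m σ σ″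
  same-trans S S′ = record
    { same-tot = trans (same-tot S′) (same-tot S)
    ; same-par = trans (same-par S′) (same-par S)
    ; same-val = trans (same-val S′) (same-val S)
    ; same-mrk = λ e → trans (same-mrk S′ e) (same-mrk S e)
    ; same-ext = λ q q< → trans (same-ext S′ q (subst (q <_) (sym (same-tot S)) q<)) (same-ext S q q<) }

  Fresh : ℕ → State → Set
  Fresh m σ = ∀ m′ → m ≤ m′ → ∀ e → mrk σ m′ e ≡ 0

  record Kid (n l : ℕ) (f : ℕ → ℕ) (m s : ℕ) (σ : State) : Set a where
    field
      kid-tot      : tot σ m ≡ s
      kid-par      : par σ m ≡ n
      kid-val      : val σ m ≡ v l (f s)
      kid-ext      : ∀ q → q < s → ext σ m q ≡ f q
      kid-marked   : ∀ q → q < s → mrk σ m (f q) ≡ 1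
      kid-unmarked : ∀ e → mrk σ m e ≡ 0 ⊎ ∃[ q ] (q < s × f q ≡ e)

  open Kid

  kid-same : ∀ {n l f m s σ σ′} → SameRow m σ σ′ → Kid n l f m s σ → Kid n l f m s σ′
  kid-same {s = s} S k = record
    { kid-tot      = trans (same-tot S) (kid-tot k)
    ; kid-par      = trans (same-par S) (kid-par k)
    ; kid-val      = trans (same-val S) (kid-val k)
    ; kid-ext      = λ q q<s → trans (same-ext S q (subst (q <_) (sym (kid-tot k)) q<s)) (kid-ext k q q<s)
    ; kid-marked   = λ q q<s → trans (same-mrk S _) (kid-marked k q q<s)
    ; kid-unmarked = λ e → Sum.map₁ (trans (same-mrk S e)) (kid-unmarked k e) }

  birth : (l n m s : ℕ) → List (Var × ℕ)
  birth l n m s = (oneV , 1) ∷ (zV , 0) ∷ (lV , l) ∷ (nV , n) ∷ (nnV , m) ∷ (sV , s) ∷ []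

  record Copied (n m p : ℕ) (σ₀ σ : State) : Set where
    field
      row      : ∀ q → q < p → ext σ m q ≡ ext σ₀ n q
      marks    : ∀ q → q < p → mrk σ m (ext σ₀ n q) ≡ 1
      unmarks  : ∀ e → mrk σ m e ≡ 0 ⊎ ∃[ q ] (q < p × ext σ₀ n q ≡ e)
      elsewhere : ∀ m′ → m′ ≢ m → ∀ q → ext σ m′ q ≡ ext σ₀ m′ q × mrk σ m′ q ≡ mrk σ₀ m′ q

  copied-admin : ∀ {n m p σ₀ σ k t} → Copied n m p σ₀ σ → Copied n m p σ₀ (set nat (var pV) k (tick t σ))
  copied-admin C = record { row = row ; marks = marks ; unmarks = unmarks ; elsewhere = elsewhere }
    where open Copied C

  copyAll-correct : ∀ l n m s σ → n ≢ m → Fixed (birth l n m s) σ → (∀ e → mrk σ m e ≡ 0) →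
    Copied n m s σ (⟦ copyAll ⟧ σ) × time (⟦ copyAll ⟧ σ) ≤ time σ + copyTime s
  copyAll-correct l n m s σ n≢m F@(_ , _ , _ , _ , _ , s≡ , _) Z = for-rule-timed
    (λ p σ′ → Fixed (birth l n m s) σ′ × Copied n m p σ σ′)
    (λ σ′ → Copied n m s σ σ′ × time σ′ ≤ time σ + copyTime s)
    pV sV copyOne s (steps copyOne) σ s≡
    (F , record { row = λ q () ; marks = λ q () ; unmarks = λ e → inj₁ (Z e) ; elsewhere = λ _ _ _ → refl , refl })
    (λ p σ′ p<s p≡ (F′ , C) → (F′ , copied-admin (round p (tick 1 σ′) p≡ F′ (copied-tick C))) ,
      time-loopFree copyOne refl (tick 1 σ′))
    λ σ′ (_ , C) t → copied-tick C , t
    where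
    copied-tick : ∀ {p σ′} → Copied n m p σ σ′ → Copied n m p σ (tick 1 σ′)
    copied-tick C = record { row = row ; marks = marks ; unmarks = unmarks ; elsewhere = elsewhere }
      where open Copied C
    round : ∀ p σ′ → nats σ′ (var pV) ≡ p → Fixed (birth l n m s) σ′ → Copied n m p σ σ′ →
            Copied n m (suc p) σ (⟦ copyOne ⟧ σ′)
    round p σ′ p≡ (one≡ , _ , _ , n≡ , m≡ , _) C = record
      { row     = below-suc _ (λ q q<p → trans (ext-miss m q (λ _ → ℕ.<⇒≢ q<p)) (row q q<p))
                              (trans (entry-hit (sym m≡) (sym p≡)) e≡)
      ; marks   = below-suc _ (λ q q<p → mark-keep _ (marks q q<p)) (trans (entry-hit (sym m≡) (sym e≡)) one≡)
      ; unmarks = un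
      ; elsewhere = λ m′ m′≢m q →
          trans (entry-row q (nats σ′ (var pV)) (λ e → m′≢m (trans e m≡))) (proj₁ (elsewhere m′ m′≢m q)) ,
          trans (entry-row q e₀ (λ e → m′≢m (trans e m≡))) (proj₂ (elsewhere m′ m′≢m q)) }
      where
      open Copied C
      e₀ : ℕ
      e₀ = nats σ′ (arr EXT (nats σ′ (var nV)) (nats σ′ (var pV)))
      e≡ : e₀ ≡ ext σ n p
      e≡ = trans (cong₂ (λ i q → nats σ′ (arr EXT i q)) n≡ p≡) (proj₁ (elsewhere n n≢m p))
      ext-miss : ∀ m′ q → (m′ ≡ m → q ≢ p) → ext (⟦ copyOne ⟧ σ′) m′ q ≡ ext σ′ m′ q
      ext-miss m′ q h with m′ ℕ.≟ m
      ... | yes refl = entry-column m′ (nats σ′ (var nnV)) (λ e → h refl (trans e p≡))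
      ... | no m′≢m  = entry-row q (nats σ′ (var pV)) (λ e → m′≢m (trans e m≡))
      mark-keep : ∀ e → mrk σ′ m e ≡ 1 → mrk (⟦ copyOne ⟧ σ′) m e ≡ 1
      mark-keep e z with e ℕ.≟ e₀
      ... | yes e≡e₀ = trans (entry-hit (sym m≡) e≡e₀) one≡
      ... | no e≢e₀  = trans (entry-column m (nats σ′ (var nnV)) e≢e₀) z
      un : ∀ e → mrk (⟦ copyOne ⟧ σ′) m e ≡ 0 ⊎ ∃[ q ] (q < suc p × ext σ n q ≡ e)
      un e with e ℕ.≟ e₀
      ... | yes e≡e₀ = inj₂ (p , ≤-refl , trans (sym e≡) (sym e≡e₀))
      ... | no e≢e₀  = Sum.map (trans (entry-column m (nats σ′ (var nnV)) e≢e₀))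
                               (λ (q , q<p , e′) → q , ℕ.m<n⇒m<1+n q<p , e′) (unmarks e)

  child-correct : ∀ l n m s σ → n ≢ m → s ≤ r → Fixed (birth l n m s) σ → Stored σ → (∀ e → mrk σ m e ≡ 0) →
    (Kid n l (ext σ n) m s (⟦ child ⟧ σ) × (∀ m′ → m′ ≢ m → SameRow m′ σ (⟦ child ⟧ σ)) ×
     (∀ q → ext (⟦ child ⟧ σ) n q ≡ ext σ n q) ×
     nats (⟦ child ⟧ σ) (var nnV) ≡ suc m × nats (⟦ child ⟧ σ) (var newV) ≡ suc (nats σ (var newV))) ×
    time (⟦ child ⟧ σ) ≤ time σ + childTime
  child-correct l n m s σ n≢m s≤r F V≡ Z = finish (⟦ copyAll ⟧ σ)
    (fixed-frame (birth l n m s) copyAll refl σ F)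
    (λ c j → trans (frame copyAll ring (arr V c j) refl σ) (V≡ c j))
    (λ m′ → frame copyAll nat (arr TOT m′ 0) refl σ) (λ m′ → frame copyAll nat (arr PAR m′ 0) refl σ)
    (λ m′ → frame copyAll ring (arr VAL m′ 0) refl σ) (frame copyAll nat (var newV) refl σ)
    (copyAll-correct l n m s σ n≢m F Z)
    where
    finish : ∀ σ₁ → Fixed (birth l n m s) σ₁ → Stored σ₁ → (∀ m′ → tot σ₁ m′ ≡ tot σ m′) →
      (∀ m′ → par σ₁ m′ ≡ par σ m′) → (∀ m′ → val σ₁ m′ ≡ val σ m′) →
      nats σ₁ (var newV) ≡ nats σ (var newV) → Copied n m s σ σ₁ × time σ₁ ≤ time σ + copyTime s →
      (Kid n l (ext σ n) m s (⟦ tail ⟧ σ₁) × (∀ m′ → m′ ≢ m → SameRow m′ σ (⟦ tail ⟧ σ₁)) ×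
       (∀ q → ext (⟦ tail ⟧ σ₁) n q ≡ ext σ n q) ×
       nats (⟦ tail ⟧ σ₁) (var nnV) ≡ suc m × nats (⟦ tail ⟧ σ₁) (var newV) ≡ suc (nats σ (var newV))) ×
      time (⟦ tail ⟧ σ₁) ≤ time σ + childTime
    finish σ₁ (one≡ , z≡ , l≡ , n≡ , m≡ , s≡ , _) V₁ tot≡ par≡ val≡ new≡ (C , t) =
      ( record
          { kid-tot = trans (entry-hit (sym m≡) (sym z≡)) s≡
          ; kid-par = trans (entry-hit (sym m≡) (sym z≡)) n≡
          ; kid-val = trans (entry-hit (sym m≡) (sym z≡)) (trans (cong₂ (λ c j → rings σ₁ (arr V c j)) l≡ e≡) (V₁ l (ext σ n s)))
          ; kid-ext = row ; kid-marked = marks ; kid-unmarked = unmarks }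
      , (λ m′ m′≢m → record
          { same-tot = trans (entry-row 0 (nats σ₁ (var zV)) (λ e → m′≢m (trans e m≡))) (tot≡ m′)
          ; same-par = trans (entry-row 0 (nats σ₁ (var zV)) (λ e → m′≢m (trans e m≡))) (par≡ m′)
          ; same-val = trans (entry-row 0 (nats σ₁ (var zV)) (λ e → m′≢m (trans e m≡))) (val≡ m′)
          ; same-mrk = λ e → proj₂ (elsewhere m′ m′≢m e)
          ; same-ext = λ q _ → proj₁ (elsewhere m′ m′≢m q) })
      , (λ q → proj₁ (elsewhere n n≢m q))
      , trans (cong₂ _+_ m≡ one≡) (ℕ.+-comm m 1)
      , trans (cong₂ _+_ new≡ one≡) (ℕ.+-comm _ 1) ) ,
      ≤-trans (time-loopFree tail refl σ₁) (≤-trans (ℕ.+-monoˡ-≤ (steps tail) (≤-trans t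
        (ℕ.+-monoʳ-≤ (time σ) (ℕ.+-monoˡ-≤ 2 (ℕ.*-monoˡ-≤ (4 + steps copyOne) s≤r)))))
        (ℕ.≤-reflexive (ℕ.+-assoc (time σ) (copyTime r) (steps tail))))
      where
      open Copied C
      e≡ : nats σ₁ (arr EXT (nats σ₁ (var nV)) (nats σ₁ (var sV))) ≡ ext σ n s
      e≡ = trans (cong₂ (λ i q → nats σ₁ (arr EXT i q)) n≡ s≡) (proj₁ (elsewhere n n≢m s))

  -- Variables at a node n of level l, below the last one.
  inner : (l n t : ℕ) → List (Var × ℕ)
  inner l n t = (RV , suc r) ∷ (oneV , 1) ∷ (zV , 0) ∷ (lV , l) ∷ (nV , n) ∷ (DV , D) ∷ (topV , suc l) ∷
                (tV , t) ∷ []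

  offspringTime : ℕ → ℕ
  offspringTime b = suc r * 7 + (b * childTime + 2)

  ∸-step : ∀ {t j} → t ≤ j → suc j ∸ t ≡ suc (j ∸ t)
  ∸-step {t} {j} t≤j = ℕ.+-∸-assoc 1 t≤j

  ∸-none : ∀ {t j} → j < t → suc j ∸ t ≡ j ∸ t
  ∸-none {t} {j} j<t = trans (ℕ.m≤n⇒m∸n≡0 j<t) (sym (ℕ.m≤n⇒m∸n≡0 (ℕ.<⇒≤ j<t)))

  -- The child with `s` deletions gets number `m₀ + (s ∸ t)`. Truncated subtraction also covers the
  -- idle rounds `j < t`, in which no child has been created.
  record Born (n l t m₀ : ℕ) (σ₀ : State) (j : ℕ) (σ : State) : Set a where
    field
      kids    : ∀ s → t ≤ s → s < j → Kid n l (ext σ₀ n) (m₀ + (s ∸ t)) s σ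
      old     : ∀ m → m < m₀ → SameRow m σ₀ σ
      row-n   : ∀ q → ext σ n q ≡ ext σ₀ n q
      next    : nats σ (var nnV) ≡ m₀ + (j ∸ t)
      new     : nats σ (var newV) ≡ nats σ₀ (var newV) + (j ∸ t)
      fresh   : Fresh (m₀ + (j ∸ t)) σ
      best    : ∀ i k → nats σ (arr BEST i k) ≡ nats σ₀ (arr BEST i k)

  born-same : ∀ {n l t m₀ σ₀ j σ} j′ → j′ ∸ t ≡ j ∸ t → (∀ s → t ≤ s → s < j′ → s < j) →
              Born n l t m₀ σ₀ j σ → Born n l t m₀ σ₀ j′ σ
  born-same {m₀ = m₀} {σ₀} {σ = σ} j′ e h B = record
    { kids = λ s t≤s s<j′ → kids s t≤s (h s t≤s s<j′) ; old = old ; row-n = row-n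
    ; next = trans next (cong (m₀ +_) (sym e)) ; new = trans new (cong (nats σ₀ (var newV) +_) (sym e))
    ; fresh = subst (λ i → Fresh (m₀ + i) σ) (sym e) fresh ; best = best }
    where open Born B

  born-admin : ∀ {n l t m₀ σ₀ j σ} k u → Born n l t m₀ σ₀ j σ → Born n l t m₀ σ₀ j (set nat (var sV) k (tick u σ))
  born-admin k u B = record
    { kids = λ s t≤s s<j → kid-same admin (kids s t≤s s<j) ; old = λ m m<m₀ → same-trans (old m m<m₀) admin
    ; row-n = row-n ; next = next ; new = new ; fresh = fresh ; best = best }
    where
    open Born B
    admin : ∀ {m σ} → SameRow m σ (set nat (var sV) k (tick u σ))
    admin = record { same-tot = refl ; same-par = refl ; same-val = refl
                   ; same-mrk = λ _ → refl ; same-ext = λ _ _ → refl }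

  born-tick : ∀ {n l t m₀ σ₀ j σ} u → Born n l t m₀ σ₀ j σ → Born n l t m₀ σ₀ j (tick u σ)
  born-tick u B = record
    { kids = λ s t≤s s<j → kid-same admin (kids s t≤s s<j) ; old = λ m m<m₀ → same-trans (old m m<m₀) admin
    ; row-n = row-n ; next = next ; new = new ; fresh = fresh ; best = best }
    where
    open Born B
    admin : ∀ {m σ} → SameRow m σ (tick u σ)
    admin = record { same-tot = refl ; same-par = refl ; same-val = refl
                   ; same-mrk = λ _ → refl ; same-ext = λ _ _ → refl }

  born-child : ∀ {n l t m₀ σ₀ j σ} σ′ → n < m₀ → t ≤ j → Born n l t m₀ σ₀ j σ →
    let m = m₀ + (j ∸ t) in
    Kid n l (ext σ n) m j σ′ → (∀ m′ → m′ ≢ m → SameRow m′ σ σ′) → (∀ q → ext σ′ n q ≡ ext σ n q) →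
    nats σ′ (var nnV) ≡ suc m → nats σ′ (var newV) ≡ suc (nats σ (var newV)) →
    (∀ i k → nats σ′ (arr BEST i k) ≡ nats σ (arr BEST i k)) →
    Born n l t m₀ σ₀ (suc j) σ′
  born-child {n} {l} {t} {m₀} {σ₀} {j} {σ} σ′ n<m₀ t≤j B k same ext≡ next′ new′ best′ = record
    { kids  = λ s t≤s s< → all s s< t≤s
    ; old   = λ m m<m₀ → same-trans (old m m<m₀) (same m (ℕ.<⇒≢ (ℕ.<-≤-trans m<m₀ (ℕ.m≤m+n m₀ (j ∸ t)))))
    ; row-n = λ q → trans (ext≡ q) (row-n q)
    ; next  = trans next′ (sym bump)
    ; new   = trans new′ (trans (cong suc new) (sym (trans (cong (nats σ₀ (var newV) +_) (∸-step t≤j)) (ℕ.+-suc _ _))))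
    ; fresh = λ m′ m≤m′ e → trans (same-mrk (same m′ (ℕ.>⇒≢ (subst (_≤ m′) bump m≤m′))) e)
        (fresh m′ (ℕ.<⇒≤ (subst (_≤ m′) bump m≤m′)) e)
    ; best  = λ i k → trans (best′ i k) (best i k) }
    where
    open Born B
    bump : m₀ + (suc j ∸ t) ≡ suc (m₀ + (j ∸ t))
    bump = trans (cong (m₀ +_) (∸-step t≤j)) (ℕ.+-suc m₀ (j ∸ t))
    row-cong : ∀ {m s} → s ≤ j → Kid n l (ext σ n) m s σ′ → Kid n l (ext σ₀ n) m s σ′
    row-cong s≤j k = record
      { kid-tot = kid-tot k ; kid-par = kid-par k ; kid-val = trans (kid-val k) (cong (v l) (row-n _))
      ; kid-ext = λ q q<s → trans (kid-ext k q q<s) (row-n q)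
      ; kid-marked = λ q q<s → subst (λ e → mrk σ′ _ e ≡ 1) (row-n q) (kid-marked k q q<s)
      ; kid-unmarked = λ e → Sum.map₂ (λ (q , q<s , e′) → q , q<s , trans (sym (row-n q)) e′) (kid-unmarked k e) }
    all : ∀ s → s < suc j → t ≤ s → Kid n l (ext σ₀ n) (m₀ + (s ∸ t)) s σ′
    all = below-suc (λ s → t ≤ s → Kid n l (ext σ₀ n) (m₀ + (s ∸ t)) s σ′)
      (λ s s<j t≤s → kid-same (same (m₀ + (s ∸ t)) (ℕ.<⇒≢ (ℕ.+-monoʳ-< m₀ (ℕ.∸-monoˡ-< s<j t≤s))))
        (kids s t≤s s<j))
      (λ _ → row-cong ≤-refl k)

  offspring-correct : ∀ l n t m₀ σ → suc l < D → n < m₀ → t ≤ r → Fixed (inner l n t) σ → Stored σ →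
    nats σ (var nnV) ≡ m₀ → Fresh m₀ σ →
    Born n l t m₀ σ (suc r) (⟦ offspring ⟧ σ) ×
    time (⟦ offspring ⟧ σ) ≤ time σ + offspringTime (suc r ∸ t)
  offspring-correct l n t m₀ σ l<D n<m₀ t≤r F@(R≡ , _) V≡ next₀ fresh₀ = for-rule
    (λ j σ′ → Fixed (inner l n t) σ′ × Stored σ′ × Born n l t m₀ σ j σ′ ×
              time σ′ ≤ time σ + (j * 7 + ((j ∸ t) * childTime + 1)))
    (λ σ′ → Born n l t m₀ σ (suc r) σ′ × time σ′ ≤ time σ + offspringTime (suc r ∸ t))
    sV RV kid (suc r) σ R≡
    (F , V≡ , born₀ , ≤-trans (ℕ.≤-reflexive (cong (λ i → time σ + i) refl)) (ℕ.+-monoʳ-≤ (time σ) (ℕ.m≤n+m 1 ((0 ∸ t) * childTime))))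
    (λ j σ′ j<r s≡ (F′ , V′ , B , τ) → round j (tick 1 σ′) j<r s≡ F′ V′ (born-tick 1 B) (ℕ.+-monoˡ-≤ 1 τ))
    (λ σ′ (_ , _ , B , τ) → born-tick 1 B , ≤-trans (ℕ.+-monoˡ-≤ 1 τ)
      (ℕ.≤-reflexive (rearrange₁₇ (time σ) (suc r * 7) ((suc r ∸ t) * childTime))))
    where
    born₀ : Born n l t m₀ σ 0 (set nat (var sV) 0 (tick 1 σ))
    born₀ = born-admin 0 1 (record
      { kids = λ s _ () ; old = λ _ _ → same-refl ; row-n = λ _ → refl
      ; next = trans next₀ zero-gap ; new = trans (sym (ℕ.+-identityʳ _)) (cong (nats σ (var newV) +_) (sym (ℕ.0∸n≡0 t)))
      ; fresh = λ m m₀≤m → fresh₀ m (subst (_≤ m) (sym zero-gap) m₀≤m)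
      ; best = λ _ _ → refl })
      where
      zero-gap : m₀ ≡ m₀ + (0 ∸ t)
      zero-gap = trans (sym (ℕ.+-identityʳ m₀)) (cong (m₀ +_) (sym (ℕ.0∸n≡0 t)))
    Next : ℕ → State → Set a
    Next j σ′ = Fixed (inner l n t) σ′ × Stored σ′ × Born n l t m₀ σ (suc j) (set nat (var sV) (suc j) (tick 3 σ′)) ×
      time σ′ + 3 ≤ time σ + (suc j * 7 + ((suc j ∸ t) * childTime + 1))
    round : ∀ j σ′ → j < suc r → nats σ′ (var sV) ≡ j → Fixed (inner l n t) σ′ → Stored σ′ →
      Born n l t m₀ σ j σ′ → time σ′ ≤ time σ + (j * 7 + ((j ∸ t) * childTime + 1)) + 1 →
      Next j (⟦ kid ⟧ σ′)
    round j σ′ j<r s≡ F′@(_ , one≡ , z≡ , l≡ , n≡ , D≡ , top≡ , t≡ , _) V′ B τ =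
      if-nat (Next j) tV sV branch skip σ′
        (λ t≤s → let t≤j = subst₂ _≤_ t≡ s≡ t≤s in
          if-nat (Next j) DV topV leaf child (tick 1 σ′)
            (λ D≤top → contradiction l<D (ℕ.≤⇒≯ (subst₂ _≤_ D≡ top≡ D≤top)))
            λ _ → grown t≤j (child-correct l n (m₀ + (j ∸ t)) j (tick 1 (tick 1 σ′))
              (ℕ.<⇒≢ (ℕ.<-≤-trans n<m₀ (ℕ.m≤m+n m₀ (j ∸ t)))) (ℕ.≤-pred j<r)
              (one≡ , z≡ , l≡ , n≡ , Born.next B , s≡ , tt) V′ (Born.fresh B _ ≤-refl)))
        λ s<t → let j<t = subst₂ _<_ s≡ t≡ s<t in
          F′ , V′ ,
          born-admin (suc j) 3 (born-tick 1 (born-tick 1 (born-same (suc j) (∸-none j<t)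
            (λ s t≤s s≤j → contradiction (≤-trans j<t t≤s) (ℕ.<⇒≱ s≤j)) B))) ,
          ≤-trans (ℕ.+-monoˡ-≤ 3 (ℕ.+-monoˡ-≤ 1 (ℕ.+-monoˡ-≤ 1 τ)))
            (≤-trans (ℕ.m≤m+n _ 1) (ℕ.≤-reflexive (trans (rearrange₁ (time σ) j ((j ∸ t) * childTime))
              (cong (λ i → time σ + (suc j * 7 + (i * childTime + 1))) (sym (∸-none j<t))))))
      where
      

      grown : t ≤ j →
        (Kid n l (ext σ′ n) (m₀ + (j ∸ t)) j (⟦ child ⟧ (tick 1 (tick 1 σ′))) ×
         (∀ m′ → m′ ≢ m₀ + (j ∸ t) → SameRow m′ (tick 1 (tick 1 σ′)) (⟦ child ⟧ (tick 1 (tick 1 σ′)))) ×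
         (∀ q → ext (⟦ child ⟧ (tick 1 (tick 1 σ′))) n q ≡ ext σ′ n q) ×
         nats (⟦ child ⟧ (tick 1 (tick 1 σ′))) (var nnV) ≡ suc (m₀ + (j ∸ t)) ×
         nats (⟦ child ⟧ (tick 1 (tick 1 σ′))) (var newV) ≡ suc (nats σ′ (var newV))) ×
        time (⟦ child ⟧ (tick 1 (tick 1 σ′))) ≤ time (tick 1 (tick 1 σ′)) + childTime →
        Next j (tick 1 (⟦ child ⟧ (tick 1 (tick 1 σ′))))
      grown t≤j ((k , same , ext≡ , next′ , new′) , τ′) =
        fixed-frame (inner l n t) child refl (tick 1 (tick 1 σ′)) F′ ,
        (λ c i → trans (frame child ring (arr V c i) refl (tick 1 (tick 1 σ′))) (V′ c i)) ,
        born-admin (suc j) 3 (born-tick 1 (born-child (⟦ child ⟧ (tick 1 (tick 1 σ′))) n<m₀ t≤j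
          (born-tick 1 (born-tick 1 B)) k same ext≡ next′ new′
          (λ i k → frame child nat (arr BEST i k) refl (tick 1 (tick 1 σ′))))) ,
        ≤-trans (ℕ.+-monoˡ-≤ 3 (ℕ.+-monoˡ-≤ 1 τ′))
          (≤-trans (ℕ.+-monoˡ-≤ 3 (ℕ.+-monoˡ-≤ 1 (ℕ.+-monoˡ-≤ childTime (ℕ.+-monoˡ-≤ 1 (ℕ.+-monoˡ-≤ 1 τ)))))
          (≤-trans (ℕ.≤-reflexive (rearrange₁₀ (time σ) j ((j ∸ t) * childTime) childTime))
            (ℕ.≤-reflexive (cong (λ i → time σ + (suc j * 7 + (i * childTime + 1))) (sym (∸-step t≤j))))))

  levelVars : (l lo cnt : ℕ) → List (Var × ℕ)
  levelVars l lo cnt = (RV , suc r) ∷ (oneV , 1) ∷ (zV , 0) ∷ (lV , l) ∷ (DV , D) ∷ (topV , suc l) ∷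
                       (loV , lo) ∷ (cntV , cnt) ∷ []

  record Entered (l n : ℕ) (σ σ′ : State) : Set (a ⊔ˡ ℓ₂) where
    field
      row-n  : Row l (tot σ n) (ext σ′ n)
      agree  : ∀ q → q < tot σ n → ext σ′ n q ≡ ext σ n q
      same   : ∀ m → SameRow m σ σ′
      others : OtherRows n σ σ′
      vars   : Fixed (inner l n (tot σ n)) σ′
      keep   : ∀ τ x → τ ≡ nat → unwritten enter nat (var x) ≡ true → nats σ′ (var x) ≡ nats σ (var x)
      timely : time σ′ ≤ time σ + enterTime

  enter-correct : ∀ l lo cnt i σ → Fixed (levelVars l lo cnt) σ → nats σ (var iV) ≡ i → Ordered σ →
    TopRow l → Marked (lo + i) σ → Entered l (lo + i) σ (⟦ enter ⟧ σ)
  enter-correct l lo cnt i σ F@(R≡ , one≡ , z≡ , l≡ , D≡ , top≡ , lo≡ , _) i≡ O T M =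
    finish (extend-correct l n σ₁ (R≡ , one≡ , z≡ , l≡ , n≡ , tt) O T M₁)
    where
    n : ℕ
    n = lo + i
    σ₁ : State
    σ₁ = ⟦ prepare ⟧ σ
    n≡ : nats σ₁ (var nV) ≡ n
    n≡ = cong₂ _+_ lo≡ i≡
    M₁ : Marked n σ₁
    M₁ = record { t≤r = t≤r ; bounded = bounded ; injective = injective ; marked = marked ; unmarked = unmarked }
      where open Marked M
    tV≡ : nats (⟦ extend ⟧ σ₁) (var tV) ≡ tot σ n
    tV≡ = trans (frame (copyᶜ nat kkV tV ⨾ for pV RV pick) nat (var tV) refl (⟦ getᶜ nat tV TOT nV zV ⟧ σ₁))
      (cong₂ (λ i j → nats σ (arr TOT i j)) n≡ z≡)
    finish : (Row l (tot σ n) (ext (⟦ extend ⟧ σ₁) n) ×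
        (∀ q → q < tot σ n → ext (⟦ extend ⟧ σ₁) n q ≡ ext σ n q) × OtherRows n σ₁ (⟦ extend ⟧ σ₁)) ×
      time (⟦ extend ⟧ σ₁) ≤ time σ₁ + extendTime → Entered l n σ (⟦ enter ⟧ σ)
    finish ((row , agree , others) , τ) = record
      { row-n = row
      ; agree = agree
      ; same  = λ m → record
          { same-tot = frame extend nat (arr TOT m 0) refl σ₁
          ; same-par = frame extend nat (arr PAR m 0) refl σ₁
          ; same-val = frame extend ring (arr VAL m 0) refl σ₁
          ; same-mrk = λ e → frame extend nat (arr MARK m e) refl σ₁
          ; same-ext = same-entries m }
      ; others = others
      ; vars  = trans (frame enter nat (var RV) refl σ) R≡ , trans (frame enter nat (var oneV) refl σ) one≡ ,
                trans (frame enter nat (var zV) refl σ) z≡ , trans (frame enter nat (var lV) refl σ) l≡ ,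
                trans (frame extend nat (var nV) refl σ₁) n≡ , trans (frame enter nat (var DV) refl σ) D≡ ,
                trans (frame enter nat (var topV) refl σ) top≡ , tV≡ , tt
      ; keep  = λ { .nat x refl u → frame enter nat (var x) u σ }
      ; timely = ≤-trans τ (ℕ.≤-reflexive (ℕ.+-assoc (time σ) 1 extendTime)) }
      where
      same-entries : ∀ m q → q < tot σ m → ext (⟦ enter ⟧ σ) m q ≡ ext σ m q
      same-entries m q q< with m ℕ.≟ n
      ... | yes refl = agree q q<
      ... | no m≢n   = others m m≢n q

  -- Bounds along a branch, and the branch that follows a given set

  -- The entries of `x` below `l` are stored in the ancestors of `n`, the last one in `n` itself.
  -- Parents having smaller numbers, a climb stays among the old nodes and is not affected by new
  -- ones.
  Chain : State → ℕ → ℕ → (ℕ → Carrier) → Set a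
  Chain σ zero    n x = Level.Lift a ⊤
  Chain σ (suc l) n x = val σ n ≡ x l × par σ n < n × Chain σ l (par σ n) x

  -- `x` bounds the column maxima over the rows not deleted. Equality can fail, since a later
  -- deletion may remove the row where an earlier bound was attained.
  Covers : ℕ → (ℕ → ℕ) → ℕ → (ℕ → Carrier) → Set ℓ₂
  Covers t f l x = ∀ i → i < l → ∀ j → j < N → (∀ q → q < t → f q ≢ j) → v i j ≼ x i

  record Node (l n : ℕ) (x : ℕ → Carrier) (σ : State) : Set (a ⊔ˡ ℓ₂) where
    field
      deletions : Marked n σ
      chain     : Chain σ l n x
      covers    : Covers (tot σ n) (ext σ n) l x

  SameBelow : ℕ → State → State → Set a
  SameBelow b σ σ′ = ∀ m → m < b → SameRow m σ σ′

  chain-same : ∀ {b σ σ′ x} l n → SameBelow b σ σ′ → n < b → Chain σ l n x → Chain σ′ l n x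
  chain-same zero    n S n<b _           = _
  chain-same {b} {σ} {σ′} {x} (suc l) n S n<b (e , p , c) = trans (same-val (S n n<b)) e ,
    subst (_< n) (sym par≡) p ,
    subst (λ m → Chain σ′ l m x) (sym par≡) (chain-same l (par σ n) S (ℕ.<-trans p n<b) c)
    where
    par≡ : par σ′ n ≡ par σ n
    par≡ = same-par (S n n<b)

  chain-cong : ∀ {σ x x′} l n → (∀ i → i < l → x i ≡ x′ i) → Chain σ l n x → Chain σ l n x′
  chain-cong zero    n h c           = _
  chain-cong (suc l) n h (e , p , c) = trans e (h l ≤-refl) , p ,
    chain-cong l _ (λ i i<l → h i (ℕ.m<n⇒m<1+n i<l)) c

  marked-same : ∀ {n σ σ′} → SameRow n σ σ′ → Marked n σ → Marked n σ′
  marked-same {n} {σ} {σ′} S M = record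
    { t≤r       = subst (_≤ r) (sym (same-tot S)) t≤r
    ; bounded   = λ q q< → subst (_< N) (sym (same-ext S q (low q<))) (bounded q (low q<))
    ; injective = λ p< q< e → injective (low p<) (low q<)
        (trans (sym (same-ext S _ (low p<))) (trans e (same-ext S _ (low q<))))
    ; marked    = λ q q< → trans (cong (mrk σ′ n) (same-ext S q (low q<))) (trans (same-mrk S _) (marked q (low q<)))
    ; unmarked  = λ e → Sum.map (trans (same-mrk S e))
        (λ (q , q< , e′) → q , subst (q <_) (sym (same-tot S)) q< , trans (same-ext S q q<) e′) (unmarked e) }
    where
    open Marked M
    low : ∀ {q} → q < tot σ′ n → q < tot σ n
    low {q} = subst (q <_) (same-tot S)

  covers-same : ∀ {n σ σ′ l x} → SameRow n σ σ′ → Covers (tot σ n) (ext σ n) l x → Covers (tot σ′ n) (ext σ′ n) l x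
  covers-same S C i i<l j j<N h = C i i<l j j<N λ q q< e →
    h q (subst (q <_) (sym (same-tot S)) q<) (trans (same-ext S q q<) e)

  node-same : ∀ {b l n x σ σ′} → SameBelow b σ σ′ → n < b → Node l n x σ → Node l n x σ′
  node-same {l = l} {n} S n<b node = record
    { deletions = marked-same (S n n<b) deletions
    ; chain     = chain-same l n S n<b chain
    ; covers    = covers-same (S n n<b) covers }
    where open Node node

  In : Subset N → ℕ → Set
  In S e = ∃[ y ] (y ∈ S × toℕ y ≡ e)

  Out : Subset N → ℕ → Set
  Out S e = ∃[ y ] (¬ y ∈ S × toℕ y ≡ e)

  -- The node lies on the branch that follows `S`. Each bound being attained outside `S`, it does
  -- not exceed the column maximum that remains after deleting `S`.
  record Path (S : Subset N) (l n : ℕ) (x : ℕ → Carrier) (σ : State) : Set a where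
    field
      inside-S : ∀ q → q < tot σ n → In S (ext σ n q)
      attained : ∀ i → i < l → ∃[ e ] (Out S e × x i ≡ v i e)

  path-same : ∀ {S l n x σ σ′} → SameRow n σ σ′ → Path S l n x σ → Path S l n x σ′
  path-same {S} same P = record
    { inside-S = λ q q< → let q<′ = subst (q <_) (same-tot same) q< in
        subst (In S) (sym (same-ext same q q<′)) (inside-S q q<′)
    ; attained = attained }
    where open Path P

  in-or-out : ∀ S {e} → e < N → In S e ⊎ Out S e
  in-or-out S {e} e<N with Fin.fromℕ< e<N Subset.∈? S
  ... | yes p = inj₁ (_ , p , Fin.toℕ-fromℕ< e<N)
  ... | no ¬p = inj₂ (_ , ¬p , Fin.toℕ-fromℕ< e<N)

  -- The `r + 1` distinct entries of a row cannot all lie in a set of at most `r` elements. The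
  -- number `u` of positions still to be examined drives the recursion.
  first-out : ∀ S {l t f} → Row l t f → ∣ S ∣ ≤ r → ∀ u s → s + u ≡ suc r → (∀ q → q < s → In S (f q)) →
    ∃[ k ] (s ≤ k × k ≤ r × (∀ q → q < k → In S (f q)) × Out S (f k))
  first-out S {f = f} R ∣S∣≤r zero s e h with refl ← trans (sym (ℕ.+-identityʳ s)) e =
    contradiction ∣S∣≤r (ℕ.<⇒≱ (injective⇒≤∣ S ∣ (Row.injective R) (λ q q<s → let y , p , e = h q q<s in y , p , sym e)))
  first-out S {f = f} R ∣S∣≤r (suc u) s e h = go (in-or-out S (Row.bounded R s s≤r))
    where
    s≤r : s ≤ r
    s≤r = ℕ.≤-pred (subst (suc s ≤_) (trans (sym (ℕ.+-suc s u)) e) (s≤s (ℕ.m≤m+n s u)))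
    go : In S (f s) ⊎ Out S (f s) → ∃[ k ] (s ≤ k × k ≤ r × (∀ q → q < k → In S (f q)) × Out S (f k))
    go (inj₂ out) = s , ≤-refl , s≤r , h , out
    go (inj₁ inS) = let k , s<k , rest = first-out S R ∣S∣≤r u (suc s) (trans (sym (ℕ.+-suc s u)) e) (below-suc _ h inS)
      in k , ℕ.<⇒≤ s<k , rest

  _,_↦_ : (ℕ → Carrier) → ℕ → Carrier → ℕ → Carrier
  (x , l ↦ u) i = if i ≡ᵇ l then u else x i

  ↦-hit : ∀ x l {u} → (x , l ↦ u) l ≡ u
  ↦-hit x l = if-true (≡ᵇ-refl l)

  ↦-miss : ∀ x {l u i} → i < l → (x , l ↦ u) i ≡ x i
  ↦-miss x i<l = if-false (≢⇒≡ᵇ-false (ℕ.<⇒≢ i<l))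

  -- In the new column, position `s` holds the greatest entry outside the first `s` of the row. In
  -- the old columns the bounds persist because more rows are deleted.
  covers-extend : ∀ {l t t₀ f f₀ x s} → Row l t₀ f → t₀ ≤ s → s ≤ r → t ≡ t₀ → (∀ q → q < t₀ → f q ≡ f₀ q) →
    Covers t f₀ l x → Covers s f (suc l) (x , l ↦ v l (f s))
  covers-extend {l} {f = f} {x = x} {s} R t≤s s≤r refl agree C i i<sl j j<N h =
    below-suc (λ i → v i j ≼ (x , l ↦ v l (f s)) i)
      (λ i i<l → subst (v i j ≼_) (sym (↦-miss x i<l))
        (C i i<l j j<N λ q q<t e → h q (ℕ.<-≤-trans q<t t≤s) (trans (agree q q<t) e)))
      (subst (v l j ≼_) (sym (↦-hit x l)) (Row.sorted R s t≤s s≤r j j<N h)) i i<sl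

  kid-node : ∀ {b l n x σ σ′ f m s} → n < m → n < b → SameBelow b σ σ′ → Node l n x σ → Row l (tot σ n) f →
    (∀ q → q < tot σ n → f q ≡ ext σ n q) → tot σ n ≤ s → s ≤ r → Kid n l f m s σ′ →
    Node (suc l) m (x , l ↦ v l (f s)) σ′
  kid-node {b} {l} {n} {x} {σ} {σ′} {f} {m} {s} n<m n<b S node R agree t≤s s≤r k = record
    { deletions = record
        { t≤r       = subst (_≤ r) (sym (kid-tot k)) s≤r
        ; bounded   = λ q q< → subst (_< N) (sym (kid-ext k q (low q<))) (Row.bounded R q (ℕ.<⇒≤ (ℕ.<-≤-trans (low q<) s≤r)))
        ; injective = λ p< q< e → Row.injective R (up (low p<)) (up (low q<))
            (trans (sym (kid-ext k _ (low p<))) (trans e (kid-ext k _ (low q<))))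
        ; marked    = λ q q< → trans (cong (mrk σ′ m) (kid-ext k q (low q<))) (kid-marked k q (low q<))
        ; unmarked  = λ e → Sum.map₂ (λ (q , q<s , e′) → q , subst (q <_) (sym (kid-tot k)) q<s ,
            trans (kid-ext k q q<s) e′) (kid-unmarked k e) }
    ; chain  = trans (kid-val k) (sym (↦-hit x l)) , subst (_< m) (sym (kid-par k)) n<m ,
        subst (λ i → Chain σ′ l i (x , l ↦ v l (f s))) (sym (kid-par k))
          (chain-cong l n (λ i i<l → sym (↦-miss x i<l)) (chain-same l n S n<b (Node.chain node)))
    ; covers = λ i i<sl j j<N h → covers-extend R t≤s s≤r refl agree (Node.covers node) i i<sl j j<N
        λ q q<s e → h q (subst (q <_) (sym (kid-tot k)) q<s) (trans (kid-ext k q q<s) e) }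
    where
    low : ∀ {q} → q < tot σ′ m → q < s
    low {q} = subst (q <_) (kid-tot k)
    up : ∀ {q} → q < s → q < suc r
    up q<s = ℕ.<-≤-trans q<s (ℕ.m≤n⇒m≤1+n s≤r)

  kid-path : ∀ {S l n x σ σ′ f m s} → (∀ q → q < s → In S (f q)) → Out S (f s) →
    Path S l n x σ → Kid n l f m s σ′ → Path S (suc l) m (x , l ↦ v l (f s)) σ′
  kid-path {S} {l} {x = x} {f = f} {s = s} ins out P k = record
    { inside-S = λ q q< → let q<s = subst (q <_) (kid-tot k) q< in
        subst (In S) (sym (kid-ext k q q<s)) (ins q q<s)
    ; attained = below-suc _ (λ i i<l → let e , o , eq = Path.attained P i i<l in e , o , trans (↦-miss x i<l) eq)
        (f s , out , ↦-hit x l) }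

  -- One inner level of the tree

  -- The number of descendants `j` levels below: these are the `j`-tuples whose sum stays within the
  -- budget `r ∸ tot` left at the node.
  weightOf : State → ℕ → ℕ → ℕ
  weightOf σ j m = binom (r ∸ tot σ m) j

  -- The nodes lo, …, lo + cnt - 1 are those of level l.
  record Layer (l lo cnt : ℕ) (σ : State) : Set (a ⊔ˡ ℓ₂) where
    field
      nodes    : ∀ n → lo ≤ n → n < lo + cnt → ∃[ x ] Node l n x σ
      complete : ∀ S → ∣ S ∣ ≤ r → ∃[ i ] (i < cnt × ∃[ x ] (Node l (lo + i) x σ × Path S l (lo + i) x σ))
      fresh    : Fresh (lo + cnt) σ
      weight   : ∀ j → total (weightOf σ j) lo cnt ≡ binom r (l + j)

  module InLevel (l lo cnt : ℕ) (l<D : suc l < D) (T : TopRow l) (σ₀ : State) (L₀ : Layer l lo cnt σ₀) where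

    m₁ : ℕ
    m₁ = lo + cnt

    -- After `i` nodes of the level have been processed, `w` children exist. Their weights at depth
    -- `j` add up to those of their parents at depth `suc j`, which carries the count of nodes from
    -- level to level.
    record Progress (i w : ℕ) (σ : State) : Set (a ⊔ˡ ℓ₂) where
      field
        vars     : Fixed (levelVars l lo cnt) σ
        ordered  : Ordered σ
        stored   : Stored σ
        same     : SameBelow m₁ σ₀ σ
        new≡     : nats σ (var newV) ≡ w
        next     : nats σ (var nnV) ≡ m₁ + w
        nodes    : ∀ m → m₁ ≤ m → m < m₁ + w → ∃[ x ] Node (suc l) m x σ
        complete : ∀ S → ∣ S ∣ ≤ r → ∀ i′ → i′ < i → ∀ x → Node l (lo + i′) x σ₀ → Path S l (lo + i′) x σ₀ →
          ∃[ i″ ] (i″ < w × ∃[ x′ ] (Node (suc l) (m₁ + i″) x′ σ × Path S (suc l) (m₁ + i″) x′ σ))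
        fresh    : Fresh (m₁ + w) σ
        weight   : ∀ j → total (weightOf σ j) m₁ w ≡ total (weightOf σ₀ (suc j)) lo i
        best     : ∀ i k → nats σ (arr BEST i k) ≡ nats σ₀ (arr BEST i k)

    admin-same : ∀ x k u {m σ} → SameRow m σ (set nat (var x) k (tick u σ))
    admin-same x k u = record { same-tot = refl ; same-par = refl ; same-val = refl
                              ; same-mrk = λ _ → refl ; same-ext = λ _ _ → refl }

    tick-same : ∀ u {m σ} → SameRow m σ (tick u σ)
    tick-same u = record { same-tot = refl ; same-par = refl ; same-val = refl
                         ; same-mrk = λ _ → refl ; same-ext = λ _ _ → refl }

    progress-admin : ∀ {i w σ} k u → Progress i w σ → Progress i w (set nat (var iV) k (tick u σ))
    progress-admin {σ = σ} k u P = record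
      { vars = vars ; ordered = ordered ; stored = stored ; new≡ = new≡ ; next = next ; fresh = fresh
      ; weight = weight ; best = best
      ; same = λ m m< → same-trans (same m m<) (admin-same iV k u)
      ; nodes = λ m m₁≤m m< → let x , node = nodes m m₁≤m m< in x , node-same (λ _ _ → admin-same iV k u) m< node
      ; complete = λ S ∣S∣ i′ i′< x n p → let i″ , i″< , x′ , n′ , p′ = complete S ∣S∣ i′ i′< x n p in
          i″ , i″< , x′ , node-same (λ _ _ → admin-same iV k u) ≤-refl n′ , path-same (admin-same iV k u) p′ }
      where open Progress P

    progress-tick : ∀ {i w σ} u → Progress i w σ → Progress i w (tick u σ)
    progress-tick u P = record
      { vars = vars ; ordered = ordered ; stored = stored ; new≡ = new≡ ; next = next ; fresh = fresh
      ; weight = weight ; best = best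
      ; same = λ m m< → same-trans (same m m<) (tick-same u)
      ; nodes = λ m m₁≤m m< → let x , node = nodes m m₁≤m m< in x , node-same (λ _ _ → tick-same u) m< node
      ; complete = λ S ∣S∣ i′ i′< x n p → let i″ , i″< , x′ , n′ , p′ = complete S ∣S∣ i′ i′< x n p in
          i″ , i″< , x′ , node-same (λ _ _ → tick-same u) ≤-refl n′ , path-same (tick-same u) p′ }
      where open Progress P

    module Round (i w : ℕ) (i<cnt : i < cnt) (σ : State) (P : Progress i w σ) where

      open Progress P

      n t M b : ℕ
      n = lo + i
      t = tot σ n
      M = m₁ + w
      b = suc r ∸ t

      n<m₁ : n < m₁
      n<m₁ = ℕ.+-monoʳ-< lo i<cnt

      n<M : n < M
      n<M = ℕ.<-≤-trans n<m₁ (ℕ.m≤m+n m₁ w)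

      here : ∀ {x} → Node l n x σ₀ → Node l n x σ
      here = node-same same n<m₁

      some : ∃[ x ] Node l n x σ
      some = let x , node = Layer.nodes L₀ n (ℕ.m≤m+n lo i) n<m₁ in x , here node

      deletions : Marked n σ
      deletions = Node.deletions (proj₂ some)

      t≤r : t ≤ r
      t≤r = Marked.t≤r deletions

      b≡ : b ≡ suc (r ∸ t)
      b≡ = ∸-step t≤r

      σ₂ σ₃ : State
      σ₂ = ⟦ enter ⟧ σ
      σ₃ = ⟦ offspring ⟧ σ₂

      module Combine (E : Entered l n σ σ₂) (B : Born n l t M σ₂ (suc r) σ₃) where

        module E = Entered E
        module B = Born B

        f : ℕ → ℕ
        f = ext σ₂ n

        same₃ : SameBelow M σ σ₃
        same₃ m m<M = same-trans (E.same m) (B.old m m<M)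

        kid-at : ∀ s → t ≤ s → s ≤ r → Kid n l f (M + (s ∸ t)) s σ₃
        kid-at s t≤s s≤r = B.kids s t≤s (s≤s s≤r)

        kid-at-node : ∀ {x} s → t ≤ s → s ≤ r → Node l n x σ →
                      Node (suc l) (M + (s ∸ t)) (x , l ↦ v l (f s)) σ₃
        kid-at-node s t≤s s≤r node = kid-node (ℕ.<-≤-trans n<M (ℕ.m≤m+n M (s ∸ t))) n<M same₃ node
          E.row-n E.agree t≤s s≤r (kid-at s t≤s s≤r)

        nodes₃ : ∀ m → m₁ ≤ m → m < m₁ + (w + b) → ∃[ x ] Node (suc l) m x σ₃
        nodes₃ m m₁≤m m< with m ℕ.<? M
        ... | yes m<M = let x , node = nodes m m₁≤m m<M in x , node-same same₃ m<M node
        ... | no m≮M = subst (λ m → ∃[ x ] Node (suc l) m x σ₃) m≡ (_ , kid-at-node (t + j) (ℕ.m≤m+n t j) s≤r (proj₂ some))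
          where
          j : ℕ
          j = m ∸ M
          M+j≡m : M + j ≡ m
          M+j≡m = ℕ.m+[n∸m]≡n (ℕ.≮⇒≥ m≮M)
          m≡ : M + ((t + j) ∸ t) ≡ m
          m≡ = trans (cong (M +_) (ℕ.m+n∸m≡n t j)) M+j≡m
          j<b : j < b
          j<b = ℕ.+-cancelˡ-< M j b (subst₂ _<_ (sym M+j≡m) (sym (ℕ.+-assoc m₁ w b)) m<)
          s≤r : t + j ≤ r
          s≤r = ≤-trans (ℕ.+-monoʳ-≤ t (ℕ.≤-pred (subst (j <_) b≡ j<b))) (ℕ.≤-reflexive (ℕ.m+[n∸m]≡n t≤r))

        -- A branch that follows `S` through node `i` continues with the child of the first row
        -- entry outside `S`. That entry exists by `first-out`; it comes at or after position `t`
        -- because the deletions of the node lie in `S`.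
        complete₃ : ∀ S → ∣ S ∣ ≤ r → ∀ i′ → i′ < suc i → ∀ x → Node l (lo + i′) x σ₀ → Path S l (lo + i′) x σ₀ →
          ∃[ i″ ] (i″ < w + b × ∃[ x′ ] (Node (suc l) (m₁ + i″) x′ σ₃ × Path S (suc l) (m₁ + i″) x′ σ₃))
        complete₃ S ∣S∣ = below-suc _ earlier now
          where
          Goal : ℕ → Set _
          Goal i′ = ∀ x → Node l (lo + i′) x σ₀ → Path S l (lo + i′) x σ₀ →
            ∃[ i″ ] (i″ < w + b × ∃[ x′ ] (Node (suc l) (m₁ + i″) x′ σ₃ × Path S (suc l) (m₁ + i″) x′ σ₃))
          earlier : ∀ i′ → i′ < i → Goal i′
          earlier i′ i′<i x node path = let i″ , i″<w , x′ , node′ , path′ = complete S ∣S∣ i′ i′<i x node path in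
            i″ , ℕ.<-≤-trans i″<w (ℕ.m≤m+n w b) , x′ ,
            node-same same₃ (ℕ.+-monoʳ-< m₁ i″<w) node′ , path-same (same₃ _ (ℕ.+-monoʳ-< m₁ i″<w)) path′
          now : Goal i
          now x node path = go (first-out S E.row-n ∣S∣ (suc r ∸ t) t (ℕ.m+[n∸m]≡n (ℕ.m≤n⇒m≤1+n t≤r))
              (λ q q<t → subst (In S) (sym (E.agree q q<t)) (Path.inside-S path₂ q q<t)))
            where
            path₂ : Path S l n x σ
            path₂ = path-same (same n n<m₁) path
            go : ∃[ k ] (t ≤ k × k ≤ r × (∀ q → q < k → In S (f q)) × Out S (f k)) →
              ∃[ i″ ] (i″ < w + b × ∃[ x′ ] (Node (suc l) (m₁ + i″) x′ σ₃ × Path S (suc l) (m₁ + i″) x′ σ₃))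
            go (k , t≤k , k≤r , ins , out) = w + (k ∸ t) ,
              ℕ.+-monoʳ-< w (ℕ.∸-monoˡ-< (s≤s k≤r) t≤k) , (x , l ↦ v l (f k)) ,
              subst (λ m → Node (suc l) m (x , l ↦ v l (f k)) σ₃) (ℕ.+-assoc m₁ w (k ∸ t))
                (kid-at-node k t≤k k≤r (here node)) ,
              subst (λ m → Path S (suc l) m (x , l ↦ v l (f k)) σ₃) (ℕ.+-assoc m₁ w (k ∸ t))
                (kid-path ins out path₂ (kid-at k t≤k k≤r))

        weight₃ : ∀ j → total (weightOf σ₃ j) m₁ (w + b) ≡ total (weightOf σ₀ (suc j)) lo (suc i)
        weight₃ j = trans (total-++ (weightOf σ₃ j) m₁ w b)
          (trans (cong₂ _+_ (trans (total-cong (weightOf σ₃ j) (weightOf σ j) m₁ w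
                     λ m _ m<M → cong (λ t → binom (r ∸ t) j) (same-tot (same₃ m m<M))) (weight j)) last)
          (sym (trans (cong (total (weightOf σ₀ (suc j)) lo) (sym (ℕ.+-comm i 1)))
            (total-++ (weightOf σ₀ (suc j)) lo i 1))))
          where
          -- The budgets left to the new children run from `r ∸ t` down to 0, as `total-binom`
          -- requires.
          last : total (weightOf σ₃ j) M b ≡ weightOf σ₀ (suc j) (lo + i) + 0
          last = trans (cong (total (weightOf σ₃ j) M) b≡)
            (trans (total-binom (weightOf σ₃ j) M (r ∸ t) j λ i′ i′≤ →
              cong (λ u → binom u j) (trans (cong (r ∸_) (trans (cong (tot σ₃ ∘ (M +_)) (sym (ℕ.m+n∸m≡n t i′)))
                  (kid-tot (kid-at (t + i′) (ℕ.m≤m+n t i′) (≤-trans (ℕ.+-monoʳ-≤ t i′≤) (ℕ.≤-reflexive (ℕ.m+[n∸m]≡n t≤r)))))))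
                (sym (ℕ.∸-+-assoc r t i′))))
            (trans (cong (λ t → binom (r ∸ t) (suc j)) (same-tot (same n n<m₁))) (sym (ℕ.+-identityʳ _))))

        progress : Progress (suc i) (w + b) σ₃
        progress = record
          { vars     = fixed-frame (levelVars l lo cnt) process refl σ vars
          ; ordered  = λ c k → trans (frame process nat (arr ORD c k) refl σ) (ordered c k)
          ; stored   = λ c k → trans (frame process ring (arr V c k) refl σ) (stored c k)
          ; same     = λ m m<m₁ → same-trans (same m m<m₁) (same₃ m (ℕ.<-≤-trans m<m₁ (ℕ.m≤m+n m₁ w)))
          ; new≡     = trans B.new (cong (_+ b) (trans (E.keep nat newV refl refl) new≡))
          ; next     = trans B.next (ℕ.+-assoc m₁ w b)
          ; nodes    = nodes₃
          ; complete = complete₃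
          ; fresh    = subst (λ m → Fresh m σ₃) (ℕ.+-assoc m₁ w b) B.fresh
          ; weight   = weight₃
          ; best     = λ i k → trans (B.best i k) (trans (frame enter nat (arr BEST i k) refl σ) (best i k)) }

      result : nats σ (var iV) ≡ i →
        ∃[ b ] (Progress (suc i) (w + b) (⟦ process ⟧ σ) ×
                time (⟦ process ⟧ σ) ≤ time σ + (enterTime + offspringTime b))
      result i≡ = finish (enter-correct l lo cnt i σ vars i≡ ordered T deletions)
        where
        finish : Entered l n σ σ₂ → ∃[ b ] (Progress (suc i) (w + b) (⟦ process ⟧ σ) ×
                   time (⟦ process ⟧ σ) ≤ time σ + (enterTime + offspringTime b))
        finish E = conclude (offspring-correct l n t M σ₂ l<D n<M t≤r (Entered.vars E)
            (λ c k → trans (frame enter ring (arr V c k) refl σ) (stored c k))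
            (trans (Entered.keep E nat nnV refl refl) next)
            (λ m M≤m e → trans (frame enter nat (arr MARK m e) refl σ) (fresh m M≤m e)))
          where
          conclude : Born n l t M σ₂ (suc r) σ₃ × time σ₃ ≤ time σ₂ + offspringTime b →
            ∃[ b ] (Progress (suc i) (w + b) (⟦ process ⟧ σ) ×
                    time (⟦ process ⟧ σ) ≤ time σ + (enterTime + offspringTime b))
          conclude (B , τ) = b , Combine.progress E B ,
            ≤-trans τ (≤-trans (ℕ.+-monoˡ-≤ (offspringTime b) (Entered.timely E))
              (ℕ.≤-reflexive (ℕ.+-assoc (time σ) enterTime (offspringTime b))))

    Rounds : ℕ → State → Set (a ⊔ˡ ℓ₂)
    Rounds i σ = ∃[ w ] (Progress i w σ × time σ ≤ time σ₀ + (i * nodeTime + (w * childTime + 1)))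

    round : ∀ i σ → i < cnt → nats σ (var iV) ≡ i → Rounds i σ →
            Rounds (suc i) (set nat (var iV) (suc i) (tick 3 (⟦ process ⟧ (tick 1 σ))))
    round i σ i<cnt i≡ (w , P , τ) = finish (Round.result i w i<cnt (tick 1 σ) (progress-tick 1 P) i≡)
      where
      finish : ∃[ b ] (Progress (suc i) (w + b) (⟦ process ⟧ (tick 1 σ)) ×
          time (⟦ process ⟧ (tick 1 σ)) ≤ time σ + 1 + (enterTime + offspringTime b)) →
        Rounds (suc i) (set nat (var iV) (suc i) (tick 3 (⟦ process ⟧ (tick 1 σ))))
      finish (b , P′ , τ′) = w + b , progress-admin (suc i) 3 P′ ,
        ≤-trans (ℕ.+-monoˡ-≤ 3 (≤-trans τ′ (ℕ.+-monoˡ-≤ (enterTime + offspringTime b) (ℕ.+-monoˡ-≤ 1 τ))))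
          (ℕ.≤-reflexive (rearrange₁₁ (time σ₀) i w b childTime enterTime (suc r * 7)))

    nodesLoop-correct : Progress 0 0 σ₀ →
      ∃[ w ] (Progress cnt w (⟦ nodesLoop ⟧ σ₀) ×
              time (⟦ nodesLoop ⟧ σ₀) ≤ time σ₀ + (cnt * nodeTime + (w * childTime + 2)))
    nodesLoop-correct P = for-rule Rounds
      (λ σ → ∃[ w ] (Progress cnt w σ × time σ ≤ time σ₀ + (cnt * nodeTime + (w * childTime + 2))))
      iV cntV process cnt σ₀ (proj₁ (proj₂ (proj₂ (proj₂ (proj₂ (proj₂ (proj₂ (proj₂ (Progress.vars P)))))))))
      (0 , progress-admin 0 1 P , ≤-refl) round
      λ σ (w , P′ , τ) → w , progress-tick 1 P′ , ≤-trans (ℕ.+-monoˡ-≤ 1 τ)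
        (ℕ.≤-reflexive (rearrange₁₇ (time σ₀) (cnt * nodeTime) (w * childTime)))

    finished : ∀ {w σ} → Progress cnt w σ → Layer (suc l) m₁ w σ
    finished {w} {σ} P = record
      { nodes    = nodes
      ; complete = λ S ∣S∣ → let i , i<cnt , x , node , path = Layer.complete L₀ S ∣S∣ in
          complete S ∣S∣ i i<cnt x node path
      ; fresh    = fresh
      ; weight   = λ j → trans (weight j) (trans (Layer.weight L₀ (suc j)) (cong (binom r) (ℕ.+-suc l j))) }
      where open Progress P

  -- Evaluating a leaf

  bit : Bool → ℕ
  bit true  = 1
  bit false = 0

  record Measured (xs : List Carrier) (σ : State) : Set ℓ₁ where
    field
      emptiness : nats σ (var pV) ≡ bit (negative xs)
      extent    : nats σ (var dimV) ≡ 2 + dimension xs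
      substance : rings σ (var prodR) ≈ content xs

  Computed : Code → State → Set ℓ₁
  Computed (n , y) σ = nats σ (var dimV) ≡ n × rings σ (var prodR) ≈ y

  module Evaluation (σ₀ : State) (x : ℕ → Carrier) where

    -- Side `i` is next when the argument is `suc i`: its odd column bound is already in `aR`, its
    -- even one is stored in node `ancV`. When no side is left, the values fetched at or beyond the
    -- root are meaningless and nothing is claimed of them.
    Rest : ℕ → State → Set a
    Rest zero    σ = Level.Lift a ⊤
    Rest (suc i) σ = rings σ (var aR) ≡ x (suc (i * 2)) × Chain σ₀ (suc (i * 2)) (nats σ (var ancV)) x

    Links : State → Set a
    Links σ = (∀ n → val σ n ≡ val σ₀ n) × (∀ n → par σ n ≡ par σ₀ n)

    evalVars : List (Var × ℕ)
    evalVars = (dV , d) ∷ (oneV , 1) ∷ (zV , 0) ∷ []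

    -- The climb meets the columns in decreasing order, so the list of measured sides grows at its
    -- front. Each side takes two links of the chain.
    record Evaluating (g i : ℕ) (σ : State) : Set (a ⊔ˡ ℓ₁) where
      field
        vars     : Fixed evalVars σ
        zero≡    : rings σ (var zR) ≡ 0#
        links    : Links σ
        measured : Measured (sidesFrom x i g) σ
        rest     : Rest i σ

    descend fetch testEmpty testFlat : Cmd
    fetch = getᶜ ring bR VAL ancV zV ⨾ addᶜ ring wR aR bR ⨾ subᶜ wR zR wR
    testEmpty = if≤ ring zR wR skip (setᶜ nat pV 1)
    testFlat  = if≤ ring wR zR skip (addᶜ nat dimV dimV oneV ⨾ mulᶜ ring prodR prodR wR)
    descend = getᶜ nat ancV PAR ancV zV ⨾ getᶜ ring aR VAL ancV zV ⨾ getᶜ nat ancV PAR ancV zV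

    measured-empty : ∀ {w xs} σ → rings σ (var wR) ≡ w → rings σ (var zR) ≡ 0# → Measured xs σ →
      nats (⟦ testEmpty ⟧ σ) (var pV) ≡ bit (negative (w ∷ xs))
    measured-empty {xs = xs} σ refl z≡ M rewrite sym z≡ with rings σ (var zR) ≼? rings σ (var wR)
    ... | yes p = Measured.emptiness M
    ... | no ¬p = refl

    measured-flat : ∀ {w xs} σ → rings σ (var wR) ≡ w → rings σ (var zR) ≡ 0# → nats σ (var oneV) ≡ 1 →
      nats σ (var dimV) ≡ 2 + dimension xs → rings σ (var prodR) ≈ content xs →
      nats (⟦ testFlat ⟧ σ) (var dimV) ≡ 2 + dimension (w ∷ xs) ×
      rings (⟦ testFlat ⟧ σ) (var prodR) ≈ content (w ∷ xs)
    measured-flat {xs = xs} σ refl z≡ one≡ e s rewrite sym z≡ with rings σ (var wR) ≼? rings σ (var zR)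
    ... | yes p = e , s
    ... | no ¬p = trans (cong₂ _+_ e one≡) (ℕ.+-comm _ 1) , *-congʳ s

    evaluating-round : ∀ g i σ → Evaluating g (suc i) σ → Evaluating (suc g) i (⟦ evalSide ⟧ σ)
    evaluating-round g i σ E = record
      { vars     = fixed-frame evalVars evalSide refl σ vars
      ; zero≡    = trans (frame evalSide ring (var zR) refl σ) zero≡
      ; links    = (λ n → trans (frame evalSide ring (arr VAL n 0) refl σ) (proj₁ links n)) ,
                   (λ n → trans (frame evalSide nat (arr PAR n 0) refl σ) (proj₂ links n))
      ; measured = record
          { emptiness = trans (frame testFlat nat (var pV) refl σ₂) (measured-empty σ₁ w≡ zero≡ M₁)
          ; extent    = proj₁ flat₃
          ; substance = proj₂ flat₃ }
      ; rest     = next i (proj₂ rest) }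
      where
      open Evaluating E
      σ₁ σ₂ σ₃ : State
      σ₁ = ⟦ fetch ⟧ σ
      σ₂ = ⟦ testEmpty ⟧ σ₁
      σ₃ = ⟦ testFlat ⟧ σ₂
      M₁ : Measured (sidesFrom x (suc i) g) σ₁
      M₁ = record { emptiness = emptiness ; extent = extent ; substance = substance }
        where open Measured measured
      anc : ℕ
      anc = nats σ (var ancV)
      zV≡ : nats σ (var zV) ≡ 0
      zV≡ = proj₁ (proj₂ (proj₂ vars))
      val≡ : rings σ (arr VAL anc (nats σ (var zV))) ≡ val σ₀ anc
      val≡ = trans (cong (λ z → rings σ (arr VAL anc z)) zV≡) (proj₁ links anc)
      w≡ : rings σ₁ (var wR) ≡ side x i
      w≡ = cong₂ _⊖_ zero≡ (cong₂ _⊕_ (proj₁ rest) (trans val≡ (proj₁ (proj₂ rest))))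
      keep₂ : ∀ {l} → unwritten testEmpty nat (name l) ≡ true → nats σ₂ l ≡ nats σ₁ l
      keep₂ {l} u = frame testEmpty nat l u σ₁
      flat₃ : nats σ₃ (var dimV) ≡ 2 + dimension (sidesFrom x i (suc g)) ×
              rings σ₃ (var prodR) ≈ content (sidesFrom x i (suc g))
      flat₃ = measured-flat {xs = sidesFrom x (suc i) g} σ₂ (trans (frame testEmpty ring (var wR) refl σ₁) w≡)
        (trans (frame testEmpty ring (var zR) refl σ₁) zero≡)
        (trans (keep₂ {var oneV} refl) (proj₁ (proj₂ vars)))
        (trans (keep₂ {var dimV} refl) (Measured.extent M₁))
        (≈-trans (≈-reflexive (frame testEmpty ring (var prodR) refl σ₁)) (Measured.substance M₁))
      tests : Cmd
      tests = testEmpty ⨾ testFlat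
      anc₃ : nats σ₃ (var ancV) ≡ anc
      anc₃ = frame tests nat (var ancV) refl σ₁
      z₃ : nats σ₃ (var zV) ≡ 0
      z₃ = trans (frame tests nat (var zV) refl σ₁) zV≡
      par₃ : ∀ {n z} → z ≡ 0 → nats σ₃ (arr PAR n z) ≡ par σ₀ n
      par₃ {n} refl = trans (frame tests nat (arr PAR n 0) refl σ₁) (proj₂ links n)
      val₃ : ∀ {n z} → z ≡ 0 → rings σ₃ (arr VAL n z) ≡ val σ₀ n
      val₃ {n} refl = trans (frame tests ring (arr VAL n 0) refl σ₁) (proj₁ links n)
      up : nats σ₃ (arr PAR (nats σ₃ (var ancV)) (nats σ₃ (var zV))) ≡ par σ₀ anc
      up = trans (par₃ z₃) (cong (par σ₀) anc₃)
      next : ∀ i → Chain σ₀ (suc (i * 2)) anc x → Rest i (⟦ descend ⟧ σ₃)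
      next zero    _                              = _
      next (suc i) (_ , _ , e , _ , c) =
        trans (val₃ z₃) (trans (cong (val σ₀) up) e) ,
        subst (λ n → Chain σ₀ (suc (i * 2)) n x) (sym (trans (par₃ z₃) (cong (par σ₀) up))) c

    evaluating-admin : ∀ {g i σ} k u → Evaluating g i σ → Evaluating g i (set nat (var gV) k (tick u σ))
    evaluating-admin {i = i} k u E = record
      { vars = vars ; zero≡ = zero≡ ; links = links
      ; measured = record { emptiness = emptiness ; extent = extent ; substance = substance }
      ; rest = same i rest }
      where
      open Evaluating E
      open Measured measured
      same : ∀ i {σ} → Rest i σ → Rest i (set nat (var gV) k (tick u σ))
      same zero    _ = _
      same (suc i) p = p

    evaluating-tick : ∀ {g i σ} u → Evaluating g i σ → Evaluating g i (tick u σ)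
    evaluating-tick {i = i} u E = record
      { vars = vars ; zero≡ = zero≡ ; links = links
      ; measured = record { emptiness = emptiness ; extent = extent ; substance = substance }
      ; rest = same i rest }
      where
      open Evaluating E
      open Measured measured
      same : ∀ i {σ} → Rest i σ → Rest i (tick u σ)
      same zero    _ = _
      same (suc i) p = p

    evalSides-correct : ∀ σ → Evaluating 0 d σ →
      Evaluating d 0 (⟦ evalSides ⟧ σ) × time (⟦ evalSides ⟧ σ) ≤ time σ + (d * (4 + steps evalSide) + 2)
    evalSides-correct σ E = for-rule-timed
      (λ g σ′ → ∃[ i ] (g + i ≡ d × Evaluating g i σ′))
      (λ σ′ → Evaluating d 0 σ′ × time σ′ ≤ time σ + (d * (4 + steps evalSide) + 2))
      gV dV evalSide d (steps evalSide) σ (proj₁ (Evaluating.vars E))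
      (d , refl , evaluating-admin 0 1 E)
      (λ g σ′ g<d _ I → round g σ′ g<d I , time-loopFree evalSide refl (tick 1 σ′))
      (λ σ′ (i , e , E′) t → evaluating-tick 1 (subst (λ i → Evaluating d i σ′)
        (ℕ.+-cancelˡ-≡ d i 0 (trans e (sym (ℕ.+-identityʳ d)))) E′) , t)
      where
      round : ∀ g σ′ → g < d → ∃[ i ] (g + i ≡ d × Evaluating g i σ′) →
        ∃[ i ] (suc g + i ≡ d × Evaluating (suc g) i (set nat (var gV) (suc g) (tick 3 (⟦ evalSide ⟧ (tick 1 σ′)))))
      round g σ′ g<d (zero , e , E′)  = contradiction (trans (sym (ℕ.+-identityʳ g)) e) (ℕ.<⇒≢ g<d)
      round g σ′ g<d (suc i , e , E′) = i , trans (sym (ℕ.+-suc g i)) e ,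
        evaluating-admin (suc g) 3 (evaluating-round g i (tick 1 σ′) (evaluating-tick 1 E′))

    closing : Cmd
    closing = if≤ nat dimV eV (copyᶜ ring prodR zR) skip

    endEval-correct : ∀ {xs} σ → Measured xs σ → rings σ (var zR) ≡ 0# → nats σ (var oneV) ≡ 1 →
                      Computed (codeOf xs) (⟦ endEval ⟧ σ)
    endEval-correct {xs} σ M z≡ one≡ = if-nat (Computed (codeOf xs)) oneV pV
      (setᶜ nat dimV 1 ⨾ copyᶜ ring prodR zR) (setᶜ nat eV 2 ⨾ closing) σ
      (λ one≤ → empty (negative xs) (subst₂ _≤_ one≡ emptiness one≤))
      (λ p<one → if-nat (Computed (codeOf xs)) dimV eV (copyᶜ ring prodR zR) skip (⟦ setᶜ nat eV 2 ⟧ (tick 1 σ))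
        (λ dim≤ → lower (negative xs) (dimension xs) (subst₂ _<_ emptiness one≡ p<one) extent (subst (_≤ 2) extent dim≤))
        (λ dim> → solid (negative xs) (dimension xs) (subst₂ _<_ emptiness one≡ p<one) extent (subst (2 <_) extent dim>)))
      where
      open Measured M
      empty : ∀ b → 1 ≤ bit b → 1 ≡ proj₁ (encode b (dimension xs) (content xs)) ×
              rings σ (var zR) ≈ proj₂ (encode b (dimension xs) (content xs))
      empty true _ = refl , ≈-reflexive z≡
      lower : ∀ b n → bit b < 1 → nats σ (var dimV) ≡ 2 + n → 2 + n ≤ 2 →
        nats σ (var dimV) ≡ proj₁ (encode b n (content xs)) × rings σ (var zR) ≈ proj₂ (encode b n (content xs))
      lower true  n       (s≤s ()) _ _
      lower false zero    _ e _ = e , ≈-reflexive z≡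
      lower false (suc n) _ e (s≤s (s≤s ()))
      solid : ∀ b n → bit b < 1 → nats σ (var dimV) ≡ 2 + n → 2 < 2 + n →
        nats σ (var dimV) ≡ proj₁ (encode b n (content xs)) × rings σ (var prodR) ≈ proj₂ (encode b n (content xs))
      solid true  n       (s≤s ()) _ _
      solid false zero    _ e (s≤s (s≤s ()))
      solid false (suc n) _ e _ = e , substance

  leafVars : (l n s : ℕ) → List (Var × ℕ)
  leafVars l n s = (dV , d) ∷ (oneV , 1) ∷ (zV , 0) ∷ (lV , l) ∷ (nV , n) ∷ (sV , s) ∷ []

  evaluate-correct : ∀ l n s σ x → suc l ≡ D → Fixed (leafVars l n s) σ → rings σ (var zR) ≡ 0# → Stored σ →
    Chain σ l n x →
    Computed (volumeCode (x , l ↦ v l (ext σ n s))) (⟦ evaluate ⟧ σ) × time (⟦ evaluate ⟧ σ) ≤ time σ + evalTime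
  evaluate-correct l n s σ x l≡D (d≡ , one≡ , z≡ , l≡ , n≡ , s≡ , _) zero≡ V≡ chain =
    finish (evalSides-correct σ₁ E₀)
    where
    y : ℕ → Carrier
    y = x , l ↦ v l (ext σ n s)
    open Evaluation σ y
    σ₁ σ₂ : State
    σ₁ = ⟦ startEval ⟧ σ
    σ₂ = ⟦ evalSides ⟧ σ₁
    a≡ : rings σ₁ (var aR) ≡ y l
    a≡ = trans (cong₂ (λ c j → rings σ (arr V c j)) l≡ (cong₂ (λ i q → nats σ (arr EXT i q)) n≡ s≡))
           (trans (V≡ l (ext σ n s)) (sym (↦-hit x l)))
    rest₀ : ∀ d → suc l ≡ d * 2 → Rest d σ₁
    rest₀ (suc i) e with refl ← e = a≡ ,
      subst (λ n → Chain σ l n y) (sym n≡) (chain-cong l n (λ i i<l → sym (↦-miss x i<l)) chain)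
    E₀ : Evaluating 0 d σ₁
    E₀ = record
      { vars = d≡ , one≡ , z≡ , tt ; zero≡ = zero≡ ; links = (λ _ → refl) , (λ _ → refl)
      ; measured = record { emptiness = refl ; extent = refl ; substance = +-identityʳ 1# }
      ; rest = rest₀ d l≡D }
    finish : Evaluating d 0 σ₂ × time σ₂ ≤ time σ₁ + (d * (4 + steps evalSide) + 2) →
      Computed (volumeCode y) (⟦ evaluate ⟧ σ) × time (⟦ evaluate ⟧ σ) ≤ time σ + evalTime
    finish (E , τ) = endEval-correct σ₂ (Evaluating.measured E) (Evaluating.zero≡ E) (proj₁ (proj₂ (Evaluating.vars E))) ,
      ≤-trans (time-loopFree endEval refl σ₂) (≤-trans (ℕ.+-monoˡ-≤ (steps endEval) (≤-trans τ
        (ℕ.+-monoˡ-≤ (d * (4 + steps evalSide) + 2) (time-loopFree startEval refl σ))))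
        (ℕ.≤-reflexive (rearrange₁₈ (time σ) (steps startEval) (d * (4 + steps evalSide) + 2) (steps endEval))))

  bestCode : State → ℕ → Code
  bestCode σ s = nats σ (arr BEST s 0) , rings σ (arr VOL s 0)

  infix 4 _≋_
  _≋_ : Code → Code → Set ℓ₁
  (m , y) ≋ (n , z) = m ≡ n × y ≈ z

  ⊑-respʳ : ∀ {u w w′} → w ≋ w′ → u ⊑ w → u ⊑ w′
  ⊑-respʳ (refl , _) (inj₁ p)       = inj₁ p
  ⊑-respʳ (refl , e) (inj₂ (e′ , p)) = inj₂ (e′ , ≼-respʳ e p)

  ⊑-respˡ : ∀ {u u′ w} → u ≋ u′ → u ⊑ w → u′ ⊑ w
  ⊑-respˡ (refl , _) (inj₁ p)       = inj₁ p
  ⊑-respˡ (refl , e) (inj₂ (e′ , p)) = inj₂ (e′ , ≼-respˡ e p)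

  -- `improved` and `exceeds` serve completeness of the search, `origin` its soundness.
  record Recorded (n s : ℕ) (u : Code) (σ σ′ : State) : Set (a ⊔ˡ ℓ₁ ⊔ˡ ℓ₂) where
    field
      improved : bestCode σ s ⊑ bestCode σ′ s
      exceeds  : u ⊑ bestCode σ′ s
      origin   : (nats σ′ (arr BEST s 0) ≡ nats σ (arr BEST s 0) × rings σ′ (arr VOL s 0) ≡ rings σ (arr VOL s 0) ×
                  nats σ′ (arr BEST s 1) ≡ nats σ (arr BEST s 1)) ⊎
                 (bestCode σ′ s ≋ u × nats σ′ (arr BEST s 1) ≡ n)
      others   : ∀ s′ → s′ ≢ s → ∀ k → nats σ′ (arr BEST s′ k) ≡ nats σ (arr BEST s′ k) ×
                                        rings σ′ (arr VOL s′ k) ≡ rings σ (arr VOL s′ k)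

  total-order : ∀ {y z : Carrier} → ¬ y ≼ z → z ≼ y
  total-order {y} {z} p with ≼-total y z
  ... | inj₁ q = contradiction q p
  ... | inj₂ q = q

  compareBest-correct : ∀ l n s u σ → Fixed (leafVars l n s) σ → Computed u σ →
    Recorded n s u σ (⟦ compareBest ⟧ σ)
  compareBest-correct l n s u@(uₙ , uᵥ) σ (_ , one≡ , z≡ , _ , n≡ , s≡ , _) (dim≡ , prod≡) =
    if-nat Goal dimV eV (if≤ nat eV dimV compareVolume skip) record-best σ₁
      (λ dim≤best → if-nat Goal eV dimV compareVolume skip (tick 1 σ₁)
        (λ best≤dim → let eq = ℕ.≤-antisym (subst₂ _≤_ dim≡ old-e dim≤best) (subst₂ _≤_ old-e dim≡ best≤dim) in
          if-ring Goal prodR bR skip record-best (⟦ getᶜ ring bR VOL sV zV ⟧ (tick 1 (tick 1 σ₁)))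
            (λ le → unchanged (inj₂ (eq , ≼-resp prod≡ (≈-reflexive old-v) le)) (λ _ → refl) (λ _ → refl))
            (λ ¬le → changed (tick 1 (⟦ getᶜ ring bR VOL sV zV ⟧ (tick 1 (tick 1 σ₁)))) (λ _ → refl) (λ _ → refl)
              n≡ s≡ z≡ one≡ dim≡ prod≡
              (inj₂ (sym eq , ≼-resp (≈-reflexive old-v) prod≡ (total-order ¬le)))))
        (λ dim<best → unchanged (inj₁ (Level.lift (subst₂ _<_ dim≡ old-e dim<best))) (λ _ → refl) (λ _ → refl)))
      (λ best<dim → changed (tick 1 σ₁) (λ _ → refl) (λ _ → refl) n≡ s≡ z≡ one≡ dim≡ prod≡
        (inj₁ (Level.lift (subst₂ _<_ old-e dim≡ best<dim))))
    where
    σ₁ : State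
    σ₁ = ⟦ getᶜ nat eV BEST sV zV ⟧ σ
    Goal : State → Set (a ⊔ˡ ℓ₁ ⊔ˡ ℓ₂)
    Goal σ′ = Recorded n s u σ σ′
    old-e : nats σ (arr BEST (nats σ (var sV)) (nats σ (var zV))) ≡ nats σ (arr BEST s 0)
    old-e = cong₂ (λ s z → nats σ (arr BEST s z)) s≡ z≡
    old-v : rings σ (arr VOL (nats σ (var sV)) (nats σ (var zV))) ≡ rings σ (arr VOL s 0)
    old-v = cong₂ (λ s z → rings σ (arr VOL s z)) s≡ z≡
    unchanged : ∀ {σ′} → u ⊑ bestCode σ s → (∀ l → nats σ′ (arr BEST (proj₁ l) (proj₂ l)) ≡ nats σ (arr BEST (proj₁ l) (proj₂ l))) →
      (∀ l → rings σ′ (arr VOL (proj₁ l) (proj₂ l)) ≡ rings σ (arr VOL (proj₁ l) (proj₂ l))) → Goal σ′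
    unchanged le f g = record
      { improved = ⊑-respʳ (sym (f (s , 0)) , ≈-reflexive (sym (g (s , 0)))) ⊑-refl
      ; exceeds  = ⊑-respʳ (sym (f (s , 0)) , ≈-reflexive (sym (g (s , 0)))) le
      ; origin   = inj₁ (f (s , 0) , g (s , 0) , f (s , 1))
      ; others   = λ s′ _ k → f (s′ , k) , g (s′ , k) }
    changed : ∀ σ′ → (∀ l → nats σ′ (arr BEST (proj₁ l) (proj₂ l)) ≡ nats σ (arr BEST (proj₁ l) (proj₂ l))) →
      (∀ l → rings σ′ (arr VOL (proj₁ l) (proj₂ l)) ≡ rings σ (arr VOL (proj₁ l) (proj₂ l))) →
      nats σ′ (var nV) ≡ n → nats σ′ (var sV) ≡ s → nats σ′ (var zV) ≡ 0 → nats σ′ (var oneV) ≡ 1 →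
      nats σ′ (var dimV) ≡ uₙ → rings σ′ (var prodR) ≈ uᵥ → bestCode σ s ⊑ u →
      Goal (tick 1 (⟦ record-best ⟧ σ′))
    changed σ′ f g n≡ s≡ z≡ one≡ dim≡ prod≡ le = record
      { improved = ⊑-respʳ (sym (proj₁ new) , ≈-sym (proj₂ new)) le
      ; exceeds  = ⊑-respʳ (sym (proj₁ new) , ≈-sym (proj₂ new)) ⊑-refl
      ; origin   = inj₂ (new , trans (entry-hit (sym s≡) (sym one≡)) n≡)
      ; others   = λ s′ s′≢s k →
          trans (entry-row k (nats σ′ (var oneV)) (λ e → s′≢s (trans e s≡)))
            (trans (entry-row k (nats σ′ (var zV)) (λ e → s′≢s (trans e s≡))) (f (s′ , k))) ,
          trans (entry-row k (nats σ′ (var zV)) (λ e → s′≢s (trans e s≡))) (g (s′ , k)) }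
      where
      0≢1 : ∀ {i} → i ≡ 1 → 0 ≢ i
      0≢1 refl ()
      new : bestCode (tick 1 (⟦ record-best ⟧ σ′)) s ≋ u
      new = trans (entry-column s (nats σ′ (var sV)) (0≢1 one≡))
              (trans (entry-hit (sym s≡) (sym z≡)) dim≡) ,
            ≈-trans (≈-reflexive (entry-hit (sym s≡) (sym z≡))) prod≡

  -- One code `u`, the one that is computed, represents the value for every `x` that the chain
  -- admits. This uniformity is needed because the tree invariants supply such an `x` only
  -- existentially, and possibly different ones for soundness and completeness.
  leaf-correct : ∀ l n s σ → suc l ≡ D → Fixed (leafVars l n s) σ → rings σ (var zR) ≡ 0# → Stored σ →
    ∃[ x ] Chain σ l n x →
    (∃[ u ] ((∀ x → Chain σ l n x → u ≋ volumeCode (x , l ↦ v l (ext σ n s))) × Recorded n s u σ (⟦ leaf ⟧ σ))) ×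
    time (⟦ leaf ⟧ σ) ≤ time σ + leafTime
  leaf-correct l n s σ l≡D F zero≡ V≡ (x₀ , chain₀) =
    (u , (λ x chain → computed x (evaluate-correct l n s σ x l≡D F zero≡ V≡ chain)) ,
     transfer (compareBest-correct l n s u σ₁ F₁ (refl , ≈-refl))) ,
    ≤-trans (time-loopFree compareBest refl σ₁)
      (≤-trans (ℕ.+-monoˡ-≤ (steps compareBest) (proj₂ (evaluate-correct l n s σ x₀ l≡D F zero≡ V≡ chain₀)))
        (ℕ.≤-reflexive (ℕ.+-assoc (time σ) evalTime (steps compareBest))))
    where
    σ₁ : State
    σ₁ = ⟦ evaluate ⟧ σ
    u : Code
    u = nats σ₁ (var dimV) , rings σ₁ (var prodR)
    F₁ : Fixed (leafVars l n s) σ₁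
    F₁ = fixed-frame (leafVars l n s) evaluate refl σ F
    computed : ∀ x → Computed (volumeCode (x , l ↦ v l (ext σ n s))) σ₁ × time σ₁ ≤ time σ + evalTime →
               u ≋ volumeCode (x , l ↦ v l (ext σ n s))
    computed x (c , _) = c
    best≡ : ∀ s k → nats σ₁ (arr BEST s k) ≡ nats σ (arr BEST s k)
    best≡ s k = frame evaluate nat (arr BEST s k) refl σ
    vol≡ : ∀ s k → rings σ₁ (arr VOL s k) ≡ rings σ (arr VOL s k)
    vol≡ s k = frame evaluate ring (arr VOL s k) refl σ
    transfer : ∀ {σ′} → Recorded n s u σ₁ σ′ → Recorded n s u σ σ′
    transfer R = record
      { improved = ⊑-respˡ (best≡ s 0 , ≈-reflexive (vol≡ s 0)) improved
      ; exceeds  = exceeds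
      ; origin   = Sum.map₁ (λ (p , q , w) → trans p (best≡ s 0) , trans q (vol≡ s 0) , trans w (best≡ s 1)) origin
      ; others   = λ s′ s′≢s k → let p , q = others s′ s′≢s k in trans p (best≡ s′ k) , trans q (vol≡ s′ k) }
      where open Recorded R

  -- The last level: soundness and completeness of the recorded leaves

  -- The recorded code belongs to upper bounds for the column maxima, so it is only a lower bound
  -- for the volume that the deletions leave. This suffices, as it already dominates all
  -- competitors.
  record Witness (b s : ℕ) (σ : State) : Set (a ⊔ˡ ℓ₁ ⊔ˡ ℓ₂) where
    field
      node      : ℕ
      maxima    : ℕ → Carrier
      node<b    : node < b
      recorded  : nats σ (arr BEST s 1) ≡ node
      bounded   : ∀ q → q < s → ext σ node q < N
      injective : Injective< s (ext σ node)
      covers    : Covers s (ext σ node) D maxima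
      code≋     : bestCode σ s ≋ volumeCode maxima

  Sound : ℕ → ℕ → State → Set (a ⊔ˡ ℓ₁ ⊔ˡ ℓ₂)
  Sound b s σ = nats σ (arr BEST s 0) ≡ 0 ⊎ Witness b s σ

  sound-same : ∀ {b b′ s σ σ′} → b ≤ b′ → (∀ m → m < b → ∀ q → ext σ′ m q ≡ ext σ m q) →
    nats σ′ (arr BEST s 0) ≡ nats σ (arr BEST s 0) → rings σ′ (arr VOL s 0) ≡ rings σ (arr VOL s 0) →
    nats σ′ (arr BEST s 1) ≡ nats σ (arr BEST s 1) → Sound b s σ → Sound b′ s σ′
  sound-same b≤b′ rows e₀ eᵥ e₁ (inj₁ z) = inj₁ (trans e₀ z)
  sound-same b≤b′ rows e₀ eᵥ e₁ (inj₂ W) = inj₂ (record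
    { node      = node
    ; maxima    = maxima
    ; node<b    = ℕ.<-≤-trans node<b b≤b′
    ; recorded  = trans e₁ recorded
    ; bounded   = λ q q<s → subst (_< N) (sym (rows node node<b q)) (bounded q q<s)
    ; injective = λ p<s q<s e → injective p<s q<s (trans (sym (rows node node<b _)) (trans e (rows node node<b _)))
    ; covers    = λ i i<D j j<N h → covers i i<D j j<N λ q q<s e → h q q<s (trans (rows node node<b q) e)
    ; code≋     = trans e₀ (proj₁ code≋) , ≈-trans (≈-reflexive eᵥ) (proj₂ code≋) })
    where open Witness W

  record SameTables (σ σ′ : State) : Set a where
    field
      tables-tot : ∀ m → tot σ′ m ≡ tot σ m
      tables-par : ∀ m → par σ′ m ≡ par σ m
      tables-val : ∀ m → val σ′ m ≡ val σ m
      tables-mrk : ∀ m e → mrk σ′ m e ≡ mrk σ m e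
      tables-ext : ∀ m q → ext σ′ m q ≡ ext σ m q

  leaf-tables : ∀ σ → SameTables σ (⟦ leaf ⟧ σ)
  leaf-tables σ = record
    { tables-tot = λ m → frame leaf nat (arr TOT m 0) refl σ
    ; tables-par = λ m → frame leaf nat (arr PAR m 0) refl σ
    ; tables-val = λ m → frame leaf ring (arr VAL m 0) refl σ
    ; tables-mrk = λ m e → frame leaf nat (arr MARK m e) refl σ
    ; tables-ext = λ m q → frame leaf nat (arr EXT m q) refl σ }

  -- Each `x i` is at most an entry that survives the deletion of `S`, so the code of `x` lies above
  -- the volume left by `S`, and the recorded code above both.
  Dominated : Subset N → ℕ → State → Set (a ⊔ˡ ℓ₂)
  Dominated S s σ = ∃[ x ] ((∀ i → i < D → ∃[ e ] (Out S e × x i ≼ v i e)) × volumeCode x ⊑ bestCode σ s)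

  module _ (l lo cnt : ℕ) (l≡D : suc l ≡ D) (T : TopRow l) (σ₀ : State) (L₀ : Layer l lo cnt σ₀) where

    lastVars : List (Var × ℕ)
    lastVars = (dV , d) ∷ levelVars l lo cnt

    m₁ : ℕ
    m₁ = lo + cnt

    record LastFacts (i : ℕ) (σ : State) : Set (a ⊔ˡ ℓ₁ ⊔ˡ ℓ₂) where
      field
        vars      : Fixed lastVars σ
        zero≡     : rings σ (var zR) ≡ 0#
        ordered   : Ordered σ
        stored    : Stored σ
        same      : SameBelow m₁ σ₀ σ
        sound     : ∀ s → s ≤ r → Sound (lo + i) s σ
        dominated : ∀ S → ∣ S ∣ ≤ r → ∀ i′ → i′ < i → ∀ x → Node l (lo + i′) x σ₀ → Path S l (lo + i′) x σ₀ →
                    Dominated S ∣ S ∣ σ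

    -- The weight at depth 1 counts the leaves under the first `i` nodes.
    lastBound : ℕ → ℕ
    lastBound i = time σ₀ + (i * nodeTime + (total (weightOf σ₀ 1) lo i * leafTime + 1))

    module AtNode (i : ℕ) (i<cnt : i < cnt) (σ : State) (R : LastFacts i σ) where

      module R = LastFacts R

      n t : ℕ
      n = lo + i
      t = tot σ n

      n<m₁ : n < m₁
      n<m₁ = ℕ.+-monoʳ-< lo i<cnt

      here : ∀ {x} → Node l n x σ₀ → Node l n x σ
      here = node-same R.same n<m₁

      x₀ : ℕ → Carrier
      x₀ = proj₁ (Layer.nodes L₀ n (ℕ.m≤m+n lo i) n<m₁)

      node₀ : Node l n x₀ σ
      node₀ = here (proj₂ (Layer.nodes L₀ n (ℕ.m≤m+n lo i) n<m₁))

      t≤r : t ≤ r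
      t≤r = Marked.t≤r (Node.deletions node₀)

      σ₂ : State
      σ₂ = ⟦ enter ⟧ σ

      module Entrance (E : Entered l n σ σ₂) where

        module E = Entered E

        f : ℕ → ℕ
        f = ext σ₂ n

        chain₂ : ∀ {x} → Chain σ l n x → Chain σ₂ l n x
        chain₂ = chain-same {b = suc n} l n (λ m _ → E.same m) ≤-refl

        record SameTable (σ′ : State) : Set a where
          field
            tot≡ : ∀ m → tot σ′ m ≡ tot σ₂ m
            par≡ : ∀ m → par σ′ m ≡ par σ₂ m
            val≡ : ∀ m → val σ′ m ≡ val σ₂ m
            mrk≡ : ∀ m e → mrk σ′ m e ≡ mrk σ₂ m e
            ext≡ : ∀ m q → ext σ′ m q ≡ ext σ₂ m q

        table-row : ∀ {σ′} → SameTable σ′ → ∀ m → SameRow m σ₂ σ′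
        table-row S m = record { same-tot = tot≡ m ; same-par = par≡ m ; same-val = val≡ m
                               ; same-mrk = mrk≡ m ; same-ext = λ q _ → ext≡ m q }
          where open SameTable S

        leafLoopVars : List (Var × ℕ)
        leafLoopVars = (dV , d) ∷ inner l n t

        record LeafFacts (j : ℕ) (σ′ : State) : Set (a ⊔ˡ ℓ₁ ⊔ˡ ℓ₂) where
          field
            vars     : Fixed leafLoopVars σ′
            zero≡    : rings σ′ (var zR) ≡ 0#
            stored   : Stored σ′
            table    : SameTable σ′
            improved : ∀ s → bestCode σ₂ s ⊑ bestCode σ′ s
            done     : ∀ s → s < j → t ≤ s → ∀ x → Chain σ₂ l n x →
                       volumeCode (x , l ↦ v l (f s)) ⊑ bestCode σ′ s
            sound    : ∀ s → s ≤ r → Sound (suc n) s σ′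

        leafBound : ℕ → ℕ
        leafBound j = time σ₂ + (j * 7 + ((j ∸ t) * leafTime + 1))

        LeafRun : ℕ → State → Set (a ⊔ˡ ℓ₁ ⊔ˡ ℓ₂)
        LeafRun j σ′ = LeafFacts j σ′ × time σ′ ≤ leafBound j

        facts-tick : ∀ {j σ′} u → LeafFacts j σ′ → LeafFacts j (tick u σ′)
        facts-tick {σ′ = σ′} u L = record
          { vars = vars ; zero≡ = zero≡ ; stored = stored
          ; table = record { tot≡ = tot≡ ; par≡ = par≡ ; val≡ = val≡ ; mrk≡ = mrk≡ ; ext≡ = ext≡ }
          ; improved = improved ; done = done
          ; sound = λ s s≤r → sound-same {σ = σ′} ≤-refl (λ _ _ _ → refl) refl refl refl (sound s s≤r) }
          where
          open LeafFacts L
          open SameTable table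

        facts-admin : ∀ {j σ′} k → LeafFacts j σ′ → LeafFacts j (set nat (var sV) k σ′)
        facts-admin {σ′ = σ′} k L = record
          { vars = vars ; zero≡ = zero≡ ; stored = stored
          ; table = record { tot≡ = tot≡ ; par≡ = par≡ ; val≡ = val≡ ; mrk≡ = mrk≡ ; ext≡ = ext≡ }
          ; improved = improved ; done = done
          ; sound = λ s s≤r → sound-same {σ = σ′} ≤-refl (λ _ _ _ → refl) refl refl refl (sound s s≤r) }
          where
          open LeafFacts L
          open SameTable table

        facts-skip : ∀ {j σ′} → j < t → LeafFacts j σ′ → LeafFacts (suc j) σ′
        facts-skip j<t L = record
          { vars = vars ; zero≡ = zero≡ ; stored = stored ; table = table ; improved = improved ; sound = sound
          ; done = λ s s<sj t≤s → contradiction (≤-trans j<t t≤s) (ℕ.<⇒≱ s<sj) }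
          where open LeafFacts L

        chain-table : ∀ {σ′ x} → SameTable σ′ → Chain σ₂ l n x → Chain σ′ l n x
        chain-table S = chain-same {b = suc n} l n (λ m _ → table-row S m) ≤-refl

        facts-leaf : ∀ j σ′ σ″ → t ≤ j → j ≤ r → LeafFacts j σ′ →
          Fixed leafLoopVars σ″ → rings σ″ (var zR) ≡ 0# → Stored σ″ → SameTables σ′ σ″ →
          ∃[ u ] ((∀ x → Chain σ′ l n x → u ≋ volumeCode (x , l ↦ v l (ext σ′ n j))) × Recorded n j u σ′ σ″) →
          LeafFacts (suc j) σ″
        facts-leaf j σ′ σ″ t≤j j≤r L vars″ zero″ stored″ tables (u , code , rec) = record
          { vars   = vars″
          ; zero≡  = zero″
          ; stored = stored″
          ; table  = record
              { tot≡ = λ m → trans (tables-tot m) (tot≡ m)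
              ; par≡ = λ m → trans (tables-par m) (par≡ m)
              ; val≡ = λ m → trans (tables-val m) (val≡ m)
              ; mrk≡ = λ m e → trans (tables-mrk m e) (mrk≡ m e)
              ; ext≡ = λ m q → trans (rows m q) (ext≡ m q) }
          ; improved = λ s → ⊑-trans (improved s) (better s)
          ; done  = below-suc _ (λ s s<j t≤s x c → ⊑-trans (done s s<j t≤s x c) (better s))
              (λ _ x c → ⊑-respˡ (code′ x c) exceeds)
          ; sound = λ s s≤r → sound′ s s≤r (s ℕ.≟ j) }
          where
          open LeafFacts L
          open SameTable table
          open SameTables tables
          open Recorded rec renaming (improved to improved-j; others to others-j)
          rows : ∀ m q → ext σ″ m q ≡ ext σ′ m q
          rows = tables-ext
          f≡ : ∀ q → ext σ′ n q ≡ f q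
          f≡ = ext≡ n
          code′ : ∀ x → Chain σ₂ l n x → u ≋ volumeCode (x , l ↦ v l (f j))
          code′ x c = subst (λ e → u ≋ volumeCode (x , l ↦ v l e)) (f≡ j)
            (code x (chain-same {b = suc n} l n (λ m _ → record { same-tot = tot≡ m ; same-par = par≡ m
              ; same-val = val≡ m ; same-mrk = mrk≡ m ; same-ext = λ q _ → ext≡ m q }) ≤-refl c))
          better : ∀ s → bestCode σ′ s ⊑ bestCode σ″ s
          better s with s ℕ.≟ j
          ... | yes refl = improved-j
          ... | no s≢j   = ⊑-respʳ (sym (proj₁ (others-j s s≢j 0)) , ≈-reflexive (sym (proj₂ (others-j s s≢j 0)))) ⊑-refl
          new-witness : bestCode σ″ j ≋ u → nats σ″ (arr BEST j 1) ≡ n →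
                        Witness (suc n) j σ″
          new-witness e e′ = record
            { node      = n
            ; maxima    = x₀ , l ↦ v l (f j)
            ; node<b    = ≤-refl
            ; recorded  = e′
            ; bounded   = λ q q<j → subst (_< N) (sym (row q)) (Row.bounded E.row-n q (ℕ.<⇒≤ (ℕ.<-≤-trans q<j j≤r)))
            ; injective = λ p<j q<j e → Row.injective E.row-n (up p<j) (up q<j) (trans (sym (row _)) (trans e (row _)))
            ; covers    = λ i i<D k k<N h →
                covers-extend E.row-n t≤j j≤r refl E.agree (Node.covers node₀) i (subst (i <_) (sym l≡D) i<D) k k<N
                  λ q q<j e → h q q<j (trans (row q) e)
            ; code≋     = trans (proj₁ e) (proj₁ u≋) , ≈-trans (proj₂ e) (proj₂ u≋) }
            where
            row : ∀ q → ext σ″ n q ≡ f q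
            row q = trans (rows n q) (f≡ q)
            up : ∀ {q} → q < j → q < suc r
            up q<j = ℕ.<-≤-trans q<j (ℕ.m≤n⇒m≤1+n j≤r)
            u≋ : u ≋ volumeCode (x₀ , l ↦ v l (f j))
            u≋ = code′ x₀ (chain₂ (Node.chain node₀))
          sound′ : ∀ s → s ≤ r → Dec (s ≡ j) → Sound (suc n) s σ″
          sound′ s s≤r (no s≢j) = sound-same {σ = σ′} ≤-refl (λ m _ q → rows m q)
            (proj₁ (others-j s s≢j 0)) (proj₂ (others-j s s≢j 0)) (proj₁ (others-j s s≢j 1)) (sound s s≤r)
          sound′ s s≤r (yes refl) = go origin
            where
            go : (nats σ″ (arr BEST j 0) ≡ nats σ′ (arr BEST j 0) ×
                  rings σ″ (arr VOL j 0) ≡ rings σ′ (arr VOL j 0) ×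
                  nats σ″ (arr BEST j 1) ≡ nats σ′ (arr BEST j 1)) ⊎
                 (bestCode σ″ j ≋ u × nats σ″ (arr BEST j 1) ≡ n) →
                 Sound (suc n) j σ″
            go (inj₁ (e₀ , eᵥ , e₁)) = sound-same {σ = σ′} ≤-refl (λ m _ q → rows m q) e₀ eᵥ e₁ (sound s s≤r)
            go (inj₂ (e , e′))       = inj₂ (new-witness e e′)

        offspring-last : LeafRun 0 (set nat (var sV) 0 (tick 1 σ₂)) →
          ∃[ σ′ ] (⟦ offspring ⟧ σ₂ ≡ tick 1 σ′ × LeafRun (suc r) σ′)
        offspring-last L₀ = for-rule LeafRun
          (λ σ′ → ∃[ σ″ ] (σ′ ≡ tick 1 σ″ × LeafRun (suc r) σ″))
          sV RV kid (suc r) σ₂ (proj₁ (proj₂ (LeafFacts.vars (proj₁ L₀)))) L₀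
          (λ j σ′ j<r s≡ L → go j σ′ (ℕ.≤-pred j<r) s≡ L)
          (λ σ′ L → σ′ , refl , L)
          where
          go : ∀ j σ′ → j ≤ r → nats σ′ (var sV) ≡ j → LeafRun j σ′ →
               LeafRun (suc j) (set nat (var sV) (suc j) (tick 3 (⟦ kid ⟧ (tick 1 σ′))))
          go j σ′ j≤r s≡ (L , timely) = if-nat Next tV sV branch skip (tick 1 σ′)
            (λ t≤s → if-nat Next DV topV leaf child (tick 1 (tick 1 σ′))
                (λ _ → leaf-case (subst₂ _≤_ t≡ s≡ t≤s) (tick 1 (tick 1 (tick 1 σ′)))
                  (facts-tick 1 (facts-tick 1 (facts-tick 1 L))) s≡ ≤-refl)
                (λ top<D → contradiction (subst₂ _<_ top≡ D≡ top<D) (ℕ.<-irrefl l≡D)))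
            (λ s<t → skip-case (subst₂ _<_ s≡ t≡ s<t))
            where
            open LeafFacts L
            open SameTable table
            Next : State → Set (a ⊔ˡ ℓ₁ ⊔ˡ ℓ₂)
            Next σ″ = LeafRun (suc j) (set nat (var sV) (suc j) (tick 3 σ″))
            D≡ = proj₁ (proj₂ (proj₂ (proj₂ (proj₂ (proj₂ (proj₂ vars))))))
            top≡ = proj₁ (proj₂ (proj₂ (proj₂ (proj₂ (proj₂ (proj₂ (proj₂ vars)))))))
            t≡ = proj₁ (proj₂ (proj₂ (proj₂ (proj₂ (proj₂ (proj₂ (proj₂ (proj₂ vars))))))))
            skip-case : j < t → Next (tick 1 (tick 1 (tick 1 σ′)))
            skip-case j<t =
              facts-admin (suc j) (facts-tick 3 (facts-tick 1 (facts-tick 1 (facts-tick 1 (facts-skip j<t L))))) ,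
              ≤-trans (ℕ.+-monoˡ-≤ 3 (ℕ.+-monoˡ-≤ 1 (ℕ.+-monoˡ-≤ 1 (ℕ.+-monoˡ-≤ 1 timely))))
                (≤-trans (ℕ.m≤m+n _ 1) (ℕ.≤-reflexive (trans (rearrange₁ (time σ₂) j ((j ∸ t) * leafTime))
                  (cong (λ i → time σ₂ + (suc j * 7 + (i * leafTime + 1))) (sym (∸-none j<t))))))
            leaf-case : t ≤ j → ∀ σ″ → LeafFacts j σ″ → nats σ″ (var sV) ≡ j → time σ″ ≤ time σ′ + 1 + 1 + 1 →
                        Next (⟦ leaf ⟧ σ″)
            leaf-case t≤j σ″ L″ s≡ τ = finish (leaf-correct l n j σ″ l≡D
                (d≡ , one≡ , z≡ , l≡ , n≡ , s≡ , tt) (LeafFacts.zero≡ L″) (LeafFacts.stored L″)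
                (x₀ , chain-table (LeafFacts.table L″) (chain₂ (Node.chain node₀))))
              where
              F = LeafFacts.vars L″
              d≡ = proj₁ F
              one≡ = proj₁ (proj₂ (proj₂ F))
              z≡ = proj₁ (proj₂ (proj₂ (proj₂ F)))
              l≡ = proj₁ (proj₂ (proj₂ (proj₂ (proj₂ F))))
              n≡ = proj₁ (proj₂ (proj₂ (proj₂ (proj₂ (proj₂ F)))))
              finish : (∃[ u ] ((∀ x → Chain σ″ l n x → u ≋ volumeCode (x , l ↦ v l (ext σ″ n j))) ×
                  Recorded n j u σ″ (⟦ leaf ⟧ σ″))) × time (⟦ leaf ⟧ σ″) ≤ time σ″ + leafTime → Next (⟦ leaf ⟧ σ″)
              finish (U , τ″) = facts-admin (suc j) (facts-tick 3 (facts-leaf j σ″ (⟦ leaf ⟧ σ″) t≤j j≤r L″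
                    (fixed-frame leafLoopVars leaf refl σ″ F)
                    (trans (frame leaf ring (var zR) refl σ″) (LeafFacts.zero≡ L″))
                    (λ c k → trans (frame leaf ring (arr V c k) refl σ″) (LeafFacts.stored L″ c k))
                    (leaf-tables σ″) U)) ,
                ≤-trans (ℕ.+-monoˡ-≤ 3 (≤-trans τ″ (ℕ.+-monoˡ-≤ leafTime (≤-trans τ
                    (ℕ.+-monoˡ-≤ 1 (ℕ.+-monoˡ-≤ 1 (ℕ.+-monoˡ-≤ 1 timely)))))))
                  (≤-trans (ℕ.m≤m+n _ 1) (ℕ.≤-reflexive (trans (rearrange₂ (time σ₂) j ((j ∸ t) * leafTime) leafTime)
                    (cong (λ i → time σ₂ + (suc j * 7 + (i * leafTime + 1))) (sym (∸-step t≤j))))))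

        best₂ : ∀ s k → nats σ₂ (arr BEST s k) ≡ nats σ (arr BEST s k)
        best₂ s k = frame enter nat (arr BEST s k) refl σ

        vol₂ : ∀ s k → rings σ₂ (arr VOL s k) ≡ rings σ (arr VOL s k)
        vol₂ s k = frame enter ring (arr VOL s k) refl σ

        initial : LeafFacts 0 σ₂
        initial = record
          { vars     = trans (frame enter nat (var dV) refl σ) (proj₁ R.vars) , E.vars
          ; zero≡    = trans (frame enter ring (var zR) refl σ) R.zero≡
          ; stored   = λ c k → trans (frame enter ring (arr V c k) refl σ) (R.stored c k)
          ; table    = record { tot≡ = λ _ → refl ; par≡ = λ _ → refl ; val≡ = λ _ → refl
                              ; mrk≡ = λ _ _ → refl ; ext≡ = λ _ _ → refl }
          ; improved = λ s → ⊑-refl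
          ; done     = λ s ()
          ; sound    = λ s s≤r → sound-same {σ = σ} {σ₂} (ℕ.n≤1+n n) (λ m m<n q → E.others m (ℕ.<⇒≢ m<n) q)
              (best₂ s 0) (vol₂ s 0) (best₂ s 1) (R.sound s s≤r) }

        first-run : LeafRun 0 (set nat (var sV) 0 (tick 1 σ₂))
        first-run = facts-admin {0} {tick 1 σ₂} 0 (facts-tick {0} {σ₂} 1 initial) ,
          ℕ.+-monoʳ-≤ (time σ₂) (ℕ.m≤n+m 1 ((0 ∸ t) * leafTime))

        module Conclude (σ′ : State) (L : LeafRun (suc r) σ′) where

          module L = LeafFacts (proj₁ L)

          same′ : ∀ m → SameRow m σ σ′
          same′ m = same-trans (E.same m) (table-row L.table m)

          improved′ : ∀ s → bestCode σ s ⊑ bestCode σ′ s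
          improved′ s = ⊑-respˡ (best₂ s 0 , ≈-reflexive (vol₂ s 0)) (L.improved s)

          -- Let `k` be the first position outside `S`. The `k` entries before it are distinct
          -- members of `S`, so `k` is at most the size of `S`. The leaf that deletes as many
          -- entries as `S` has is taken in place of the one at `k`: it has the required number of
          -- deletions, and its last bound is no greater because the row is sorted from `t` on.
          dominated′ : ∀ S → ∣ S ∣ ≤ r → ∀ i′ → i′ < suc i → ∀ x → Node l (lo + i′) x σ₀ →
                       Path S l (lo + i′) x σ₀ → Dominated S ∣ S ∣ σ′
          dominated′ S ∣S∣≤r = below-suc _
            (λ i′ i′<i x node path → let y , h , le = R.dominated S ∣S∣≤r i′ i′<i x node path in
              y , h , ⊑-trans le (improved′ ∣ S ∣))
            now
            where
            now : ∀ x → Node l (lo + i) x σ₀ → Path S l (lo + i) x σ₀ → Dominated S ∣ S ∣ σ′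
            now x node path = go (first-out S E.row-n ∣S∣≤r (suc r ∸ t) t (ℕ.m+[n∸m]≡n (ℕ.m≤n⇒m≤1+n t≤r))
                (λ q q<t → subst (In S) (sym (E.agree q q<t)) (Path.inside-S path₂ q q<t)))
              where
              path₂ : Path S l n x σ
              path₂ = path-same (R.same n n<m₁) path
              s : ℕ
              s = ∣ S ∣
              go : ∃[ k ] (t ≤ k × k ≤ r × (∀ q → q < k → In S (f q)) × Out S (f k)) → Dominated S s σ′
              go (k , t≤k , k≤r , ins , out) = (x , l ↦ v l (f s)) , attained ,
                L.done s (s≤s ∣S∣≤r) (≤-trans t≤k k≤s) x (chain₂ (Node.chain (here node)))
                where
                k≤s : k ≤ s
                k≤s = injective⇒≤∣ S ∣ (Injective<-⊆ (ℕ.m≤n⇒m≤1+n k≤r) (Row.injective E.row-n))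
                  (λ q q<k → let y , p , e = ins q q<k in y , p , sym e)
                attained : ∀ i → i < D → ∃[ e ] (Out S e × (x , l ↦ v l (f s)) i ≼ v i e)
                attained i i<D = below-suc (λ i → ∃[ e ] (Out S e × (x , l ↦ v l (f s)) i ≼ v i e))
                  (λ i i<l → let e , o , eq = Path.attained path i i<l in
                    e , o , ≼-reflexive (≈-reflexive (trans (↦-miss x i<l) eq)))
                  (f k , out , subst (_≼ v l (f k)) (sym (↦-hit x l))
                    (Row.sorted E.row-n k t≤k k≤r (f s) (Row.bounded E.row-n s ∣S∣≤r)
                      λ q q<k e → ℕ.<⇒≢ (ℕ.<-≤-trans q<k k≤s)
                        (Row.injective E.row-n (ℕ.<-≤-trans q<k (ℕ.m≤n⇒m≤1+n k≤r)) (s≤s ∣S∣≤r) e)))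
                  i (subst (i <_) (sym l≡D) i<D)

          binom-one : ∀ u → binom u 1 ≡ suc u
          binom-one u = trans (sym (ℕ.*-identityˡ _)) (trans (binom-sucʳ u 0) (ℕ.*-identityʳ (suc u)))

          weight′ : total (weightOf σ₀ 1) lo (suc i) ≡ total (weightOf σ₀ 1) lo i + (suc r ∸ t)
          weight′ = trans (cong (total (weightOf σ₀ 1) lo) (sym (ℕ.+-comm i 1)))
            (trans (total-++ (weightOf σ₀ 1) lo i 1) (cong (total (weightOf σ₀ 1) lo i +_)
              (trans (ℕ.+-identityʳ _) (trans (binom-one (r ∸ tot σ₀ n))
                (trans (cong (λ t → suc (r ∸ t)) (sym (same-tot (R.same n n<m₁)))) (sym (∸-step t≤r)))))))

          next-run : ∀ σ″ → σ″ ≡ tick 1 σ′ → time σ ≤ lastBound i + 1 →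
            Fixed lastVars σ″ → rings σ″ (var zR) ≡ 0# → Ordered σ″ → Stored σ″ →
            LastFacts (suc i) (set nat (var iV) (suc i) (tick 3 σ″)) × time σ″ + 3 ≤ lastBound (suc i)
          next-run σ″ refl τ F z O S = record
            { vars = F ; zero≡ = z ; ordered = O ; stored = S
            ; same      = λ m m<m₁ → same-trans (R.same m m<m₁) (moved m)
            ; sound     = λ s s≤r → sound-same {σ = σ′} (ℕ.≤-reflexive (sym (ℕ.+-suc lo i))) (λ _ _ _ → refl) refl refl refl (L.sound s s≤r)
            ; dominated = dominated′ } ,
            ≤-trans (ℕ.+-monoˡ-≤ 3 (ℕ.+-monoˡ-≤ 1 (≤-trans (proj₂ L) (ℕ.+-monoˡ-≤ (suc r * 7 + ((suc r ∸ t) * leafTime + 1))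
                (≤-trans E.timely (ℕ.+-monoˡ-≤ enterTime τ))))))
                (ℕ.≤-reflexive (trans (rearrange₃ (time σ₀) i (total (weightOf σ₀ 1) lo i) (suc r ∸ t) leafTime enterTime (suc r * 7))
                  (cong (λ w → time σ₀ + (suc i * nodeTime + (w * leafTime + 1))) (sym weight′))))
            where
            moved : ∀ m → SameRow m σ (set nat (var iV) (suc i) (tick 3 (tick 1 σ′)))
            moved m = record { same-tot = same-tot (same′ m) ; same-par = same-par (same′ m) ; same-val = same-val (same′ m)
                             ; same-mrk = same-mrk (same′ m) ; same-ext = same-ext (same′ m) }

    last-round : ∀ i σ → i < cnt → nats σ (var iV) ≡ i → LastFacts i σ → time σ ≤ lastBound i + 1 →
      LastFacts (suc i) (set nat (var iV) (suc i) (tick 3 (⟦ process ⟧ σ))) ×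
      time (⟦ process ⟧ σ) + 3 ≤ lastBound (suc i)
    last-round i σ i<cnt i≡ R τ =
      entered (enter-correct l lo cnt i σ (proj₂ (LastFacts.vars R)) i≡ (LastFacts.ordered R) T
                 (Node.deletions (AtNode.node₀ i i<cnt σ R)))
      where
      open AtNode i i<cnt σ R using (n; σ₂; module Entrance)
      Goal : Set _
      Goal = LastFacts (suc i) (set nat (var iV) (suc i) (tick 3 (⟦ process ⟧ σ))) ×
             time (⟦ process ⟧ σ) + 3 ≤ lastBound (suc i)
      entered : Entered l n σ σ₂ → Goal
      entered E = ran (Entrance.offspring-last E (Entrance.first-run E))
        where
        ran : ∃[ σ′ ] (⟦ offspring ⟧ σ₂ ≡ tick 1 σ′ × Entrance.LeafRun E (suc r) σ′) → Goal
        ran (σ′ , e , L) = Entrance.Conclude.next-run E σ′ L (⟦ process ⟧ σ) e τ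
          (fixed-frame lastVars process refl σ (LastFacts.vars R))
          (trans (frame process ring (var zR) refl σ) (LastFacts.zero≡ R))
          (λ c k → trans (frame process nat (arr ORD c k) refl σ) (LastFacts.ordered R c k))
          (λ c k → trans (frame process ring (arr V c k) refl σ) (LastFacts.stored R c k))

    last-tick : ∀ {i σ} u → LastFacts i σ → LastFacts i (tick u σ)
    last-tick {σ = σ} u R = record
      { vars = vars ; zero≡ = zero≡ ; ordered = ordered ; stored = stored
      ; same = λ m m<m₁ → let S = same m m<m₁ in record { same-tot = same-tot S ; same-par = same-par S
          ; same-val = same-val S ; same-mrk = same-mrk S ; same-ext = same-ext S }
      ; sound = λ s s≤r → sound-same {σ = σ} {tick u σ} ≤-refl (λ _ _ _ → refl) refl refl refl (sound s s≤r)
      ; dominated = dominated }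
      where open LastFacts R

    last-admin : ∀ {i σ} k → LastFacts i σ → LastFacts i (set nat (var iV) k σ)
    last-admin {σ = σ} k R = record
      { vars = vars ; zero≡ = zero≡ ; ordered = ordered ; stored = stored
      ; same = λ m m<m₁ → let S = same m m<m₁ in record { same-tot = same-tot S ; same-par = same-par S
          ; same-val = same-val S ; same-mrk = same-mrk S ; same-ext = same-ext S }
      ; sound = λ s s≤r → sound-same {σ = σ} {set nat (var iV) k σ} ≤-refl (λ _ _ _ → refl) refl refl refl (sound s s≤r)
      ; dominated = dominated }
      where open LastFacts R

    last-nodes : LastFacts 0 σ₀ →
      LastFacts cnt (⟦ nodesLoop ⟧ σ₀) × time (⟦ nodesLoop ⟧ σ₀) ≤ lastBound cnt + 1
    last-nodes R₀ = for-rule (λ i σ → LastFacts i σ × time σ ≤ lastBound i)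
      (λ σ → LastFacts cnt σ × time σ ≤ lastBound cnt + 1)
      iV cntV process cnt σ₀
      (proj₁ (proj₂ (proj₂ (proj₂ (proj₂ (proj₂ (proj₂ (proj₂ (proj₂ (LastFacts.vars R₀))))))))))
      (last-admin {0} {tick 1 σ₀} 0 (last-tick {0} {σ₀} 1 R₀) , ≤-refl)
      (λ i σ i<cnt i≡ (R , τ) → last-round i (tick 1 σ) i<cnt i≡ (last-tick {i} {σ} 1 R) (ℕ.+-monoˡ-≤ 1 τ))
      (λ σ (R , τ) → last-tick {cnt} {σ} 1 R , ℕ.+-monoˡ-≤ 1 τ)

    last-complete : ∀ {σ} → LastFacts cnt σ → ∀ S → ∣ S ∣ ≤ r → Dominated S ∣ S ∣ σ
    last-complete R S ∣S∣≤r = let i , i<cnt , x , node , path = Layer.complete L₀ S ∣S∣≤r in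
      LastFacts.dominated R S ∣S∣≤r i i<cnt x node path

  -- All levels of the tree

  layer-same : ∀ {l lo cnt σ σ′} → (∀ m → SameRow m σ σ′) → Layer l lo cnt σ → Layer l lo cnt σ′
  layer-same {l} {lo} {cnt} {σ} {σ′} S L = record
    { nodes    = λ n lo≤n n< → let x , node = nodes n lo≤n n< in x , moved node
    ; complete = λ Z ∣Z∣ → let i , i<cnt , x , node , path = complete Z ∣Z∣ in
        i , i<cnt , x , moved node , path-same (S _) path
    ; fresh    = λ m ≤m e → trans (same-mrk (S m) e) (fresh m ≤m e)
    ; weight   = λ j → trans (total-cong (weightOf σ′ j) (weightOf σ j) lo cnt
        λ m _ _ → cong (λ t → binom (r ∸ t) j) (same-tot (S m))) (weight j) }
    where
    open Layer L
    moved : ∀ {n x} → Node l n x σ → Node l n x σ′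
    moved {n} = node-same {b = suc n} (λ m _ → S m) ≤-refl

  -- At depth 0 every node weighs 1.
  layer-count : ∀ {l lo cnt σ} → Layer l lo cnt σ → cnt ≡ binom r l
  layer-count {l} {lo} {cnt} {σ} L = trans (sym (total-one (weightOf σ 0) lo cnt λ _ → refl))
    (trans (Layer.weight L 0) (cong (binom r) (ℕ.+-identityʳ l)))

  outerVars : (lo cnt : ℕ) → List (Var × ℕ)
  outerVars lo cnt = (dV , d) ∷ (RV , suc r) ∷ (oneV , 1) ∷ (zV , 0) ∷ (DV , D) ∷ (loV , lo) ∷ (cntV , cnt) ∷ []

  record Between (l : ℕ) (σ : State) : Set (a ⊔ˡ ℓ₂) where
    field
      count   : ℕ
      vars    : Fixed (outerVars (binomSum r l) count) σ
      zero≡   : rings σ (var zR) ≡ 0#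
      ordered : Ordered σ
      stored  : Stored σ
      layer   : Layer l (binomSum r l) count σ
      unset   : ∀ i k → nats σ (arr BEST i k) ≡ 0

  record Searched (σ : State) : Set (a ⊔ˡ ℓ₁ ⊔ˡ ℓ₂) where
    field
      bound    : ℕ
      sound    : ∀ s → s ≤ r → Sound bound s σ
      complete : ∀ S → ∣ S ∣ ≤ r → Dominated S ∣ S ∣ σ

  between-tick : ∀ {l σ} u → Between l σ → Between l (tick u σ)
  between-tick u B = record
    { count = count ; vars = vars ; zero≡ = zero≡ ; ordered = ordered ; stored = stored ; unset = unset
    ; layer = layer-same (λ m → record { same-tot = refl ; same-par = refl ; same-val = refl
                                       ; same-mrk = λ _ → refl ; same-ext = λ _ _ → refl }) layer }
    where open Between B

  between-admin : ∀ {l σ} k → Between l σ → Between l (set nat (var lV) k σ)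
  between-admin k B = record
    { count = count ; vars = vars ; zero≡ = zero≡ ; ordered = ordered ; stored = stored ; unset = unset
    ; layer = layer-same (λ m → record { same-tot = refl ; same-par = refl ; same-val = refl
                                       ; same-mrk = λ _ → refl ; same-ext = λ _ _ → refl }) layer }
    where open Between B

  -- The states differ in variables and time only.
  searched-same : ∀ {σ σ′} → (∀ n q → ext σ′ n q ≡ ext σ n q) →
    (∀ s k → nats σ′ (arr BEST s k) ≡ nats σ (arr BEST s k)) →
    (∀ s → rings σ′ (arr VOL s 0) ≡ rings σ (arr VOL s 0)) → Searched σ → Searched σ′
  searched-same {σ} {σ′} e b w S = record
    { bound = bound
    ; sound = λ s s≤r → sound-same {σ = σ} {σ′} ≤-refl (λ m _ q → e m q) (b s 0) (w s) (b s 1) (sound s s≤r)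
    ; complete = λ Z ∣Z∣ → let x , h , le = complete Z ∣Z∣ in
        x , h , ⊑-respʳ (sym (b ∣ Z ∣ 0) , ≈-reflexive (sym (w ∣ Z ∣))) le }
    where open Searched S

  layerBound : ℕ → ℕ
  layerBound l = l * 12 + (binomSum r l * nodeTime + binomSum r (suc l) * childTime)

  module _ (T : ∀ l → l < D → TopRow l) where

    inner-level : ∀ l σ → suc l < D → nats σ (var lV) ≡ l → Between l σ →
      Between (suc l) (⟦ level ⟧ σ) ×
      time (⟦ level ⟧ σ) ≤ time σ + (7 + (binom r l * nodeTime + binom r (suc l) * childTime))
    inner-level l σ l<D l≡ B = finish (nodesLoop-correct start)
      where
      open Between B
      d≡ = proj₁ vars
      R≡ = proj₁ (proj₂ vars)
      one≡ = proj₁ (proj₂ (proj₂ vars))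
      z≡ = proj₁ (proj₂ (proj₂ (proj₂ vars)))
      D≡ = proj₁ (proj₂ (proj₂ (proj₂ (proj₂ vars))))
      lo≡ = proj₁ (proj₂ (proj₂ (proj₂ (proj₂ (proj₂ vars)))))
      cnt≡ = proj₁ (proj₂ (proj₂ (proj₂ (proj₂ (proj₂ (proj₂ vars))))))
      lo : ℕ
      lo = binomSum r l
      σ₁ σ₂ : State
      σ₁ = ⟦ startLevel ⟧ σ
      σ₂ = ⟦ nodesLoop ⟧ σ₁
      L₁ : Layer l lo count σ₁
      L₁ = layer-same (λ m → record { same-tot = refl ; same-par = refl ; same-val = refl
                                    ; same-mrk = λ _ → refl ; same-ext = λ _ _ → refl }) layer
      open InLevel l lo count l<D (T l (ℕ.<-trans ≤-refl l<D)) σ₁ L₁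
      start : Progress 0 0 σ₁
      start = record
        { vars     = R≡ , one≡ , z≡ , l≡ , D≡ , trans (cong₂ _+_ l≡ one≡) (ℕ.+-comm l 1) , lo≡ , cnt≡ , tt
        ; ordered  = ordered
        ; stored   = stored
        ; same     = λ _ _ → same-refl
        ; new≡     = refl
        ; next     = trans (cong₂ _+_ lo≡ cnt≡) (sym (ℕ.+-identityʳ _))
        ; nodes    = λ m m₁≤m m< → contradiction m₁≤m (ℕ.<⇒≱ (subst (m <_) (ℕ.+-identityʳ _) m<))
        ; complete = λ S _ i′ ()
        ; fresh    = subst (λ m → Fresh m σ₁) (sym (ℕ.+-identityʳ _)) (Layer.fresh L₁)
        ; weight   = λ j → refl
        ; best     = λ _ _ → refl }
      finish : ∃[ w ] (Progress count w σ₂ × time σ₂ ≤ time σ₁ + (count * nodeTime + (w * childTime + 2))) →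
        Between (suc l) (⟦ level ⟧ σ) ×
        time (⟦ level ⟧ σ) ≤ time σ + (7 + (binom r l * nodeTime + binom r (suc l) * childTime))
      finish (w , P , τ) = advance σ₂ (finished P) (Progress.new≡ P) (Progress.ordered P) (Progress.stored P)
          (λ i k → trans (Progress.best P i k) (unset i k))
          (trans (frame nodesLoop nat (var loV) refl σ₁) lo≡) (trans (frame nodesLoop nat (var cntV) refl σ₁) cnt≡)
          (trans (frame nodesLoop nat (var dV) refl σ₁) d≡) (trans (frame nodesLoop nat (var RV) refl σ₁) R≡)
          (trans (frame nodesLoop nat (var oneV) refl σ₁) one≡) (trans (frame nodesLoop nat (var zV) refl σ₁) z≡)
          (trans (frame nodesLoop nat (var DV) refl σ₁) D≡) (trans (frame nodesLoop ring (var zR) refl σ₁) zero≡) τ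
        where
        advance : ∀ σ₂ → Layer (suc l) (lo + count) w σ₂ → nats σ₂ (var newV) ≡ w → Ordered σ₂ → Stored σ₂ →
          (∀ i k → nats σ₂ (arr BEST i k) ≡ 0) → nats σ₂ (var loV) ≡ lo → nats σ₂ (var cntV) ≡ count →
          nats σ₂ (var dV) ≡ d → nats σ₂ (var RV) ≡ suc r → nats σ₂ (var oneV) ≡ 1 → nats σ₂ (var zV) ≡ 0 →
          nats σ₂ (var DV) ≡ D → rings σ₂ (var zR) ≡ 0# →
          time σ₂ ≤ time σ₁ + (count * nodeTime + (w * childTime + 2)) →
          Between (suc l) (⟦ endLevel ⟧ σ₂) ×
          time (⟦ endLevel ⟧ σ₂) ≤ time σ + (7 + (binom r l * nodeTime + binom r (suc l) * childTime))
        advance σ₂ L new≡ O V₂ U lo₂ cnt₂ d₂ R₂ one₂ z₂ D₂ zero₂ τ = record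
          { count   = w
          ; vars    = d₂ , R₂ , one₂ , z₂ , D₂ , trans (cong₂ _+_ lo₂ cnt₂) lo′ , new≡ , tt
          ; zero≡   = zero₂
          ; ordered = O
          ; stored  = V₂
          ; layer   = subst (λ lo → Layer (suc l) lo w (⟦ endLevel ⟧ σ₂)) lo′
              (layer-same (λ m → record { same-tot = refl ; same-par = refl ; same-val = refl
                                        ; same-mrk = λ _ → refl ; same-ext = λ _ _ → refl }) L)
          ; unset   = U } ,
          ≤-trans (ℕ.+-monoˡ-≤ 1 (ℕ.+-monoˡ-≤ 1 τ)) (ℕ.≤-reflexive (trans
            (rearrange₄ (time σ) (count * nodeTime) (w * childTime))
            (cong₂ (λ m n → time σ + (7 + (m * nodeTime + n * childTime))) (layer-count layer) (layer-count L))))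
          where
          lo′ : lo + count ≡ binomSum r (suc l)
          lo′ = cong (lo +_) (layer-count layer)

    last-level : ∀ l σ → suc l ≡ D → nats σ (var lV) ≡ l → Between l σ →
      Searched (⟦ level ⟧ σ) × time (⟦ level ⟧ σ) ≤ time σ + (7 + (binom r l * nodeTime + binom r D * leafTime))
    last-level l σ l≡D l≡ B = finish (last-nodes l lo count l≡D (T l (ℕ.≤-reflexive l≡D)) σ₁ L₁ start)
      where
      open Between B
      d≡ = proj₁ vars
      R≡ = proj₁ (proj₂ vars)
      one≡ = proj₁ (proj₂ (proj₂ vars))
      z≡ = proj₁ (proj₂ (proj₂ (proj₂ vars)))
      D≡ = proj₁ (proj₂ (proj₂ (proj₂ (proj₂ vars))))
      lo≡ = proj₁ (proj₂ (proj₂ (proj₂ (proj₂ (proj₂ vars)))))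
      cnt≡ = proj₁ (proj₂ (proj₂ (proj₂ (proj₂ (proj₂ (proj₂ vars))))))
      lo : ℕ
      lo = binomSum r l
      σ₁ σ₂ : State
      σ₁ = ⟦ startLevel ⟧ σ
      σ₂ = ⟦ nodesLoop ⟧ σ₁
      L₁ : Layer l lo count σ₁
      L₁ = layer-same (λ m → record { same-tot = refl ; same-par = refl ; same-val = refl
                                    ; same-mrk = λ _ → refl ; same-ext = λ _ _ → refl }) layer
      start : LastFacts l lo count l≡D (T l (ℕ.≤-reflexive l≡D)) σ₁ L₁ 0 σ₁
      start = record
        { vars      = d≡ , R≡ , one≡ , z≡ , l≡ , D≡ , trans (cong₂ _+_ l≡ one≡) (ℕ.+-comm l 1) , lo≡ , cnt≡ , tt
        ; zero≡     = zero≡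
        ; ordered   = ordered
        ; stored    = stored
        ; same      = λ _ _ → same-refl
        ; sound     = λ s _ → inj₁ (unset s 0)
        ; dominated = λ S _ i′ () }
      finish : LastFacts l lo count l≡D (T l (ℕ.≤-reflexive l≡D)) σ₁ L₁ count σ₂ ×
          time σ₂ ≤ lastBound l lo count l≡D (T l (ℕ.≤-reflexive l≡D)) σ₁ L₁ count + 1 →
        Searched (⟦ level ⟧ σ) × time (⟦ level ⟧ σ) ≤ time σ + (7 + (binom r l * nodeTime + binom r D * leafTime))
      finish (R , τ) = advance σ₂
        (record { bound = lo + count ; sound = LastFacts.sound R
                ; complete = last-complete l lo count l≡D (T l (ℕ.≤-reflexive l≡D)) σ₁ L₁ R }) τ
        where
        advance : ∀ σ₂ → Searched σ₂ →
          time σ₂ ≤ time σ₁ + (count * nodeTime + (total (weightOf σ₁ 1) lo count * leafTime + 1)) + 1 →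
          Searched (⟦ endLevel ⟧ σ₂) ×
          time (⟦ endLevel ⟧ σ₂) ≤ time σ + (7 + (binom r l * nodeTime + binom r D * leafTime))
        advance σ₂ S τ = searched-same {σ₂} {⟦ endLevel ⟧ σ₂} (λ _ _ → refl) (λ _ _ → refl) (λ _ → refl) S ,
          ≤-trans (ℕ.+-monoˡ-≤ 1 (ℕ.+-monoˡ-≤ 1 τ)) (ℕ.≤-reflexive (trans
            (rearrange₅ (time σ) (count * nodeTime) (total (weightOf σ₁ 1) lo count * leafTime))
            (cong₂ (λ m n → time σ + (7 + (m * nodeTime + n * leafTime))) (layer-count layer)
              (trans (Layer.weight L₁ 1) (cong (binom r) (trans (ℕ.+-comm l 1) l≡D))))))

    -- Leaves are not stored, so there is no layer at level `D`; after the last round the invariant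
    -- changes to the final claim about the recorded leaves.
    Stage : State → ℕ → State → Set (a ⊔ˡ ℓ₁ ⊔ˡ ℓ₂)
    Stage σ₀ l σ = (l < D × Between l σ × time σ ≤ time σ₀ + 1 + layerBound l) ⊎
                   (l ≡ D × Searched σ × time σ ≤ time σ₀ + 1 + searchBound)

    stage : ∀ σ₀ l σ → l < D → nats σ (var lV) ≡ l → Stage σ₀ l σ →
            Stage σ₀ (suc l) (set nat (var lV) (suc l) (tick 3 (⟦ level ⟧ (tick 1 σ))))
    stage σ₀ l σ l<D l≡ (inj₂ (e , _)) = contradiction e (ℕ.<⇒≢ l<D)
    stage σ₀ l σ l<D l≡ (inj₁ (_ , B , τ)) with ℕ.m≤n⇒m<n∨m≡n l<D
    ... | inj₁ sl<D = inj₁ (sl<D , go (inner-level l (tick 1 σ) sl<D l≡ (between-tick 1 B)))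
      where
      go : Between (suc l) (⟦ level ⟧ (tick 1 σ)) × time (⟦ level ⟧ (tick 1 σ)) ≤
             time σ + 1 + (7 + (binom r l * nodeTime + binom r (suc l) * childTime)) →
        Between (suc l) (set nat (var lV) (suc l) (tick 3 (⟦ level ⟧ (tick 1 σ)))) ×
        time (⟦ level ⟧ (tick 1 σ)) + 3 ≤ time σ₀ + 1 + layerBound (suc l)
      go (B′ , τ′) = between-admin (suc l) (between-tick 3 B′) ,
        ≤-trans (ℕ.+-monoˡ-≤ 3 (≤-trans τ′ (ℕ.+-monoˡ-≤ (7 + (binom r l * nodeTime + binom r (suc l) * childTime)) (ℕ.+-monoˡ-≤ 1 τ))))
          (≤-trans (ℕ.m≤m+n _ 1) (ℕ.≤-reflexive
            (rearrange₁₂ (time σ₀) l (binomSum r l) (binom r l) (binomSum r (suc l)) (binom r (suc l)) nodeTime childTime)))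
    ... | inj₂ l≡D = inj₂ (l≡D , go (last-level l (tick 1 σ) l≡D l≡ (between-tick 1 B)))
      where
      go : Searched (⟦ level ⟧ (tick 1 σ)) × time (⟦ level ⟧ (tick 1 σ)) ≤
             time σ + 1 + (7 + (binom r l * nodeTime + binom r D * leafTime)) →
        Searched (set nat (var lV) (suc l) (tick 3 (⟦ level ⟧ (tick 1 σ)))) ×
        time (⟦ level ⟧ (tick 1 σ)) + 3 ≤ time σ₀ + 1 + searchBound
      go (S , τ′) = searched-same {⟦ level ⟧ (tick 1 σ)} {set nat (var lV) (suc l) (tick 3 (⟦ level ⟧ (tick 1 σ)))}
          (λ _ _ → refl) (λ _ _ → refl) (λ _ → refl) S ,
        ≤-trans (ℕ.+-monoˡ-≤ 3 (≤-trans τ′ (ℕ.+-monoˡ-≤ (7 + (binom r l * nodeTime + binom r D * leafTime)) (ℕ.+-monoˡ-≤ 1 τ))))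
          (≤-trans (ℕ.m≤m+n _ 1) (ℕ.≤-reflexive (trans
            (rearrange₁₃ (time σ₀) l (binomSum r l) (binom r l) (binomSum r (suc l)) (binom r D) nodeTime childTime leafTime)
            (cong (λ l → time σ₀ + 1 + searchBoundAt l) l≡D))))

    levelsLoop : Cmd
    levelsLoop = for lV DV level

    rootVars : List (Var × ℕ)
    rootVars = (dV , d) ∷ (RV , suc r) ∷ (oneV , 1) ∷ (zV , 0) ∷ (DV , D) ∷ []

    root : Cmd
    root = setᶜ nat loV 0 ⨾ setᶜ nat cntV 1

    -- In zeroed arrays node 0 is already the root: it has no deletions and no marks. Its vector of
    -- bounds is arbitrary, as no column has been treated.
    between-root : ∀ σ → Fixed rootVars σ → rings σ (var zR) ≡ 0# → Ordered σ → Stored σ →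
      (∀ n → tot σ n ≡ 0) → (∀ n e → mrk σ n e ≡ 0) → (∀ i k → nats σ (arr BEST i k) ≡ 0) →
      Between 0 (⟦ root ⟧ σ)
    between-root σ (d≡ , R≡ , one≡ , z≡ , D≡ , _) zero≡ O V₀ Z M U = record
      { count = 1 ; vars = d≡ , R≡ , one≡ , z≡ , D≡ , refl , refl , tt
      ; zero≡ = zero≡ ; ordered = O ; stored = V₀ ; unset = U
      ; layer = record
          { nodes    = λ { zero _ _ → (λ _ → 0#) , node ; (suc n) _ (s≤s ()) }
          ; complete = λ S _ → 0 , s≤s z≤n , (λ _ → 0#) , node ,
              record { inside-S = λ q q< → contradiction (subst (q <_) (Z 0) q<) λ () ; attained = λ i () }
          ; fresh    = λ m _ e → M m e
          ; weight   = λ j → trans (ℕ.+-identityʳ _) (cong (λ t → binom (r ∸ t) j) (Z 0)) } }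
      where
      none : ∀ {b} {Q : Set b} {q} → q < tot σ 0 → Q
      none {q = q} q< = contradiction (subst (q <_) (Z 0) q<) λ ()
      node : Node 0 0 (λ _ → 0#) (⟦ root ⟧ σ)
      node = record
        { deletions = record
            { t≤r = subst (_≤ r) (sym (Z 0)) z≤n ; bounded = λ q → none ; injective = λ p< _ _ → none p<
            ; marked = λ q → none ; unmarked = λ e → inj₁ (M 0 e) }
        ; chain = _ ; covers = λ i () }

    levels-correct : ∀ σ → 0 < D → Between 0 (⟦ root ⟧ σ) →
      Searched (⟦ levels ⟧ σ) × time (⟦ levels ⟧ σ) ≤ time σ + (5 + childTime + searchBound)
    levels-correct σ 0<D B = for-rule (Stage σ₁) Goal lV DV level D σ₁
      (proj₁ (proj₂ (proj₂ (proj₂ (proj₂ (Between.vars B))))))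
      (inj₁ (0<D , between-admin {0} {tick 1 σ₁} 0 (between-tick {0} {σ₁} 1 B) , ℕ.m≤m+n _ (layerBound 0)))
      (stage σ₁) conclude
      where
      σ₁ : State
      σ₁ = ⟦ root ⟧ σ
      Goal : State → Set (a ⊔ˡ ℓ₁ ⊔ˡ ℓ₂)
      Goal σ′ = Searched σ′ × time σ′ ≤ time σ + (5 + childTime + searchBound)
      conclude : ∀ σ′ → Stage σ₁ D σ′ → Goal (tick 1 σ′)
      conclude σ′ (inj₁ (D<D , _))   = contradiction refl (ℕ.<⇒≢ D<D)
      conclude σ′ (inj₂ (_ , S , τ)) =
        searched-same {σ′} {tick 1 σ′} (λ _ _ → refl) (λ _ _ → refl) (λ _ → refl) S ,
        ≤-trans (ℕ.+-monoˡ-≤ 1 τ) (≤-trans (ℕ.m≤m+n _ (1 + childTime)) (ℕ.≤-reflexive (rearrange₁₄ (time σ) searchBound childTime)))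

-- Writing the answers

module Emission {a ℓ₁ ℓ₂} (K : OrderedRing a ℓ₁ ℓ₂) (lim r : ℕ)
                (room : ∀ z → z < r * r → 64 + z < lim) where

  open OrderedRingFacts K
  open Semantics K lim
  open Tree

  write-in-range : ∀ z x s → 64 + nats s (var z) < lim →
    ⟦ writeᶜ z x ⟧ s ≡ write (nats s (var z)) (fromℕ (nats s (var x))) (tick 4 s)
  write-in-range z x s p = if-false (<⇒≤ᵇ-false {lim} p)

  index< : ∀ {i q} → i < r → q ≤ i → i * r + q < suc i * r
  index< {i} {q} i<r q≤i = subst (i * r + q <_) (ℕ.+-comm (i * r) r) (ℕ.+-monoʳ-< (i * r) (ℕ.≤-<-trans q≤i i<r))

  rowTime outputTime : ℕ
  rowTime    = 11 + (r * (4 + steps emitOne) + 2)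
  outputTime = r * (4 + rowTime) + 2

  module _ (E : ℕ → ℕ → ℕ) (B : ℕ → ℕ) where

    Tables : State → Set
    Tables σ = (∀ n q → nats σ (arr EXT n q) ≡ E n q) × (∀ s → nats σ (arr BEST s 1) ≡ B s)

    emitVars : List (Var × ℕ)
    emitVars = (rV , r) ∷ (oneV , 1) ∷ []

    Emitted : ℕ → ℕ → State → Set a
    Emitted i p σ = ∀ q → q < p → flat σ (i * r + q) ≡ fromℕ (E (B (suc i)) q)

    -- Row `i` begins at index `i * r`, and no index below that is written any more; this protects
    -- the rows already emitted.
    emitAll-correct : ∀ i σ → i < r → Tables σ → nats σ (var nV) ≡ B (suc i) → nats σ (var fV) ≡ i * r →
      nats σ (var sV) ≡ suc i →
      (Emitted i (suc i) (⟦ emitAll ⟧ σ) × (∀ z → z < i * r → flat (⟦ emitAll ⟧ σ) z ≡ flat σ z)) ×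
      time (⟦ emitAll ⟧ σ) ≤ time σ + (r * (4 + steps emitOne) + 2)
    emitAll-correct i σ i<r tables n≡ f≡ s≡ = for-rule-timed
      (λ p σ′ → Tables σ′ × nats σ′ (var nV) ≡ B (suc i) × nats σ′ (var fV) ≡ i * r × Emitted i p σ′ ×
                (∀ z → z < i * r → flat σ′ z ≡ flat σ z))
      (λ σ′ → (Emitted i (suc i) σ′ × (∀ z → z < i * r → flat σ′ z ≡ flat σ z)) ×
              time σ′ ≤ time σ + (r * (4 + steps emitOne) + 2))
      pV sV emitOne (suc i) (steps emitOne) σ s≡
      (tables , n≡ , f≡ , (λ q ()) , λ _ _ → refl)
      (λ p σ′ p≤i p≡ X → round p (tick 1 σ′) (ℕ.≤-pred p≤i) p≡ X , time-loopFree emitOne refl (tick 1 σ′))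
      (λ σ′ (_ , _ , _ , em , keep) τ → (em , keep) ,
        ≤-trans τ (ℕ.+-monoʳ-≤ (time σ) (ℕ.+-monoˡ-≤ 2 (ℕ.*-monoˡ-≤ (4 + steps emitOne) i<r))))
      where
      Inv : ℕ → State → Set a
      Inv p σ′ = Tables σ′ × nats σ′ (var nV) ≡ B (suc i) × nats σ′ (var fV) ≡ i * r × Emitted i p σ′ ×
                 (∀ z → z < i * r → flat σ′ z ≡ flat σ z)
      round : ∀ p σ′ → p ≤ i → nats σ′ (var pV) ≡ p → Inv p σ′ → Inv (suc p) (⟦ emitOne ⟧ σ′)
      round p σ′ p≤i p≡ (T , n≡ , f≡ , em , keep) =
        subst (Inv (suc p)) (sym (write-in-range gV eV σ₁ (subst (λ z → 64 + z < lim) (sym g≡) in-range)))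
          (T , n≡ , f≡ ,
           (λ q q≤p → emitted q (ℕ.m≤n⇒m<n∨m≡n (ℕ.≤-pred q≤p))) ,
           λ z z< → trans (if-false (≢⇒≡ᵇ-false (λ e → ℕ.<⇒≢ (ℕ.<-≤-trans z< (ℕ.m≤m+n (i * r) p)) (trans e g≡)))) (keep z z<))
        where
        σ₁ : State
        σ₁ = ⟦ getᶜ nat eV EXT nV pV ⨾ addᶜ nat gV fV pV ⟧ σ′
        g≡ : nats σ₁ (var gV) ≡ i * r + p
        g≡ = cong₂ _+_ f≡ p≡
        e≡ : nats σ₁ (var eV) ≡ E (B (suc i)) p
        e≡ = trans (proj₁ T _ _) (cong₂ E n≡ p≡)
        in-range : 64 + (i * r + p) < lim
        in-range = room (i * r + p) (ℕ.<-≤-trans (index< i<r p≤i) (ℕ.*-monoˡ-≤ r i<r))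
        emitted : ∀ q → q < p ⊎ q ≡ p →
          (if i * r + q ≡ᵇ nats σ₁ (var gV) then fromℕ (nats σ₁ (var eV)) else flat σ′ (i * r + q)) ≡
          fromℕ (E (B (suc i)) q)
        emitted q (inj₁ q<p)  = trans (if-false (≢⇒≡ᵇ-false (λ e → ℕ.<⇒≢ q<p
          (ℕ.+-cancelˡ-≡ (i * r) q p (trans e g≡))))) (em q q<p)
        emitted q (inj₂ refl) = trans (if-true (trans (cong (i * r + q ≡ᵇ_) g≡) (≡ᵇ-refl (i * r + q)))) (cong fromℕ e≡)

    output-correct : ∀ σ → Fixed emitVars σ → Tables σ →
      (∀ i → i < r → Emitted i (suc i) (⟦ output ⟧ σ)) × time (⟦ output ⟧ σ) ≤ time σ + outputTime
    output-correct σ F@(r≡ , _) tables = for-rule-timed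
      (λ i σ′ → Fixed emitVars σ′ × Tables σ′ × (∀ i′ → i′ < i → Emitted i′ (suc i′) σ′))
      (λ σ′ → (∀ i → i < r → Emitted i (suc i) σ′) × time σ′ ≤ time σ + outputTime)
      iV rV emitRow r rowTime σ r≡ (F , tables , λ i ())
      (λ i σ′ i<r i≡ (F′ , T′ , em) → round i (tick 1 σ′) i<r i≡ F′ T′ em)
      (λ σ′ (_ , _ , em) τ → em , τ)
      where
      round : ∀ i σ′ → i < r → nats σ′ (var iV) ≡ i → Fixed emitVars σ′ → Tables σ′ →
        (∀ i′ → i′ < i → Emitted i′ (suc i′) σ′) →
        (Fixed emitVars (⟦ emitRow ⟧ σ′) × Tables (⟦ emitRow ⟧ σ′) ×
         (∀ i′ → i′ < suc i → Emitted i′ (suc i′) (⟦ emitRow ⟧ σ′))) ×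
        time (⟦ emitRow ⟧ σ′) ≤ time σ′ + rowTime
      round i σ′ i<r i≡ F′@(r≡ , one≡ , _) T′ em = finish (emitAll-correct i σ₁ i<r T′ n≡ (cong₂ _*_ i≡ r≡) s≡)
        where
        σ₁ : State
        σ₁ = ⟦ addᶜ nat sV iV oneV ⨾ getᶜ nat nV BEST sV oneV ⨾ mulᶜ nat fV iV rV ⟧ σ′
        s≡ : nats σ₁ (var sV) ≡ suc i
        s≡ = trans (cong₂ _+_ i≡ one≡) (ℕ.+-comm i 1)
        n≡ : nats σ₁ (var nV) ≡ B (suc i)
        n≡ = trans (cong₂ (λ s k → nats σ′ (arr BEST s k)) s≡ one≡) (proj₂ T′ (suc i))
        finish : (Emitted i (suc i) (⟦ emitAll ⟧ σ₁) × (∀ z → z < i * r → flat (⟦ emitAll ⟧ σ₁) z ≡ flat σ₁ z)) ×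
          time (⟦ emitAll ⟧ σ₁) ≤ time σ₁ + (r * (4 + steps emitOne) + 2) →
          (Fixed emitVars (⟦ emitRow ⟧ σ′) × Tables (⟦ emitRow ⟧ σ′) ×
           (∀ i′ → i′ < suc i → Emitted i′ (suc i′) (⟦ emitRow ⟧ σ′))) ×
          time (⟦ emitRow ⟧ σ′) ≤ time σ′ + rowTime
        finish ((now , keep) , τ) =
          (fixed-frame emitVars emitRow refl σ′ F′ ,
           ((λ n q → trans (frame emitRow nat (arr EXT n q) refl σ′) (proj₁ T′ n q)) ,
            (λ s → trans (frame emitRow nat (arr BEST s 1) refl σ′) (proj₂ T′ s))) ,
           λ i′ i′≤i → all i′ (ℕ.m≤n⇒m<n∨m≡n (ℕ.≤-pred i′≤i))) ,
          ≤-trans τ (ℕ.≤-reflexive (rearrange₆ (time σ′) (r * (4 + steps emitOne) + 2)))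
          where
          all : ∀ i′ → i′ < i ⊎ i′ ≡ i → Emitted i′ (suc i′) (⟦ emitAll ⟧ σ₁)
          all i′ (inj₂ refl) = now
          all i′ (inj₁ i′<i) q q≤i′ = trans (keep (i′ * r + q)
              (ℕ.<-≤-trans (index< (ℕ.<-trans i′<i i<r) (ℕ.≤-pred q≤i′)) (ℕ.*-monoˡ-≤ r i′<i)))
            (em i′ i′<i q q≤i′)

-- Recovering the parameters and loading the matrix

module SetupFacts {a ℓ₁ ℓ₂} (K : OrderedRing a ℓ₁ ℓ₂) (lim d r N q : ℕ) (1≤N : 1 ≤ N)
                  (q≡ : q ≡ 64 * (d * N)) (q+61≤lim : q + 61 ≤ lim) (matrix<q : 3 + N * (d * 2) ≤ q) where

  open OrderedRingFacts K
  open Semantics K lim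
  open Setup

  M : ℕ
  M = N * (d * 2)

  recoveredVars : List (Var × ℕ)
  recoveredVars = (dV , d) ∷ (DV , d * 2) ∷ (RV , suc r) ∷ (MV , M) ∷ (oneV , 1) ∷ (kV , 61) ∷ []

  countTime recoverTime : ℕ
  countTime   = q * (4 + steps countStep) + 2
  recoverTime = 5 + countTime

  -- After `j` rounds the counter is the minimum of `j` and `d`.
  Counted : ℕ → ℕ → Set
  Counted j n = (j ≤ d × n ≡ j) ⊎ (d ≤ j × n ≡ d)

  -- As `q = 64dN` with `N` positive, `64nN < q` holds exactly for `n < d`; and `d ≤ q`, so `q`
  -- rounds let the counter arrive at `d`.
  count-correct : ∀ s → nats s (var qV) ≡ q → nats s (var NV) ≡ N → nats s (var dV) ≡ 0 → nats s (var oneV) ≡ 1 →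
    nats (⟦ countLoop ⟧ s) (var dV) ≡ d × time (⟦ countLoop ⟧ s) ≤ time s + countTime
  count-correct s q₀ N₀ d₀ one₀ = for-rule-timed
    (λ j s′ → Fixed fixedVars s′ × Counted j (nats s′ (var dV)))
    (λ s′ → nats s′ (var dV) ≡ d × time s′ ≤ time s + countTime)
    xV qV countStep q (steps countStep) s q₀
    ((q₀ , N₀ , one₀ , tt) , inj₁ (z≤n , d₀))
    (λ j s′ j<q _ (F , Γ) → (fixed-frame fixedVars countStep refl (tick 1 s′) F , round j (tick 1 s′) F Γ) ,
      time-loopFree countStep refl (tick 1 s′))
    (λ s′ (_ , Γ) τ → done Γ , τ)
    where
    fixedVars : List (Var × ℕ)
    fixedVars = (qV , q) ∷ (NV , N) ∷ (oneV , 1) ∷ []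
    d≤q : d ≤ q
    d≤q = subst (d ≤_) (sym q≡) (≤-trans (≤-trans (ℕ.≤-reflexive (sym (ℕ.*-identityʳ d))) (ℕ.*-monoʳ-≤ d 1≤N))
      (ℕ.m≤m+n (d * N) (63 * (d * N))))
    done : ∀ {n} → Counted q n → n ≡ d
    done (inj₁ (q≤d , e)) = trans e (ℕ.≤-antisym q≤d d≤q)
    done (inj₂ (_ , e))   = e
    round : ∀ j s′ → Fixed fixedVars s′ → Counted j (nats s′ (var dV)) → Counted (suc j) (nats (⟦ countStep ⟧ s′) (var dV))
    round j s′ (q′ , N′ , one′ , _) Γ = if-nat (λ s″ → Counted (suc j) (nats s″ (var dV))) qV yV skip (addᶜ nat dV dV oneV)
      (⟦ mulᶜ nat yV dV NV ⨾ setᶜ nat eV 64 ⨾ mulᶜ nat yV eV yV ⟧ s′)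
      (λ q≤ → stop Γ (λ n<d → ℕ.<⇒≱ (below n<d) (subst₂ _≤_ q′ y≡ q≤)))
      (λ <q → go Γ (λ d≤n → ℕ.<⇒≱ (subst₂ _<_ y≡ q′ <q) (above d≤n)))
      where
      n : ℕ
      n = nats s′ (var dV)
      y≡ : 64 * (nats s′ (var dV) * nats s′ (var NV)) ≡ 64 * (n * N)
      y≡ = cong (λ m → 64 * (n * m)) N′
      below : n < d → 64 * (n * N) < q
      below n<d = subst (64 * (n * N) <_) (sym q≡) (ℕ.*-monoʳ-< 64 (ℕ.*-monoˡ-< N {{>-nonZero 1≤N}} n<d))
      above : d ≤ n → q ≤ 64 * (n * N)
      above d≤n = subst (_≤ 64 * (n * N)) (sym q≡) (ℕ.*-monoʳ-≤ 64 (ℕ.*-monoˡ-≤ N d≤n))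
      stop : Counted j n → ¬ n < d → Counted (suc j) n
      stop (inj₁ (j≤d , e)) n≮d = inj₂ (ℕ.m≤n⇒m≤1+n (subst (d ≤_) e (ℕ.≮⇒≥ n≮d)) ,
        ℕ.≤-antisym (subst (_≤ d) (sym e) j≤d) (ℕ.≮⇒≥ n≮d))
      stop (inj₂ (d≤j , e)) _   = inj₂ (ℕ.m≤n⇒m≤1+n d≤j , e)
      go : Counted j n → ¬ d ≤ n → Counted (suc j) (n + nats s′ (var oneV))
      go (inj₁ (j≤d , e)) d≰n = inj₁ (subst (_< d) e (ℕ.≰⇒> d≰n) , trans (cong₂ _+_ e one′) (ℕ.+-comm j 1))
      go (inj₂ (d≤j , e)) d≰n = contradiction (ℕ.≤-reflexive (sym e)) d≰n

  recover-correct : ∀ s → nats s (var qV) ≡ q → nats s (var NV) ≡ N → nats s (var rV) ≡ r → nats s (var dV) ≡ 0 →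
    Fixed recoveredVars (⟦ recover ⟧ s) × time (⟦ recover ⟧ s) ≤ time s + recoverTime
  recover-correct s q₀ N₀ r₀ d₀ = finish (⟦ countLoop ⟧ s₁)
    (frame countLoop nat (var oneV) refl s₁) (frame countLoop nat (var kV) refl s₁)
    (trans (frame countLoop nat (var rV) refl s₁) r₀) (trans (frame countLoop nat (var NV) refl s₁) N₀)
    (count-correct s₁ q₀ N₀ d₀ refl)
    where
    s₁ : State
    s₁ = ⟦ setᶜ nat oneV 1 ⨾ setᶜ nat kV 61 ⟧ s
    rest : Cmd
    rest = addᶜ nat DV dV dV ⨾ addᶜ nat RV rV oneV ⨾ mulᶜ nat MV NV DV
    finish : ∀ s₂ → nats s₂ (var oneV) ≡ 1 → nats s₂ (var kV) ≡ 61 → nats s₂ (var rV) ≡ r → nats s₂ (var NV) ≡ N →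
      nats s₂ (var dV) ≡ d × time s₂ ≤ time s₁ + countTime →
      Fixed recoveredVars (⟦ rest ⟧ s₂) × time (⟦ rest ⟧ s₂) ≤ time s + recoverTime
    finish s₂ one≡ k≡ r≡ N≡ (d≡ , τ) =
      (d≡ , D≡ , trans (cong₂ _+_ r≡ one≡) (ℕ.+-comm r 1) , cong₂ _*_ N≡ D≡ , one≡ , k≡ , tt) ,
      ≤-trans (ℕ.+-monoˡ-≤ 1 (ℕ.+-monoˡ-≤ 1 (ℕ.+-monoˡ-≤ 1 τ))) (ℕ.≤-reflexive (rearrange₁₉ (time s) countTime))
      where
      D≡ : nats s₂ (var dV) + nats s₂ (var dV) ≡ d * 2
      D≡ = trans (cong₂ _+_ d≡ d≡) (rearrange₁₅ d)

  read-in-range : ∀ x z s → 64 + nats s (var z) < lim →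
    ⟦ readᶜ x z ⟧ s ≡ set ring (var x) (flat s (nats s (var z))) (tick 4 s)
  read-in-range x z s p = if-false (<⇒≤ᵇ-false {lim} p)

  lowStep highStep : Cmd
  lowStep  = addᶜ nat yV oV xV ⨾ readᶜ aR yV ⨾ putᶜ ring IN xV zV aR
  highStep = readᶜ aR xV ⨾ addᶜ nat yV xV kV ⨾ putᶜ ring IN yV zV aR

  copyTime : ℕ
  copyTime = (61 * (4 + steps lowStep) + 2) + (M * (4 + steps highStep) + 2)

  inp : State → ℕ → Carrier
  inp s x = rings s (arr IN x 0)

  low-correct : ∀ o s → 64 + o ≡ q → nats s (var oV) ≡ o → nats s (var kV) ≡ 61 → nats s (var zV) ≡ 0 →
    ((∀ x → x < 61 → inp (⟦ copyLow ⟧ s) x ≡ flat s (o + x)) × (∀ z → flat (⟦ copyLow ⟧ s) z ≡ flat s z)) ×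
    time (⟦ copyLow ⟧ s) ≤ time s + (61 * (4 + steps lowStep) + 2)
  low-correct o s o≡ o₀ k₀ z₀ = for-rule-timed Inv
    (λ s′ → ((∀ x → x < 61 → inp s′ x ≡ flat s (o + x)) × (∀ z → flat s′ z ≡ flat s z)) ×
            time s′ ≤ time s + (61 * (4 + steps lowStep) + 2))
    xV kV lowStep 61 (steps lowStep) s k₀
    ((o₀ , z₀ , tt) , (λ x ()) , λ _ → refl)
    (λ j s′ j<61 j≡ I → round j (tick 1 s′) j<61 j≡ I , time-loopFree lowStep refl (tick 1 s′))
    (λ s′ (_ , p , f) τ → (p , f) , τ)
    where
    Inv : ℕ → State → Set a
    Inv j s′ = Fixed ((oV , o) ∷ (zV , 0) ∷ []) s′ × (∀ x → x < j → inp s′ x ≡ flat s (o + x)) ×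
               (∀ z → flat s′ z ≡ flat s z)
    round : ∀ j s′ → j < 61 → nats s′ (var xV) ≡ j → Inv j s′ → Inv (suc j) (⟦ lowStep ⟧ s′)
    round j s′ j<61 j≡ (F@(o≡′ , z≡ , _) , p , f) =
      subst (λ s″ → Inv (suc j) (⟦ putᶜ ring IN xV zV aR ⟧ s″)) (sym (read-in-range aR yV s₁ in-range))
        (F , (λ x x≤j → stored x (ℕ.m≤n⇒m<n∨m≡n (ℕ.≤-pred x≤j))) , f)
      where
      s₁ : State
      s₁ = ⟦ addᶜ nat yV oV xV ⟧ s′
      y≡ : nats s₁ (var yV) ≡ o + j
      y≡ = cong₂ _+_ o≡′ j≡
      in-range : 64 + nats s₁ (var yV) < lim
      in-range = ℕ.<-≤-trans (subst (_< q + 61) (sym (trans (cong (64 +_) y≡) (trans (sym (ℕ.+-assoc 64 o j)) (cong (_+ j) o≡))))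
        (ℕ.+-monoʳ-< q j<61)) q+61≤lim
      stored : ∀ x → x < j ⊎ x ≡ j →
        (if (x ≡ᵇ nats s′ (var xV)) ∧ (0 ≡ᵇ nats s′ (var zV)) then flat s′ (nats s₁ (var yV)) else inp s′ x) ≡ flat s (o + x)
      stored x (inj₁ x<j)  = trans (entry-row 0 (nats s′ (var zV)) (λ e → ℕ.<⇒≢ x<j (trans e j≡))) (p x x<j)
      stored x (inj₂ refl) = trans (entry-hit (sym j≡) (sym z≡)) (trans (f _) (cong (flat s) y≡))

  high-correct : ∀ s → nats s (var MV) ≡ M → nats s (var kV) ≡ 61 → nats s (var zV) ≡ 0 →
    ((∀ x → x < M → inp (⟦ copyHigh ⟧ s) (61 + x) ≡ flat s x) × (∀ x → x < 61 → inp (⟦ copyHigh ⟧ s) x ≡ inp s x)) ×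
    time (⟦ copyHigh ⟧ s) ≤ time s + (M * (4 + steps highStep) + 2)
  high-correct s M₀ k₀ z₀ = for-rule-timed Inv
    (λ s′ → ((∀ x → x < M → inp s′ (61 + x) ≡ flat s x) × (∀ x → x < 61 → inp s′ x ≡ inp s x)) ×
            time s′ ≤ time s + (M * (4 + steps highStep) + 2))
    xV MV highStep M (steps highStep) s M₀
    ((k₀ , z₀ , tt) , (λ x ()) , (λ _ _ → refl) , λ _ → refl)
    (λ j s′ j<M j≡ I → round j (tick 1 s′) j<M j≡ I , time-loopFree highStep refl (tick 1 s′))
    (λ s′ (_ , p , u , f) τ → (p , u) , τ)
    where
    Inv : ℕ → State → Set a
    Inv j s′ = Fixed ((kV , 61) ∷ (zV , 0) ∷ []) s′ × (∀ x → x < j → inp s′ (61 + x) ≡ flat s x) ×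
               (∀ x → x < 61 → inp s′ x ≡ inp s x) × (∀ z → flat s′ z ≡ flat s z)
    round : ∀ j s′ → j < M → nats s′ (var xV) ≡ j → Inv j s′ → Inv (suc j) (⟦ highStep ⟧ s′)
    round j s′ j<M j≡ (F@(k≡ , z≡ , _) , p , u , f) =
      subst (λ s″ → Inv (suc j) (⟦ addᶜ nat yV xV kV ⨾ putᶜ ring IN yV zV aR ⟧ s″)) (sym (read-in-range aR xV s′ in-range))
        (F , (λ x x≤j → stored x (ℕ.m≤n⇒m<n∨m≡n (ℕ.≤-pred x≤j))) ,
         (λ x x<61 → trans (entry-row 0 (nats s′ (var zV)) (λ e → ℕ.<⇒≢ (ℕ.<-≤-trans x<61 (ℕ.m≤m+n 61 j)) (trans e y≡))) (u x x<61)) , f)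
      where
      y≡ : nats s′ (var xV) + nats s′ (var kV) ≡ 61 + j
      y≡ = trans (cong₂ _+_ j≡ k≡) (ℕ.+-comm j 61)
      in-range : 64 + nats s′ (var xV) < lim
      in-range = ≤-trans (subst (λ x → suc (64 + x) ≤ 61 + (3 + M)) (sym j≡) (ℕ.+-monoʳ-< 64 j<M))
        (≤-trans (ℕ.+-monoʳ-≤ 61 matrix<q) (≤-trans (ℕ.≤-reflexive (ℕ.+-comm 61 q)) q+61≤lim))
      stored : ∀ x → x < j ⊎ x ≡ j →
        (if (61 + x ≡ᵇ (nats s′ (var xV) + nats s′ (var kV))) ∧ (0 ≡ᵇ nats s′ (var zV))
         then flat s′ (nats s′ (var xV)) else inp s′ (61 + x)) ≡ flat s x
      stored x (inj₁ x<j)  = trans (entry-row 0 (nats s′ (var zV)) (λ e → ℕ.<⇒≢ x<j (ℕ.+-cancelˡ-≡ 61 x j (trans e y≡)))) (p x x<j)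
      stored x (inj₂ refl) = trans (entry-hit (sym y≡) (sym z≡)) (trans (f _) (cong (flat s) j≡))

  -- Matrix entry `x` was given in cell `3 + x`. The first 61 entries were moved by the boot code to
  -- the cells from `q` on; entry 61 and its successors are still in place from cell 64 on.
  copy-correct : ∀ (m₀ : ℕ → Carrier) o s → 64 + o ≡ q → nats s (var oV) ≡ o → nats s (var kV) ≡ 61 → nats s (var zV) ≡ 0 →
    nats s (var MV) ≡ M → (∀ x → x < 61 → flat s (o + x) ≈ m₀ x) → (∀ z → 64 + z < q → flat s z ≈ m₀ (61 + z)) →
    (∀ x → x < M → inp (⟦ copy ⟧ s) x ≈ m₀ x) × time (⟦ copy ⟧ s) ≤ time s + copyTime
  copy-correct m₀ o s o≡ o₀ k₀ z₀ M₀ lows highs = finish (low-correct o s o≡ o₀ k₀ z₀)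
      (high-correct s₁ (trans (frame copyLow nat (var MV) refl s) M₀) (trans (frame copyLow nat (var kV) refl s) k₀)
        (trans (frame copyLow nat (var zV) refl s) z₀))
    where
    s₁ : State
    s₁ = ⟦ copyLow ⟧ s
    finish : ((∀ x → x < 61 → inp s₁ x ≡ flat s (o + x)) × (∀ z → flat s₁ z ≡ flat s z)) ×
        time s₁ ≤ time s + (61 * (4 + steps lowStep) + 2) →
      ((∀ x → x < M → inp (⟦ copyHigh ⟧ s₁) (61 + x) ≡ flat s₁ x) × (∀ x → x < 61 → inp (⟦ copyHigh ⟧ s₁) x ≡ inp s₁ x)) ×
        time (⟦ copyHigh ⟧ s₁) ≤ time s₁ + (M * (4 + steps highStep) + 2) →
      (∀ x → x < M → inp (⟦ copy ⟧ s) x ≈ m₀ x) × time (⟦ copy ⟧ s) ≤ time s + copyTime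
    finish ((p , f) , τ) ((p′ , u) , τ′) = entries ,
      ≤-trans τ′ (≤-trans (ℕ.+-monoˡ-≤ (M * (4 + steps highStep) + 2) τ) (ℕ.≤-reflexive (ℕ.+-assoc (time s) _ _)))
      where
      entries : ∀ x → x < M → inp (⟦ copyHigh ⟧ s₁) x ≈ m₀ x
      entries x x<M with x ℕ.<? 61
      ... | yes x<61 = ≈-trans (≈-reflexive (trans (u x x<61) (p x x<61))) (lows x x<61)
      ... | no x≮61 = subst (λ x → inp (⟦ copyHigh ⟧ s₁) x ≈ m₀ x) 61+y
          (≈-trans (≈-reflexive (trans (p′ y (ℕ.≤-<-trans (ℕ.m∸n≤m x 61) x<M)) (f y)))
            (highs y (≤-trans (subst (λ x → suc (3 + x) ≤ 3 + M) (sym 61+y) (ℕ.+-monoʳ-< 3 x<M)) matrix<q)))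
        where
        y : ℕ
        y = x ∸ 61
        61+y : 61 + y ≡ x
        61+y = ℕ.m+[n∸m]≡n (ℕ.≮⇒≥ x≮61)

  columnTime columnsTime : ℕ
  columnTime  = N * (4 + steps columnStep) + 2
  columnsTime = d * (4 + columnTime) + 2

  Entry : (ℕ → Carrier) → ℕ → ℕ → State → Set a
  Entry g c j s = rings s (arr V (c * 2) j) ≡ g (j * (d * 2) + c * 2) ×
                  rings s (arr V (suc (c * 2)) j) ≡ 0# ⊖ g (suc (j * (d * 2) + c * 2))

  columnVars : List (Var × ℕ)
  columnVars = (NV , N) ∷ (dV , d) ∷ (DV , d * 2) ∷ (oneV , 1) ∷ (zV , 0) ∷ []

  Columned : (ℕ → Carrier) → State → Set a
  Columned g s = Fixed columnVars s × rings s (var zR) ≡ 0# × (∀ x → inp s x ≡ g x)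

  columned-frame : ∀ {g} c → unwrittenVars c columnVars ≡ true → unwritten c ring (var zR) ≡ true →
    unwritten c ring (arr IN) ≡ true → ∀ s → Columned g s → Columned g (⟦ c ⟧ s)
  columned-frame c p q w s (F , z , i) = fixed-frame columnVars c p s F , trans (frame c ring (var zR) q s) z ,
    λ x → trans (frame c ring (arr IN x 0) w s) (i x)

  even≢odd : ∀ m n → m * 2 ≢ suc (n * 2)
  even≢odd m n e with () ← proj₂ (*+-injective 2 {m} {n} {0} {1} (s≤s z≤n) ≤-refl
    (trans (ℕ.+-identityʳ (m * 2)) (trans e (ℕ.+-comm 1 (n * 2)))))

  Written : ℕ → ℕ → Carrier → State → State → Set a
  Written w j u s s′ = rings s′ (arr V w j) ≡ u ×
    (∀ w′ j′ → (w′ ≢ w ⊎ j′ ≢ j) → rings s′ (arr V w′ j′) ≡ rings s (arr V w′ j′))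

  put-written : ∀ s w j u → nats s (var wV) ≡ w → nats s (var yV) ≡ j → rings s (var aR) ≡ u →
                Written w j u s (⟦ putᶜ ring V wV yV aR ⟧ s)
  put-written s w j u refl refl refl = entry-hit {i′ = w} {j′ = j} refl refl , other
    where
    other : ∀ w′ j′ → (w′ ≢ w ⊎ j′ ≢ j) → rings (⟦ putᶜ ring V wV yV aR ⟧ s) (arr V w′ j′) ≡ rings s (arr V w′ j′)
    other w′ j′ (inj₁ p) = entry-row j′ j p
    other w′ j′ (inj₂ p) = entry-column w′ w p

  low-written : ∀ g c j s → Columned g s → nats s (var xV) ≡ c → nats s (var yV) ≡ j →
    Written (c * 2) j (g (j * (d * 2) + c * 2)) s (⟦ columnLow ⟧ s) ×
    nats (⟦ columnLow ⟧ s) (var eV) ≡ j * (d * 2) + c * 2 × nats (⟦ columnLow ⟧ s) (var wV) ≡ c * 2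
  low-written g c j s ((_ , _ , D≡ , _ , z≡ , _) , _ , i≡) c≡ j≡ =
    put-written s₁ (c * 2) j _ w≡ j≡ (trans (cong₂ (λ x z → rings s (arr IN x z)) e≡ z≡) (i≡ _)) , e≡ , w≡
    where
    s₁ : State
    s₁ = ⟦ mulᶜ nat eV yV DV ⨾ addᶜ nat wV xV xV ⨾ addᶜ nat eV eV wV ⨾ getᶜ ring aR IN eV zV ⟧ s
    w≡ : nats s (var xV) + nats s (var xV) ≡ c * 2
    w≡ = trans (cong₂ _+_ c≡ c≡) (rearrange₂₉ c)
    e≡ : nats s (var yV) * nats s (var DV) + (nats s (var xV) + nats s (var xV)) ≡ j * (d * 2) + c * 2
    e≡ = cong₂ _+_ (cong₂ _*_ j≡ D≡) w≡

  high-written : ∀ g x w j s → Columned g s → nats s (var eV) ≡ x → nats s (var wV) ≡ w → nats s (var yV) ≡ j →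
    Written (suc w) j (0# ⊖ g (suc x)) s (⟦ columnHigh ⟧ s)
  high-written g x w j s ((_ , _ , _ , one≡ , z≡ , _) , zero≡ , i≡) e≡ w≡ j≡ =
    put-written s₁ (suc w) j _ (trans (cong₂ _+_ w≡ one≡) (ℕ.+-comm w 1)) j≡
      (cong₂ _⊖_ zero≡ (trans (cong₂ (λ x z → rings s (arr IN x z)) (trans (cong₂ _+_ e≡ one≡) (ℕ.+-comm x 1)) z≡) (i≡ _)))
    where
    s₁ : State
    s₁ = ⟦ addᶜ nat eV eV oneV ⨾ addᶜ nat wV wV oneV ⨾ getᶜ ring aR IN eV zV ⨾ subᶜ aR zR aR ⟧ s

  step-correct : ∀ g c j s → Columned g s → nats s (var xV) ≡ c → nats s (var yV) ≡ j →
    Entry g c j (⟦ columnStep ⟧ s) ×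
    (∀ c′ j′ → (c′ ≢ c ⊎ j′ ≢ j) → Entry g c′ j′ s → Entry g c′ j′ (⟦ columnStep ⟧ s))
  step-correct g c j s Γ c≡ j≡ = finish (⟦ columnLow ⟧ s) (low-written g c j s Γ c≡ j≡)
      (columned-frame columnLow refl refl refl s Γ) (trans (frame columnLow nat (var yV) refl s) j≡)
    where
    finish : ∀ s₁ → Written (c * 2) j (g (j * (d * 2) + c * 2)) s s₁ × nats s₁ (var eV) ≡ j * (d * 2) + c * 2 ×
        nats s₁ (var wV) ≡ c * 2 → Columned g s₁ → nats s₁ (var yV) ≡ j →
      Entry g c j (⟦ columnHigh ⟧ s₁) ×
      (∀ c′ j′ → (c′ ≢ c ⊎ j′ ≢ j) → Entry g c′ j′ s → Entry g c′ j′ (⟦ columnHigh ⟧ s₁))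
    finish s₁ ((hit , miss) , e≡ , w≡) Γ₁ j≡ = combine (⟦ columnHigh ⟧ s₁) (high-written g _ _ j s₁ Γ₁ e≡ w≡ j≡)
      where
      combine : ∀ s₂ → Written (suc (c * 2)) j (0# ⊖ g (suc (j * (d * 2) + c * 2))) s₁ s₂ →
        Entry g c j s₂ × (∀ c′ j′ → (c′ ≢ c ⊎ j′ ≢ j) → Entry g c′ j′ s → Entry g c′ j′ s₂)
      combine s₂ (hit′ , miss′) = (trans (miss′ (c * 2) j (inj₁ (even≢odd c c))) hit , hit′) ,
        λ c′ j′ h (p , p′) →
          trans (miss′ (c′ * 2) j′ (inj₁ (even≢odd c′ c)))
            (trans (miss (c′ * 2) j′ (Sum.map₁ (λ q e → q (ℕ.*-cancelʳ-≡ c′ c 2 e)) h)) p) ,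
          trans (miss′ (suc (c′ * 2)) j′ (Sum.map₁ (λ q e → q (ℕ.*-cancelʳ-≡ c′ c 2 (ℕ.suc-injective e))) h))
            (trans (miss (suc (c′ * 2)) j′ (inj₁ λ e → even≢odd c c′ (sym e))) p′)

  columnLoop-correct : ∀ g c s → Columned g s → nats s (var xV) ≡ c →
    (∀ c′ → c′ < c → ∀ j → j < N → Entry g c′ j s) →
    (∀ c′ → c′ < suc c → ∀ j → j < N → Entry g c′ j (⟦ columnLoop ⟧ s)) × time (⟦ columnLoop ⟧ s) ≤ time s + columnTime
  columnLoop-correct g c s Γ c≡ done = for-rule-timed
    (λ j s′ → Columned g s′ × nats s′ (var xV) ≡ c × (∀ c′ → c′ < c → ∀ j → j < N → Entry g c′ j s′) ×
              (∀ j′ → j′ < j → Entry g c j′ s′))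
    (λ s′ → (∀ c′ → c′ < suc c → ∀ j → j < N → Entry g c′ j s′) × time s′ ≤ time s + columnTime)
    yV NV columnStep N (steps columnStep) s (proj₁ (proj₁ Γ))
    (Γ , c≡ , done , λ j ())
    (λ j s′ j<N j≡ (Γ′ , c≡′ , done′ , now) → round j (tick 1 s′) j≡ Γ′ c≡′ done′ now , time-loopFree columnStep refl (tick 1 s′))
    (λ s′ (_ , _ , done′ , now) τ → (λ c′ c′≤c → all s′ done′ now c′ (ℕ.m≤n⇒m<n∨m≡n (ℕ.≤-pred c′≤c))) , τ)
    where
    all : ∀ s′ → (∀ c′ → c′ < c → ∀ j → j < N → Entry g c′ j s′) → (∀ j → j < N → Entry g c j s′) →
          ∀ c′ → c′ < c ⊎ c′ ≡ c → ∀ j → j < N → Entry g c′ j s′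
    all s′ done′ now c′ (inj₁ p)    = done′ c′ p
    all s′ done′ now c′ (inj₂ refl) = now
    round : ∀ j s′ → nats s′ (var yV) ≡ j → Columned g s′ → nats s′ (var xV) ≡ c →
      (∀ c′ → c′ < c → ∀ j → j < N → Entry g c′ j s′) → (∀ j′ → j′ < j → Entry g c j′ s′) →
      Columned g (⟦ columnStep ⟧ s′) × nats (⟦ columnStep ⟧ s′) (var xV) ≡ c ×
      (∀ c′ → c′ < c → ∀ j → j < N → Entry g c′ j (⟦ columnStep ⟧ s′)) ×
      (∀ j′ → j′ < suc j → Entry g c j′ (⟦ columnStep ⟧ s′))
    round j s′ j≡ Γ′ c≡′ done′ now =
      columned-frame columnStep refl refl refl s′ Γ′ , c≡′ ,
      (λ c′ c′<c j′ j′<N → proj₂ E c′ j′ (inj₁ (ℕ.<⇒≢ c′<c)) (done′ c′ c′<c j′ j′<N)) ,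
      λ j′ j′≤j → latest j′ (ℕ.m≤n⇒m<n∨m≡n (ℕ.≤-pred j′≤j))
      where
      E : Entry g c j (⟦ columnStep ⟧ s′) ×
          (∀ c′ j′ → (c′ ≢ c ⊎ j′ ≢ j) → Entry g c′ j′ s′ → Entry g c′ j′ (⟦ columnStep ⟧ s′))
      E = step-correct g c j s′ Γ′ c≡′ j≡
      latest : ∀ j′ → j′ < j ⊎ j′ ≡ j → Entry g c j′ (⟦ columnStep ⟧ s′)
      latest j′ (inj₁ p)    = proj₂ E c j′ (inj₂ (ℕ.<⇒≢ p)) (now j′ p)
      latest j′ (inj₂ refl) = proj₁ E

  columns-correct : ∀ g s → Columned g s →
    (∀ c → c < d → ∀ j → j < N → Entry g c j (⟦ columns ⟧ s)) × time (⟦ columns ⟧ s) ≤ time s + columnsTime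
  columns-correct g s Γ = for-rule-timed
    (λ c s′ → Columned g s′ × (∀ c′ → c′ < c → ∀ j → j < N → Entry g c′ j s′))
    (λ s′ → (∀ c → c < d → ∀ j → j < N → Entry g c j s′) × time s′ ≤ time s + columnsTime)
    xV dV columnLoop d columnTime s (proj₁ (proj₂ (proj₁ Γ)))
    (Γ , λ c ())
    (λ c s′ c<d c≡ (Γ′ , done) → round c (tick 1 s′) Γ′ (columnLoop-correct g c (tick 1 s′) Γ′ c≡ done))
    (λ s′ (_ , done) τ → done , τ)
    where
    round : ∀ c s′ → Columned g s′ →
      (∀ c′ → c′ < suc c → ∀ j → j < N → Entry g c′ j (⟦ columnLoop ⟧ s′)) × time (⟦ columnLoop ⟧ s′) ≤ time s′ + columnTime →
      (Columned g (⟦ columnLoop ⟧ s′) × (∀ c′ → c′ < suc c → ∀ j → j < N → Entry g c′ j (⟦ columnLoop ⟧ s′))) ×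
      time (⟦ columnLoop ⟧ s′) ≤ time s′ + columnTime
    round c s′ Γ′ (done , τ) = (columned-frame columnLoop refl refl refl s′ Γ′ , done) , τ

  blocksTime : ℕ
  blocksTime = 3 + N * (4 + steps blockStep)

  -- The first bound makes the blocks cover the column; the second keeps their total length, and
  -- hence the time of a full scan, linear in `N + r + 1`.
  Blocks : ℕ → Set
  Blocks nb = N ≤ nb * suc r × nb * suc r ≤ N + suc r

  blocks-correct : ∀ s → nats s (var NV) ≡ N → nats s (var RV) ≡ suc r → nats s (var oneV) ≡ 1 → nats s (var nbV) ≡ 0 →
    Blocks (nats (⟦ blocks ⟧ s) (var nbV)) × time (⟦ blocks ⟧ s) ≤ time s + blocksTime
  blocks-correct s N₀ R₀ one₀ nb₀ = for-rule-timed Inv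
    (λ s′ → Blocks (nats s′ (var nbV)) × time s′ ≤ time s + blocksTime)
    xV NV blockStep N (steps blockStep) (⟦ setᶜ nat yV 0 ⟧ s) N₀
    ((N₀ , R₀ , one₀ , tt) , cong (_* suc r) (sym nb₀) , inj₂ z≤n , subst (λ n → n * suc r ≤ N + suc r) (sym nb₀) z≤n)
    (λ j s′ j<N _ I → round j (tick 1 s′) I , time-loopFree blockStep refl (tick 1 s′))
    (λ s′ (_ , _ , e , u) τ → (enough e , u) ,
      ≤-trans τ (ℕ.≤-reflexive (rearrange₃₀ (time s) (N * (4 + steps blockStep)))))
    where
    Inv : ℕ → State → Set
    Inv j s′ = Fixed ((NV , N) ∷ (RV , suc r) ∷ (oneV , 1) ∷ []) s′ ×
      nats s′ (var yV) ≡ nats s′ (var nbV) * suc r ×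
      (N ≤ nats s′ (var nbV) * suc r ⊎ j ≤ nats s′ (var nbV)) × nats s′ (var nbV) * suc r ≤ N + suc r
    enough : ∀ {n} → N ≤ n * suc r ⊎ N ≤ n → N ≤ n * suc r
    enough (inj₁ p)     = p
    enough {n} (inj₂ p) = ≤-trans p (ℕ.m≤m*n n (suc r))
    round : ∀ j s′ → Inv j s′ → Inv (suc j) (⟦ blockStep ⟧ s′)
    round j s′ (F@(N≡ , R≡ , one≡ , _) , y≡ , e , u) = if-nat (Inv (suc j)) NV yV skip
      (addᶜ nat yV yV RV ⨾ addᶜ nat nbV nbV oneV) s′
      (λ N≤y → F , y≡ , inj₁ (subst₂ _≤_ N≡ y≡ N≤y) , u)
      (λ y<N → let y<N′ = subst₂ _<_ y≡ N≡ y<N in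
        F , trans (cong₂ _+_ y≡ R≡) (sym more) , inj₂ (grown y<N′ e) ,
        subst (_≤ N + suc r) (sym more) (ℕ.+-monoˡ-≤ (suc r) (ℕ.<⇒≤ y<N′)))
      where
      n : ℕ
      n = nats s′ (var nbV)
      more : (n + nats s′ (var oneV)) * suc r ≡ n * suc r + suc r
      more = trans (cong (λ o → (n + o) * suc r) one≡) (trans (cong (_* suc r) (ℕ.+-comm n 1)) (ℕ.+-comm (suc r) (n * suc r)))
      grown : n * suc r < N → N ≤ n * suc r ⊎ j ≤ n → suc j ≤ n + nats s′ (var oneV)
      grown p (inj₁ q) = contradiction q (ℕ.<⇒≱ p)
      grown p (inj₂ q) = subst (suc j ≤_) (trans (ℕ.+-comm 1 n) (cong (n +_) (sym one≡))) (s≤s q)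

-- Bounds up to a constant factor

module Complexity where

  record Size : Set where
    field
      d r N nb : ℕ
      1≤d      : 1 ≤ d
      1≤N      : 1 ≤ N
      r<N      : r < N
      nb≤      : nb * suc r ≤ N + suc r

  open Size

  infix 4 _≲_
  -- The constant precedes the size, so it is uniform in `d`, `r`, `N` and the number of blocks; the
  -- final constant is assembled by these rules without being computed by hand.
  _≲_ : (f g : Size → ℕ) → Set
  f ≲ g = ∃[ κ ] (∀ n → f n ≤ κ * g n)

  ≤⇒≲ : ∀ {f g} → (∀ n → f n ≤ g n) → f ≲ g
  ≤⇒≲ h = 1 , λ n → ≤-trans (h n) (ℕ.≤-reflexive (sym (ℕ.*-identityˡ _)))

  ≲-refl : ∀ {f} → f ≲ f
  ≲-refl = ≤⇒≲ λ _ → ≤-refl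

  ≲-trans : ∀ {f g h} → f ≲ g → g ≲ h → f ≲ h
  ≲-trans (κ , p) (κ′ , q) = κ * κ′ , λ n →
    ≤-trans (p n) (≤-trans (ℕ.*-monoʳ-≤ κ (q n)) (ℕ.≤-reflexive (sym (ℕ.*-assoc κ κ′ _))))

  infixr 5 _⊞_
  _⊞_ : ∀ {f g h} → f ≲ h → g ≲ h → (λ n → f n + g n) ≲ h
  (κ , p) ⊞ (κ′ , q) = κ + κ′ , λ n →
    ≤-trans (ℕ.+-mono-≤ (p n) (q n)) (ℕ.≤-reflexive (sym (ℕ.*-distribʳ-+ _ κ κ′)))

  times : ∀ {f g} (h : Size → ℕ) → f ≲ g → (λ n → h n * f n) ≲ (λ n → h n * g n)
  times {f} {g} h (κ , p) = κ , λ n → ≤-trans (ℕ.*-monoʳ-≤ (h n) (p n)) (ℕ.≤-reflexive (rearrange₃₁ (h n) κ (g n)))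

  scaled : ∀ {f g} k → f ≲ g → (λ n → f n * k) ≲ g
  scaled {f} {g} k (κ , p) = k * κ , λ n → ≤-trans (ℕ.*-monoˡ-≤ k (p n)) (ℕ.≤-reflexive (rearrange₃₂ κ (g n) k))

  constant : ∀ {g} k → (∀ n → 1 ≤ g n) → (λ _ → k) ≲ g
  constant k h = k , λ n → ≤-trans (ℕ.≤-reflexive (sym (ℕ.*-identityʳ k))) (ℕ.*-monoʳ-≤ k (h n))

  r₁ D B A X W : Size → ℕ
  r₁ n = suc (r n)
  D n  = d n * 2
  B n  = binom (r n) (D n)
  A n  = d n * N n
  X n  = d n * B n
  W n  = X n + A n

  1≤B : ∀ n → 1 ≤ B n
  1≤B n = binom-positive (r n) (D n)

  1≤X : ∀ n → 1 ≤ X n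
  1≤X n = ℕ.*-mono-≤ (1≤d n) (1≤B n)

  1≤W : ∀ n → 1 ≤ W n
  1≤W n = ≤-trans (1≤X n) (ℕ.m≤m+n (X n) (A n))

  unit : ∀ k → (λ _ → k) ≲ W
  unit k = constant k 1≤W

  X≲W : X ≲ W
  X≲W = ≤⇒≲ λ n → ℕ.m≤m+n (X n) (A n)

  A≲W : A ≲ W
  A≲W = ≤⇒≲ λ n → ℕ.m≤n+m (A n) (X n)

  d≲W : d ≲ W
  d≲W = ≲-trans (≤⇒≲ λ n → subst (_≤ A n) (ℕ.*-identityʳ (d n)) (ℕ.*-monoʳ-≤ (d n) (1≤N n))) A≲W

  N≲W : N ≲ W
  N≲W = ≲-trans (≤⇒≲ λ n → subst (_≤ A n) (ℕ.*-identityˡ (N n)) (ℕ.*-monoˡ-≤ (N n) (1≤d n))) A≲W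

  square : Size → ℕ
  square n = r₁ n * r₁ n

  square≲B : square ≲ B
  square≲B = 2 , λ n → square≤binom (r n) {D n} (ℕ.*-monoˡ-≤ 2 (1≤d n))

  B≲W : B ≲ W
  B≲W = ≲-trans (≤⇒≲ λ n → subst (_≤ X n) (ℕ.*-identityˡ (B n)) (ℕ.*-monoˡ-≤ (B n) (1≤d n))) X≲W

  square≲W : square ≲ W
  square≲W = ≲-trans square≲B B≲W

  r₁≲square : r₁ ≲ square
  r₁≲square = ≤⇒≲ λ n → ℕ.m≤m*n (r₁ n) (r₁ n)

  r₁≲W : r₁ ≲ W
  r₁≲W = ≲-trans r₁≲square square≲W

  D*≲ : ∀ {f : Size → ℕ} → (λ n → d n * f n) ≲ W → (λ n → D n * f n) ≲ W
  D*≲ {f} (κ , p) = 2 * κ , λ n → ≤-trans (ℕ.≤-reflexive (rearrange₃₃ (d n) (f n)))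
    (≤-trans (ℕ.*-monoʳ-≤ 2 (p n)) (ℕ.≤-reflexive (sym (ℕ.*-assoc 2 κ (W n)))))

  -- The cost of selecting the r + 1 greatest entries of one column.
  G : Size → ℕ
  G n = N n + square n

  1≤G : ∀ n → 1 ≤ G n
  1≤G n = ≤-trans (1≤N n) (ℕ.m≤m+n (N n) (square n))

  square≲G : square ≲ G
  square≲G = ≤⇒≲ λ n → ℕ.m≤n+m (square n) (N n)

  r₁≲G : r₁ ≲ G
  r₁≲G = ≲-trans r₁≲square square≲G

  nb-r₁≲G : (λ n → nb n * r₁ n) ≲ G
  nb-r₁≲G = ≲-trans (≤⇒≲ nb≤) (≤⇒≲ (λ n → ℕ.m≤m+n (N n) (square n)) ⊞ r₁≲G)

  nb≲G : nb ≲ G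
  nb≲G = ≲-trans (≤⇒≲ λ n → ℕ.m≤m*n (nb n) (r₁ n)) nb-r₁≲G

  one≲r₁ : ∀ k → (λ _ → k) ≲ r₁
  one≲r₁ k = constant k λ n → s≤s z≤n

  private module Times n = SelectionTimes (r₁ n) (nb n)

  open Times using (scanTime; searchTime; extractTime; selectTime) public

  scan≲ : scanTime ≲ r₁
  scan≲ = one≲r₁ 12 ⊞ scaled (4 + (2 + steps Select.consider)) ≲-refl

  -- The initial scan costs `nb * r₁`. Each of the `r₁` extractions searches `nb` winners and
  -- rescans `r₁` entries, so together they cost `nb * r₁` plus `r₁` squared, up to constants.
  select≲G : selectTime ≲ G
  select≲G = (nb*scan ⊞ constant 2 1≤G) ⊞ (r₁*extract ⊞ constant 2 1≤G)
    where
    nb*scan : (λ n → nb n * (4 + scanTime n)) ≲ G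
    nb*scan = ≲-trans (times nb (one≲r₁ 4 ⊞ scan≲)) nb-r₁≲G
    r₁*extract : (λ n → r₁ n * (4 + extractTime n)) ≲ G
    r₁*extract = ≲-trans (times r₁ (extract′)) (expand)
      where
      extract′ : (λ n → 4 + extractTime n) ≲ (λ n → nb n + r₁ n)
      extract′ = up (one≲r₁ 4) ⊞ (scaled (4 + (9 + steps Select.consider)) (≤⇒≲ λ n → ℕ.m≤m+n (nb n) (r₁ n)) ⊞ up (one≲r₁ 3)) ⊞
                 up (one≲r₁ 19 ⊞ scan≲)
        where
        up : ∀ {f} → f ≲ r₁ → f ≲ (λ n → nb n + r₁ n)
        up p = ≲-trans p (≤⇒≲ λ n → ℕ.m≤n+m (r₁ n) (nb n))
      expand : (λ n → r₁ n * (nb n + r₁ n)) ≲ G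
      expand = ≲-trans (≤⇒≲ λ n → ℕ.≤-reflexive (rearrange₁₆ (r₁ n) (nb n))) (nb-r₁≲G ⊞ square≲G)

  d*G≲W : (λ n → d n * G n) ≲ W
  d*G≲W = ≲-trans (≤⇒≲ λ n → ℕ.≤-reflexive (ℕ.*-distribˡ-+ (d n) (N n) (square n)))
    (A≲W ⊞ ≲-trans (times d square≲B) X≲W)

  selectAll≲W : (λ n → D n * (4 + selectTime n) + 2) ≲ W
  selectAll≲W = D*≲ {λ n → 4 + selectTime n} (≲-trans (times d (constant 4 1≤G ⊞ select≲G)) d*G≲W) ⊞ unit 2

  nodes : Size → ℕ
  nodes n = binomSum (r n) (D n)

  -- By `binomSum≡` the product is `2d` times the number of leaves.
  nodes*r₁≲W : (λ n → nodes n * r₁ n) ≲ W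
  nodes*r₁≲W = ≲-trans (≤⇒≲ λ n → ℕ.≤-reflexive (trans (ℕ.*-comm (nodes n) (r₁ n)) (binomSum≡ (r n) (D n))))
    (D*≲ {B} X≲W)

  nodes*≲W : ∀ {f} → f ≲ r₁ → (λ n → nodes n * f n) ≲ W
  nodes*≲W p = ≲-trans (times nodes p) nodes*r₁≲W

  leaves*≲W : ∀ {f} → f ≲ d → (λ n → B n * f n) ≲ W
  leaves*≲W p = ≲-trans (times B p) (≲-trans (≤⇒≲ λ n → ℕ.≤-reflexive (ℕ.*-comm (B n) (d n))) X≲W)

  one≲d : ∀ k → (λ _ → k) ≲ d
  one≲d k = constant k 1≤d

-- Column maxima and the volume of the intersection

module Geometry {a ℓ₁ ℓ₂} (K : OrderedRing a ℓ₁ ℓ₂) (d N : ℕ) (ℛ : Vector (Rectangle K d) N)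
                (v : ℕ → ℕ → OrderedRing.Carrier K) where

  open OrderedRingFacts K
  open OrderedRing K using (totalOrder; commutativeRing)
  open RingProperties (CommutativeRing.ring commutativeRing) using (-‿involutive; -‿+-comm)
  open Volumes K
  open Sides d
  open Interval
  open Extrema totalOrder using (max≤v⁺; xs≤max; v≤min⁺; min≤xs)

  module _ (v-lo : ∀ c j → v (toℕ c * 2) (toℕ j) ≈ lo (ℛ j c))
           (v-hi : ∀ c j → v (suc (toℕ c * 2)) (toℕ j) ≈ 0# ⊖ hi (ℛ j c))
           (L : Subset N) (ne : Subset.Nonempty L) where

    I : Rectangle K d
    I = intersection K ℛ L ne

    members : List (Fin N)
    members = List.filter (Subset._∈? L) (List.allFin N)

    member : ∀ {b} {B : Set b} (f : Fin N → B) {j} → j ∈ L → f j ∈ᴸ List.map f members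
    member f p = ∈-map⁺ f (∈-filter⁺ (Subset._∈? L) (∈-allFin _) p)

    every : ∀ {b p} {B : Set b} {Q : B → Set p} (f : Fin N → B) → (∀ j → j ∈ L → Q (f j)) →
            All Q (List.map f members)
    every f h = All.map⁺ (AllBase.map (λ {j} → h j) (All.all-filter (Subset._∈? L) (List.allFin N)))

    lo-least : ∀ c {u} → (∀ j → j ∈ L → lo (ℛ j c) ≼ u) → lo (I c) ≼ u
    lo-least c h = max≤v⁺ (h (proj₁ ne) (proj₂ ne)) (every (λ j → lo (ℛ j c)) h)

    lo-upper : ∀ c {j} → j ∈ L → lo (ℛ j c) ≼ lo (I c)
    lo-upper c p = AllBase.lookup (xs≤max _ _) (member (λ j → lo (ℛ j c)) p)

    hi-greatest : ∀ c {u} → (∀ j → j ∈ L → u ≼ hi (ℛ j c)) → u ≼ hi (I c)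
    hi-greatest c h = v≤min⁺ (h (proj₁ ne) (proj₂ ne)) (every (λ j → hi (ℛ j c)) h)

    hi-lower : ∀ c {j} → j ∈ L → hi (I c) ≼ hi (ℛ j c)
    hi-lower c p = AllBase.lookup (min≤xs _ _) (member (λ j → hi (ℛ j c)) p)

    0⊖≈ : ∀ y → 0# ⊖ y ≈ ⊝ y
    0⊖≈ y = +-identityˡ (⊝ y)

    side≈ : ∀ x i → side x i ≈ (⊝ x (suc (i * 2))) ⊖ x (i * 2)
    side≈ x i = ≈-trans (0⊖≈ _) (≈-sym (-‿+-comm _ _))

    even< : ∀ (c : Fin d) → toℕ c * 2 < d * 2
    even< c = ℕ.*-monoˡ-< 2 (Fin.toℕ<n c)

    odd< : ∀ (c : Fin d) → suc (toℕ c * 2) < d * 2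
    odd< c = ℕ.*-monoˡ-≤ 2 (Fin.toℕ<n c)

    ≼*-from : ∀ x {g} (R : Fin g → Interval K) i → (∀ c → side x (i + toℕ c) ≼ lengthOf (R c)) →
              sidesFrom x i g ≼* List.map lengthOf (List.tabulate R)
    ≼*-from x {zero}  R i h = []
    ≼*-from x {suc g} R i h = subst (λ k → side x k ≼ lengthOf (R Fin.zero)) (ℕ.+-identityʳ i) (h Fin.zero) ∷
      ≼*-from x (R ∘ Fin.suc) (suc i) λ c → subst (λ k → side x k ≼ lengthOf (R (Fin.suc c))) (ℕ.+-suc i (toℕ c)) (h (Fin.suc c))

    ≼*-to : ∀ x {g} (R : Fin g → Interval K) i → (∀ c → lengthOf (R c) ≼ side x (i + toℕ c)) →
            List.map lengthOf (List.tabulate R) ≼* sidesFrom x i g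
    ≼*-to x {zero}  R i h = []
    ≼*-to x {suc g} R i h = subst (λ k → lengthOf (R Fin.zero) ≼ side x k) (ℕ.+-identityʳ i) (h Fin.zero) ∷
      ≼*-to x (R ∘ Fin.suc) (suc i) λ c → subst (λ k → lengthOf (R (Fin.suc c)) ≼ side x k) (ℕ.+-suc i (toℕ c)) (h (Fin.suc c))

    -- Raising the column maxima moves both endpoints inwards, so every side computed from `x` is at
    -- most the true one.
    covered⇒volume : ∀ x → (∀ i → i < d * 2 → ∀ j → j ∈ L → v i (toℕ j) ≼ x i) → volumeCode x ⊑ codeOf (lengths I)
    covered⇒volume x h = codeOf-mono (≼*-from x I 0 λ c → ≼-respˡ (≈-sym (side≈ x (toℕ c)))
      (-‿mono-anti
        (hi-greatest c λ j p → ≼-respʳ (≈-trans (-‿cong (≈-trans (v-hi c j) (0⊖≈ _))) (-‿involutive _))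
          (-‿anti (h _ (odd< c) j p)))
        (lo-least c λ j p → ≼-respˡ (v-lo c j) (h _ (even< c) j p))))

    -- Here each `x i` lies below an entry of a remaining row, hence below the column maximum, and
    -- the computed sides are at least the true ones.
    attained⇒volume : ∀ x → (∀ i → i < d * 2 → ∃[ j ] (j ∈ L × x i ≼ v i (toℕ j))) → codeOf (lengths I) ⊑ volumeCode x
    attained⇒volume x h = codeOf-mono (≼*-to x I 0 λ c → ≼-respʳ (≈-sym (side≈ x (toℕ c)))
      (-‿mono-anti
        (let j , p , le = h _ (odd< c) in ≼-trans (hi-lower c p)
          (≼-respˡ (≈-trans (-‿cong (≈-trans (v-hi c j) (0⊖≈ _))) (-‿involutive _)) (-‿anti le)))
        (let j , p , le = h _ (even< c) in ≼-trans (≼-respʳ (v-lo c j) le) (lo-upper c p))))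

-- Assembling the program and its correctness

split-program : ∀ {P} ps c qs → P ≡ ps ++ (code c (length ps) ++ qs) →
  CodeAt P 0 ps × CodeAt P (length ps) (code c (length ps)) × CodeAt P (exit c (length ps)) qs
split-program {P} ps c qs e = proj₁ whole , CodeAt-code c (length ps) rest
  where
  whole : CodeAt P 0 ps × CodeAt P (length ps + 0) (code c (length ps) ++ qs)
  whole = CodeAt-++ 0 ps (subst (CodeAt P 0) e (CodeAt-suffix [] P refl))
  rest : CodeAt P (length ps) (code c (length ps) ++ qs)
  rest = subst (λ k → CodeAt P k (code c (length ps) ++ qs)) (ℕ.+-identityʳ (length ps)) (proj₂ whole)

module Execution {a ℓ₁ ℓ₂} (K : OrderedRing a ℓ₁ ℓ₂) {d N : ℕ} (r : ℕ)
                 (1≤d : 1 ≤ d) (1≤N : 1 ≤ N) (ℛ : Vector (Rectangle K d) N)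
                 (q : ℕ) (q-def : doubles 6 (d * N) ≡ q) where

  open OrderedRingFacts K
  open Prologue K r 1≤d 1≤N ℛ q q-def using (boot)
  open Prologue K r 1≤d 1≤N ℛ q q-def public
    using (m₀; lim; q≡; 64≤q; 64≤lim; q+61≤lim; matrix<q; 1≤dN; Initial; module Initial)
  open Semantics K lim

  bootTime : ℕ
  bootTime = 7 + (61 * 4 + 9)

  record Executed (c : Cmd) (P : Program) : Set (a ⊔ˡ ℓ₁ ⊔ˡ ℓ₂) where
    field
      start    : State
      initial  : Initial P start
      duration : ℕ
      final    : Memory K
      run      : Run K P 0 m₀ duration final
      timing   : duration ≡ bootTime + (time (⟦ c ⟧ start) + 2)
      pointer  : final 0 ≈ fromℕ 64
      contents : ∀ z → 64 + z < lim → final (64 + z) ≈ flat (⟦ c ⟧ start) z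

  execute : ∀ c P → wellFormed c ≡ true → P ≡ prologue ++ (code c (length prologue) ++ epilogue) → Executed c P
  execute c P w e = booted (boot P (proj₁ parts))
    where
    open Simulation K lim 64≤lim P
    parts : CodeAt P 0 prologue × CodeAt P (length prologue) (code c (length prologue)) ×
            CodeAt P (exit c (length prologue)) epilogue
    parts = split-program prologue c epilogue e
    booted : ∃[ m ] ∃[ s ] (Reach 0 m₀ bootTime (length prologue) m × Sim m s × Initial P s) → Executed c P
    booted (m , s , R , S , I) = simulated (simulate c (length prologue) w (proj₁ (proj₂ parts)) S)
      where
      simulated : Simulates (length prologue) m s (exit c (length prologue)) (⟦ c ⟧ s) → Executed c P
      simulated (wrap (m′ , n , R′ , S′ , T)) = record
        { start    = s
        ; initial  = I
        ; run      = R (R′ (step (proj₁ (proj₂ (proj₂ parts))) const (halt (proj₁ (proj₂ (proj₂ (proj₂ parts)))))))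
        ; timing   = cong (λ n → bootTime + (n + 2)) (sym (trans T (cong (_+ n) (Initial.time-zero I))))
        ; pointer  = ≈-refl
        ; contents = λ z z< → flat-cells S′ z z< }

module SetupStage {a ℓ₁ ℓ₂} (K : OrderedRing a ℓ₁ ℓ₂) {d N : ℕ} (r : ℕ)
                  (1≤d : 1 ≤ d) (1≤N : 1 ≤ N) (ℛ : Vector (Rectangle K d) N)
                  (q : ℕ) (q-def : doubles 6 (d * N) ≡ q) (P : Program) where

  open OrderedRingFacts K
  open Execution K r 1≤d 1≤N ℛ q q-def
  open InputFacts K r ℛ using (input-entry)
  open Semantics K lim
  open SetupFacts K lim d r N q 1≤N q≡ q+61≤lim matrix<q
  open Interval

  setupTime : ℕ
  setupTime = recoverTime + (copyTime + (columnsTime + blocksTime))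

  -- All arrays of natural numbers are still zero: no flags, no marks, no deletions and nothing
  -- recorded, which is where selection and search start.
  record Prepared (s : State) : Set (a ⊔ˡ ℓ₁) where
    field
      nb     : ℕ
      vars   : Fixed ((NV , N) ∷ (RV , suc r) ∷ (nbV , nb) ∷ (oneV , 1) ∷ (zV , 0) ∷ (DV , d * 2) ∷ (dV , d) ∷ (rV , r) ∷ []) s
      zero≡  : rings s (var zR) ≡ 0#
      nb≥    : N ≤ nb * suc r
      nb≤    : nb * suc r ≤ N + suc r
      arrays : ∀ b i j → nats s (arr b i j) ≡ 0
      v-lo   : ∀ (c : Fin d) (j : Fin N) → rings s (arr V (toℕ c * 2) (toℕ j)) ≈ lo (ℛ j c)
      v-hi   : ∀ (c : Fin d) (j : Fin N) → rings s (arr V (suc (toℕ c * 2)) (toℕ j)) ≈ 0# ⊖ hi (ℛ j c)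

  open Setup using (recover; copy; columns; blocks)

  kept : List (Var × ℕ)
  kept = (NV , N) ∷ (RV , suc r) ∷ (oneV , 1) ∷ (zV , 0) ∷ (DV , d * 2) ∷ (dV , d) ∷ (rV , r) ∷ (nbV , 0) ∷ []

  Arrays : State → Set
  Arrays s = ∀ b i j → nats s (arr b i j) ≡ 0

  after-columns : ∀ g s → Fixed kept s → rings s (var zR) ≡ 0# → Arrays s →
    (∀ x → x < M → g x ≈ m₀ (3 + x)) → (∀ c → c < d → ∀ j → j < N → Entry g c j s) →
    Prepared (⟦ blocks ⟧ s) × time (⟦ blocks ⟧ s) ≤ time s + blocksTime
  after-columns g s (N≡ , R≡ , one≡ , z≡ , D≡ , d≡ , r≡ , nb≡ , _) zero≡ Z g≈ E =
    finish (blocks-correct s N≡ R≡ one≡ nb≡)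
    where
    s′ : State
    s′ = ⟦ blocks ⟧ s
    index : ∀ (c : Fin d) (j : Fin N) {k} → k < 2 → toℕ j * (d * 2) + (toℕ c * 2 + k) < M
    index c j {k} k<2 = ℕ.<-≤-trans
      (ℕ.+-monoʳ-< (toℕ j * (d * 2)) (ℕ.<-≤-trans (ℕ.+-monoʳ-< (toℕ c * 2) k<2)
        (≤-trans (ℕ.≤-reflexive (ℕ.+-comm (toℕ c * 2) 2)) (ℕ.*-monoˡ-≤ 2 (Fin.toℕ<n c)))))
      (≤-trans (ℕ.≤-reflexive (ℕ.+-comm (toℕ j * (d * 2)) (d * 2))) (ℕ.*-monoˡ-≤ (d * 2) (Fin.toℕ<n j)))
    even : ∀ (c : Fin d) (j : Fin N) → g (toℕ j * (d * 2) + toℕ c * 2) ≈ lo (ℛ j c)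
    even c j = subst (λ x → g (toℕ j * (d * 2) + x) ≈ lo (ℛ j c)) (ℕ.+-identityʳ (toℕ c * 2))
      (≈-trans (g≈ _ (index c j (s≤s z≤n))) (≈-reflexive (input-entry j c (s≤s z≤n))))
    odd : ∀ (c : Fin d) (j : Fin N) → g (suc (toℕ j * (d * 2) + toℕ c * 2)) ≈ hi (ℛ j c)
    odd c j = subst (λ x → g x ≈ hi (ℛ j c))
      (trans (cong (toℕ j * (d * 2) +_) (ℕ.+-comm (toℕ c * 2) 1)) (ℕ.+-suc (toℕ j * (d * 2)) (toℕ c * 2)))
      (≈-trans (g≈ _ (index c j ≤-refl)) (≈-reflexive (input-entry j c ≤-refl)))
    finish : Blocks (nats s′ (var nbV)) × time s′ ≤ time s + blocksTime →
             Prepared s′ × time s′ ≤ time s + blocksTime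
    finish ((nb≥ , nb≤) , τ) = record
      { nb     = nats s′ (var nbV)
      ; vars   = trans (frame blocks nat (var NV) refl s) N≡ , trans (frame blocks nat (var RV) refl s) R≡ , refl ,
                 trans (frame blocks nat (var oneV) refl s) one≡ , trans (frame blocks nat (var zV) refl s) z≡ ,
                 trans (frame blocks nat (var DV) refl s) D≡ , trans (frame blocks nat (var dV) refl s) d≡ ,
                 trans (frame blocks nat (var rV) refl s) r≡ , tt
      ; zero≡  = trans (frame blocks ring (var zR) refl s) zero≡
      ; nb≥    = nb≥
      ; nb≤    = nb≤
      ; arrays = λ b i j → trans (frame blocks nat (arr b i j) refl s) (Z b i j)
      ; v-lo   = λ c j → ≈-trans (≈-reflexive (trans (frame blocks ring (arr V (toℕ c * 2) (toℕ j)) refl s)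
          (proj₁ (E (toℕ c) (Fin.toℕ<n c) (toℕ j) (Fin.toℕ<n j))))) (even c j)
      ; v-hi   = λ c j → ≈-trans (≈-reflexive (trans (frame blocks ring (arr V (suc (toℕ c * 2)) (toℕ j)) refl s)
          (proj₂ (E (toℕ c) (Fin.toℕ<n c) (toℕ j) (Fin.toℕ<n j))))) (⊖-cong ≈-refl (odd c j)) } , τ

  after-copy : ∀ s → Fixed kept s → rings s (var zR) ≡ 0# → Arrays s →
    (∀ x → x < M → inp s x ≈ m₀ (3 + x)) →
    Prepared (⟦ columns ⨾ blocks ⟧ s) × time (⟦ columns ⨾ blocks ⟧ s) ≤ time s + (columnsTime + blocksTime)
  after-copy s F@(N≡ , R≡ , one≡ , z≡ , D≡ , d≡ , _) zero≡ Z g≈ =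
    finish (columns-correct (inp s) s ((N≡ , d≡ , D≡ , one≡ , z≡ , tt) , zero≡ , λ _ → refl))
    where
    s′ : State
    s′ = ⟦ columns ⟧ s
    chain : ∀ {t u} w → t ≤ u + blocksTime → u ≤ w + columnsTime → t ≤ w + (columnsTime + blocksTime)
    chain w p q = ≤-trans p (≤-trans (ℕ.+-monoˡ-≤ blocksTime q) (ℕ.≤-reflexive (ℕ.+-assoc w columnsTime blocksTime)))
    finish : (∀ c → c < d → ∀ j → j < N → Entry (inp s) c j s′) × time s′ ≤ time s + columnsTime →
      Prepared (⟦ columns ⨾ blocks ⟧ s) × time (⟦ columns ⨾ blocks ⟧ s) ≤ time s + (columnsTime + blocksTime)
    finish (E , τ) = conclude (after-columns (inp s) s′ (fixed-frame kept columns refl s F)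
        (trans (frame columns ring (var zR) refl s) zero≡)
        (λ b i j → trans (frame columns nat (arr b i j) refl s) (Z b i j)) g≈ E)
      where
      conclude : Prepared (⟦ blocks ⟧ s′) × time (⟦ blocks ⟧ s′) ≤ time s′ + blocksTime →
        Prepared (⟦ columns ⨾ blocks ⟧ s) × time (⟦ columns ⨾ blocks ⟧ s) ≤ time s + (columnsTime + blocksTime)
      conclude (p , τ′) = p , chain (time s) τ′ τ

  setup-correct : ∀ s → Initial P s → Prepared (⟦ setup ⟧ s) × time (⟦ setup ⟧ s) ≤ setupTime
  setup-correct s I = finish (recover-correct s q-var N-var r-var (others dV (ℕ.≤ᵇ⇒≤ 4 4 tt)))
    where
    open Initial I
    o : ℕ
    o = nats s (var oV)
    s₁ : State
    s₁ = ⟦ recover ⟧ s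
    flat≡ : ∀ z → flat s₁ z ≡ flat s z
    flat≡ z = cong (λ f → f z) (flat-frame recover refl s)
    rest : Cmd
    rest = columns ⨾ blocks
    chain : ∀ {t u} w → t ≤ u + (columnsTime + blocksTime) → u ≤ w + copyTime → w ≤ 0 + recoverTime → t ≤ setupTime
    chain w p q r = ≤-trans p (≤-trans (ℕ.+-monoˡ-≤ _ (≤-trans q (ℕ.+-monoˡ-≤ copyTime r)))
      (ℕ.≤-reflexive (ℕ.+-assoc recoverTime copyTime (columnsTime + blocksTime))))
    finish : Fixed recoveredVars s₁ × time s₁ ≤ time s + recoverTime →
             Prepared (⟦ setup ⟧ s) × time (⟦ setup ⟧ s) ≤ setupTime
    finish ((d≡ , D≡ , R≡ , M≡ , one≡ , k≡ , _) , τ) = copied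
        (copy-correct (λ x → m₀ (3 + x)) o s₁ o-var (frame recover nat (var oV) refl s) k≡ z≡ M≡
          (λ x x<61 → ≈-trans (≈-reflexive (flat≡ (o + x))) (low x x<61))
          (λ z z< → ≈-trans (≈-reflexive (flat≡ z)) (high z z<)))
      where
      z≡ : nats s₁ (var zV) ≡ 0
      z≡ = trans (frame recover nat (var zV) refl s) (others zV (ℕ.≤ᵇ⇒≤ 4 9 tt))
      kept₁ : Fixed kept s₁
      kept₁ = trans (frame recover nat (var NV) refl s) N-var , R≡ , one≡ , z≡ , D≡ , d≡ ,
        trans (frame recover nat (var rV) refl s) r-var ,
        trans (frame recover nat (var nbV) refl s) (others nbV (ℕ.≤ᵇ⇒≤ 4 11 tt)) , tt
      s₂ : State
      s₂ = ⟦ copy ⟧ s₁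
      copied : (∀ x → x < M → inp s₂ x ≈ m₀ (3 + x)) × time s₂ ≤ time s₁ + copyTime →
               Prepared (⟦ setup ⟧ s) × time (⟦ setup ⟧ s) ≤ setupTime
      copied (g≈ , τ′) = conclude (after-copy s₂ (fixed-frame kept copy refl s₁ kept₁)
          (trans (frame copy ring (var zR) refl s₁) (trans (frame recover ring (var zR) refl s) (ring-vars zR)))
          (λ b i j → trans (frame copy nat (arr b i j) refl s₁) (trans (frame recover nat (arr b i j) refl s) (nat-arrays b i j)))
          g≈)
        where
        conclude : Prepared (⟦ rest ⟧ s₂) × time (⟦ rest ⟧ s₂) ≤ time s₂ + (columnsTime + blocksTime) →
                   Prepared (⟦ setup ⟧ s) × time (⟦ setup ⟧ s) ≤ setupTime
        conclude (p , τ″) = p , chain (time s₁) τ″ τ′ (subst (λ t → time s₁ ≤ t + recoverTime) time-zero τ)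

module SearchStage {a ℓ₁ ℓ₂} (K : OrderedRing a ℓ₁ ℓ₂) {d N : ℕ} (r : ℕ)
                   (1≤d : 1 ≤ d) (1≤N : 1 ≤ N) (r<N : r < N) (ℛ : Vector (Rectangle K d) N)
                   (q : ℕ) (q-def : doubles 6 (d * N) ≡ q) (P : Program) where

  open OrderedRingFacts K
  open Execution K r 1≤d 1≤N ℛ q q-def using (lim)
  open SetupStage K r 1≤d 1≤N ℛ q q-def P using (Prepared)
  open Semantics K lim
  open Select using (selectAll)
  open Tree using (levels; level)

  -- A leaf has no row of its own. The recorded node is its parent, and the deletions are the first
  -- `k` entries of the parent's prolonged row.
  entry : State → ℕ → ℕ → ℕ
  entry σ k p = nats σ (arr EXT (nats σ (arr BEST k 1)) p)

  Answer : State → ∀ k → k < N → Set _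
  Answer σ k k<N = ∃[ Dl ] ((∀ j → j ∈ proj₁ Dl ⇔ (∃[ p ] (p < k × entry σ k p ≡ toℕ j))) ×
                            Optimal K {s = k} ℛ k<N Dl)

  module Answers (v : ℕ → ℕ → Carrier) (ord : ℕ → ℕ → ℕ)
                 (v-lo : ∀ c j → v (toℕ c * 2) (toℕ j) ≈ Interval.lo (ℛ j c))
                 (v-hi : ∀ c j → v (suc (toℕ c * 2)) (toℕ j) ≈ 0# ⊖ Interval.hi (ℛ j c)) where

    open TreeSearch K lim N r d v ord
    open Volumes K
    open Sides d
    open Geometry K d N ℛ v using (covered⇒volume; attained⇒volume)

    dominated⇒volume : ∀ {k σ} (k<N : k < N) → (D′ : Deletion N k) → Dominated (proj₁ D′) k σ →
      codeOf (lengths (intersection K ℛ (remaining D′) (remaining-nonempty k<N D′))) ⊑ bestCode σ k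
    dominated⇒volume k<N D′ (x , h , le) = ⊑-trans
      (attained⇒volume v-lo v-hi (remaining D′) (remaining-nonempty k<N D′) x
        λ i i<D → let e , (y , y∉ , y≡) , le = h i i<D in
          y , Subset.x∉p⇒x∈∁p y∉ , subst (λ e → x i ≼ v i e) (sym y≡) le) le

    -- The recorded code is squeezed between the volume left by any competing deletion, by
    -- `dominates`, and the volume left by the witnessing deletion, by `attained`.
    answer : ∀ {σ} → Searched σ → ∀ k → k ≤ r → (k<N : k < N) → Answer σ k k<N
    answer {σ} S k k≤r k<N = go (sound k k≤r)
      where
      open Searched S
      -- Any `k` rows would do. The recorded code dominates theirs, and codes are at least 1, so
      -- something has been recorded for `k`.
      first-k : Subset N
      first-k = image id k λ q q<k → ℕ.<-trans q<k k<N
      ∣first-k∣ : ∣ first-k ∣ ≡ k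
      ∣first-k∣ = ∣image∣ id k _ (λ _ _ e → e)
      dominates : (Z : Subset N) → ∣ Z ∣ ≡ k → Dominated Z k σ
      dominates Z e = subst (λ k → Dominated Z k σ) e (complete Z (subst (_≤ r) (sym e) k≤r))
      code≥1 : ∀ b n x → 1 ≤ proj₁ (encode b n x)
      code≥1 true  n       x = ≤-refl
      code≥1 false zero    x = s≤s z≤n
      code≥1 false (suc n) x = s≤s z≤n
      unset : nats σ (arr BEST k 0) ≡ 0 → ¬ Dominated first-k k σ
      unset z (x , _ , inj₁ (Level.lift p)) = contradiction (subst (_ <_) z p) λ ()
      unset z (x , _ , inj₂ (e , _))        = contradiction
        (≤-trans (code≥1 (negative xs) (dimension xs) (content xs)) (ℕ.≤-reflexive (trans e z))) λ ()
        where
        xs : List Carrier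
        xs = sidesFrom x 0 d
      go : Sound bound k σ → Answer σ k k<N
      go (inj₁ z) = contradiction (dominates first-k ∣first-k∣) (unset z)
      go (inj₂ W) = Dl , (λ j → mk⇔ (member j) (λ (p , p<k , e) → ∈-image⁺ f k bounded p p<k (trans (sym (row p)) e))) , optimal
        where
        open Witness W
        f : ℕ → ℕ
        f = ext σ node
        row : ∀ p → entry σ k p ≡ f p
        row p = cong (λ n → nats σ (arr EXT n p)) recorded
        Dl : Deletion N k
        Dl = image f k bounded , ∣image∣ f k bounded injective
        member : ∀ j → j ∈ image f k bounded → ∃[ p ] (p < k × entry σ k p ≡ toℕ j)
        member j j∈ = let p , p<k , e = ∈-image⁻ f k bounded j∈ in p , p<k , trans (row p) e
        attained : bestCode σ k ⊑ codeOf (lengths (intersection K ℛ (remaining Dl) (remaining-nonempty k<N Dl)))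
        attained = ⊑-respˡ (sym (proj₁ code≋) , ≈-sym (proj₂ code≋))
          (covered⇒volume v-lo v-hi (remaining Dl) (remaining-nonempty k<N Dl) maxima
            λ i i<D j j∈ → covers i i<D (toℕ j) (Fin.toℕ<n j)
              λ p p<k e → Subset.x∈∁p⇒x∉p j∈ (∈-image⁺ f k bounded p p<k e))
        optimal : Optimal K {s = k} ℛ k<N Dl
        optimal D′ = represents-mono
          (represents (intersection K ℛ (remaining D′) (remaining-nonempty k<N D′)))
          (represents (intersection K ℛ (remaining Dl) (remaining-nonempty k<N Dl)))
          (⊑-trans (dominated⇒volume {k} {σ} k<N D′ (dominates (proj₁ D′) (proj₂ D′))) attained)

  searchTime : ℕ → ℕ
  searchTime nb = (d * 2 * (4 + SelectionTimes.selectTime (suc r) nb) + 2) + (5 + childTime + searchBound)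
    where open TreeTimes r d

  record Result (nb : ℕ) (s σ : State) : Set (a ⊔ˡ ℓ₁ ⊔ˡ ℓ₂) where
    field
      answers : ∀ k → k ≤ r → (k<N : k < N) → Answer σ k k<N
      r-var   : nats σ (var rV) ≡ r
      one-var : nats σ (var oneV) ≡ 1
      timely  : time σ ≤ time s + searchTime nb

  search-correct : ∀ s (Q : Prepared s) → Result (Prepared.nb Q) s (⟦ selectAll ⨾ levels ⟧ s)
  search-correct s Q = selected (selectAll-correct s (N≡ , R≡ , nb≡ , one≡ , z≡ , D≡ , tt) (λ _ _ → refl)
      (λ c j → arrays FLAG c j))
    where
    open Prepared Q
    N≡ = proj₁ vars
    R≡ = proj₁ (proj₂ vars)
    nb≡ = proj₁ (proj₂ (proj₂ vars))
    one≡ = proj₁ (proj₂ (proj₂ (proj₂ vars)))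
    z≡ = proj₁ (proj₂ (proj₂ (proj₂ (proj₂ vars))))
    D≡ = proj₁ (proj₂ (proj₂ (proj₂ (proj₂ (proj₂ vars)))))
    d≡ = proj₁ (proj₂ (proj₂ (proj₂ (proj₂ (proj₂ (proj₂ vars))))))
    r≡ = proj₁ (proj₂ (proj₂ (proj₂ (proj₂ (proj₂ (proj₂ (proj₂ vars)))))))
    v : ℕ → ℕ → Carrier
    v c j = rings s (arr V c j)
    open AllColumns K lim N (suc r) nb (d * 2) nb≥ r<N v using (Top; module Top; selectAll-correct; order)
    s₁ : State
    s₁ = ⟦ selectAll ⟧ s
    selected : (∀ c → c < d * 2 → Top c (order s₁ c) (suc r)) ×
      time s₁ ≤ time s + (d * 2 * (4 + SelectionTimes.selectTime (suc r) nb) + 2) →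
      Result nb s (⟦ selectAll ⨾ levels ⟧ s)
    selected (T , τ) = found s₁ T (order s₁) (λ _ _ → refl) τ
      (trans (frame selectAll nat (var dV) refl s) d≡ , trans (frame selectAll nat (var RV) refl s) R≡ ,
       trans (frame selectAll nat (var oneV) refl s) one≡ , trans (frame selectAll nat (var zV) refl s) z≡ ,
       trans (frame selectAll nat (var DV) refl s) D≡ , tt)
      (trans (frame selectAll ring (var zR) refl s) zero≡)
      (λ c j → frame selectAll ring (arr V c j) refl s)
      (λ n → trans (frame selectAll nat (arr TOT n 0) refl s) (arrays TOT n 0))
      (λ n e → trans (frame selectAll nat (arr MARK n e) refl s) (arrays MARK n e))
      (λ i k → trans (frame selectAll nat (arr BEST i k) refl s) (arrays BEST i k))
      (trans (frame selectAll nat (var rV) refl s) r≡)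
      where
      found : ∀ s₁ → (∀ c → c < d * 2 → Top c (order s₁ c) (suc r)) → ∀ ord → (∀ c k → order s₁ c k ≡ ord c k) →
        time s₁ ≤ time s + (d * 2 * (4 + SelectionTimes.selectTime (suc r) nb) + 2) →
        Fixed ((dV , d) ∷ (RV , suc r) ∷ (oneV , 1) ∷ (zV , 0) ∷ (DV , d * 2) ∷ []) s₁ →
        rings s₁ (var zR) ≡ 0# → (∀ c j → rings s₁ (arr V c j) ≡ v c j) →
        (∀ n → nats s₁ (arr TOT n 0) ≡ 0) → (∀ n e → nats s₁ (arr MARK n e) ≡ 0) →
        (∀ i k → nats s₁ (arr BEST i k) ≡ 0) → nats s₁ (var rV) ≡ r →
        Result nb s (⟦ levels ⟧ s₁)
      found s₁ T ord ord≡ τ F zero≡ V≡ tot≡ mark≡ best≡ r≡ = concluded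
          (levels-correct tops s₁ (≤-trans (s≤s z≤n) (ℕ.*-monoˡ-≤ 2 1≤d)) (between-root tops s₁ F zero≡ ord≡ V≡ tot≡ mark≡ best≡))
        where
        open TreeSearch K lim N r d v ord
        open TreeTimes r d
        tops : ∀ l → l < D → TopRow l
        tops l l<D = record
          { bounded   = λ p p<r → subst (_< N) (ord≡ l p) (Top.bounded (T l l<D) p p<r)
          ; injective = λ p< q< e → Top.injective (T l l<D) p< q< (trans (ord≡ l _) (trans e (sym (ord≡ l _))))
          ; greatest  = λ p p<r j j<N h → subst (λ i → v l j ≼ v l i) (ord≡ l p)
              (Top.greatest (T l l<D) p p<r j j<N λ p′ p′<p e → h p′ p′<p (trans (sym (ord≡ l p′)) e)) }
        concluded : Searched (⟦ levels ⟧ s₁) × time (⟦ levels ⟧ s₁) ≤ time s₁ + (5 + childTime + searchBound) →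
                    Result nb s (⟦ levels ⟧ s₁)
        concluded (S , τ′) = record
          { answers = Answers.answer v ord v-lo v-hi S
          ; r-var   = trans (frame levels nat (var rV) refl s₁) r≡
          ; one-var = trans (frame levels nat (var oneV) refl s₁) (proj₁ (proj₂ (proj₂ F)))
          ; timely  = ≤-trans τ′ (≤-trans (ℕ.+-monoˡ-≤ (5 + childTime + searchBound) τ)
              (ℕ.≤-reflexive (ℕ.+-assoc (time s) _ (5 + childTime + searchBound)))) }

module Total where

  open Complexity
  open Size
  open Setup using (countStep; columnStep; blockStep)
  open Tree

  -- The running times restated as functions of a size, so that the rules for `≲` apply; that they
  -- are the same numbers holds by computation.
  setupTotal : ℕ → Size → ℕ
  setupTotal q n = (5 + (q * (4 + steps countStep) + 2)) +
    -- The factor 18 consists of 4 steps of loop overhead and the 14 steps of one copying round.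
    (((61 * 18 + 2) + (N n * (d n * 2) * 18 + 2)) +
    ((d n * (4 + (N n * (4 + steps columnStep) + 2)) + 2) + (3 + N n * (4 + steps blockStep))))

  childTotal enterTotal nodeTotal leafTotal levelsTotal outputTotal : Size → ℕ
  childTotal n  = (r n * (4 + steps copyOne) + 2) + steps tail
  enterTotal n  = 1 + (12 + r₁ n * (4 + steps pick))
  nodeTotal n   = 6 + (enterTotal n + r₁ n * 7)
  leafTotal n   = (steps startEval + (d n * (4 + steps evalSide) + 2) + steps endEval) + steps compareBest
  levelsTotal n = 5 + childTotal n +
    (D n * 12 + (nodes n * nodeTotal n + (nodes n * childTotal n + B n * leafTotal n)))
  outputTotal n = r n * (4 + (11 + (r n * (4 + steps emitOne) + 2))) + 2

  runTotal : ℕ → Size → ℕ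
  runTotal q n = (setupTotal q n + ((D n * (4 + selectTime n) + 2) + levelsTotal n)) + outputTotal n

  r≲r₁ : r ≲ r₁
  r≲r₁ = ≤⇒≲ λ n → ℕ.n≤1+n (r n)

  child≲ : childTotal ≲ r₁
  child≲ = (scaled (4 + steps copyOne) r≲r₁ ⊞ one≲r₁ 2) ⊞ one≲r₁ (steps tail)

  node≲ : nodeTotal ≲ r₁
  node≲ = one≲r₁ 6 ⊞ (one≲r₁ 1 ⊞ one≲r₁ 12 ⊞ scaled (4 + steps pick) ≲-refl) ⊞ scaled 7 ≲-refl

  leaf≲ : leafTotal ≲ d
  leaf≲ = ((one≲d (steps startEval) ⊞ scaled (4 + steps evalSide) ≲-refl ⊞ one≲d 2) ⊞ one≲d (steps endEval)) ⊞
    one≲d (steps compareBest)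

  levels≲W : levelsTotal ≲ W
  levels≲W = (unit 5 ⊞ ≲-trans child≲ r₁≲W) ⊞ scaled 12 (scaled 2 d≲W) ⊞
    nodes*≲W node≲ ⊞ nodes*≲W child≲ ⊞ leaves*≲W leaf≲

  output≲W : outputTotal ≲ W
  output≲W = ≲-trans (times r (one≲r₁ 4 ⊞ one≲r₁ 11 ⊞ scaled (4 + steps emitOne) r≲r₁ ⊞ one≲r₁ 2))
    (≲-trans (≤⇒≲ λ n → ℕ.*-monoˡ-≤ (r₁ n) (ℕ.n≤1+n (r n))) square≲W) ⊞ unit 2

  setup≲W : (λ n → setupTotal (64 * A n) n) ≲ W
  setup≲W = (unit 5 ⊞ scaled (4 + steps countStep) (≲-trans (≤⇒≲ λ n → ℕ.≤-reflexive (ℕ.*-comm 64 (A n))) (scaled 64 A≲W)) ⊞ unit 2) ⊞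
    ((unit (61 * 18) ⊞ unit 2) ⊞ scaled 18 (≲-trans (≤⇒≲ λ n → ℕ.≤-reflexive (rearrange₃₄ (N n) (d n))) (scaled 2 A≲W)) ⊞ unit 2) ⊞
    (columns≲W ⊞ unit 2) ⊞ unit 3 ⊞ scaled (4 + steps blockStep) N≲W
    where
    one≲N : ∀ k → (λ _ → k) ≲ N
    one≲N k = constant k 1≤N
    columns≲W : (λ n → d n * (4 + (N n * (4 + steps columnStep) + 2))) ≲ W
    columns≲W = ≲-trans (times d (one≲N 4 ⊞ scaled (4 + steps columnStep) ≲-refl ⊞ one≲N 2)) A≲W

  -- The boot code takes 260 steps and the epilogue 2; `q` is `64 * A n`. The first component is the
  -- absolute constant of the theorem.
  bounded : (λ n → 260 + (runTotal (64 * A n) n + 2)) ≲ W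
  bounded = unit 260 ⊞ ((setup≲W ⊞ selectAll≲W ⊞ levels≲W) ⊞ output≲W) ⊞ unit 2

module Solution {a ℓ₁ ℓ₂} (K : OrderedRing a ℓ₁ ℓ₂) {d N : ℕ} (r : ℕ)
                (1≤d : 1 ≤ d) (1≤N : 1 ≤ N) (r<N : r < N) (ℛ : Vector (Rectangle K d) N)
                (q : ℕ) (q-def : doubles 6 (d * N) ≡ q) where

  open OrderedRingFacts K
  open Execution K r 1≤d 1≤N ℛ q q-def
  open SetupStage K r 1≤d 1≤N ℛ q q-def program using (Prepared; module Prepared; setup-correct; setupTime)
  open SearchStage K r 1≤d 1≤N r<N ℛ q q-def program
  open Semantics K lim
  open Tree using (output)

  -- With `x = d * N`, both 64 and `r * r` are bounded through `r ≤ x` and `1 ≤ x`, and `64x² + x²`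
  -- is at most `(64x)²`. So the `r × r` answer fits below the arrays.
  r*r<lim : ∀ z → z < r * r → 64 + z < lim
  r*r<lim z z< = ℕ.<-≤-trans (ℕ.+-monoʳ-< 64 z<) (subst (λ q → 64 + r * r ≤ q * q) (sym q≡)
    (≤-trans (ℕ.+-mono-≤ (ℕ.m≤m*n 64 (d * N * (d * N)) {{>-nonZero (ℕ.*-mono-≤ 1≤dN 1≤dN)}})
        (ℕ.*-mono-≤ r≤dN r≤dN))
      (≤-trans (ℕ.m≤m+n _ (4031 * (d * N * (d * N)))) (ℕ.≤-reflexive (rearrange₃₅ (d * N))))))
    where
    r≤dN : r ≤ d * N
    r≤dN = ≤-trans (ℕ.<⇒≤ r<N) (subst (_≤ d * N) (ℕ.*-identityˡ N) (ℕ.*-monoˡ-≤ N 1≤d))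

  open Emission K lim r r*r<lim using (output-correct; outputTime; index<)

  record Solved : Set (a ⊔ˡ ℓ₁ ⊔ˡ ℓ₂) where
    field
      nb       : ℕ
      nb≤      : nb * suc r ≤ N + suc r
      duration : ℕ
      final    : Memory K
      run      : Run K program 0 m₀ duration final
      timely   : duration ≤ bootTime + (((setupTime + searchTime nb) + outputTime) + 2)
      solution : Output K r r<N ℛ final

  Emits : State → State → Set a
  Emits s₂ s₃ = (∀ i → i < r → ∀ p → p < suc i → flat s₃ (i * r + p) ≡ fromℕ (entry s₂ (suc i) p)) ×
                time s₃ ≤ time s₂ + outputTime

  -- The commands are variables here to keep their semantics folded.
  solved-by : ∀ c₁ c₂ c₃ → Executed ((c₁ ⨾ c₂) ⨾ c₃) program →
    (∀ s → Initial program s → Prepared (⟦ c₁ ⟧ s) × time (⟦ c₁ ⟧ s) ≤ setupTime) →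
    (∀ s (Q : Prepared s) → Result (Prepared.nb Q) s (⟦ c₂ ⟧ s)) →
    (∀ s → nats s (var rV) ≡ r → nats s (var oneV) ≡ 1 → Emits s (⟦ c₃ ⟧ s)) → Solved
  solved-by c₁ c₂ c₃ X prepare search emit = prepared (prepare start initial)
    where
    open Executed X
    s₁ : State
    s₁ = ⟦ c₁ ⟧ start
    prepared : Prepared s₁ × time s₁ ≤ setupTime → Solved
    prepared (Q , τ₁) = found (⟦ c₂ ⟧ s₁) (search s₁ Q) timing contents
      where
      found : ∀ s₂ → Result (Prepared.nb Q) s₁ s₂ →
        duration ≡ bootTime + (time (⟦ c₃ ⟧ s₂) + 2) →
        (∀ z → 64 + z < lim → final (64 + z) ≈ flat (⟦ c₃ ⟧ s₂) z) → Solved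
      found s₂ R timing contents = emitted (⟦ c₃ ⟧ s₂)
          (emit s₂ (Result.r-var R) (Result.one-var R)) timing contents
        where
        emitted : ∀ s₃ → Emits s₂ s₃ → duration ≡ bootTime + (time s₃ + 2) →
          (∀ z → 64 + z < lim → final (64 + z) ≈ flat s₃ z) → Solved
        emitted s₃ (E , τ₃) timing contents = record
          { nb       = Prepared.nb Q
          ; nb≤      = Prepared.nb≤ Q
          ; duration = duration
          ; final    = final
          ; run      = run
          ; timely   = ≤-trans (ℕ.≤-reflexive timing) (ℕ.+-monoʳ-≤ bootTime (ℕ.+-monoˡ-≤ 2
              (≤-trans τ₃ (ℕ.+-monoˡ-≤ outputTime (≤-trans (Result.timely R)
                (ℕ.+-monoˡ-≤ (searchTime (Prepared.nb Q)) τ₁))))))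
          ; solution = 64 , pointer , λ { (suc i) _ i<r → row i i<r (Result.answers R (suc i) i<r (ℕ.≤-<-trans i<r r<N)) } }
          where
          cell : ∀ i → i < r → ∀ p → p < suc i → final (64 + i * r + p) ≈ fromℕ (entry s₂ (suc i) p)
          cell i i<r p p≤i = ≈-trans (≈-reflexive (cong final (ℕ.+-assoc 64 (i * r) p)))
            (≈-trans (contents (i * r + p) (r*r<lim _ (ℕ.<-≤-trans (index< i<r (ℕ.≤-pred p≤i)) (ℕ.*-monoˡ-≤ r i<r))))
              (≈-reflexive (E i i<r p p≤i)))
          row : ∀ i → (i<r : i < r) → Answer s₂ (suc i) (ℕ.≤-<-trans i<r r<N) →
            ∃[ Dl ] (ListedAt K {N} {suc i} final (64 + i * r) Dl × Optimal K {s = suc i} ℛ (ℕ.≤-<-trans i<r r<N) Dl)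
          row i i<r (Dl , listed , optimal) = Dl , (λ j → mk⇔ (to j) (from j)) , optimal
            where
            to : ∀ j → j ∈ proj₁ Dl → ∃[ k ] (final (64 + i * r + toℕ {suc i} k) ≈ fromℕ (toℕ j))
            to j j∈ = let p , p<k , e = Equivalence.to (listed j) j∈ in
              Fin.fromℕ< p<k , subst (λ p → final (64 + i * r + p) ≈ fromℕ (toℕ j)) (sym (Fin.toℕ-fromℕ< p<k))
                (≈-trans (cell i i<r p p<k) (≈-reflexive (cong fromℕ e)))
            from : ∀ j → ∃[ k ] (final (64 + i * r + toℕ {suc i} k) ≈ fromℕ (toℕ j)) → j ∈ proj₁ Dl
            from j (k , e) = Equivalence.from (listed j) (toℕ k , Fin.toℕ<n k ,
              fromℕ-injective (≈-trans (≈-sym (cell i i<r (toℕ k) (Fin.toℕ<n k))) e))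

  abstract
    solved : Solved
    solved = solved-by setup (Select.selectAll ⨾ Tree.levels) output
      (execute main program main-wellFormed refl) setup-correct search-correct
      (λ s r≡ one≡ → output-correct (λ n p → nats s (arr EXT n p)) (λ k → nats s (arr BEST k 1)) s
        (r≡ , one≡ , tt) ((λ _ _ → refl) , λ _ → refl))

  within : (S : Solved) → Solved.duration S ≤ proj₁ Total.bounded * (d * ((r + 2 * d) C (2 * d)) + d * N)
  within S = ≤-trans (Solved.timely S) (≤-trans (ℕ.≤-reflexive total≡)
      (≤-trans (proj₂ Total.bounded size) (ℕ.*-monoʳ-≤ (proj₁ Total.bounded) (ℕ.≤-reflexive W≡))))
    where
    size : Complexity.Size
    size = record { d = d ; r = r ; N = N ; nb = Solved.nb S ; 1≤d = 1≤d ; 1≤N = 1≤N ; r<N = r<N ; nb≤ = Solved.nb≤ S }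
    setup≡ : setupTime ≡ Total.setupTotal q size
    setup≡ = refl
    search≡ : searchTime (Solved.nb S) ≡
      (Complexity.D size * (4 + Complexity.selectTime size) + 2) + Total.levelsTotal size
    search≡ = refl
    output≡ : outputTime ≡ Total.outputTotal size
    output≡ = refl
    total≡ : bootTime + (((setupTime + searchTime (Solved.nb S)) + outputTime) + 2) ≡
             260 + (Total.runTotal (64 * (d * N)) size + 2)
    total≡ = trans (cong (λ t → bootTime + (t + 2)) (cong₂ _+_ (cong₂ _+_ setup≡ search≡) output≡))
      (cong (λ q → 260 + (Total.runTotal q size + 2)) q≡)
    W≡ : Complexity.W size ≡ d * ((r + 2 * d) C (2 * d)) + d * N
    W≡ = cong (λ b → d * b + d * N) (trans (binom≡C r (d * 2)) (cong (λ k → (r + k) C k) (ℕ.*-comm d 2)))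

theorem2p5 : ∀ {a ℓ₁ ℓ₂} →
    ∃[ P ] ∃[ c ]
    ((K : OrderedRing a ℓ₁ ℓ₂) (d r N : ℕ) →
    1 ≤ d → 0 < r → (r<N : r < N) →
    (ℛ : Vector (Rectangle K d) N) →
    ∃[ t ] ∃[ m ]
    (Run K P 0 (input K r ℛ) t m ×
    t ≤ c * (d * ((r + 2 * d) C (2 * d)) + d * N) ×
    Output K r r<N ℛ m))
-- Program and constant are chosen before the ring, the sizes and the rectangles are given;
-- `doubles 6 (d * N)` is the number `q` that the boot code computes.
theorem2p5 = program , proj₁ Total.bounded , λ K d r N 1≤d 0<r r<N ℛ →
  let module S = Solution K r 1≤d (≤-trans (s≤s z≤n) r<N) r<N ℛ (doubles 6 (d * N)) refl
      open S.Solved S.solved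
  in duration , final , run , S.within S.solved , solution
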